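{- Let $(f_n(x_1,\dots,x_{u(n)}))$ be a family of multivariate polynomials with integer coefficients that can be evaluated in polynomial time at integer points. If $\mathsf{VP}^0=\mathsf{VNP}^0$, then $(f_n)\in\mathsf{VP}^0_{\mathsf{nb}}$. (Consequently, if there exists a family of integer polynomials that can be evaluated in polynomial time at integer points but that is not in $\mathsf{VP}^0_{\mathsf{nb}}$, then $\mathsf{VP}^0\neq\mathsf{VNP}^0$.)
   Context: Arithmetic circuits have inputs that are indeterminates or constants and gates $+,-,\times$; size is the number of gates. A constant-free circuit uses only the constant $1$. The formal degree of a circuit is defined inductively: inputs have formal degree $1$, a $+$ or $-$ gate has the maximum of the formal degrees of its inputs, a $\times$ gate has the sum; the formal degree of the circuit is that of its output gate. $\mathsf{VP}^0_{\mathsf{nb}}$: families $(f_n)$ (number of variables polynomial in $n$) computed by constant-free circuits of size polynomial in $n$, no degree bound. $\mathsf{VP}^0$: families computed by constant-free circuits of size and formal degree polynomial in $n$. $\mathsf{VNP}^0$: families $(f_n(\bar x))$ such that $f_n(\bar x)=\sum_{\bar\epsilon\in\{0,1\}^{p(n)}}g_n(\bar x,\bar\epsilon)$ for some $(g_n(\bar x,\bar y))\in\mathsf{VP}^0$ and polynomial $p$ with $|\bar y|=p(n)$. A family $(f_n(x_1,\dots,x_{u(n)}))$ of polynomials with integer coefficients can be evaluated in polynomial time at integer points if: (1) $u(n)$ is polynomially bounded; (2) the degree of $f_n$ and the bitsize of its coefficients are bounded by $2^{p(n)}$ for some polynomial $p$; (3) the language $\{(1^n,i_1,\dots,i_{u(n)},j,b)\mid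 \text{the } j\text{ -th bit of } f_n(i_1,\dots,i_{u(n)}) \text{ is } b\}$ (with $n$ in unary and the integers in binary, sign recoverable from the encoding) is in $\mathsf{P}$. -}

module Defs where

open import Data.Nat as ℕ using (ℕ; zero; suc; _≤_; _<_; _⊔_; _^_)
open import Data.Nat.DivMod using (_/_; _%_)
open import Data.Integer as ℤ using (ℤ; +_; -[1+_]; ∣_∣)
open import Data.Fin as Fin using (Fin)
open import Data.Bool using (Bool; true; false; if_then_else_)
open import Data.Maybe using (Maybe; just; nothing)
open import Data.List as List using (List; []; _∷_; _++_)
open import Data.Vec as Vec using (Vec)
import Data.Vec.Properties as VecP
open import Data.Product using (Σ; ∃; ∃-syntax; _×_; _,_; proj₁; proj₂)
open import Data.Sum using (_⊎_; inj₁; inj₂)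
open import Relation.Nullary using (¬_; yes; no; ⌊_⌋)
open import Relation.Binary.PropositionalEquality using (_≡_; _≢_)

PolyBounded : (ℕ → ℕ) → Set
PolyBounded t = ∃[ c ] (∀ n → t n ≤ n ^ c ℕ.+ c)

evalℕPoly : List ℕ → ℕ → ℕ
evalℕPoly []       n = 0
evalℕPoly (a ∷ as) n = a ℕ.+ n ℕ.* evalℕPoly as n

-- Multivariate polynomials with integer coefficients in v variables:
-- a finite formal sum of terms  c · x^m  (m an exponent vector).
-- Two representations denote the same polynomial iff all coefficients agree.

Monomial : ℕ → Set
Monomial v = Vec ℕ v

Poly : ℕ → Set
Poly v = List (Monomial v × ℤ)

coeff : ∀ {v} → Poly v → Monomial v → ℤ
coeff []             m = + 0
coeff ((m' , c) ∷ f) m with VecP.≡-dec ℕ._≟_ m' m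
... | yes _ = c ℤ.+ coeff f m
... | no  _ = coeff f m

_≈P_ : ∀ {v} → Poly v → Poly v → Set
f ≈P g = ∀ m → coeff f m ≡ coeff g m

totalDeg : ∀ {v} → Monomial v → ℕ
totalDeg m = Vec.foldr _ ℕ._+_ 0 m

DegreeAtMost : ∀ {v} → Poly v → ℕ → Set
DegreeAtMost f D = ∀ m → coeff f m ≢ + 0 → totalDeg m ≤ D

CoeffBitsizeAtMost : ∀ {v} → Poly v → ℕ → Set
CoeffBitsizeAtMost f B = ∀ m → ∣ coeff f m ∣ < 2 ^ B

pconst1 : ∀ {v} → Poly v
pconst1 {v} = (Vec.replicate v 0 , + 1) ∷ []

pvar : ∀ {v} → Fin v → Poly v
pvar i = (Vec.tabulate (λ j → if ⌊ i Fin.≟ j ⌋ then 1 else 0) , + 1) ∷ []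

padd : ∀ {v} → Poly v → Poly v → Poly v
padd f g = f ++ g

pneg : ∀ {v} → Poly v → Poly v
pneg = List.map (λ t → proj₁ t , ℤ.- proj₂ t)

psub : ∀ {v} → Poly v → Poly v → Poly v
psub f g = f ++ pneg g

pmul : ∀ {v} → Poly v → Poly v → Poly v
pmul f g = List.concatMap
  (λ t → List.map (λ s → Vec.zipWith ℕ._+_ (proj₁ t) (proj₁ s) , proj₂ t ℤ.* proj₂ s) g) f

evalP : ∀ {v} → Poly v → Vec ℤ v → ℤ
evalP f x = List.foldr ℤ._+_ (+ 0)
  (List.map (λ t → proj₂ t ℤ.* Vec.foldr _ ℤ._*_ (+ 1) (Vec.zipWith ℤ._^_ x (proj₁ t))) f)

bool→ℤ : Bool → ℤ
bool→ℤ true  = + 1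
bool→ℤ false = + 0

substBits : ∀ {v p} → Poly (v ℕ.+ p) → Vec Bool p → Poly v
substBits {v} {p} g ε = List.map
  (λ t → Vec.take v (proj₁ t) ,
         proj₂ t ℤ.* Vec.foldr _ ℤ._*_ (+ 1)
           (Vec.zipWith ℤ._^_ (Vec.map bool→ℤ ε) (Vec.drop v (proj₁ t)))) g

allBits : (p : ℕ) → List (Vec Bool p)
allBits zero    = Vec.[] ∷ []
allBits (suc p) = List.concatMap (λ e → (false Vec.∷ e) ∷ (true Vec.∷ e) ∷ []) (allBits p)

sumOverBits : ∀ {v p} → Poly (v ℕ.+ p) → Poly v
sumOverBits {p = p} g = List.concatMap (substBits g) (allBits p)

-- Constant-free arithmetic circuits (straight-line programs / DAGs).
-- Inputs are the variables x_i and the constant 1; gates are +, -, ×.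
-- Gates v k : a list of k gates; a gate may refer to inputs or to
-- earlier gates (gate zero = most recently added earlier gate).

data Op : Set where
  plus minus times : Op

data Ref (v k : ℕ) : Set where
  var  : Fin v → Ref v k
  one  : Ref v k
  gate : Fin k → Ref v k

data Gates (v : ℕ) : ℕ → Set where
  []  : Gates v 0
  _▷_ : ∀ {k} → Gates v k → Op × Ref v k × Ref v k → Gates v (suc k)

record Circuit (v : ℕ) : Set where
  field
    size   : ℕ
    gates  : Gates v size
    output : Ref v size
open Circuit public

module Interp {A : Set} {v : ℕ} (varA : Fin v → A) (oneA : A) (opA : Op → A → A → A) where
  refVal : ∀ {k} → (Fin k → A) → Ref v k → A
  refVal val (var i)  = varA i
  refVal val one      = oneA
  refVal val (gate i) = val i

  gateVals : ∀ {k} → Gates v k → Fin k → A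
  gateVals []                      ()
  gateVals (gs ▷ (o , r₁ , r₂)) Fin.zero    =
    opA o (refVal (gateVals gs) r₁) (refVal (gateVals gs) r₂)
  gateVals (gs ▷ _)              (Fin.suc i) = gateVals gs i

  outVal : Circuit v → A
  outVal C = refVal (gateVals (gates C)) (output C)

polyOp : ∀ {v} → Op → Poly v → Poly v → Poly v
polyOp plus  = padd
polyOp minus = psub
polyOp times = pmul

circuitPoly : ∀ {v} → Circuit v → Poly v
circuitPoly {v} = Interp.outVal pvar pconst1 polyOp

degOp : Op → ℕ → ℕ → ℕ
degOp plus  = _⊔_
degOp minus = _⊔_
degOp times = ℕ._+_

formalDegree : ∀ {v} → Circuit v → ℕ
formalDegree {v} = Interp.outVal {v = v} (λ _ → 1) 1 degOp

Computes : ∀ {v} → Circuit v → Poly v → Set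
Computes C f = circuitPoly C ≈P f

VP0nb : (u : ℕ → ℕ) → ((n : ℕ) → Poly (u n)) → Set
VP0nb u f = PolyBounded u ×
  ∃[ s ] (PolyBounded s ×
    (∀ n → ∃[ C ] (size C ≤ s n × Computes C (f n))))

VP0 : (u : ℕ → ℕ) → ((n : ℕ) → Poly (u n)) → Set
VP0 u f = PolyBounded u ×
  ∃[ s ] (PolyBounded s ×
    (∀ n → ∃[ C ] (size C ≤ s n × formalDegree C ≤ s n × Computes C (f n))))

VNP0 : (u : ℕ → ℕ) → ((n : ℕ) → Poly (u n)) → Set
VNP0 u f = PolyBounded u ×
  ∃[ ps ] (let p = evalℕPoly ps in
    ∃[ g ] (VP0 (λ n → u n ℕ.+ p n) g ×
      (∀ n → f n ≈P sumOverBits {u n} {p n} (g n))))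

VP0≡VNP0 : Set
VP0≡VNP0 = ∀ (u : ℕ → ℕ) (f : (n : ℕ) → Poly (u n)) →
  (VP0 u f → VNP0 u f) × (VNP0 u f → VP0 u f)

data Move : Set where
  left right stay : Move

Sym : Set
Sym = Maybe Bool      -- nothing = blank

record TM : Set where
  field
    nQ : ℕ            -- states Fin (suc nQ), start state zero
    δ  : Fin (suc nQ) → Sym → (Fin (suc nQ) ⊎ Bool) × Sym × Move
                      -- inj₂ b : halt, accepting iff b

record Config (M : TM) : Set where
  constructor conf
  field
    state : Fin (suc (TM.nQ M)) ⊎ Bool
    lft   : List Sym   -- left of head, nearest first
    hd    : Sym
    rgt   : List Sym

moveHead : Move → List Sym → Sym → List Sym → List Sym × Sym × List Sym
moveHead left  []      a r = [] , nothing , a ∷ r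
moveHead left  (x ∷ l) a r = l , x , a ∷ r
moveHead right l a []      = a ∷ l , nothing , []
moveHead right l a (x ∷ r) = a ∷ l , x , r
moveHead stay  l a r       = l , a , r

stepTM : (M : TM) → Config M → Config M
stepTM M (conf (inj₂ b) l a r) = conf (inj₂ b) l a r
stepTM M (conf (inj₁ q) l a r) with TM.δ M q a
... | (q' , a' , mv) with moveHead mv l a' r
...   | (l' , a'' , r') = conf q' l' a'' r'

runTM : (M : TM) → ℕ → Config M → Config M
runTM M zero    c = c
runTM M (suc t) c = runTM M t (stepTM M c)

initConf : (M : TM) → List Bool → Config M
initConf M []      = conf (inj₁ Fin.zero) [] nothing []
initConf M (b ∷ w) = conf (inj₁ Fin.zero) [] (just b) (List.map just w)

InP : (List Bool → Set) → Set
InP L = ∃[ M ] ∃[ T ] (PolyBounded T ×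
  (∀ w → (L w → Config.state (runTM M (T (List.length w)) (initConf M w)) ≡ inj₂ true) ×
         (¬ L w → Config.state (runTM M (T (List.length w)) (initConf M w)) ≡ inj₂ false)))

-- binary, least significant bit first, no leading zeros (0 ↦ empty)
bitsFuel : ℕ → ℕ → List Bool
bitsFuel zero    n = []
bitsFuel (suc k) zero = []
bitsFuel (suc k) (suc n) = ⌊ (suc n % 2) ℕ.≟ 1 ⌋ ∷ bitsFuel k (suc n / 2)

encNat : ℕ → List Bool
encNat n = bitsFuel n n

isNeg : ℤ → Bool
isNeg (+ _)    = false
isNeg -[1+ _ ] = true

encInt : ℤ → List Bool
encInt z = isNeg z ∷ encNat ∣ z ∣

encTuple : List (List Bool) → List Bool
encTuple = List.concatMap (λ w → List.concatMap (λ b → false ∷ b ∷ []) w ++ true ∷ true ∷ [])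

encInstance : (n : ℕ) {u : ℕ} → Vec ℤ u → ℕ → Bool → List Bool
encInstance n i j b =
  encTuple (List.replicate n true ∷ (List.map encInt (Vec.toList i) ++ (encNat j ∷ (b ∷ []) ∷ [])))

-- j-th bit (from 0) of a bit string, 0 beyond its end
bitAt : List Bool → ℕ → Bool
bitAt []      j       = false
bitAt (b ∷ w) zero    = b
bitAt (b ∷ w) (suc j) = bitAt w j

bitOf : ℤ → ℕ → Bool
bitOf z j = bitAt (encInt z) j

EvalLang : (u : ℕ → ℕ) → ((n : ℕ) → Poly (u n)) → List Bool → Set
EvalLang u f w = ∃[ n ] ∃[ i ] ∃[ j ] ∃[ b ]
  (w ≡ encInstance n {u n} i j b × bitOf (evalP (f n) i) j ≡ b)

PolyTimeEvaluable : (u : ℕ → ℕ) → ((n : ℕ) → Poly (u n)) → Set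
PolyTimeEvaluable u f = PolyBounded u ×
  (∃[ p ] (PolyBounded p ×
     (∀ n → DegreeAtMost (f n) (2 ^ p n) × CoeffBitsizeAtMost (f n) (2 ^ p n)))) ×
  InP (EvalLang u f)

{-# OPTIONS --safe #-}
-- Let Z = f(ξ) be the value at the Kronecker point ξ_i = 2 ^ (B E ^ i), whose base 2 ^ B digits are the
-- coefficients of f.  If VP⁰ = VNP⁰, sums of small circuits over exponentially many Boolean points have small
-- circuits.  Arithmetised Boolean circuits therefore count, so they compute quotients, primes, discrete
-- logarithms and iterated products modulo short primes q.  They also compute Z mod q, since Z ≡ f(ρ) for short
-- residues ρ of ξ and the Turing machine gives the bits of f(ρ).  The conversion of Hesse, Allender and
-- Barrington turns the residues into signed digits d_j with Z = Σ_j d_j 2 ^ j.  Since coefficients are read off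
-- from blocks of digits, f(x) = Σ_j d_j Π_t W_t ^ (j_t), where j_t are the bits of j and the weights W_t are the
-- repeated squares 2 ^ 2 ^ t and x_i ^ 2 ^ t: once more an exponential sum, now over the variables W_t.
module Submission where

open import Defs
open import Data.Bool using (Bool; true; false; if_then_else_)
open import Data.Empty using (⊥; ⊥-elim)
open import Data.Fin as Fin using (Fin; _↑ˡ_; _↑ʳ_)
import Data.Fin.Properties as Fin
import Data.Integer as ℤ
import Data.Integer.Properties as ℤ
import Data.Integer.Tactic.RingSolver as ZS
open import Data.List as List using (List)
open import Data.Nat as ℕ using (ℕ; zero; suc; z≤n; s≤s)
import Data.Nat.Properties as ℕ
import Data.Nat.Tactic.RingSolver as NS
open import Data.Product using (Σ; Σ-syntax; _,_; _×_; ∃; ∃-syntax; proj₁; proj₂)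
open import Data.Sum using (_⊎_; inj₁; inj₂; [_,_])
open import Data.Unit using (⊤; tt)
open import Data.Vec as Vec using (Vec; []; _∷_)
import Data.Vec.Properties as Vec
open import Relation.Binary.PropositionalEquality hiding ([_])
open import Relation.Nullary using (yes; no; Dec; ¬_)

-- `Z` has exponentially many bits, so only the map from an index `j` to its digit is ever computed.
-- The hypothesis concerns sums of polynomials of small formal degree, whereas counting has to be
-- nested: residues, logarithms, digits. Two translations make it iterable. A Boolean circuit
-- becomes a polynomial of low degree once its gate values are added as summation variables, and the
-- integer circuit obtained for a sum is simulated by a Boolean circuit modulo a power of two.
-- Products over exponentially many factors are not sums, but modulo a prime discrete logarithms
-- make them so. Ordinary binary digits are out of reach, because the approximations of Z / 2 ^ j
-- cannot decide a rounding close to a tie; redundant signed digits, exact at the boundaries between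
-- coefficients, take their place. The weights `W_t` have exponential degree in the inputs, so they
-- stay independent variables until the last sum has its circuit and are then replaced by repeated
-- squares. That substitution gives up the degree bound and leads to `VP0nb`.

module Growth where
 open import Data.Nat
 open import Data.Nat.Properties
 open import Data.Nat.Tactic.RingSolver using (solve-∀)

 -- Polynomial growth and finite sums

 n<2^n : ∀ n → n < 2 ^ n
 n<2^n zero = s≤s z≤n
 n<2^n (suc n) = begin-strict
   suc n ≤⟨ n<2^n n ⟩
   2 ^ n <⟨ m<m+n (2 ^ n) (m^n>0 2 n) ⟩
   2 ^ n + 2 ^ n ≡⟨ cong (2 ^ n +_) (sym (+-identityʳ (2 ^ n))) ⟩
   2 ^ suc n ∎
   where open ≤-Reasoning

 -- PolyBounded's bound n ^ c + c is not monotone in c at n = 0, 1; this equivalent form is.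
 PB : (ℕ → ℕ) → Set
 PB t = ∃[ c ] (∀ n → t n ≤ (2 + n) ^ c)

 abstract
   -- From `n` = 2 on, 2 + n is at most n ^ 2; the constant `3 ^ c` covers `n` = 0 and `n` = 1.
   2+n^≤ : ∀ n c → (2 + n) ^ c ≤ n ^ (2 * c) + 3 ^ c
   2+n^≤ zero c = ≤-trans (^-monoˡ-≤ c {2} {3} (s≤s (s≤s z≤n))) (m≤n+m (3 ^ c) (0 ^ (2 * c)))
   2+n^≤ (suc zero) c = m≤n+m (3 ^ c) (1 ^ (2 * c))
   2+n^≤ n@(suc (suc m)) c = begin
     (2 + n) ^ c ≤⟨ ^-monoˡ-≤ c 2+n≤n² ⟩
     (n ^ 2) ^ c ≡⟨ ^-*-assoc n 2 c ⟩
     n ^ (2 * c) ≤⟨ m≤m+n _ _ ⟩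
     n ^ (2 * c) + 3 ^ c ∎
     where
     open ≤-Reasoning
     eq : ∀ m → (2 + m) * ((2 + m) * 1) ≡ (2 + (2 + m)) + (m * m + 3 * m)
     eq = solve-∀
     2+n≤n² : 2 + n ≤ n ^ 2
     2+n≤n² = ≤-trans (m≤m+n (2 + n) (m * m + 3 * m)) (≤-reflexive (sym (eq m)))

   fromPB : ∀ {t} → PB t → PolyBounded t
   -- One constant serves as exponent and as summand. Its `suc` absorbs the value 0 ^ 0 = 1 that can
   -- occur at `n` = 0.
   fromPB {t} (c , h) = suc (2 * c + 3 ^ c) , λ n → begin
     t n ≤⟨ h n ⟩
     (2 + n) ^ c ≤⟨ 2+n^≤ n c ⟩
     n ^ (2 * c) + 3 ^ c ≤⟨ lem n ⟩
     n ^ suc (2 * c + 3 ^ c) + suc (2 * c + 3 ^ c) ∎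
     where
     open ≤-Reasoning
     0^≤1 : ∀ d → 0 ^ d ≤ 1
     0^≤1 zero = s≤s z≤n
     0^≤1 (suc d) = z≤n
     lem : ∀ n → n ^ (2 * c) + 3 ^ c ≤ n ^ suc (2 * c + 3 ^ c) + suc (2 * c + 3 ^ c)
     lem zero = +-mono-≤ (0^≤1 (2 * c)) (m≤n+m (3 ^ c) (2 * c))
     lem (suc n) = +-mono-≤ (^-monoʳ-≤ (suc n) (≤-trans (m≤m+n (2 * c) (3 ^ c)) (n≤1+n _))) (≤-trans (m≤n+m (3 ^ c) (2 * c)) (n≤1+n _))

   toPB : ∀ {t} → PolyBounded t → PB t
   toPB {t} (c , h) = suc c , λ n → begin
     t n ≤⟨ h n ⟩
     n ^ c + c ≤⟨ +-mono-≤ (^-monoˡ-≤ c (m≤n+m n 2)) (≤-trans (<⇒≤ (n<2^n c)) (^-monoˡ-≤ c {2} {2 + n} (s≤s (s≤s z≤n)))) ⟩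
     (2 + n) ^ c + (2 + n) ^ c ≡⟨ cong ((2 + n) ^ c +_) (sym (+-identityʳ _)) ⟩
     2 * (2 + n) ^ c ≤⟨ *-monoˡ-≤ ((2 + n) ^ c) (s≤s (s≤s (z≤n {n}))) ⟩
     (2 + n) ^ suc c ∎
     where open ≤-Reasoning

   PB-≤ : ∀ {s t : ℕ → ℕ} → (∀ n → s n ≤ t n) → PB t → PB s
   PB-≤ h (c , k) = c , λ n → ≤-trans (h n) (k n)

   PB-const : ∀ k → PB (λ _ → k)
   PB-const k = k , λ n → ≤-trans (<⇒≤ (n<2^n k)) (^-monoˡ-≤ k {2} {2 + n} (s≤s (s≤s z≤n)))

   PB-id : PB (λ n → n)
   PB-id = 1 , λ n → ≤-trans (m≤n+m n 2) (≤-reflexive (sym (*-identityʳ (2 + n))))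

   PB-* : ∀ {s t : ℕ → ℕ} → PB s → PB t → PB (λ n → s n * t n)
   PB-* (c , h) (d , k) = c + d , λ n →
     ≤-trans (*-mono-≤ (h n) (k n)) (≤-reflexive (sym (^-distribˡ-+-* (2 + n) c d)))

   PB-+ : ∀ {s t : ℕ → ℕ} → PB s → PB t → PB (λ n → s n + t n)
   PB-+ {s} {t} (c , h) (d , k) = suc (c + d) , λ n → begin
     s n + t n ≤⟨ +-mono-≤ (≤-trans (h n) (^-monoʳ-≤ (2 + n) (m≤m+n c d))) (≤-trans (k n) (^-monoʳ-≤ (2 + n) (m≤n+m d c))) ⟩
     (2 + n) ^ (c + d) + (2 + n) ^ (c + d) ≡⟨ cong ((2 + n) ^ (c + d) +_) (sym (+-identityʳ _)) ⟩
     2 * (2 + n) ^ (c + d) ≤⟨ *-monoˡ-≤ ((2 + n) ^ (c + d)) (s≤s (s≤s (z≤n {n}))) ⟩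
     (2 + n) ^ suc (c + d) ∎
     where open ≤-Reasoning

   PB-^ : ∀ {t : ℕ → ℕ} → PB t → ∀ k → PB (λ n → t n ^ k)
   PB-^ h zero = PB-const 1
   PB-^ h (suc k) = PB-* h (PB-^ h k)

   PB-suc : ∀ {t : ℕ → ℕ} → PB t → PB (λ n → suc (t n))
   PB-suc = PB-+ (PB-const 1)

 sumN : ℕ → (ℕ → ℕ) → ℕ
 sumN zero f = 0
 sumN (suc n) f = sumN n f + f n

 prodN : ℕ → (ℕ → ℕ) → ℕ
 prodN zero f = 1
 prodN (suc n) f = prodN n f * f n

 sumN-cong : ∀ n {f g : ℕ → ℕ} → (∀ i → i < n → f i ≡ g i) → sumN n f ≡ sumN n g
 sumN-cong zero h = refl
 sumN-cong (suc n) h = cong₂ _+_ (sumN-cong n (λ i l → h i (m<n⇒m<1+n l))) (h n ≤-refl)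

 prodN-cong : ∀ n {f g : ℕ → ℕ} → (∀ i → i < n → f i ≡ g i) → prodN n f ≡ prodN n g
 prodN-cong zero h = refl
 prodN-cong (suc n) h = cong₂ _*_ (prodN-cong n (λ i l → h i (m<n⇒m<1+n l))) (h n ≤-refl)

 sumN-≤ : ∀ n {f : ℕ → ℕ} {b} → (∀ i → i < n → f i ≤ b) → sumN n f ≤ n * b
 sumN-≤ zero h = z≤n
 sumN-≤ (suc n) {f} {b} h = ≤-trans (+-mono-≤ (sumN-≤ n (λ i l → h i (m<n⇒m<1+n l))) (h n ≤-refl)) (≤-reflexive (+-comm (n * b) b))

 sumN-+ : ∀ n (f g : ℕ → ℕ) → sumN n (λ i → f i + g i) ≡ sumN n f + sumN n g
 sumN-+ zero f g = refl
 sumN-+ (suc n) f g rewrite sumN-+ n f g = lem (sumN n f) (sumN n g) (f n) (g n)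
   where
   lem : ∀ a b c d → (a + b) + (c + d) ≡ (a + c) + (b + d)
   lem = solve-∀

 sumN-* : ∀ n k (f : ℕ → ℕ) → sumN n (λ i → k * f i) ≡ k * sumN n f
 sumN-* zero k f = sym (*-zeroʳ k)
 sumN-* (suc n) k f rewrite sumN-* n k f = sym (*-distribˡ-+ k (sumN n f) (f n))

 sumN-split : ∀ m n (f : ℕ → ℕ) → sumN (m + n) f ≡ sumN m f + sumN n (λ i → f (m + i))
 sumN-split m zero f rewrite +-identityʳ m = sym (+-identityʳ _)
 sumN-split m (suc n) f rewrite +-suc m n | sumN-split m n f = +-assoc (sumN m f) _ _

 term≤sumN : ∀ n (f : ℕ → ℕ) i → i < n → f i ≤ sumN n f
 term≤sumN (suc n) f i (s≤s i≤n) with m≤n⇒m<n∨m≡n i≤n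
 ... | inj₁ i<n = ≤-trans (term≤sumN n f i i<n) (m≤m+n _ _)
 ... | inj₂ refl = m≤n+m _ _

 sumN≡0 : ∀ n (f : ℕ → ℕ) → (∀ i → i < n → f i ≡ 0) → sumN n f ≡ 0
 sumN≡0 zero f h = refl
 sumN≡0 (suc n) f h rewrite sumN≡0 n f (λ i l → h i (m<n⇒m<1+n l)) = h n ≤-refl

-- Polynomials and their values at integer points

module Evaluation where
 open import Data.Integer using (ℤ; +_; _+_; _*_; -_; _-_; _^_; ∣_∣)
 open import Data.Integer.Tactic.RingSolver using (solve-∀)
 open import Data.List using ([]; _∷_; _++_)
 import Data.List.Properties as List
 open import Data.Vec.Relation.Unary.All as All using (All; []; _∷_)
 open import Relation.Nullary using (⌊_⌋)

 open ≡-Reasoning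

 mon : ∀ {v} → Vec ℤ v → Monomial v → ℤ
 mon x m = Vec.foldr _ _*_ (+ 1) (Vec.zipWith _^_ x m)

 sumZ : ℕ → (ℕ → ℤ) → ℤ
 sumZ zero f = + 0
 sumZ (suc n) f = sumZ n f + f n

 Σb : ∀ p → (Vec Bool p → ℤ) → ℤ
 Σb zero φ = φ []
 Σb (suc p) φ = Σb p (λ e → φ (false ∷ e) + φ (true ∷ e))

 b2z : ∀ {p} → Vec Bool p → Vec ℤ p
 b2z = Vec.map bool→ℤ

 abstract
   Σb-cong : ∀ p {φ ψ : Vec Bool p → ℤ} → (∀ e → φ e ≡ ψ e) → Σb p φ ≡ Σb p ψ
   Σb-cong zero h = h []
   Σb-cong (suc p) h = Σb-cong p (λ e → cong₂ _+_ (h _) (h _))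

   mon-+ : ∀ {v} (x : Vec ℤ v) m m' → mon x (Vec.zipWith ℕ._+_ m m') ≡ mon x m * mon x m'
   mon-+ [] [] [] = refl
   mon-+ (a ∷ x) (i ∷ m) (j ∷ m') rewrite mon-+ x m m' | ℤ.^-distribˡ-+-* a i j =
     lem (a ^ i) (a ^ j) (mon x m) (mon x m')
     where
     lem : ∀ p q r s → (p * q) * (r * s) ≡ (p * r) * (q * s)
     lem = solve-∀

   mon-0 : ∀ {v} (x : Vec ℤ v) → mon x (Vec.replicate v 0) ≡ + 1
   mon-0 [] = refl
   mon-0 (a ∷ x) rewrite mon-0 x = refl

   mon-var : ∀ {v} (x : Vec ℤ v) (i : Fin v) →
     mon x (Vec.tabulate (λ j → if ⌊ i Fin.≟ j ⌋ then 1 else 0)) ≡ Vec.lookup x i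
   mon-var (a ∷ x) Fin.zero = trans (cong₂ _*_ (ℤ.^-identityʳ a)
     (trans (cong (mon x) (Vec.tabulate-cong (λ _ → refl))) (trans (cong (mon x) (zeros _)) (mon-0 x)))) (ℤ.*-identityʳ a)
     where
     zeros : ∀ v → Vec.tabulate {n = v} (λ j → 0) ≡ Vec.replicate v 0
     zeros zero = refl
     zeros (suc v) = cong (0 ∷_) (zeros v)
   mon-var (a ∷ x) (Fin.suc i) = trans (ℤ.*-identityˡ _)
     (trans (cong (mon x) (Vec.tabulate-cong (λ j → lem i j))) (mon-var x i))
     where
     lem : ∀ {v} (i j : Fin v) → (if ⌊ Fin.suc i Fin.≟ Fin.suc j ⌋ then 1 else 0) ≡ (if ⌊ i Fin.≟ j ⌋ then 1 else 0)
     lem i j with i Fin.≟ j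
     ... | yes _ = refl
     ... | no _ = refl

   mon-++ : ∀ {v p} (x : Vec ℤ v) (y : Vec ℤ p) (m : Monomial (v ℕ.+ p)) →
     mon (x Vec.++ y) m ≡ mon x (Vec.take v m) * mon y (Vec.drop v m)
   mon-++ [] y m = sym (ℤ.*-identityˡ _)
   mon-++ {suc v} (a ∷ x) y (i ∷ m) = trans (cong (a ^ i *_) (mon-++ x y m)) (sym (ℤ.*-assoc (a ^ i) _ _))

   evalP-++ : ∀ {v} (f g : Poly v) x → evalP (f ++ g) x ≡ evalP f x + evalP g x
   evalP-++ [] g x = sym (ℤ.+-identityˡ _)
   evalP-++ ((m , c) ∷ f) g x = trans (cong (λ z → c * mon x m + z) (evalP-++ f g x)) (sym (ℤ.+-assoc (c * mon x m) _ _))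

   evalP-neg : ∀ {v} (f : Poly v) x → evalP (pneg f) x ≡ - evalP f x
   evalP-neg [] x = refl
   evalP-neg ((m , c) ∷ f) x rewrite evalP-neg f x = lem c (mon x m) (evalP f x)
     where
     lem : ∀ a b d → - a * b + - d ≡ - (a * b + d)
     lem = solve-∀

   evalP-mul1 : ∀ {v} (t : Monomial v × ℤ) (g : Poly v) x →
     evalP (List.map (λ s → Vec.zipWith ℕ._+_ (proj₁ t) (proj₁ s) , proj₂ t * proj₂ s) g) x
       ≡ (proj₂ t * mon x (proj₁ t)) * evalP g x
   evalP-mul1 (m , c) [] x = sym (ℤ.*-zeroʳ (c * mon x m))
   evalP-mul1 (m , c) ((m' , d) ∷ g) x rewrite evalP-mul1 (m , c) g x | mon-+ x m m' = lem c d (mon x m) (mon x m') (evalP g x)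
     where
     lem : ∀ c d a b e → (c * d) * (a * b) + (c * a) * e ≡ (c * a) * (d * b + e)
     lem = solve-∀

   evalP-mul : ∀ {v} (f g : Poly v) x → evalP (pmul f g) x ≡ evalP f x * evalP g x
   evalP-mul [] g x = sym (ℤ.*-zeroˡ (evalP g x))
   evalP-mul (t ∷ f) g x = begin
     evalP (List.map _ g ++ pmul f g) x ≡⟨ evalP-++ (List.map _ g) (pmul f g) x ⟩
     _ ≡⟨ cong₂ _+_ (evalP-mul1 t g x) (evalP-mul f g x) ⟩
     _ ≡⟨ sym (ℤ.*-distribʳ-+ (evalP g x) (proj₂ t * mon x (proj₁ t)) (evalP f x)) ⟩
     _ ∎

   evalP-one : ∀ {v} (x : Vec ℤ v) → evalP pconst1 x ≡ + 1
   evalP-one x rewrite mon-0 x = refl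

   evalP-var : ∀ {v} (x : Vec ℤ v) i → evalP (pvar i) x ≡ Vec.lookup x i
   evalP-var x i = trans (ℤ.+-identityʳ _) (trans (ℤ.*-identityˡ _) (mon-var x i))

 opZ : Op → ℤ → ℤ → ℤ
 opZ plus = _+_
 opZ minus = _-_
 opZ times = _*_

 abstract
   evalP-op : ∀ {v} o (f g : Poly v) x → evalP (polyOp o f g) x ≡ opZ o (evalP f x) (evalP g x)
   evalP-op plus f g x = evalP-++ f g x
   evalP-op minus f g x = trans (evalP-++ f (pneg g) x) (cong (λ z → evalP f x + z) (evalP-neg g x))
   evalP-op times f g x = evalP-mul f g x

 evalC : ∀ {v} → Circuit v → Vec ℤ v → ℤ
 evalC C x = Interp.outVal (Vec.lookup x) (+ 1) opZ C

 abstract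
   evalP-gates : ∀ {v} (x : Vec ℤ v) {k} (gs : Gates v k) i →
     evalP (Interp.gateVals pvar pconst1 polyOp gs i) x ≡ Interp.gateVals (Vec.lookup x) (+ 1) opZ gs i
   evalP-ref : ∀ {v} (x : Vec ℤ v) {k} (gs : Gates v k) r →
     evalP (Interp.refVal pvar pconst1 polyOp (Interp.gateVals pvar pconst1 polyOp gs) r) x
       ≡ Interp.refVal (Vec.lookup x) (+ 1) opZ (Interp.gateVals (Vec.lookup x) (+ 1) opZ gs) r
   evalP-ref x gs (var i) = evalP-var x i
   evalP-ref x gs one = evalP-one x
   evalP-ref x gs (gate i) = evalP-gates x gs i
   evalP-gates x (gs ▷ (o , r₁ , r₂)) Fin.zero =
     trans (evalP-op o _ _ x) (cong₂ (opZ o) (evalP-ref x gs r₁) (evalP-ref x gs r₂))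
   evalP-gates x (gs ▷ _) (Fin.suc i) = evalP-gates x gs i

   evalP-circuit : ∀ {v} (C : Circuit v) x → evalP (circuitPoly C) x ≡ evalC C x
   evalP-circuit C x = evalP-ref x (gates C) (output C)

   evalP-substBits : ∀ {v p} (g : Poly (v ℕ.+ p)) (ε : Vec Bool p) x →
     evalP (substBits {v} {p} g ε) x ≡ evalP g (x Vec.++ b2z ε)
   evalP-substBits [] ε x = refl
   evalP-substBits {v} {p} ((m , c) ∷ g) ε x
     rewrite evalP-substBits {v} {p} g ε x | mon-++ x (b2z ε) m =
     cong (_+ evalP g (x Vec.++ b2z ε)) (lem c (mon (b2z ε) (Vec.drop v m)) (mon x (Vec.take v m)))
     where
     lem : ∀ c a b → c * a * b ≡ c * (b * a)
     lem = solve-∀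

   evalP-bits : ∀ {v} p (h : Vec Bool p → Poly v) x →
     evalP (List.concatMap h (allBits p)) x ≡ Σb p (λ ε → evalP (h ε) x)
   evalP-bits zero h x = cong (λ f → evalP f x) (List.++-identityʳ (h []))
   evalP-bits (suc p) h x = begin
     evalP (List.concatMap h (List.concatMap _ (allBits p))) x ≡⟨ cong (λ f → evalP f x) (lem (allBits p)) ⟩
     evalP (List.concatMap (λ e → h (false ∷ e) ++ h (true ∷ e)) (allBits p)) x ≡⟨ evalP-bits p _ x ⟩
     Σb p (λ e → evalP (h (false ∷ e) ++ h (true ∷ e)) x) ≡⟨ Σb-cong p (λ e → evalP-++ (h (false ∷ e)) _ x) ⟩
     Σb (suc p) (λ ε → evalP (h ε) x) ∎
     where
     lem : ∀ l → List.concatMap h (List.concatMap (λ e → (false ∷ e) ∷ (true ∷ e) ∷ []) l)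
               ≡ List.concatMap (λ e → h (false ∷ e) ++ h (true ∷ e)) l
     lem [] = refl
     lem (e ∷ l) = trans (cong (λ z → h (false ∷ e) ++ (h (true ∷ e) ++ z)) (lem l))
                         (sym (List.++-assoc (h (false ∷ e)) (h (true ∷ e)) _))

   evalP-sumOverBits : ∀ {v p} (g : Poly (v ℕ.+ p)) x →
     evalP (sumOverBits {v} {p} g) x ≡ Σb p (λ ε → evalP g (x Vec.++ b2z ε))
   evalP-sumOverBits {v} {p} g x = trans (evalP-bits p (substBits {v} {p} g) x) (Σb-cong p (λ ε → evalP-substBits {v} {p} g ε x))

   sumZ-cong : ∀ n {f g : ℕ → ℤ} → (∀ i → i ℕ.< n → f i ≡ g i) → sumZ n f ≡ sumZ n g
   sumZ-cong zero h = refl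
   sumZ-cong (suc n) h = cong₂ _+_ (sumZ-cong n (λ i l → h i (ℕ.m<n⇒m<1+n l))) (h n ℕ.≤-refl)

   sumZ-+ : ∀ n (f g : ℕ → ℤ) → sumZ n (λ i → f i + g i) ≡ sumZ n f + sumZ n g
   sumZ-+ zero f g = refl
   sumZ-+ (suc n) f g rewrite sumZ-+ n f g = lem (sumZ n f) (sumZ n g) (f n) (g n)
     where
     lem : ∀ a b c d → (a + b) + (c + d) ≡ (a + c) + (b + d)
     lem = solve-∀

   sumZ-* : ∀ n k (f : ℕ → ℤ) → sumZ n (λ i → k * f i) ≡ k * sumZ n f
   sumZ-* zero k f = sym (ℤ.*-zeroʳ k)
   sumZ-* (suc n) k f rewrite sumZ-* n k f = sym (ℤ.*-distribˡ-+ k (sumZ n f) (f n))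

   sumZ-0 : ∀ n (f : ℕ → ℤ) → (∀ i → i ℕ.< n → f i ≡ + 0) → sumZ n f ≡ + 0
   sumZ-0 zero f h = refl
   sumZ-0 (suc n) f h rewrite sumZ-0 n f (λ i l → h i (ℕ.m<n⇒m<1+n l)) = trans (ℤ.+-identityˡ _) (h n ℕ.≤-refl)

   sumZ-split : ∀ m n (f : ℕ → ℤ) → sumZ (m ℕ.+ n) f ≡ sumZ m f + sumZ n (λ i → f (m ℕ.+ i))
   sumZ-split m zero f rewrite ℕ.+-identityʳ m = sym (ℤ.+-identityʳ _)
   sumZ-split m (suc n) f rewrite ℕ.+-suc m n | sumZ-split m n f = ℤ.+-assoc (sumZ m f) _ _

   sumZ-first : ∀ n (f : ℕ → ℤ) → sumZ (suc n) f ≡ f 0 + sumZ n (λ i → f (suc i))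
   sumZ-first n f = trans (sumZ-split 1 n f) (cong (_+ sumZ n (λ i → f (suc i))) (ℤ.+-identityˡ (f 0)))

 -- A list of terms may repeat a monomial. A sum of `coeff f m` over a box of exponent vectors
 -- depends on the coefficients alone, and in this form values and coefficients determine each
 -- other.
 box : ∀ v → ℕ → (Vec ℕ v → ℤ) → ℤ
 box zero E φ = φ []
 box (suc v) E φ = sumZ E (λ i → box v E (λ m → φ (i ∷ m)))

 δ1 : ℕ → ℕ → ℤ
 δ1 a b = if ⌊ a ℕ.≟ b ⌋ then + 1 else + 0

 δ : ∀ {v} → Vec ℕ v → Vec ℕ v → ℤ
 δ [] [] = + 1
 δ (a ∷ m) (b ∷ n) = δ1 a b * δ m n

 abstract
   δ1-refl : ∀ a → δ1 a a ≡ + 1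
   δ1-refl a with a ℕ.≟ a
   ... | yes _ = refl
   ... | no ne = ⊥-elim (ne refl)

   δ1-≢ : ∀ {a b} → a ≢ b → δ1 a b ≡ + 0
   δ1-≢ {a} {b} ne with a ℕ.≟ b
   ... | yes e = ⊥-elim (ne e)
   ... | no _ = refl

   δ-refl : ∀ {v} (m : Vec ℕ v) → δ m m ≡ + 1
   δ-refl [] = refl
   δ-refl (a ∷ m) rewrite δ1-refl a | δ-refl m = refl

   δ-≢ : ∀ {v} {m n : Vec ℕ v} → m ≢ n → δ m n ≡ + 0
   δ-≢ {m = []} {[]} ne = ⊥-elim (ne refl)
   δ-≢ {m = a ∷ m} {b ∷ n} ne with a ℕ.≟ b
   ... | no _ = ℤ.*-zeroˡ (δ m n)
   ... | yes refl = trans (ℤ.*-identityˡ (δ m n)) (δ-≢ {m = m} {n} (λ e → ne (cong (a ∷_) e)))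

   coeff-∷ : ∀ {v} m' c (f : Poly v) m → coeff ((m' , c) ∷ f) m ≡ δ m' m * c + coeff f m
   coeff-∷ m' c f m with Vec.≡-dec ℕ._≟_ m' m
   ... | yes refl rewrite δ-refl m' = cong (_+ coeff f m') (sym (ℤ.*-identityˡ c))
   ... | no ne rewrite δ-≢ {m = m'} {m} ne = trans (sym (ℤ.+-identityˡ _)) (cong (_+ coeff f m) (sym (ℤ.*-zeroˡ c)))

   box-cong : ∀ v E {φ ψ : Vec ℕ v → ℤ} → (∀ m → All (ℕ._< E) m → φ m ≡ ψ m) → box v E φ ≡ box v E ψ
   box-cong zero E h = h [] []
   box-cong (suc v) E h = sumZ-cong E (λ i l → box-cong v E (λ m a → h (i ∷ m) (l ∷ a)))

   box-+ : ∀ v E (φ ψ : Vec ℕ v → ℤ) → box v E (λ m → φ m + ψ m) ≡ box v E φ + box v E ψ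
   box-+ zero E φ ψ = refl
   box-+ (suc v) E φ ψ = trans (sumZ-cong E (λ i _ → box-+ v E _ _)) (sumZ-+ E _ _)

   box-* : ∀ v E k (φ : Vec ℕ v → ℤ) → box v E (λ m → k * φ m) ≡ k * box v E φ
   box-* zero E k φ = refl
   box-* (suc v) E k φ = trans (sumZ-cong E (λ i _ → box-* v E k _)) (sumZ-* E k _)

   box-0 : ∀ v E (φ : Vec ℕ v → ℤ) → (∀ m → φ m ≡ + 0) → box v E φ ≡ + 0
   box-0 zero E φ h = h []
   box-0 (suc v) E φ h = sumZ-0 E _ (λ i _ → box-0 v E _ (λ m → h (i ∷ m)))

   sumZ-δ : ∀ E a (φ : ℕ → ℤ) → a ℕ.< E → sumZ E (λ i → δ1 a i * φ i) ≡ φ a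
   sumZ-δ (suc E) a φ (s≤s a≤E) with a ℕ.≟ E
   ... | yes refl = trans (cong₂ _+_ (sumZ-0 E _ (λ i l → trans (cong (_* φ i) (δ1-≢ (λ e → ℕ.<-irrefl (sym e) l))) (ℤ.*-zeroˡ (φ i))))
                       (ℤ.*-identityˡ (φ a))) (ℤ.+-identityˡ (φ a))
   ... | no ne = trans (cong₂ _+_ (sumZ-δ E a φ (ℕ.≤∧≢⇒< a≤E ne)) (ℤ.*-zeroˡ (φ E))) (ℤ.+-identityʳ (φ a))

   box-δ : ∀ v E m' (φ : Vec ℕ v → ℤ) → All (ℕ._< E) m' → box v E (λ m → δ m' m * φ m) ≡ φ m'
   box-δ zero E [] φ [] = ℤ.*-identityˡ (φ [])
   box-δ (suc v) E (a ∷ m') φ (l ∷ ls) = begin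
     sumZ E (λ i → box v E (λ m → δ1 a i * δ m' m * φ (i ∷ m)))
       ≡⟨ sumZ-cong E (λ i _ → trans (box-cong v E (λ m _ → ℤ.*-assoc (δ1 a i) _ _)) (box-* v E (δ1 a i) _)) ⟩
     sumZ E (λ i → δ1 a i * box v E (λ m → δ m' m * φ (i ∷ m)))
       ≡⟨ sumZ-cong E (λ i _ → cong (δ1 a i *_) (box-δ v E m' (λ m → φ (i ∷ m)) ls)) ⟩
     sumZ E (λ i → δ1 a i * φ (i ∷ m')) ≡⟨ sumZ-δ E a (λ i → φ (i ∷ m')) l ⟩
     φ (a ∷ m') ∎

   box-ext : ∀ v E k (φ : Vec ℕ v → ℤ) → (∀ m → ¬ All (ℕ._< E) m → φ m ≡ + 0) → box v (E ℕ.+ k) φ ≡ box v E φ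
   box-ext zero E k φ h = refl
   box-ext (suc v) E k φ h = begin
     sumZ (E ℕ.+ k) (λ i → box v (E ℕ.+ k) (λ m → φ (i ∷ m))) ≡⟨ sumZ-split E k _ ⟩
     _ ≡⟨ cong₂ _+_
           (sumZ-cong E (λ i l → box-ext v E k (λ m → φ (i ∷ m)) (λ m na → h (i ∷ m) (λ { (_ ∷ a) → na a }))))
           (sumZ-0 k _ (λ i _ → box-0 v (E ℕ.+ k) _ (λ m → h _ (λ { (l ∷ _) → ℕ.<⇒≱ l (ℕ.m≤m+n E i) })))) ⟩
     sumZ E (λ i → box v E (λ m → φ (i ∷ m))) + + 0 ≡⟨ ℤ.+-identityʳ _ ⟩
     _ ∎

 BoundedExp : ∀ {v} → ℕ → Poly v → Set
 BoundedExp E f = ∀ m → ¬ All (ℕ._< E) m → coeff f m ≡ + 0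

 abstract
   all< : ∀ {v} (m : Vec ℕ v) → ∃[ E ] All (ℕ._< E) m
   all< [] = 0 , []
   all< (a ∷ m) with all< m
   ... | E , h = suc a ℕ.+ E , (ℕ.m≤m+n (suc a) E ∷ All.map (λ l → ℕ.≤-trans l (ℕ.m≤n+m E (suc a))) h)

   -- The slack `k` lets two polynomials be expanded over one common box.
   evalP-box₀ : ∀ {v} (f : Poly v) → ∃[ E₀ ] (∀ k x → evalP f x ≡ box v (E₀ ℕ.+ k) (λ m → coeff f m * mon x m))
   evalP-box₀ {v} [] = 0 , λ k x → sym (box-0 v k _ (λ m → ℤ.*-zeroˡ (mon x m)))
   evalP-box₀ {v} ((m' , c) ∷ f) with evalP-box₀ f | all< m'
   ... | E , h | F , a = E ℕ.+ F , λ k x → begin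
     c * mon x m' + evalP f x
       ≡⟨ cong₂ _+_ (sym (box-δ v (E ℕ.+ F ℕ.+ k) m' (λ m → c * mon x m) (All.map (λ l → ℕ.≤-trans l (ℕ.≤-trans (ℕ.m≤n+m F E) (ℕ.m≤m+n _ k))) a)))
                    (trans (h (F ℕ.+ k) x) (cong (λ z → box v z (λ m → coeff f m * mon x m)) (sym (ℕ.+-assoc E F k)))) ⟩
     box v (E ℕ.+ F ℕ.+ k) (λ m → δ m' m * (c * mon x m)) + box v (E ℕ.+ F ℕ.+ k) (λ m → coeff f m * mon x m) ≡⟨ sym (box-+ v (E ℕ.+ F ℕ.+ k) (λ m → δ m' m * (c * mon x m)) (λ m → coeff f m * mon x m)) ⟩
     box v (E ℕ.+ F ℕ.+ k) (λ m → δ m' m * (c * mon x m) + coeff f m * mon x m)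
       ≡⟨ box-cong v _ (λ m _ → trans (lem (δ m' m) c (mon x m) (coeff f m)) (cong (_* mon x m) (sym (coeff-∷ m' c f m)))) ⟩
     box v (E ℕ.+ F ℕ.+ k) (λ m → coeff ((m' , c) ∷ f) m * mon x m) ∎
     where
     lem : ∀ d c a e → d * (c * a) + e * a ≡ (d * c + e) * a
     lem = solve-∀

   evalP-box : ∀ {v} (f : Poly v) E → BoundedExp E f → ∀ x → evalP f x ≡ box v E (λ m → coeff f m * mon x m)
   evalP-box {v} f E b x with evalP-box₀ f
   ... | E₀ , h = begin
     evalP f x ≡⟨ h E x ⟩
     box v (E₀ ℕ.+ E) (λ m → coeff f m * mon x m) ≡⟨ cong (λ z → box v z (λ m → coeff f m * mon x m)) (ℕ.+-comm E₀ E) ⟩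
     box v (E ℕ.+ E₀) (λ m → coeff f m * mon x m) ≡⟨ box-ext v E E₀ (λ m → coeff f m * mon x m) (λ m na → trans (cong (_* mon x m) (b m na)) (ℤ.*-zeroˡ (mon x m))) ⟩
     box v E (λ m → coeff f m * mon x m) ∎

   ≈P⇒evalP : ∀ {v} {f g : Poly v} → f ≈P g → ∀ x → evalP f x ≡ evalP g x
   ≈P⇒evalP {v} {f} {g} e x with evalP-box₀ f | evalP-box₀ g
   ... | E , h | F , h' = begin
     evalP f x ≡⟨ h F x ⟩
     box v (E ℕ.+ F) (λ m → coeff f m * mon x m) ≡⟨ box-cong v (E ℕ.+ F) (λ m _ → cong (_* mon x m) (e m)) ⟩
     box v (E ℕ.+ F) (λ m → coeff g m * mon x m) ≡⟨ cong (λ z → box v z (λ m → coeff g m * mon x m)) (ℕ.+-comm E F) ⟩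
     box v (F ℕ.+ E) (λ m → coeff g m * mon x m) ≡⟨ sym (h' E x) ⟩
     evalP g x ∎

   -- The constant term is divisible by every t ≥ 1, hence zero; then cancel t.
   zeroUni : ∀ n (c : ℕ → ℤ) → (∀ t → sumZ n (λ i → c i * (+ suc t) ^ i) ≡ + 0) → ∀ i → i ℕ.< n → c i ≡ + 0
   zeroUni (suc n) c h = go
     where
     rest : ℕ → ℤ
     rest t = sumZ n (λ i → c (suc i) * (+ suc t) ^ i)
     eq : ∀ t → c 0 + + suc t * rest t ≡ + 0
     eq t = trans (sym (trans (sumZ-first n _) (cong₂ _+_ (ℤ.*-identityʳ (c 0))
              (trans (sumZ-cong n (λ i _ → lem (c (suc i)) (+ suc t) ((+ suc t) ^ i))) (sumZ-* n (+ suc t) _))))) (h t)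
       where
       lem : ∀ a b d → a * (b * d) ≡ b * (a * d)
       lem = solve-∀
     neg : ∀ t → c 0 ≡ - (+ suc t * rest t)
     neg t = trans (trans (lem (c 0) (+ suc t * rest t)) (cong (_- (+ suc t * rest t)) (eq t))) (ℤ.+-identityˡ _)
       where
       lem : ∀ a b → a ≡ a + b - b
       lem = solve-∀
     absurd-size : ∀ a b → a ≡ suc a ℕ.* b → b ≡ 0
     absurd-size a zero e = refl
     absurd-size a (suc b) e = ⊥-elim (ℕ.<-irrefl e (ℕ.≤-trans (ℕ.n<1+n a) (ℕ.m≤m*n (suc a) (suc b))))
     A : ℕ
     A = ∣ c 0 ∣
     r0 : (∣ rest A ∣) ≡ 0
     r0 = absurd-size A (∣ rest A ∣)
            (trans (cong ∣_∣ (neg A)) (trans (ℤ.∣-i∣≡∣i∣ (+ suc A * rest A)) (ℤ.∣i*j∣≡∣i∣*∣j∣ (+ suc A) (rest A))))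
     c0 : c 0 ≡ + 0
     c0 = trans (neg A) (cong -_ (trans (cong (+ suc A *_) (ℤ.∣i∣≡0⇒i≡0 r0)) (ℤ.*-zeroʳ (+ suc A))))
     rest0 : ∀ t → rest t ≡ + 0
     rest0 t = ℤ.*-cancelˡ-≡ (+ suc t) (rest t) (+ 0)
       (trans (trans (sym (ℤ.+-identityˡ _)) (trans (cong (_+ + suc t * rest t) (sym c0)) (eq t))) (sym (ℤ.*-zeroʳ (+ suc t))))
     go : ∀ i → i ℕ.< suc n → c i ≡ + 0
     go zero l = c0
     go (suc i) (s≤s l) = zeroUni n (λ j → c (suc j)) rest0 i l

   -- With the other coordinates fixed, a polynomial in the first variable vanishes at all positive
   -- integers. Its coefficients are polynomials in the remaining variables that therefore vanish
   -- everywhere, and induction applies.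
   zeroBox : ∀ v E (c : Vec ℕ v → ℤ) → (∀ x → box v E (λ m → c m * mon x m) ≡ + 0) → ∀ m → All (ℕ._< E) m → c m ≡ + 0
   zeroBox zero E c h [] [] = trans (sym (ℤ.*-identityʳ (c []))) (h [])
   zeroBox (suc v) E c h (i ∷ m) (l ∷ ls) = zeroBox v E (λ m → c (i ∷ m)) (λ x → zeroUni E (λ j → box v E (λ m → c (j ∷ m) * mon x m))
       (λ t → trans (sumZ-cong E (λ j _ → trans (ℤ.*-comm (box v E (λ m → c (j ∷ m) * mon x m)) ((+ suc t) ^ j)) (trans (sym (box-* v E ((+ suc t) ^ j) (λ m → c (j ∷ m) * mon x m)))
         (box-cong v E (λ m _ → lem ((+ suc t) ^ j) (c (j ∷ m)) (mon x m)))))) (h (+ suc t ∷ x))) i l) m ls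
     where
     lem : ∀ a b d → a * (b * d) ≡ b * (a * d)
     lem = solve-∀

   -- The differences of the coefficients sum to zero at every point, so `zeroBox` applies on a box
   -- that contains `m`. The final circuit is checked through this lemma, by its values.
   evalP⇒≈P : ∀ {v} {f g : Poly v} → (∀ x → evalP f x ≡ evalP g x) → f ≈P g
   evalP⇒≈P {v} {f} {g} e m with evalP-box₀ f | evalP-box₀ g | all< m
   ... | E , h | F , h' | G , a = begin
     coeff f m ≡⟨ lem (coeff f m) (coeff g m) ⟩
     (coeff f m - coeff g m) + coeff g m ≡⟨ cong (_+ coeff g m) (zeroBox v B (λ m → coeff f m - coeff g m) vanish m (All.map (λ l → ℕ.≤-trans l (ℕ.m≤n+m G (E ℕ.+ F))) a)) ⟩
     + 0 + coeff g m ≡⟨ ℤ.+-identityˡ _ ⟩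
     coeff g m ∎
     where
     B : ℕ
     B = E ℕ.+ F ℕ.+ G
     lem : ∀ a b → a ≡ (a - b) + b
     lem = solve-∀
     lem2 : ∀ a b d → (a - b) * d ≡ a * d + (- + 1) * (b * d)
     lem2 = solve-∀
     B≡ : F ℕ.+ (E ℕ.+ G) ≡ B
     B≡ = trans (sym (ℕ.+-assoc F E G)) (cong (ℕ._+ G) (ℕ.+-comm F E))
     vanish : ∀ x → box v B (λ m → (coeff f m - coeff g m) * mon x m) ≡ + 0
     vanish x = begin
       box v B (λ m → (coeff f m - coeff g m) * mon x m) ≡⟨ box-cong v B (λ m _ → lem2 (coeff f m) (coeff g m) (mon x m)) ⟩
       box v B (λ m → coeff f m * mon x m + (- + 1) * (coeff g m * mon x m)) ≡⟨ trans (box-+ v B (λ m → coeff f m * mon x m) (λ m → (- + 1) * (coeff g m * mon x m))) (cong (λ z → box v B (λ m → coeff f m * mon x m) + z) (box-* v B (- + 1) (λ m → coeff g m * mon x m))) ⟩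
       box v B (λ m → coeff f m * mon x m) + (- + 1) * box v B (λ m → coeff g m * mon x m)
         ≡⟨ cong₂ (λ a b → a + (- + 1) * b)
              (trans (cong (λ z → box v z (λ m → coeff f m * mon x m)) (ℕ.+-assoc E F G)) (sym (h (F ℕ.+ G) x)))
              (trans (cong (λ z → box v z (λ m → coeff g m * mon x m)) (sym B≡)) (sym (h' (E ℕ.+ G) x))) ⟩
       evalP f x + (- + 1) * evalP g x ≡⟨ cong (λ z → z + (- + 1) * evalP g x) (e x) ⟩
       evalP g x + (- + 1) * evalP g x ≡⟨ lem3 (evalP g x) ⟩
       + 0 ∎
       where
       lem3 : ∀ a → a + (- + 1) * a ≡ + 0
       lem3 = solve-∀

-- Composition and evaluation of circuits

module CircuitTools where
 open import Data.Nat using (_+_; _*_; _≤_)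
 open import Data.Nat.Properties
 open import Data.Integer using (ℤ)
 open import Data.Bool using (_xor_; _∧_)
 open import Function using (_∘_)
 open Evaluation using (opZ)

 -- One compilation scheme serves every interpretation of the gates: integers, formal
 -- degrees, and Boolean circuits, which are arithmetic circuits over the field of two elements.
 record Alg : Set₁ where
   field
     Car : Set
     𝟙 : Car
     op : Op → Car → Car → Car
 open Alg public

 opB : Op → Bool → Bool → Bool
 opB plus = _xor_
 opB minus = _xor_
 opB times = _∧_

 ℤA 𝔹A degA : Alg
 ℤA = record { Car = ℤ ; 𝟙 = ℤ.+ 1 ; op = opZ }
 𝔹A = record { Car = Bool ; 𝟙 = true ; op = opB }
 degA = record { Car = ℕ ; 𝟙 = 1 ; op = degOp }

 gv : ∀ (𝒜 : Alg) {v k} → (Fin v → Car 𝒜) → Gates v k → Fin k → Car 𝒜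
 gv 𝒜 x = Interp.gateVals x (𝟙 𝒜) (op 𝒜)

 rv : ∀ (𝒜 : Alg) {v k} → (Fin v → Car 𝒜) → (Fin k → Car 𝒜) → Ref v k → Car 𝒜
 rv 𝒜 {v} x = Interp.refVal {v = v} x (𝟙 𝒜) (op 𝒜)

 wkRef : ∀ {v k} l → Ref v k → Ref v (l + k)
 wkRef l (var i) = var i
 wkRef l one = one
 wkRef l (gate j) = gate (l ↑ʳ j)

 trRef : ∀ {v k m l} → (Fin m → Ref v k) → Ref m l → Ref v (l + k)
 trRef {l = l} σ (var i) = wkRef l (σ i)
 trRef σ one = one
 trRef {k = k} σ (gate j) = gate (j ↑ˡ k)

 -- Gate `zero` is the newest. The `l` grafted gates therefore come first, an old gate `j` becomes
 -- `l ↑ʳ j`, and the inputs of the grafted circuit become the references `σ` into the old one.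
 graft : ∀ {v k m l} → Gates v k → (Fin m → Ref v k) → Gates m l → Gates v (l + k)
 graft G σ [] = G
 graft G σ (gs ▷ (o , r₁ , r₂)) = graft G σ gs ▷ (o , trRef σ r₁ , trRef σ r₂)

 -- Trees rather than circuits with sharing: their formal degree is bounded by their size, so
 -- polynomial size alone puts a family of trees into VP⁰.
 data Exp (m : ℕ) : Set where
   v# : Fin m → Exp m
   o# : Exp m
   op# : Op → Exp m → Exp m → Exp m

 nodes : ∀ {m} → Exp m → ℕ
 nodes (v# i) = 0
 nodes o# = 0
 nodes (op# o a b) = suc (nodes b + nodes a)

 evE : ∀ (𝒜 : Alg) {m} → (Fin m → Car 𝒜) → Exp m → Car 𝒜
 evE 𝒜 x (v# i) = x i
 evE 𝒜 x o# = 𝟙 𝒜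
 evE 𝒜 x (op# o a b) = op 𝒜 o (evE 𝒜 x a) (evE 𝒜 x b)

 compile : ∀ {m} (e : Exp m) → Gates m (nodes e) × Ref m (nodes e)
 compile (v# i) = [] , var i
 compile o# = [] , one
 compile (op# o a b) with compile a | compile b
 ... | G , r | H , s = (graft G var H ▷ (o , wkRef (nodes b) r , trRef var s)) , gate Fin.zero

 circuitOf : ∀ {m} → Exp m → Circuit m
 circuitOf e = record { size = nodes e ; gates = proj₁ (compile e) ; output = proj₂ (compile e) }

 module _ (𝒜 : Alg) where
   abstract
     gv-graft-old : ∀ {v k m l} (x : Fin v → Car 𝒜) (G : Gates v k) (σ : Fin m → Ref v k) (H : Gates m l) j →
       gv 𝒜 x (graft G σ H) (l ↑ʳ j) ≡ gv 𝒜 x G j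
     gv-graft-old x G σ [] j = refl
     gv-graft-old x G σ (H ▷ _) j = gv-graft-old x G σ H j

     rv-wk : ∀ {v k m l} (x : Fin v → Car 𝒜) (G : Gates v k) (σ : Fin m → Ref v k) (H : Gates m l) r →
       rv 𝒜 x (gv 𝒜 x (graft G σ H)) (wkRef l r) ≡ rv 𝒜 x (gv 𝒜 x G) r
     rv-wk x G σ H (var i) = refl
     rv-wk x G σ H one = refl
     rv-wk x G σ H (gate j) = gv-graft-old x G σ H j

     gv-graft-new : ∀ {v k m l} (x : Fin v → Car 𝒜) (G : Gates v k) (σ : Fin m → Ref v k) (H : Gates m l) j →
       gv 𝒜 x (graft G σ H) (j ↑ˡ k) ≡ gv 𝒜 (λ i → rv 𝒜 x (gv 𝒜 x G) (σ i)) H j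
     rv-tr : ∀ {v k m l} (x : Fin v → Car 𝒜) (G : Gates v k) (σ : Fin m → Ref v k) (H : Gates m l) r →
       rv 𝒜 x (gv 𝒜 x (graft G σ H)) (trRef σ r)
         ≡ rv 𝒜 (λ i → rv 𝒜 x (gv 𝒜 x G) (σ i)) (gv 𝒜 (λ i → rv 𝒜 x (gv 𝒜 x G) (σ i)) H) r
     rv-tr x G σ H (var i) = rv-wk x G σ H (σ i)
     rv-tr x G σ H one = refl
     rv-tr x G σ H (gate j) = gv-graft-new x G σ H j
     gv-graft-new x G σ (H ▷ (o , r₁ , r₂)) Fin.zero = cong₂ (op 𝒜 o) (rv-tr x G σ H r₁) (rv-tr x G σ H r₂)
     gv-graft-new x G σ (H ▷ _) (Fin.suc j) = gv-graft-new x G σ H j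

     compile-correct : ∀ {m} (x : Fin m → Car 𝒜) (e : Exp m) →
       rv 𝒜 x (gv 𝒜 x (proj₁ (compile e))) (proj₂ (compile e)) ≡ evE 𝒜 x e
     compile-correct x (v# i) = refl
     compile-correct x o# = refl
     compile-correct x (op# o a b) = cong₂ (op 𝒜 o)
       (trans (rv-wk x (proj₁ (compile a)) var (proj₁ (compile b)) (proj₂ (compile a))) (compile-correct x a))
       (trans (rv-tr x (proj₁ (compile a)) var (proj₁ (compile b)) (proj₂ (compile b))) (compile-correct x b))

     gv-cong : ∀ {v k} {x y : Fin v → Car 𝒜} → (∀ i → x i ≡ y i) → (G : Gates v k) → ∀ j → gv 𝒜 x G j ≡ gv 𝒜 y G j
     rv-cong : ∀ {v k} {x y : Fin v → Car 𝒜} → (∀ i → x i ≡ y i) → (G : Gates v k) → ∀ r →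
       rv 𝒜 x (gv 𝒜 x G) r ≡ rv 𝒜 y (gv 𝒜 y G) r
     rv-cong h G (var i) = h i
     rv-cong h G one = refl
     rv-cong h G (gate j) = gv-cong h G j
     gv-cong h (G ▷ (o , r₁ , r₂)) Fin.zero = cong₂ (op 𝒜 o) (rv-cong h G r₁) (rv-cong h G r₂)
     gv-cong h (G ▷ _) (Fin.suc j) = gv-cong h G j

     evE-cong : ∀ {m} {x y : Fin m → Car 𝒜} → (∀ i → x i ≡ y i) → ∀ e → evE 𝒜 x e ≡ evE 𝒜 y e
     evE-cong h (v# i) = h i
     evE-cong h o# = refl
     evE-cong h (op# o a b) = cong₂ (op 𝒜 o) (evE-cong h a) (evE-cong h b)

 abstract
   -- The formal degree of a tree is at most its number of leaves.
   deg-exp : ∀ {m} (e : Exp m) → evE degA (λ _ → 1) e ≤ suc (nodes e)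
   deg-exp (v# i) = s≤s z≤n
   deg-exp o# = s≤s z≤n
   deg-exp (op# times a b) = ≤-trans (+-mono-≤ (deg-exp a) (deg-exp b))
     (≤-reflexive (trans (cong suc (+-suc (nodes a) (nodes b))) (cong (suc ∘ suc) (+-comm (nodes a) (nodes b)))))
   deg-exp (op# plus a b) = ⊔-lub (≤-trans (deg-exp a) (s≤s (≤-trans (m≤n+m _ (nodes b)) (n≤1+n _))))
                                  (≤-trans (deg-exp b) (s≤s (≤-trans (m≤m+n _ (nodes a)) (n≤1+n _))))
   deg-exp (op# minus a b) = ⊔-lub (≤-trans (deg-exp a) (s≤s (≤-trans (m≤n+m _ (nodes b)) (n≤1+n _))))
                                  (≤-trans (deg-exp b) (s≤s (≤-trans (m≤m+n _ (nodes a)) (n≤1+n _))))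

   formalDegree-exp : ∀ {m} (e : Exp m) → formalDegree (circuitOf e) ≤ suc (nodes e)
   formalDegree-exp e = ≤-trans (≤-reflexive (compile-correct degA (λ _ → 1) e)) (deg-exp e)

 record BC (v : ℕ) (O : Set) : Set where
   constructor bc
   field
     {len} : ℕ
     gts : Gates v len
     outs : O → Ref v len
 open BC public

 ev : ∀ (𝒜 : Alg) {v O} → BC v O → (Fin v → Car 𝒜) → O → Car 𝒜
 ev 𝒜 C x o = rv 𝒜 x (gv 𝒜 x (gts C)) (outs C o)

 extend : ∀ {v m O O'} → BC v O → BC m O' → (Fin m → O) → BC v (O ⊎ O')
 extend C B w = bc (graft (gts C) (λ i → outs C (w i)) (gts B))
   [ (λ o → wkRef (len B) (outs C o)) , (λ o → trRef (λ i → outs C (w i)) (outs B o)) ]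

 -- A Boolean circuit is handled only through the function `F` that it computes and a bound `s` on
 -- its size. Outputs are indexed by an arbitrary type `O`, so that wiring is a plain function.
 record Cp (v : ℕ) (O : Set) (s : ℕ) (F : (Fin v → Bool) → O → Bool) : Set where
   constructor mkCp
   field
     cir : BC v O
     size≤ : len cir ≤ s
     correct : ∀ x o → ev 𝔹A cir x o ≡ F x o
 open Cp public

 module _ {v : ℕ} where
   cp-wire : ∀ {O} (w : O → Fin v) → Cp v O 0 (λ x o → x (w o))
   cp-wire w = mkCp (bc [] (λ o → var (w o))) z≤n (λ x o → refl)

   cp-map : ∀ {O O' : Set} {s F} (h : O' → O) → Cp v O s F → Cp v O' s (λ x o → F x (h o))
   cp-map h (mkCp (bc G r) l c) = mkCp (bc G (λ o → r (h o))) l (λ x o → c x (h o))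

   cp-eq : ∀ {O s F F'} → (∀ x o → F x o ≡ F' x o) → Cp v O s F → Cp v O s F'
   cp-eq h (mkCp C l c) = mkCp C l (λ x o → trans (c x o) (h x o))

   cp-≤ : ∀ {O s s' F} → s ≤ s' → Cp v O s F → Cp v O s' F
   cp-≤ h (mkCp C l c) = mkCp C (≤-trans l h) c

   -- The outputs of the first circuit stay available next to those of the second. This sharing
   -- makes the sizes add up, instead of multiply, under repeated extension.
   cp-ext : ∀ {m O O' s s' F H} → Cp v O s F → Cp m O' s' H → (w : Fin m → O) →
     Cp v (O ⊎ O') (s' + s) (λ x → [ F x , H (λ i → F x (w i)) ])
   cp-ext {F = F} {H} (mkCp C l c) (mkCp B l' c') w = mkCp (extend C B w) (+-mono-≤ l' l) cor
     where
     cor : ∀ x o → ev 𝔹A (extend C B w) x o ≡ [ F x , H (λ i → F x (w i)) ] o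
     cor x (inj₁ o) = trans (rv-wk 𝔹A x (gts C) (λ i → outs C (w i)) (gts B) (outs C o)) (c x o)
     cor x (inj₂ o) = trans (rv-tr 𝔹A x (gts C) (λ i → outs C (w i)) (gts B) (outs B o))
       (trans (rv-cong 𝔹A (λ i → c x (w i)) (gts B) (outs B o)) (c' _ o))

   cp-seq : ∀ {m O O' s s' F H} → Cp v O s F → Cp m O' s' H → (w : Fin m → O) →
     Cp v O' (s' + s) (λ x → H (λ i → F x (w i)))
   cp-seq C B w = cp-map inj₂ (cp-ext C B w)

   cp-withIn : ∀ {O s F} → Cp v O s F → Cp v (O ⊎ Fin v) s (λ x → [ F x , x ])
   cp-withIn {F = F} (mkCp (bc G r) l c) = mkCp (bc G [ r , var ]) l (λ { x (inj₁ o) → c x o ; x (inj₂ i) → refl })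

   cp-par : ∀ {O O' s s' F F'} → Cp v O s F → Cp v O' s' F' → Cp v (O ⊎ O') (s' + s) (λ x → [ F x , F' x ])
   cp-par {O} {O'} {F = F} {F'} C C' = cp-eq (λ { x (inj₁ o) → refl ; x (inj₂ o) → refl })
     (cp-map h (cp-ext (cp-withIn C) C' inj₂))
     where
     h : O ⊎ O' → (O ⊎ Fin v) ⊎ O'
     h (inj₁ o) = inj₁ (inj₁ o)
     h (inj₂ o) = inj₂ o

   cp-many : ∀ c {O t} {F : Fin c → (Fin v → Bool) → O → Bool} → (∀ i → Cp v O t (F i)) →
     Cp v (Fin c × O) (c * t) (λ x io → F (proj₁ io) x (proj₂ io))
   cp-many zero {O} h = mkCp (bc [] (λ { (() , _) })) z≤n (λ { x (() , _) })
   cp-many (suc c) {O} {t} {F} h = cp-≤ (≤-reflexive (+-comm (c * t) t))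
     (cp-eq (λ { x (Fin.zero , o) → refl ; x (Fin.suc i , o) → refl })
       (cp-map split (cp-par (h Fin.zero) (cp-many c (λ i → h (Fin.suc i))))))
     where
     split : Fin (suc c) × O → O ⊎ (Fin c × O)
     split (Fin.zero , o) = inj₁ o
     split (Fin.suc i , o) = inj₂ (i , o)

   cp-exp1 : (e : Exp v) → ∀ {t} → nodes e ≤ t → Cp v (Fin 1) t (λ x _ → evE 𝔹A x e)
   cp-exp1 e l = mkCp (bc (proj₁ (compile e)) (λ _ → proj₂ (compile e))) l (λ x _ → compile-correct 𝔹A x e)

   cp-exp : ∀ c {t} (es : Fin c → Exp v) → (∀ i → nodes (es i) ≤ t) → Cp v (Fin c) (c * t) (λ x i → evE 𝔹A x (es i))
   cp-exp c es l = cp-map (λ i → i , Fin.zero) (cp-many c (λ i → cp-exp1 (es i) (l i)))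

   iterF : ∀ {m} {O : Set} → (ℕ → (Fin m → Bool) → O → Bool) → (Fin m → O) → ℕ → (O → Bool) → (O → Bool)
   iterF H w zero st = st
   iterF H w (suc T) st = H T (λ i → iterF H w T st (w i))

   cp-iter : ∀ T {m O s s' F} {H : ℕ → (Fin m → Bool) → O → Bool} → Cp v O s F → (∀ t → Cp m O s' (H t)) → (w : Fin m → O) →
     Cp v O (T * s' + s) (λ x → iterF H w T (F x))
   cp-iter zero C B w = C
   cp-iter (suc T) {s = s} {s'} C B w = cp-≤ (≤-reflexive (sym (+-assoc s' (T * s') s))) (cp-seq (cp-iter T C B w) (B T) w)

-- Exponential sums under the hypothesis

module SumClosure where
 open import Data.Nat using (_≤_)
 open import Data.Integer using (ℤ; +_; _+_; _*_; -_; _-_)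
 open import Data.Integer.Tactic.RingSolver using (solve-∀)
 open import Data.List using ([]; _∷_)
 open Growth
 open Evaluation
 open CircuitTools

 open ≡-Reasoning

 powL : ℕ → List ℕ
 powL zero = 1 ∷ []
 powL (suc c) = 0 ∷ powL c

 mapV : ∀ {m n} → (Fin m → Fin n) → Exp m → Exp n
 mapV ι (v# i) = v# (ι i)
 mapV ι o# = o#
 mapV ι (op# o a b) = op# o (mapV ι a) (mapV ι b)

 -- The product of the factors 1 - b vanishes unless all padding bits are 0. Multiplied by it, a
 -- summand can be given additional summation bits without a change of the sum.
 noneE : ∀ {m} d → (Fin d → Fin m) → Exp m
 noneE zero ι = o#
 noneE (suc d) ι = op# times (op# minus o# (v# (ι Fin.zero))) (noneE d (λ j → ι (Fin.suc j)))

 none : ∀ {d} → Vec Bool d → ℤ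
 none [] = + 1
 none (b ∷ e) = (+ 1 - bool→ℤ b) * none e

 abstract
   evalℕPoly-powL : ∀ c n → evalℕPoly (powL c) n ≡ n ℕ.^ c
   evalℕPoly-powL zero n = cong suc (ℕ.*-zeroʳ n)
   evalℕPoly-powL (suc c) n = cong (n ℕ.*_) (evalℕPoly-powL c n)

   -- `VNP0` takes the number of summation bits from a coefficient list, exactly; the sums below
   -- have polynomially bounded numbers of bits. The difference is filled by padding.
   poly-above : ∀ {p} → PolyBounded p → ∃[ ps ] (∀ n → p n ≤ evalℕPoly ps n) × PB (evalℕPoly ps)
   -- The list denotes suc c + n * n ^ c. Its `suc` pays for 0 ^ 0 = 1 at `n` = 0.
   poly-above {p} (c , h) = (suc c ∷ powL c) , (λ n → ℕ.≤-trans (h n) (le n)) ,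
     PB-+ (PB-const (suc c)) (PB-* PB-id (PB-≤ (λ n → ℕ.≤-reflexive (evalℕPoly-powL c n)) (PB-^ PB-id c)))
     where
     0^≤1 : ∀ d → 0 ℕ.^ d ≤ 1
     0^≤1 zero = s≤s z≤n
     0^≤1 (suc d) = z≤n
     le : ∀ n → n ℕ.^ c ℕ.+ c ≤ suc c ℕ.+ n ℕ.* evalℕPoly (powL c) n
     le zero = ℕ.≤-trans (ℕ.+-monoˡ-≤ c (0^≤1 c)) (ℕ.m≤m+n (suc c) 0)
     le n@(suc m) rewrite evalℕPoly-powL c n = ℕ.≤-trans (ℕ.≤-reflexive (ℕ.+-comm (n ℕ.^ c) c))
       (ℕ.+-mono-≤ (ℕ.n≤1+n c) (ℕ.m≤m+n (n ℕ.^ c) (m ℕ.* n ℕ.^ c)))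

   nodes-mapV : ∀ {m n} (ι : Fin m → Fin n) e → nodes (mapV ι e) ≡ nodes e
   nodes-mapV ι (v# i) = refl
   nodes-mapV ι o# = refl
   nodes-mapV ι (op# o a b) = cong suc (cong₂ ℕ._+_ (nodes-mapV ι b) (nodes-mapV ι a))

   evE-mapV : ∀ 𝒜 {m n} (ι : Fin m → Fin n) (x : Fin n → Car 𝒜) e → evE 𝒜 x (mapV ι e) ≡ evE 𝒜 (λ i → x (ι i)) e
   evE-mapV 𝒜 ι x (v# i) = refl
   evE-mapV 𝒜 ι x o# = refl
   evE-mapV 𝒜 ι x (op# o a b) = cong₂ (op 𝒜 o) (evE-mapV 𝒜 ι x a) (evE-mapV 𝒜 ι x b)

   nodes-none : ∀ {m} d (ι : Fin d → Fin m) → nodes (noneE d ι) ≡ d ℕ.* 2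
   nodes-none zero ι = refl
   nodes-none (suc d) ι = trans (cong suc (cong (ℕ._+ 1) (nodes-none d (λ j → ι (Fin.suc j))))) (cong suc (ℕ.+-comm (d ℕ.* 2) 1))

   evE-none : ∀ {m d} (e : Vec Bool d) (ι : Fin d → Fin m) (x : Fin m → ℤ) →
     (∀ j → x (ι j) ≡ bool→ℤ (Vec.lookup e j)) → evE ℤA x (noneE d ι) ≡ none e
   evE-none [] ι x h = refl
   evE-none (b ∷ e) ι x h = cong₂ (λ s t → (+ 1 - s) * t) (h Fin.zero) (evE-none e (λ j → ι (Fin.suc j)) x (λ j → h (Fin.suc j)))

   Σb-+ : ∀ p (φ ψ : Vec Bool p → ℤ) → Σb p (λ e → φ e + ψ e) ≡ Σb p φ + Σb p ψ
   Σb-+ zero φ ψ = refl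
   Σb-+ (suc p) φ ψ = trans (Σb-cong p (λ e → lem (φ (false ∷ e)) (ψ (false ∷ e)) (φ (true ∷ e)) (ψ (true ∷ e)))) (Σb-+ p (λ e → φ (false ∷ e) + φ (true ∷ e)) (λ e → ψ (false ∷ e) + ψ (true ∷ e)))
     where
     lem : ∀ a b c d → (a + b) + (c + d) ≡ (a + c) + (b + d)
     lem = solve-∀

   Σb-++ : ∀ p d (φ : Vec Bool (p ℕ.+ d) → ℤ) → Σb (p ℕ.+ d) φ ≡ Σb p (λ a → Σb d (λ b → φ (a Vec.++ b)))
   Σb-++ zero d φ = refl
   Σb-++ (suc p) d φ = trans (Σb-++ p d (λ e → φ (false ∷ e) + φ (true ∷ e)))
     (Σb-cong p (λ a → Σb-+ d (λ b → φ (false ∷ a Vec.++ b)) (λ b → φ (true ∷ a Vec.++ b))))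

   Σb-none : ∀ d c → Σb d (λ e → none e * c) ≡ c
   Σb-none zero c = ℤ.*-identityˡ c
   Σb-none (suc d) c = trans (Σb-cong d (λ e → lem (none e) c)) (Σb-none d c)
     where
     lem : ∀ a c → (+ 1 - + 0) * a * c + (+ 1 - + 1) * a * c ≡ a * c
     lem = solve-∀

   lookup-++b : ∀ {v p} (x : Vec ℤ v) (a : Vec Bool p) i → Vec.lookup (x Vec.++ b2z a) (i ↑ˡ p) ≡ Vec.lookup x i
   lookup-++b x a i = Vec.lookup-++ˡ x (b2z a) i

   lookup-++b' : ∀ {v p} (x : Vec ℤ v) (a : Vec Bool p) j → Vec.lookup (x Vec.++ b2z a) (v ↑ʳ j) ≡ bool→ℤ (Vec.lookup a j)
   lookup-++b' x a j = trans (Vec.lookup-++ʳ x (b2z a) j) (Vec.lookup-map j bool→ℤ a)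

 sumE : ∀ v p → Exp (v ℕ.+ p) → Vec ℤ v → ℤ
 sumE v p E x = Σb p (λ ε → evE ℤA (Vec.lookup (x Vec.++ b2z ε)) E)

 module Pad (v p d : ℕ) (E : Exp (v ℕ.+ p)) where
   ι : Fin (v ℕ.+ p) → Fin (v ℕ.+ (p ℕ.+ d))
   ι k = [ (λ i → i ↑ˡ (p ℕ.+ d)) , (λ j → v ↑ʳ (j ↑ˡ d)) ] (Fin.splitAt v k)
   κ : Fin d → Fin (v ℕ.+ (p ℕ.+ d))
   κ j = v ↑ʳ (p ↑ʳ j)
   padded : Exp (v ℕ.+ (p ℕ.+ d))
   padded = op# times (noneE d κ) (mapV ι E)
   abstract
     nodes-padded : nodes padded ≡ suc (nodes E ℕ.+ d ℕ.* 2)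
     nodes-padded = cong suc (cong₂ ℕ._+_ (nodes-mapV ι E) (nodes-none d κ))
     lookup-ι : ∀ (x : Vec ℤ v) (a : Vec Bool p) (b : Vec Bool d) k →
       Vec.lookup (x Vec.++ b2z (a Vec.++ b)) (ι k) ≡ Vec.lookup (x Vec.++ b2z a) k
     lookup-ι x a b k with Fin.splitAt v k in eq
     ... | inj₁ i = trans (lookup-++b x (a Vec.++ b) i) (trans (sym (lookup-++b x a i)) (cong (Vec.lookup (x Vec.++ b2z a)) (Fin.splitAt⁻¹-↑ˡ eq)))
     ... | inj₂ j = trans (lookup-++b' x (a Vec.++ b) (j ↑ˡ d)) (trans (cong bool→ℤ (Vec.lookup-++ˡ a b j))
                    (trans (sym (lookup-++b' x a j)) (cong (Vec.lookup (x Vec.++ b2z a)) (Fin.splitAt⁻¹-↑ʳ eq))))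
     sum-padded : ∀ x → sumE v (p ℕ.+ d) padded x ≡ sumE v p E x
     sum-padded x = trans (Σb-++ p d (λ ε → evE ℤA (Vec.lookup (x Vec.++ b2z ε)) padded)) (Σb-cong p (λ a → trans (Σb-cong d (λ b → cong₂ _*_
         (evE-none b κ (Vec.lookup (x Vec.++ b2z (a Vec.++ b))) (λ j → trans (lookup-++b' x (a Vec.++ b) (p ↑ʳ j)) (cong bool→ℤ (Vec.lookup-++ʳ a b j))))
         (trans (evE-mapV ℤA ι _ E) (evE-cong ℤA (lookup-ι x a b) E))))
       (Σb-none d (evE ℤA (Vec.lookup (x Vec.++ b2z a)) E))))

 padTo : ∀ v p P → p ≤ P → (E : Exp (v ℕ.+ p)) →
   Σ[ E' ∈ Exp (v ℕ.+ P) ] (nodes E' ≤ suc (nodes E ℕ.+ P ℕ.* 2) × (∀ x → sumE v P E' x ≡ sumE v p E x))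
 padTo v p P le E with ℕ.m≤n⇒∃[o]m+o≡n le
 ... | d , refl = Pad.padded v p d E ,
   ℕ.≤-trans (ℕ.≤-reflexive (Pad.nodes-padded v p d E)) (s≤s (ℕ.+-monoʳ-≤ (nodes E) (ℕ.*-monoˡ-≤ 2 (ℕ.m≤n+m d p)))) ,
   Pad.sum-padded v p d E

 -- The form in which the hypothesis enters everything below: the summands are trees, and the sum is
 -- described by its values instead of its coefficients.
 SumClosed : Set
 SumClosed = (v p : ℕ → ℕ) → PB v → PB p → (E : ∀ n → Exp (v n ℕ.+ p n)) → PB (λ n → nodes (E n)) →
   ∃[ s ] (PB s × (∀ n → Σ[ C ∈ Circuit (v n) ] (size C ≤ s n × (∀ x → evalC C x ≡ sumE (v n) (p n) (E n) x))))

 abstract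
   sumClosed : VP0≡VNP0 → SumClosed
   sumClosed hyp v p pv pp E pE with poly-above {p} (fromPB pp)
   ... | ps , le , pP with proj₂ (hyp v (λ n → sumOverBits {v n} {evalℕPoly ps n} (circuitPoly (circuitOf (proj₁ (padTo (v n) (p n) (evalℕPoly ps n) (le n) (E n)))))))
                         (fromPB pv , ps , (λ n → circuitPoly (circuitOf (E' n))) , (fromPB (PB-+ pv pP) , (λ n → suc (suc (nodes (E n) ℕ.+ P n ℕ.* 2))) ,
                            fromPB (PB-suc (PB-suc (PB-+ pE (PB-* pP (PB-const 2))))) ,
                            (λ n → circuitOf (E' n) , ℕ.≤-trans (nE n) (ℕ.n≤1+n _) , ℕ.≤-trans (formalDegree-exp (E' n)) (s≤s (nE n)) , λ m → refl)) , λ n m → refl)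
     where
     P : ℕ → ℕ
     P = evalℕPoly ps
     E' : ∀ n → Exp (v n ℕ.+ P n)
     E' n = proj₁ (padTo (v n) (p n) (P n) (le n) (E n))
     nE : ∀ n → nodes (E' n) ≤ suc (nodes (E n) ℕ.+ P n ℕ.* 2)
     nE n = proj₁ (proj₂ (padTo (v n) (p n) (P n) (le n) (E n)))
   ... | _ , s , ps' , h = s , toPB ps' , λ n → proj₁ (h n) , proj₁ (proj₂ (h n)) , λ x → begin
     evalC (proj₁ (h n)) x ≡⟨ sym (evalP-circuit (proj₁ (h n)) x) ⟩
     evalP (circuitPoly (proj₁ (h n))) x ≡⟨ ≈P⇒evalP {f = circuitPoly (proj₁ (h n))} {sumOverBits {v n} {P n} (circuitPoly (circuitOf (E' n)))} (proj₂ (proj₂ (proj₂ (h n)))) x ⟩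
     evalP (sumOverBits {v n} {P n} (circuitPoly (circuitOf (E' n)))) x ≡⟨ evalP-sumOverBits {v n} {P n} (circuitPoly (circuitOf (E' n))) x ⟩
     Σb (P n) (λ ε → evalP (circuitPoly (circuitOf (E' n))) (x Vec.++ b2z ε))
       ≡⟨ Σb-cong (P n) (λ ε → trans (evalP-circuit (circuitOf (E' n)) (x Vec.++ b2z ε)) (compile-correct ℤA (Vec.lookup (x Vec.++ b2z ε)) (E' n))) ⟩
     sumE (v n) (P n) (E' n) x ≡⟨ proj₂ (proj₂ (padTo (v n) (p n) (P n) (le n) (E n))) x ⟩
     sumE (v n) (p n) (E n) x ∎
     where
     P : ℕ → ℕ
     P = evalℕPoly ps
     E' : ∀ n → Exp (v n ℕ.+ P n)
     E' n = proj₁ (padTo (v n) (p n) (P n) (le n) (E n))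

-- Boolean circuits as polynomials of low degree

module Verification where
 open import Data.Nat using (_≤_)
 open import Data.Integer using (ℤ; +_; _+_; _*_; -_; _-_)
 open import Data.Integer.Tactic.RingSolver using (solve-∀)
 open import Data.Bool using (_xor_)
 open Evaluation
 open CircuitTools

 b2n : Bool → ℕ
 b2n false = 0
 b2n true = 1

 num : ∀ {L} → (Fin L → Bool) → ℕ
 num {zero} b = 0
 num {suc L} b = b2n (b Fin.zero) ℕ.+ 2 ℕ.* num (λ i → b (Fin.suc i))

 record Mod (M : ℕ) (a b : ℤ) : Set where
   constructor mod
   field
     quot : ℤ
     eqn : a ≡ b + quot * + M

 abstract
   num-cong : ∀ {L} {a b : Fin L → Bool} → (∀ i → a i ≡ b i) → num a ≡ num b
   num-cong {zero} h = refl
   num-cong {suc L} h = cong₂ (λ s t → s ℕ.+ 2 ℕ.* t) (cong b2n (h Fin.zero)) (num-cong (λ i → h (Fin.suc i)))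

   num< : ∀ {L} (b : Fin L → Bool) → num b ℕ.< 2 ℕ.^ L
   num< {zero} b = s≤s z≤n
   num< {suc L} b = ℕ.<-≤-trans (ℕ.+-monoˡ-< (2 ℕ.* num (λ i → b (Fin.suc i))) (lt (b Fin.zero)))
     (ℕ.≤-trans (ℕ.≤-reflexive (sym (ℕ.*-suc 2 (num (λ i → b (Fin.suc i)))))) (ℕ.*-monoʳ-≤ 2 (num< (λ i → b (Fin.suc i)))))
     where
     lt : ∀ c → b2n c ℕ.< 2
     lt false = s≤s z≤n
     lt true = s≤s (s≤s z≤n)

   b2z≡ : ∀ b → bool→ℤ b ≡ + b2n b
   b2z≡ false = refl
   b2z≡ true = refl

   mod-refl : ∀ {M a b} → a ≡ b → Mod M a b
   mod-refl {M} {a} {b} e = mod (+ 0) (trans e (sym (trans (cong (λ z → b + z) (ℤ.*-zeroˡ (+ M))) (ℤ.+-identityʳ b))))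

   mod-trans : ∀ {M a b c} → Mod M a b → Mod M b c → Mod M a c
   mod-trans {M} {a} {b} {c} (mod p e) (mod q e') = mod (q + p) (trans e (trans (cong (λ z → z + p * + M) e') (lem c p q (+ M))))
     where
     lem : ∀ c p q m → (c + q * m) + p * m ≡ c + (q + p) * m
     lem = solve-∀

   mod-sym : ∀ {M a b} → Mod M a b → Mod M b a
   mod-sym {M} {a} {b} (mod p e) = mod (- p) (trans (lem b p (+ M)) (cong (λ z → z + (- p) * + M) (sym e)))
     where
     lem : ∀ b p m → b ≡ (b + p * m) + (- p) * m
     lem = solve-∀

   mod-op : ∀ {M a b c d} o → Mod M a b → Mod M c d → Mod M (opZ o a c) (opZ o b d)
   mod-op {M} {a} {b} {c} {d} plus (mod p e) (mod q e') = mod (p + q) (trans (cong₂ _+_ e e') (lem b d p q (+ M)))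
     where
     lem : ∀ b d p q m → (b + p * m) + (d + q * m) ≡ (b + d) + (p + q) * m
     lem = solve-∀
   mod-op {M} {a} {b} {c} {d} minus (mod p e) (mod q e') = mod (p - q) (trans (cong₂ _-_ e e') (lem b d p q (+ M)))
     where
     lem : ∀ b d p q m → (b + p * m) - (d + q * m) ≡ (b - d) + (p - q) * m
     lem = solve-∀
   mod-op {M} {a} {b} {c} {d} times (mod p e) (mod q e') = mod (p * d + b * q + p * q * + M) (trans (cong₂ _*_ e e') (lem b d p q (+ M)))
     where
     lem : ∀ b d p q m → (b + p * m) * (d + q * m) ≡ b * d + (p * d + b * q + p * q * m) * m
     lem = solve-∀

   mod-unique : ∀ {M x y} → x ℕ.< M → y ℕ.< M → Mod M (+ x) (+ y) → x ≡ y
   mod-unique {M} {x} {y} lx ly (mod (+ zero) e) = ℤ.+-injective (trans e (trans (cong (λ z → + y + z) (ℤ.*-zeroˡ (+ M))) (ℤ.+-identityʳ (+ y))))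
   mod-unique {M} {x} {y} lx ly (mod (+ suc q) e) = ⊥-elim (ℕ.<⇒≱ lx (ℕ.≤-trans (ℕ.m≤m+n M (q ℕ.* M)) (ℕ.≤-trans (ℕ.m≤n+m _ y) (ℕ.≤-reflexive (sym x≡)))))
     where
     x≡ : x ≡ y ℕ.+ suc q ℕ.* M
     x≡ = ℤ.+-injective (trans e (cong (λ z → + y + z) (sym (ℤ.pos-* (suc q) M))))
   mod-unique {M} {x} {y} lx ly (mod (ℤ.-[1+ q ]) e) = ⊥-elim (ℕ.<⇒≱ ly (ℕ.≤-trans (ℕ.m≤m+n M (q ℕ.* M)) (ℕ.≤-trans (ℕ.m≤n+m _ x) (ℕ.≤-reflexive (sym y≡)))))
     where
     lem : ∀ y q m → y ≡ (y + (- q) * m) + q * m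
     lem = solve-∀
     y≡ : y ≡ x ℕ.+ suc q ℕ.* M
     y≡ = ℤ.+-injective (trans (lem (+ y) (+ suc q) (+ M)) (trans (cong (λ z → z + + suc q * + M) (sym e)) (cong (λ z → + x + z) (sym (ℤ.pos-* (suc q) M)))))

 -- Both additive gates are exclusive or on bits, the polynomial a + b - 2ab.
 opE : ∀ {V} → Op → Exp V → Exp V → Exp V
 opE plus a b = op# minus (op# plus a b) (op# plus (op# times a b) (op# times a b))
 opE minus a b = op# minus (op# plus a b) (op# plus (op# times a b) (op# times a b))
 opE times a b = op# times a b

 refE : ∀ {V m k} → (Fin m → Fin V) → (Fin k → Fin V) → Ref m k → Exp V
 refE ι κ (var i) = v# (ι i)
 refE ι κ one = o#
 refE ι κ (gate j) = v# (κ j)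

 eqE : ∀ {V} → Exp V → Exp V → Exp V
 eqE a b = op# minus o# (op# times (op# minus a b) (op# minus a b))

 -- Over the integers this polynomial is 1 when every gate variable carries the Boolean value of
 -- its gate and 0 for all other Boolean values of the gate variables.
 chkE : ∀ {V m k} → Gates m k → (Fin m → Fin V) → (Fin k → Fin V) → Exp V
 chkE [] ι κ = o#
 chkE (G ▷ (o , r₁ , r₂)) ι κ =
   op# times (eqE (v# (κ Fin.zero)) (opE o (refE ι (λ j → κ (Fin.suc j)) r₁) (refE ι (λ j → κ (Fin.suc j)) r₂)))
             (chkE G ι (λ j → κ (Fin.suc j)))

 eqV : Bool → Bool → ℤ
 eqV a b = if a xor b then + 0 else + 1

 chkV : ∀ {m k} → Gates m k → (Fin m → Bool) → Vec Bool k → ℤ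
 chkV [] y [] = + 1
 chkV (G ▷ (o , r₁ , r₂)) y (b ∷ g) =
   eqV b (opB o (rv 𝔹A y (Vec.lookup g) r₁) (rv 𝔹A y (Vec.lookup g) r₂)) * chkV G y g

 -- Horner's rule for the binary number at the outputs; the constant 0 has to be produced as 1 - 1.
 linE : ∀ {V m k L} → (Fin m → Fin V) → (Fin k → Fin V) → (Fin L → Ref m k) → Exp V
 linE {L = zero} ι κ r = op# minus o# o#
 linE {L = suc L} ι κ r = op# plus (refE ι κ (r Fin.zero)) (op# times (op# plus o# o#) (linE ι κ (λ i → r (Fin.suc i))))

 abstract
   nodes-refE : ∀ {V m k} (ι : Fin m → Fin V) (κ : Fin k → Fin V) r → nodes (refE ι κ r) ≡ 0
   nodes-refE ι κ (var i) = refl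
   nodes-refE ι κ one = refl
   nodes-refE ι κ (gate j) = refl

   nodes-chkE : ∀ {V m k} (G : Gates m k) (ι : Fin m → Fin V) (κ : Fin k → Fin V) → nodes (chkE G ι κ) ≤ k ℕ.* 15
   nodes-chkE [] ι κ = z≤n
   nodes-chkE {V} {k = suc k} (G ▷ (o , r₁ , r₂)) ι κ = ℕ.≤-trans (s≤s (ℕ.+-mono-≤ (nodes-chkE G ι κ') (h o)))
     (ℕ.≤-reflexive (trans (sym (ℕ.+-suc (k ℕ.* 15) 14)) (ℕ.+-comm (k ℕ.* 15) 15)))
     where
     κ' : Fin k → Fin V
     κ' j = κ (Fin.suc j)
     h : ∀ o → nodes (eqE (v# (κ Fin.zero)) (opE o (refE ι κ' r₁) (refE ι κ' r₂))) ≤ 14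
     h plus rewrite nodes-refE ι κ' r₁ | nodes-refE ι κ' r₂ = ℕ.≤-refl
     h minus rewrite nodes-refE ι κ' r₁ | nodes-refE ι κ' r₂ = ℕ.≤-refl
     h times rewrite nodes-refE ι κ' r₁ | nodes-refE ι κ' r₂ = ℕ.m≤m+n 6 8

   nodes-linE : ∀ {V m k L} (ι : Fin m → Fin V) (κ : Fin k → Fin V) (r : Fin L → Ref m k) → nodes (linE ι κ r) ≡ 1 ℕ.+ L ℕ.* 3
   nodes-linE {L = zero} ι κ r = refl
   nodes-linE {L = suc L} ι κ r rewrite nodes-refE ι κ (r Fin.zero) | nodes-linE ι κ (λ i → r (Fin.suc i)) = lem (L ℕ.* 3)
     where
     lem : ∀ a → suc (suc (1 ℕ.+ a ℕ.+ 1) ℕ.+ 0) ≡ 1 ℕ.+ (3 ℕ.+ a)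
     lem = NS.solve-∀

   module _ {V m k} (ι : Fin m → Fin V) (κ : Fin k → Fin V) (x : Fin V → ℤ) (y : Fin m → Bool) (g : Fin k → Bool)
            (hx : ∀ i → x (ι i) ≡ bool→ℤ (y i)) (hg : ∀ j → x (κ j) ≡ bool→ℤ (g j)) where
     evE-refE : ∀ r → evE ℤA x (refE ι κ r) ≡ bool→ℤ (rv 𝔹A y g r)
     evE-refE (var i) = hx i
     evE-refE one = refl
     evE-refE (gate j) = hg j

     evE-linE : ∀ {L} (r : Fin L → Ref m k) → evE ℤA x (linE ι κ r) ≡ + num (λ i → rv 𝔹A y g (r i))
     evE-linE {zero} r = refl
     evE-linE {suc L} r rewrite evE-refE (r Fin.zero) | evE-linE (λ i → r (Fin.suc i)) =
       cong₂ _+_ (b2z≡ (rv 𝔹A y g (r Fin.zero))) (sym (ℤ.pos-* 2 (num (λ i → rv 𝔹A y g (r (Fin.suc i))))))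

   evE-opE : ∀ {V} (x : Fin V → ℤ) o (a b : Exp V) p q → evE ℤA x a ≡ bool→ℤ p → evE ℤA x b ≡ bool→ℤ q →
     evE ℤA x (opE o a b) ≡ bool→ℤ (opB o p q)
   evE-opE x plus a b p q ea eb rewrite ea | eb with p | q
   ... | false | false = refl
   ... | false | true = refl
   ... | true | false = refl
   ... | true | true = refl
   evE-opE x minus a b p q ea eb rewrite ea | eb with p | q
   ... | false | false = refl
   ... | false | true = refl
   ... | true | false = refl
   ... | true | true = refl
   evE-opE x times a b p q ea eb rewrite ea | eb with p | q
   ... | false | false = refl
   ... | false | true = refl
   ... | true | false = refl
   ... | true | true = refl

   eqV-eval : ∀ a b → + 1 - (bool→ℤ a - bool→ℤ b) * (bool→ℤ a - bool→ℤ b) ≡ eqV a b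
   eqV-eval false false = refl
   eqV-eval false true = refl
   eqV-eval true false = refl
   eqV-eval true true = refl

   evE-chkE : ∀ {V m k} (G : Gates m k) (ι : Fin m → Fin V) (κ : Fin k → Fin V) (x : Fin V → ℤ) (y : Fin m → Bool) (g : Vec Bool k) →
     (∀ i → x (ι i) ≡ bool→ℤ (y i)) → (∀ j → x (κ j) ≡ bool→ℤ (Vec.lookup g j)) → evE ℤA x (chkE G ι κ) ≡ chkV G y g
   evE-chkE [] ι κ x y [] hx hg = refl
   evE-chkE {V} {m} {suc k} (G ▷ (o , r₁ , r₂)) ι κ x y (b ∷ g) hx hg = cong₂ _*_
     (trans (cong₂ (λ s t → + 1 - (s - t) * (s - t)) (hg Fin.zero)
              (evE-opE x o _ _ _ _ (evE-refE ι κ' x y (Vec.lookup g) hx (λ j → hg (Fin.suc j)) r₁)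
                                   (evE-refE ι κ' x y (Vec.lookup g) hx (λ j → hg (Fin.suc j)) r₂)))
            (eqV-eval b _))
     (evE-chkE G ι κ' x y g hx (λ j → hg (Fin.suc j)))
     where
     κ' : Fin k → Fin V
     κ' j = κ (Fin.suc j)

 gvV : ∀ {m k} → Gates m k → (Fin m → Bool) → Vec Bool k
 gvV [] y = []
 gvV (G ▷ (o , r₁ , r₂)) y = opB o (rv 𝔹A y (Vec.lookup (gvV G y)) r₁) (rv 𝔹A y (Vec.lookup (gvV G y)) r₂) ∷ gvV G y

 abstract
   rv-cong₂ : ∀ {m k} (y : Fin m → Bool) {g h : Fin k → Bool} → (∀ j → g j ≡ h j) → ∀ r → rv 𝔹A y g r ≡ rv 𝔹A y h r
   rv-cong₂ y e (var i) = refl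
   rv-cong₂ y e one = refl
   rv-cong₂ y e (gate j) = e j

   lookup-gvV : ∀ {m k} (G : Gates m k) (y : Fin m → Bool) j → Vec.lookup (gvV G y) j ≡ gv 𝔹A y G j
   lookup-gvV (G ▷ (o , r₁ , r₂)) y Fin.zero = cong₂ (opB o) (rv-cong₂ y (lookup-gvV G y) r₁) (rv-cong₂ y (lookup-gvV G y) r₂)
   lookup-gvV (G ▷ _) y (Fin.suc j) = lookup-gvV G y j

   -- Each gate bit is forced by the bits of earlier gates, so the check selects the single vector
   -- `gvV G y`. Evaluation of a circuit thus becomes a sum, over gate bits, of a polynomial whose
   -- degree is linear in the size of the circuit, however deep the circuit is.
   Σb-chk : ∀ {m k} (G : Gates m k) (y : Fin m → Bool) (φ : Vec Bool k → ℤ) → Σb k (λ g → chkV G y g * φ g) ≡ φ (gvV G y)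
   Σb-chk [] y φ = ℤ.*-identityˡ (φ [])
   Σb-chk {k = suc k} (G ▷ (o , r₁ , r₂)) y φ = trans (Σb-cong k (λ g → lem g (t g))) (Σb-chk G y (λ g → φ (t g ∷ g)))
     where
     t : Vec Bool k → Bool
     t g = opB o (rv 𝔹A y (Vec.lookup g) r₁) (rv 𝔹A y (Vec.lookup g) r₂)
     l1 : ∀ c p q → (+ 1) * c * p + (+ 0) * c * q ≡ c * p
     l1 = solve-∀
     l2 : ∀ c p q → (+ 0) * c * p + (+ 1) * c * q ≡ c * q
     l2 = solve-∀
     lem : ∀ g b → eqV false b * chkV G y g * φ (false ∷ g) + eqV true b * chkV G y g * φ (true ∷ g) ≡ chkV G y g * φ (b ∷ g)
     lem g false = l1 (chkV G y g) (φ (false ∷ g)) (φ (true ∷ g))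
     lem g true = l2 (chkV G y g) (φ (false ∷ g)) (φ (true ∷ g))

-- Boolean circuits for arithmetic modulo powers of two

module BitArithmetic where
 open import Data.Nat using (_≤_)
 open import Data.Integer using (ℤ; +_; _+_; _*_; -_; _-_)
 open import Data.Integer.Tactic.RingSolver using (solve-∀)
 open import Data.Bool using (_xor_; _∧_)
 open Evaluation
 open CircuitTools
 open Verification

 infixl 6 _⊕_
 infixl 7 _⊗_
 _⊕_ _⊗_ : ∀ {m} → Exp m → Exp m → Exp m
 _⊕_ = op# plus
 _⊗_ = op# times

 -- Over the field of two elements 1 + 1 is the constant false.
 0# : ∀ {m} → Exp m
 0# = o# ⊕ o#

 -- Ripple-carry addition with carry-in `c`. The majority of three bits is written ab + c(a + b),
 -- where `c` occurs only once; hence the carries grow linearly although they are trees.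
 addT : ∀ {L m} → Exp m → (Fin L → Exp m) → (Fin L → Exp m) → Fin L → Exp m
 addT c a b Fin.zero = a Fin.zero ⊕ b Fin.zero ⊕ c
 addT c a b (Fin.suc i) =
   addT (a Fin.zero ⊗ b Fin.zero ⊕ c ⊗ (a Fin.zero ⊕ b Fin.zero)) (λ j → a (Fin.suc j)) (λ j → b (Fin.suc j)) i

 shiftT : ∀ {L m} → (Fin L → Exp m) → Fin L → Exp m
 shiftT a Fin.zero = 0#
 shiftT {suc (suc L)} a (Fin.suc i) = a (Fin.inject₁ i)

 abstract
   addT-nodes : ∀ {L m} (c : Exp m) (a b : Fin L → Exp m) → (∀ i → nodes (a i) ≤ 1) → (∀ i → nodes (b i) ≤ 1) →
     ∀ i → nodes (addT c a b i) ≤ nodes c ℕ.+ L ℕ.* 8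
   addT-nodes {suc L} c a b ha hb Fin.zero = begin
     suc (nodes c ℕ.+ suc (nodes (b Fin.zero) ℕ.+ nodes (a Fin.zero))) ≤⟨ s≤s (ℕ.+-monoʳ-≤ (nodes c) (s≤s (ℕ.+-mono-≤ (hb Fin.zero) (ha Fin.zero)))) ⟩
     suc (nodes c ℕ.+ 3) ≡⟨ sym (ℕ.+-suc (nodes c) 3) ⟩
     nodes c ℕ.+ 4 ≤⟨ ℕ.+-monoʳ-≤ (nodes c) (ℕ.m≤m+n 4 (4 ℕ.+ L ℕ.* 8)) ⟩
     nodes c ℕ.+ (8 ℕ.+ L ℕ.* 8) ∎
     where open ℕ.≤-Reasoning
   addT-nodes {suc L} c a b ha hb (Fin.suc i) = begin
     _ ≤⟨ addT-nodes _ _ _ (λ j → ha (Fin.suc j)) (λ j → hb (Fin.suc j)) i ⟩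
     suc ((suc (suc (nb ℕ.+ na) ℕ.+ nodes c)) ℕ.+ suc (nb ℕ.+ na)) ℕ.+ L ℕ.* 8
       ≤⟨ ℕ.+-monoˡ-≤ (L ℕ.* 8) (s≤s (ℕ.+-mono-≤ (s≤s (ℕ.+-monoˡ-≤ (nodes c) (s≤s h))) (s≤s h))) ⟩
     suc ((suc (3 ℕ.+ nodes c)) ℕ.+ 3) ℕ.+ L ℕ.* 8 ≡⟨ lem (nodes c) (L ℕ.* 8) ⟩
     nodes c ℕ.+ (8 ℕ.+ L ℕ.* 8) ∎
     where
     open ℕ.≤-Reasoning
     na nb : ℕ
     na = nodes (a Fin.zero)
     nb = nodes (b Fin.zero)
     h : nb ℕ.+ na ≤ 2
     h = ℕ.+-mono-≤ (hb Fin.zero) (ha Fin.zero)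
     lem : ∀ c l → suc ((suc (3 ℕ.+ c)) ℕ.+ 3) ℕ.+ l ≡ c ℕ.+ (8 ℕ.+ l)
     lem = NS.solve-∀

   fullAdder : ∀ a b c → b2n ((a xor b) xor c) ℕ.+ 2 ℕ.* b2n ((a ∧ b) xor (c ∧ (a xor b))) ≡ b2n a ℕ.+ b2n b ℕ.+ b2n c
   fullAdder false false false = refl
   fullAdder false false true = refl
   fullAdder false true false = refl
   fullAdder false true true = refl
   fullAdder true false false = refl
   fullAdder true false true = refl
   fullAdder true true false = refl
   fullAdder true true true = refl

   addT-spec : ∀ {L m} (x : Fin m → Bool) (c : Exp m) (a b : Fin L → Exp m) →
     ∃[ q ] num (λ i → evE 𝔹A x (addT c a b i)) ℕ.+ q ℕ.* 2 ℕ.^ L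
          ≡ num (λ i → evE 𝔹A x (a i)) ℕ.+ num (λ i → evE 𝔹A x (b i)) ℕ.+ b2n (evE 𝔹A x c)
   addT-spec {zero} x c a b = b2n (evE 𝔹A x c) , ℕ.*-identityʳ _
   addT-spec {suc L} x c a b with addT-spec {L} x (a Fin.zero ⊗ b Fin.zero ⊕ c ⊗ (a Fin.zero ⊕ b Fin.zero)) (λ j → a (Fin.suc j)) (λ j → b (Fin.suc j))
   ... | q , e = q , (begin
     (s ℕ.+ 2 ℕ.* n) ℕ.+ q ℕ.* (2 ℕ.* 2 ℕ.^ L) ≡⟨ l1 s n q (2 ℕ.^ L) ⟩
     s ℕ.+ 2 ℕ.* (n ℕ.+ q ℕ.* 2 ℕ.^ L) ≡⟨ cong (λ z → s ℕ.+ 2 ℕ.* z) e ⟩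
     s ℕ.+ 2 ℕ.* (na ℕ.+ nb ℕ.+ b2n ma) ≡⟨ l2 s na nb (b2n ma) ⟩
     (s ℕ.+ 2 ℕ.* b2n ma) ℕ.+ 2 ℕ.* na ℕ.+ 2 ℕ.* nb ≡⟨ cong (λ z → z ℕ.+ 2 ℕ.* na ℕ.+ 2 ℕ.* nb) (fullAdder a0 b0 c0) ⟩
     (b2n a0 ℕ.+ b2n b0 ℕ.+ b2n c0) ℕ.+ 2 ℕ.* na ℕ.+ 2 ℕ.* nb ≡⟨ l3 (b2n a0) (b2n b0) (b2n c0) na nb ⟩
     (b2n a0 ℕ.+ 2 ℕ.* na) ℕ.+ (b2n b0 ℕ.+ 2 ℕ.* nb) ℕ.+ b2n c0 ∎)
     where
     open ≡-Reasoning
     a0 b0 c0 ma : Bool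
     a0 = evE 𝔹A x (a Fin.zero)
     b0 = evE 𝔹A x (b Fin.zero)
     c0 = evE 𝔹A x c
     ma = (a0 ∧ b0) xor (c0 ∧ (a0 xor b0))
     s n na nb : ℕ
     s = b2n ((a0 xor b0) xor c0)
     n = num (λ i → evE 𝔹A x (addT c a b (Fin.suc i)))
     na = num (λ i → evE 𝔹A x (a (Fin.suc i)))
     nb = num (λ i → evE 𝔹A x (b (Fin.suc i)))
     l1 : ∀ s n q p → (s ℕ.+ 2 ℕ.* n) ℕ.+ q ℕ.* (2 ℕ.* p) ≡ s ℕ.+ 2 ℕ.* (n ℕ.+ q ℕ.* p)
     l1 = NS.solve-∀
     l2 : ∀ s a b m → s ℕ.+ 2 ℕ.* (a ℕ.+ b ℕ.+ m) ≡ (s ℕ.+ 2 ℕ.* m) ℕ.+ 2 ℕ.* a ℕ.+ 2 ℕ.* b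
     l2 = NS.solve-∀
     l3 : ∀ a b c p q → (a ℕ.+ b ℕ.+ c) ℕ.+ 2 ℕ.* p ℕ.+ 2 ℕ.* q ≡ (a ℕ.+ 2 ℕ.* p) ℕ.+ (b ℕ.+ 2 ℕ.* q) ℕ.+ c
     l3 = NS.solve-∀

   ℕ⇒mod : ∀ {a q M b} → a ℕ.+ q ℕ.* M ≡ b → Mod M (+ a) (+ b)
   ℕ⇒mod {a} {q} {M} {b} e = mod-sym (mod (+ q) (trans (cong +_ (sym e)) (cong (λ z → + a + z) (ℤ.pos-* q M))))

   addT-mod : ∀ {L m} (x : Fin m → Bool) (c : Exp m) (a b : Fin L → Exp m) →
     Mod (2 ℕ.^ L) (+ num (λ i → evE 𝔹A x (addT c a b i))) (+ (num (λ i → evE 𝔹A x (a i)) ℕ.+ num (λ i → evE 𝔹A x (b i)) ℕ.+ b2n (evE 𝔹A x c)))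
   addT-mod {L} x c a b = ℕ⇒mod {q = proj₁ (addT-spec x c a b)} (proj₂ (addT-spec x c a b))

   num-not : ∀ {L} (b : Fin L → Bool) → suc (num (λ i → true xor b i) ℕ.+ num b) ≡ 2 ℕ.^ L
   num-not {zero} b = refl
   num-not {suc L} b = trans (lem (b Fin.zero) (num (λ i → true xor b (Fin.suc i))) (num (λ i → b (Fin.suc i)))) (cong (2 ℕ.*_) (num-not (λ i → b (Fin.suc i))))
     where
     l1 : ∀ n m → suc (1 ℕ.+ 2 ℕ.* n ℕ.+ 2 ℕ.* m) ≡ 2 ℕ.* suc (n ℕ.+ m)
     l1 = NS.solve-∀
     l2 : ∀ n m → suc (2 ℕ.* n ℕ.+ (1 ℕ.+ 2 ℕ.* m)) ≡ 2 ℕ.* suc (n ℕ.+ m)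
     l2 = NS.solve-∀
     lem : ∀ b n m → suc ((b2n (true xor b) ℕ.+ 2 ℕ.* n) ℕ.+ (b2n b ℕ.+ 2 ℕ.* m)) ≡ 2 ℕ.* suc (n ℕ.+ m)
     lem false = l1
     lem true = l2

   num-false : ∀ {L} (b : Fin L → Bool) → (∀ i → b i ≡ false) → num b ≡ 0
   num-false {zero} b h = refl
   num-false {suc L} b h = cong₂ (λ s t → b2n s ℕ.+ 2 ℕ.* t) (h Fin.zero) (num-false (λ i → b (Fin.suc i)) (λ i → h (Fin.suc i)))

   num-and : ∀ {L} c (b : Fin L → Bool) → num (λ i → c ∧ b i) ≡ b2n c ℕ.* num b
   num-and {L} false b = num-false {L} (λ i → false) (λ i → refl)
   num-and true b = sym (ℕ.+-identityʳ _)

   num-shift : ∀ {L m} (x : Fin m → Bool) (a : Fin L → Exp m) →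
     Mod (2 ℕ.^ L) (+ num (λ i → evE 𝔹A x (shiftT a i))) (+ (2 ℕ.* num (λ i → evE 𝔹A x (a i))))
   num-shift {L} x a = ℕ⇒mod {q = proj₁ (go L a)} (proj₂ (go L a))
     where
     last : ∀ L (a : Fin (suc L) → Bool) → ∃[ q ] num (λ i → a (Fin.inject₁ i)) ℕ.+ q ℕ.* 2 ℕ.^ L ≡ num a
     last zero a = b2n (a Fin.zero) , trans (ℕ.*-identityʳ _) (sym (ℕ.+-identityʳ _))
     last (suc L) a with last L (λ i → a (Fin.suc i))
     ... | q , e = q , trans (lem (b2n (a Fin.zero)) (num (λ i → a (Fin.suc (Fin.inject₁ i)))) q (2 ℕ.^ L)) (cong (λ z → b2n (a Fin.zero) ℕ.+ 2 ℕ.* z) e)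
       where
       lem : ∀ s n q p → (s ℕ.+ 2 ℕ.* n) ℕ.+ q ℕ.* (2 ℕ.* p) ≡ s ℕ.+ 2 ℕ.* (n ℕ.+ q ℕ.* p)
       lem = NS.solve-∀
     go : ∀ L (a : Fin L → Exp _) → ∃[ q ] num (λ i → evE 𝔹A x (shiftT a i)) ℕ.+ q ℕ.* 2 ℕ.^ L ≡ 2 ℕ.* num (λ i → evE 𝔹A x (a i))
     go zero a = 0 , refl
     go (suc zero) a = b2n (evE 𝔹A x (a Fin.zero)) , lem (b2n (evE 𝔹A x (a Fin.zero)))
       where
       lem : ∀ z → z ℕ.* 2 ≡ 2 ℕ.* (z ℕ.+ 0)
       lem = NS.solve-∀
     go (suc (suc L)) a with last (suc L) (λ i → evE 𝔹A x (a i))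
     ... | q , e = q , trans (lem (num (λ i → evE 𝔹A x (a (Fin.inject₁ i)))) q (2 ℕ.* 2 ℕ.^ L)) (cong (2 ℕ.*_) e)
       where
       lem : ∀ n q p → 2 ℕ.* n ℕ.+ q ℕ.* (2 ℕ.* p) ≡ 2 ℕ.* (n ℕ.+ q ℕ.* p)
       lem = NS.solve-∀

 record OpBlock (L : ℕ) (o : Op) (s : ℕ) : Set where
   field
     fn : (Fin (L ℕ.+ L) → Bool) → Fin L → Bool
     cp : Cp (L ℕ.+ L) (Fin L) s fn
     spec : ∀ x → Mod (2 ℕ.^ L) (+ num (fn x)) (opZ o (+ num (λ i → x (i ↑ˡ L))) (+ num (λ i → x (L ↑ʳ i))))
 open OpBlock public

 plusBlock : ∀ L → OpBlock L plus (L ℕ.* (1 ℕ.+ L ℕ.* 8))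
 plusBlock L = record
   { fn = λ x i → evE 𝔹A x (t i)
   ; cp = cp-exp L t (λ i → addT-nodes 0# (λ i → v# (i ↑ˡ L)) (λ i → v# (L ↑ʳ i)) (λ _ → z≤n) (λ _ → z≤n) i)
   ; spec = λ x → mod-trans (addT-mod x 0# (λ i → v# (i ↑ˡ L)) (λ i → v# (L ↑ʳ i))) (mod-refl (cong +_ (ℕ.+-identityʳ _))) }
   where
   t : Fin L → Exp (L ℕ.+ L)
   t = addT 0# (λ i → v# (i ↑ˡ L)) (λ i → v# (L ↑ʳ i))

 -- Two's complement: by `num-not`, adding the complement and a carry-in of 1 gives the difference
 -- plus one multiple of 2 ^ L.
 minusBlock : ∀ L → OpBlock L minus (L ℕ.* (1 ℕ.+ L ℕ.* 8))
 minusBlock L = record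
   { fn = λ x i → evE 𝔹A x (t i)
   ; cp = cp-exp L t (λ i → ℕ.≤-trans (addT-nodes o# (λ i → v# (i ↑ˡ L)) (λ i → o# ⊕ v# (L ↑ʳ i)) (λ _ → z≤n) (λ _ → s≤s z≤n) i) (ℕ.n≤1+n _))
   ; spec = λ x → mod-trans (addT-mod x o# (λ i → v# (i ↑ˡ L)) (λ i → o# ⊕ v# (L ↑ʳ i))) (mod (+ 1) (eq (num (λ i → x (i ↑ˡ L))) (num (λ i → true xor x (L ↑ʳ i))) (num (λ i → x (L ↑ʳ i))) (2 ℕ.^ L) (num-not (λ i → x (L ↑ʳ i))))) }
   where
   t : Fin L → Exp (L ℕ.+ L)
   t = addT o# (λ i → v# (i ↑ˡ L)) (λ i → o# ⊕ v# (L ↑ʳ i))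
   eq : ∀ a b c p → suc (b ℕ.+ c) ≡ p → + (a ℕ.+ b ℕ.+ 1) ≡ (+ a - + c) + + 1 * + p
   eq a b c .(suc (b ℕ.+ c)) refl = lem (+ a) (+ b) (+ c)
     where
     lem : ∀ a b c → a + b + + 1 ≡ (a - c) + + 1 * (+ 1 + (b + c))
     lem = solve-∀

 -- Schoolbook multiplication, from the recursion (a₀ + 2a') b = a₀ b + 2 (a' b).
 mulCp : ∀ L v n (α : Fin n → Fin v) (β : Fin L → Fin v) →
   Σ[ F ∈ ((Fin v → Bool) → Fin L → Bool) ] (Cp v (Fin L) (L ℕ.+ n ℕ.* (L ℕ.* (1 ℕ.+ L ℕ.* 8))) F ×
     (∀ x → Mod (2 ℕ.^ L) (+ num (F x)) (+ num (λ i → x (α i)) * + num (λ i → x (β i)))))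
 mulCp L v zero α β = (λ x i → evE 𝔹A x (0# {v})) ,
   cp-≤ (ℕ.≤-reflexive (trans (ℕ.*-identityʳ L) (sym (ℕ.+-identityʳ L)))) (cp-exp L (λ _ → 0#) (λ _ → s≤s z≤n)) ,
   λ x → mod-refl (trans (cong +_ (num-false {L} (λ _ → false) (λ _ → refl))) (sym (ℤ.*-zeroˡ (+ num (λ i → x (β i))))))
 mulCp L v (suc n) α β with mulCp L v n (λ i → α (Fin.suc i)) β
 ... | F , C , sp = _ , cp-≤ (ℕ.≤-reflexive (lem L n _)) (cp-seq (cp-withIn C) (cp-exp L t tn) (Fin.splitAt L)) ,
       λ x → mod-trans (addT-mod (λ k → [ F x , x ] (Fin.splitAt L k)) 0# accT bT) (sp' x)
   where
   lem : ∀ L n p → p ℕ.+ (L ℕ.+ n ℕ.* p) ≡ L ℕ.+ suc n ℕ.* p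
   lem = NS.solve-∀
   accT bT : Fin L → Exp (L ℕ.+ v)
   accT = shiftT (λ i → v# (i ↑ˡ v))
   bT i = v# (L ↑ʳ α Fin.zero) ⊗ v# (L ↑ʳ β i)
   t : Fin L → Exp (L ℕ.+ v)
   t = addT 0# accT bT
   shn : ∀ {L m} (a : Fin L → Exp m) → (∀ i → nodes (a i) ≤ 1) → ∀ i → nodes (shiftT a i) ≤ 1
   shn a h Fin.zero = s≤s z≤n
   shn {suc (suc L)} a h (Fin.suc i) = h (Fin.inject₁ i)
   tn : ∀ i → nodes (t i) ≤ 1 ℕ.+ L ℕ.* 8
   tn = addT-nodes 0# accT bT (shn _ (λ _ → z≤n)) (λ _ → s≤s z≤n)
   abstract
     sp' : ∀ x → let z = λ k → [ F x , x ] (Fin.splitAt L k) in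
       Mod (2 ℕ.^ L) (+ (num (λ i → evE 𝔹A z (accT i)) ℕ.+ num (λ i → evE 𝔹A z (bT i)) ℕ.+ 0))
                     (+ num (λ i → x (α i)) * + num (λ i → x (β i)))
     sp' x = mod-trans (mod-refl (cong +_ (ℕ.+-identityʳ (num (λ i → evE 𝔹A z (accT i)) ℕ.+ num (λ i → evE 𝔹A z (bT i)))))) (mod-trans
         (mod-op plus (mod-trans (num-shift z (λ i → v# (i ↑ˡ v)))
                        (mod-trans (mod-refl (trans (cong (λ w → + (2 ℕ.* w)) (num-cong zl)) (ℤ.pos-* 2 (num (F x)))))
                                   (mod-op times (mod-refl {a = + 2} refl) (sp x))))
                      (mod-refl (cong +_ (trans (num-cong (λ i → cong₂ _∧_ (zr (α Fin.zero)) (zr (β i)))) (num-and (x (α Fin.zero)) (λ i → x (β i)))))))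
         (mod-refl (fin (num (λ i → x (α (Fin.suc i)))) (num (λ i → x (β i))) (b2n (x (α Fin.zero))))))
       where
       z : Fin (L ℕ.+ v) → Bool
       z k = [ F x , x ] (Fin.splitAt L k)
       zl : ∀ i → z (i ↑ˡ v) ≡ F x i
       zl i = cong [ F x , x ] (Fin.splitAt-↑ˡ L i v)
       zr : ∀ j → z (L ↑ʳ j) ≡ x j
       zr j = cong [ F x , x ] (Fin.splitAt-↑ʳ L v j)
       fin : ∀ a b c → + 2 * (+ a * + b) + + (c ℕ.* b) ≡ + (c ℕ.+ 2 ℕ.* a) * + b
       fin a b c = trans (cong (λ w → + 2 * (+ a * + b) + w) (ℤ.pos-* c b))
         (trans (l (+ a) (+ b) (+ c)) (cong (λ w → (+ c + w) * + b) (sym (ℤ.pos-* 2 a))))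
         where
         l : ∀ a b c → + 2 * (a * b) + c * b ≡ (c + + 2 * a) * b
         l = solve-∀

 costOp : ℕ → ℕ
 costOp L = L ℕ.+ suc L ℕ.* (L ℕ.* (1 ℕ.+ L ℕ.* 8))

 opBlock : ∀ L o → OpBlock L o (costOp L)
 opBlock L times with mulCp L (L ℕ.+ L) L (_↑ˡ L) (L ↑ʳ_)
 ... | F , C , sp = record { fn = F ; cp = cp-≤ (ℕ.+-monoʳ-≤ L (ℕ.*-monoˡ-≤ _ (ℕ.n≤1+n L))) C ; spec = sp }
 opBlock L plus = record { fn = fn B ; cp = cp-≤ (ℕ.≤-trans (ℕ.m≤m+n _ _) (ℕ.m≤n+m _ L)) (cp B) ; spec = spec B }
   where B = plusBlock L
 opBlock L minus = record { fn = fn B ; cp = cp-≤ (ℕ.≤-trans (ℕ.m≤m+n _ _) (ℕ.m≤n+m _ L)) (cp B) ; spec = spec B }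
   where B = minusBlock L

 unit : ∀ {v} → (Fin v → Bool) → Ref v 0 → Bool
 unit x (var i) = x i
 unit x one = true

 single : ∀ {L} → Bool → Fin L → Bool
 single b Fin.zero = b
 single b (Fin.suc _) = false

 abstract
   num-single : ∀ {L} b → Mod (2 ℕ.^ L) (+ num {L} (single b)) (bool→ℤ b)
   num-single {zero} b = mod (- bool→ℤ b) (lem (bool→ℤ b))
     where
     lem : ∀ z → + 0 ≡ z + (- z) * + 1
     lem = solve-∀
   num-single {suc L} b = mod-refl (trans (cong +_ (trans (cong (λ z → b2n b ℕ.+ 2 ℕ.* z) (num-false {L} _ (λ _ → refl))) (ℕ.+-identityʳ _))) (sym (b2z≡ b)))

 -- A Boolean circuit that simulates an arithmetic circuit at Boolean points modulo 2 ^ L.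
 simG : ∀ {v k} L (G : Gates v k) → Σ[ F ∈ ((Fin v → Bool) → Ref v k × Fin L → Bool) ]
   (Cp v (Ref v k × Fin L) (1 ℕ.+ k ℕ.* costOp L) F ×
    (∀ x r → Mod (2 ℕ.^ L) (+ num (λ i → F x (r , i))) (rv ℤA (λ i → bool→ℤ (x i)) (gv ℤA (λ i → bool→ℤ (x i)) G) r)))
 simG {v} L [] = F , base , λ { x (var i) → num-single {L} (x i) ; x one → num-single {L} true }
   where
   F : (Fin v → Bool) → Ref v 0 × Fin L → Bool
   F x (r , i) = single (unit x r) i
   out : Ref v 0 × Fin L → Ref v 1
   out (var i , Fin.zero) = var i
   out (one , Fin.zero) = one
   out (r , Fin.suc _) = gate Fin.zero
   base : Cp v (Ref v 0 × Fin L) 1 F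
   base = mkCp (bc ([] ▷ (plus , one , one)) out) ℕ.≤-refl
     (λ { x (var i , Fin.zero) → refl ; x (one , Fin.zero) → refl ; x (var i , Fin.suc _) → refl ; x (one , Fin.suc _) → refl })
 simG {v} {suc k} L (G ▷ (o , r₁ , r₂)) with simG L G | opBlock L o
 ... | F , C , sp | B = _ , cp-map h (cp-≤ (ℕ.≤-reflexive (ℕ.+-suc (costOp L) (k ℕ.* costOp L))) (cp-ext C (cp B) w)) , sp'
   where
   h : Ref v (suc k) × Fin L → (Ref v k × Fin L) ⊎ Fin L
   h (var i , j) = inj₁ (var i , j)
   h (one , j) = inj₁ (one , j)
   h (gate Fin.zero , j) = inj₂ j
   h (gate (Fin.suc g) , j) = inj₁ (gate g , j)
   w : Fin (L ℕ.+ L) → Ref v k × Fin L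
   w i = [ (λ j → r₁ , j) , (λ j → r₂ , j) ] (Fin.splitAt L i)
   abstract
     sp' : ∀ x r → Mod (2 ℕ.^ L) (+ num (λ i → [ F x , fn B (λ i → F x (w i)) ] (h (r , i))))
                  (rv ℤA (λ i → bool→ℤ (x i)) (gv ℤA (λ i → bool→ℤ (x i)) (G ▷ (o , r₁ , r₂))) r)
     sp' x (var i) = sp x (var i)
     sp' x one = sp x one
     sp' x (gate Fin.zero) = mod-trans (spec B (λ i → F x (w i))) (mod-op o
       (mod-trans (mod-refl (cong +_ (num-cong (λ i → cong (λ z → F x ([ (λ j → r₁ , j) , (λ j → r₂ , j) ] z)) (Fin.splitAt-↑ˡ L i L))))) (sp x r₁))
       (mod-trans (mod-refl (cong +_ (num-cong (λ i → cong (λ z → F x ([ (λ j → r₁ , j) , (λ j → r₂ , j) ] z)) (Fin.splitAt-↑ʳ L L i))))) (sp x r₂)))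
     sp' x (gate (Fin.suc g)) = sp x (gate g)

-- Families of numbers closed under exponential sums

module Counting where
 open import Data.Nat using (_≤_; _<_; _+_; _*_; _∸_; _^_; _≤ᵇ_)
 open import Data.Integer using (ℤ; +_)
 open import Data.Bool using (T)
 open Growth
 open Evaluation using (Σb; Σb-cong; b2z; evalC; opZ)
 open CircuitTools
 open SumClosure
 open Verification
 open BitArithmetic

 halves : ℕ → Bool × ℕ
 halves zero = false , 0
 halves (suc zero) = true , 0
 halves (suc (suc n)) = proj₁ (halves n) , suc (proj₂ (halves n))

 toBits : ∀ L → ℕ → Fin L → Bool
 toBits (suc L) c Fin.zero = proj₁ (halves c)
 toBits (suc L) c (Fin.suc i) = toBits L (proj₂ (halves c)) i

 padBits : ∀ L w → (Fin w → Bool) → Fin L → Bool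
 padBits (suc L) zero b i = false
 padBits (suc L) (suc w) b Fin.zero = b Fin.zero
 padBits (suc L) (suc w) b (Fin.suc i) = padBits L w (λ j → b (Fin.suc j)) i

 padE : ∀ L w {m} → (Fin w → Fin m) → Fin L → Exp m
 padE (suc L) zero b i = 0#
 padE (suc L) (suc w) b Fin.zero = v# (b Fin.zero)
 padE (suc L) (suc w) b (Fin.suc i) = padE L w (λ j → b (Fin.suc j)) i

 abstract
   halves-spec : ∀ n → b2n (proj₁ (halves n)) + 2 * proj₂ (halves n) ≡ n
   halves-spec zero = refl
   halves-spec (suc zero) = refl
   halves-spec (suc (suc n)) = trans (lem (b2n (proj₁ (halves n))) (proj₂ (halves n))) (cong (λ z → suc (suc z)) (halves-spec n))
     where
     lem : ∀ a b → a + 2 * suc b ≡ suc (suc (a + 2 * b))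
     lem = NS.solve-∀

   halves-unique : ∀ b n → halves (b2n b + 2 * n) ≡ (b , n)
   halves-unique false zero = refl
   halves-unique true zero = refl
   halves-unique b (suc n) = trans (cong halves (lem (b2n b) n)) (cong (λ z → proj₁ z , suc (proj₂ z)) (halves-unique b n))
     where
     lem : ∀ a b → a + 2 * suc b ≡ suc (suc (a + 2 * b))
     lem = NS.solve-∀

   num-toBits : ∀ L c → ∃[ q ] num (toBits L c) + q * 2 ^ L ≡ c
   num-toBits zero c = c , ℕ.*-identityʳ c
   num-toBits (suc L) c with num-toBits L (proj₂ (halves c))
   ... | q , e = q , trans (lem (b2n (proj₁ (halves c))) (num (toBits L (proj₂ (halves c)))) q (2 ^ L))
                     (trans (cong (λ z → b2n (proj₁ (halves c)) + 2 * z) e) (halves-spec c))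
     where
     lem : ∀ s n q p → (s + 2 * n) + q * (2 * p) ≡ s + 2 * (n + q * p)
     lem = NS.solve-∀

   num-toBits< : ∀ L c → c < 2 ^ L → num (toBits L c) ≡ c
   num-toBits< L c l with num-toBits L c
   ... | zero , e = trans (sym (ℕ.+-identityʳ _)) e
   ... | suc q , e = ⊥-elim (ℕ.<⇒≱ l (ℕ.≤-trans (ℕ.≤-trans (ℕ.m≤m+n (2 ^ L) (q * 2 ^ L)) (ℕ.m≤n+m _ (num (toBits L c)))) (ℕ.≤-reflexive e)))

   toBits-num : ∀ {L} (b : Fin L → Bool) i → toBits L (num b) i ≡ b i
   toBits-num {suc L} b Fin.zero = cong proj₁ (halves-unique (b Fin.zero) (num (λ i → b (Fin.suc i))))
   toBits-num {suc L} b (Fin.suc i) = trans (cong (λ z → toBits L (proj₂ z) i) (halves-unique (b Fin.zero) (num (λ i → b (Fin.suc i))))) (toBits-num (λ i → b (Fin.suc i)) i)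

   toBits-inject : ∀ w L (le : w ≤ L) c i → toBits w c i ≡ toBits L c (Fin.inject≤ i le)
   toBits-inject (suc w) (suc L) (s≤s le) c Fin.zero = refl
   toBits-inject (suc w) (suc L) (s≤s le) c (Fin.suc i) = toBits-inject w L le (proj₂ (halves c)) i

   num-pad : ∀ L w (b : Fin w → Bool) → ∃[ q ] num (padBits L w b) + q * 2 ^ L ≡ num b
   num-pad zero w b = num b , ℕ.*-identityʳ _
   num-pad (suc L) zero b = 0 , trans (ℕ.+-identityʳ _) (num-false {suc L} (padBits (suc L) 0 b) (λ i → refl))
   num-pad (suc L) (suc w) b with num-pad L w (λ j → b (Fin.suc j))
   ... | q , e = q , trans (lem (b2n (b Fin.zero)) (num (padBits L w (λ j → b (Fin.suc j)))) q (2 ^ L)) (cong (λ z → b2n (b Fin.zero) + 2 * z) e)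
     where
     lem : ∀ s n q p → (s + 2 * n) + q * (2 * p) ≡ s + 2 * (n + q * p)
     lem = NS.solve-∀

   padE-nodes : ∀ L w {m} (b : Fin w → Fin m) i → nodes (padE L w b i) ≤ 1
   padE-nodes (suc L) zero b i = s≤s z≤n
   padE-nodes (suc L) (suc w) b Fin.zero = z≤n
   padE-nodes (suc L) (suc w) b (Fin.suc i) = padE-nodes L w (λ j → b (Fin.suc j)) i

   padE-ev : ∀ L w {m} (b : Fin w → Fin m) (x : Fin m → Bool) i → evE 𝔹A x (padE L w b i) ≡ padBits L w (λ j → x (b j)) i
   padE-ev (suc L) zero b x i = refl
   padE-ev (suc L) (suc w) b x Fin.zero = refl
   padE-ev (suc L) (suc w) b x (Fin.suc i) = padE-ev L w (λ j → b (Fin.suc j)) x i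

   num-top : ∀ {K} (b : Fin (suc K) → Bool) → num b ≡ num (λ i → b (Fin.inject₁ i)) + 2 ^ K * b2n (b (Fin.fromℕ K))
   num-top {zero} b = trans (ℕ.+-identityʳ _) (sym (ℕ.+-identityʳ _))
   num-top {suc K} b = trans (cong (λ z → b2n (b Fin.zero) + 2 * z) (num-top (λ i → b (Fin.suc i))))
     (lem (b2n (b Fin.zero)) (num (λ i → b (Fin.suc (Fin.inject₁ i)))) (2 ^ K) (b2n (b (Fin.suc (Fin.fromℕ K)))))
     where
     lem : ∀ a n p c → a + 2 * (n + p * c) ≡ (a + 2 * n) + 2 * p * c
     lem = NS.solve-∀

   Σb-mod : ∀ {M} p {φ ψ : Vec Bool p → ℤ} → (∀ a → Mod M (φ a) (ψ a)) → Mod M (Σb p φ) (Σb p ψ)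
   Σb-mod zero h = h []
   Σb-mod (suc p) h = Σb-mod p (λ e → mod-op plus (h _) (h _))

   sumN-double : ∀ n (f : ℕ → ℕ) → sumN (2 * n) f ≡ sumN n (λ i → f (2 * i) + f (1 + 2 * i))
   sumN-double zero f = refl
   sumN-double (suc n) f = trans (cong (λ z → sumN z f) (ℕ.*-suc 2 n)) (trans (ℕ.+-assoc (sumN (2 * n) f) _ _) (cong (_+ (f (2 * n) + f (1 + 2 * n))) (sumN-double n f)))

   Σb-num : ∀ w (f : ℕ → ℕ) → Σb w (λ a → + f (num (Vec.lookup a))) ≡ + sumN (2 ^ w) f
   Σb-num zero f = refl
   Σb-num (suc w) f = trans (Σb-num w (λ i → f (2 * i) + f (1 + 2 * i))) (cong +_ (sym (sumN-double (2 ^ w) f)))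

 -- A context of number variables: the possible arguments, the admissible ones, and their encoding
 -- as circuit inputs. Formulas with bound summation variables are compiled over such contexts, much
 -- as terms are interpreted over typing contexts.
 record Ctx : Set₁ where
   field
     Dom : ℕ → Set
     Ok : ∀ n → Dom n → Set
     wid : ℕ → ℕ
     widPB : PB wid
     enc : ∀ n → Dom n → Fin (wid n) → Bool
 open Ctx public

 -- The new variable has `w n` bits. `P` is an invariant that it may be assumed to satisfy; a fold
 -- uses it for its accumulator.
 extC : (X : Ctx) (w : ℕ → ℕ) → PB w → (∀ n → Dom X n → ℕ → Set) → Ctx
 extC X w pw P = record
   { Dom = λ n → Dom X n × ℕ
   ; Ok = λ n xy → Ok X n (proj₁ xy) × (proj₂ xy < 2 ^ w n) × P n (proj₁ xy) (proj₂ xy)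
   ; wid = λ n → wid X n + w n
   ; widPB = PB-+ (widPB X) pw
   ; enc = λ n xy k → [ enc X n (proj₁ xy) , toBits (w n) (proj₂ xy) ] (Fin.splitAt (wid X n) k) }

 leN : ℕ → ℕ → ℕ
 leN a b = if a ≤ᵇ b then 1 else 0

 abstract
   leN-yes : ∀ {a b} → a ≤ b → leN a b ≡ 1
   leN-yes {a} {b} h with a ≤ᵇ b in eq
   ... | true = refl
   ... | false = ⊥-elim (subst T eq (ℕ.≤⇒≤ᵇ h))

   leN-no : ∀ {a b} → b < a → leN a b ≡ 0
   leN-no {a} {b} h with a ≤ᵇ b in eq
   ... | false = refl
   ... | true = ⊥-elim (ℕ.<⇒≱ h (ℕ.≤ᵇ⇒≤ a b (subst T (sym eq) tt)))

   top-yes : ∀ {low p v} t → low < p → low + p * b2n t ≡ v → p ≤ v → b2n t ≡ 1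
   top-yes true l e h = refl
   top-yes {low} {p} false l e h = ⊥-elim (ℕ.<⇒≱ l (ℕ.≤-trans h (ℕ.≤-reflexive (trans (sym e) (trans (cong (λ z → low + z) (ℕ.*-zeroʳ p)) (ℕ.+-identityʳ low))))))

   top-no : ∀ {low p v} t → low + p * b2n t ≡ v → v < p → b2n t ≡ 0
   top-no false e h = refl
   top-no {low} {p} true e h = ⊥-elim (ℕ.<⇒≱ h (ℕ.≤-trans (ℕ.≤-trans (ℕ.≤-reflexive (sym (ℕ.*-identityʳ p))) (ℕ.m≤n+m (p * 1) low)) (ℕ.≤-reflexive e)))

 module Num (sumC : SumClosed) (K : ℕ → ℕ) (PK : PB K) where
   L : ℕ → ℕ
   L n = suc (K n)
   PL : PB L
   PL = PB-suc PK

   -- Only the residue modulo 2 ^ L is prescribed, so sums and products compose without size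
   -- conditions. Bounds are asked for only where a value is read as such, in comparison,
   -- substitution and folding.
   record N (X : Ctx) (F : ∀ n → Dom X n → ℕ) : Set where
     constructor mkN
     field
       sz : ℕ → ℕ
       szPB : PB sz
       fn : ∀ n → (Fin (wid X n) → Bool) → Fin (L n) → Bool
       cpn : ∀ n → Cp (wid X n) (Fin (L n)) (sz n) (fn n)
       spec : ∀ n x → Ok X n x → Mod (2 ^ L n) (+ num (fn n (enc X n x))) (+ F n x)

   abstract
     fn-cong : ∀ {X F} (a : N X F) n {x y : Fin (wid X n) → Bool} → (∀ i → x i ≡ y i) → ∀ o → N.fn a n x o ≡ N.fn a n y o
     fn-cong a n {x} {y} h o = trans (sym (correct (N.cpn a n) x o)) (trans (rv-cong 𝔹A h (gts (cir (N.cpn a n))) (outs (cir (N.cpn a n)) o)) (correct (N.cpn a n) y o))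

     fn-low : ∀ {X F} (a : N X F) n x → Ok X n x → ∀ {w} (wL : w ≤ L n) → F n x < 2 ^ w → ∀ i →
       N.fn a n (enc X n x) (Fin.inject≤ i wL) ≡ toBits w (F n x) i
     fn-low {X} {F} a n x ok {w} wL lt i = trans (sym (toBits-num out (Fin.inject≤ i wL)))
         (trans (cong (λ z → toBits (L n) z (Fin.inject≤ i wL)) (mod-unique (num< out) (ℕ.<-≤-trans lt (ℕ.^-monoʳ-≤ 2 wL)) (N.spec a n x ok))) (sym (toBits-inject w (L n) wL (F n x) i)))
       where
       out : Fin (L n) → Bool
       out = N.fn a n (enc X n x)

   PcostOp : PB (λ n → costOp (L n))
   PcostOp = PB-+ PL (PB-* (PB-suc PL) (PB-* PL (PB-+ (PB-const 1) (PB-* PL (PB-const 8)))))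

   module _ {X : Ctx} where
     n-cong : ∀ {F G : ∀ n → Dom X n → ℕ} → (∀ n x → Ok X n x → F n x ≡ G n x) → N X F → N X G
     n-cong h (mkN s p f c sp) = mkN s p f c (λ n x o → mod-trans (sp n x o) (mod-refl (cong +_ (h n x o))))

     n-const : (c : ℕ → ℕ) → N X (λ n _ → c n)
     n-const c = mkN (λ n → L n * 1) (PB-* PL (PB-const 1)) (λ n x i → evE 𝔹A x (t n i))
       (λ n → cp-exp (L n) (t n) (tn n)) (λ n x o → mod-trans (mod-refl (cong +_ (num-cong (te n (enc X n x))))) (ℕ⇒mod {q = proj₁ (num-toBits (L n) (c n))} (proj₂ (num-toBits (L n) (c n)))))
       where
       bitE : ∀ {m} → Bool → Exp m
       bitE b = if b then o# else 0#
       t : ∀ n → Fin (L n) → Exp (wid X n)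
       t n i = bitE (toBits (L n) (c n) i)
       tn : ∀ n i → nodes (t n i) ≤ 1
       tn n i with toBits (L n) (c n) i
       ... | true = z≤n
       ... | false = s≤s z≤n
       te : ∀ n x i → evE 𝔹A x (t n i) ≡ toBits (L n) (c n) i
       te n x i with toBits (L n) (c n) i
       ... | true = refl
       ... | false = refl

     n-op : ∀ o {F G H : ∀ n → Dom X n → ℕ} → (∀ n x → Ok X n x → opZ o (+ F n x) (+ G n x) ≡ + H n x) → N X F → N X G → N X H
     n-op o h (mkN s p f c sp) (mkN s' p' f' c' sp') = mkN (λ n → costOp (L n) + (s' n + s n)) (PB-+ PcostOp (PB-+ p' p)) _
       (λ n → cp-seq (cp-par (c n) (c' n)) (cp (opBlock (L n) o)) (Fin.splitAt (L n)))
       (λ n x ok → mod-trans (spec (opBlock (L n) o) _) (mod-trans (mod-op o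
          (mod-trans (mod-refl (cong +_ (num-cong (λ i → cong [ f n (enc X n x) , f' n (enc X n x) ] (Fin.splitAt-↑ˡ (L n) i (L n)))))) (sp n x ok))
          (mod-trans (mod-refl (cong +_ (num-cong (λ i → cong [ f n (enc X n x) , f' n (enc X n x) ] (Fin.splitAt-↑ʳ (L n) (L n) i))))) (sp' n x ok)))
          (mod-refl (h n x ok))))

     n-+ : ∀ {F G} → N X F → N X G → N X (λ n x → F n x + G n x)
     n-+ = n-op plus (λ _ _ _ → refl)

     n-* : ∀ {F G} → N X F → N X G → N X (λ n x → F n x * G n x)
     n-* {F} {G} = n-op times (λ n x _ → sym (ℤ.pos-* (F n x) (G n x)))

     n-∸ : ∀ {F G} → (∀ n x → Ok X n x → G n x ≤ F n x) → N X F → N X G → N X (λ n x → F n x ∸ G n x)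
     n-∸ {F} {G} h = n-op minus (λ n x ok → trans (ℤ.m-n≡m⊖n (F n x) (G n x)) (ℤ.⊖-≥ (h n x ok)))

     -- The answer is the top bit of 2 ^ K + G - F, a number below 2 ^ (K + 1) when both arguments
     -- are below 2 ^ K.
     n-le : ∀ {F G} → (∀ n x → Ok X n x → F n x < 2 ^ K n) → (∀ n x → Ok X n x → G n x < 2 ^ K n) → N X F → N X G →
       N X (λ n x → leN (F n x) (G n x))
     n-le {F} {G} hF hG NF NG = out (n-∸ {F = D} sub (n-+ (n-const (λ n → 2 ^ K n)) NG) NF)
       where
       D : ∀ n → Dom X n → ℕ
       D n x = 2 ^ K n + G n x
       sub : ∀ n x → Ok X n x → F n x ≤ D n x
       sub n x ok = ℕ.≤-trans (ℕ.<⇒≤ (hF n x ok)) (ℕ.m≤m+n _ _)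
       topE : ∀ n → Fin (L n) → Exp (L n)
       topE n Fin.zero = v# (Fin.fromℕ (K n))
       topE n (Fin.suc i) = 0#
       topn : ∀ n i → nodes (topE n i) ≤ 1
       topn n Fin.zero = z≤n
       topn n (Fin.suc i) = s≤s z≤n
       abstract
         final : ∀ n (b : Fin (L n) → Bool) x → Ok X n x → Mod (2 ^ L n) (+ num b) (+ (D n x ∸ F n x)) →
           num (λ i → evE 𝔹A b (topE n i)) ≡ leN (F n x) (G n x)
         final n b x ok m = trans (trans (cong (λ z → b2n tp + 2 * z) (num-false {K n} (λ _ → false) (λ i → refl))) (ℕ.+-identityʳ _)) (tp≡ (F n x ℕ.≤? G n x))
           where
           tp : Bool
           tp = b (Fin.fromℕ (K n))
           low : ℕ
           low = num (λ i → b (Fin.inject₁ i))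
           D<  : D n x ∸ F n x < 2 ^ L n
           D< = ℕ.≤-<-trans (ℕ.m∸n≤m (D n x) (F n x)) (ℕ.<-≤-trans (ℕ.+-monoʳ-< (2 ^ K n) (hG n x ok)) (ℕ.≤-reflexive (cong (λ z → 2 ^ K n + z) (sym (ℕ.+-identityʳ (2 ^ K n))))))
           eqn : low + 2 ^ K n * b2n tp ≡ D n x ∸ F n x
           eqn = trans (sym (num-top b)) (mod-unique (num< b) D< m)
           tp≡ : Dec (F n x ≤ G n x) → b2n tp ≡ leN (F n x) (G n x)
           tp≡ (yes le) = trans (top-yes tp (num< (λ i → b (Fin.inject₁ i))) eqn (ℕ.≤-trans (ℕ.m≤m+n (2 ^ K n) (G n x ∸ F n x)) (ℕ.≤-reflexive (sym (ℕ.+-∸-assoc (2 ^ K n) le))))) (sym (leN-yes le))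
           tp≡ (no nle) = trans (top-no tp eqn (ℕ.≤-<-trans (ℕ.≤-reflexive e1) (ℕ.∸-monoʳ-< gt (hle n x ok)))) (sym (leN-no (ℕ.≰⇒> nle)))
             where
             hle : ∀ n x → Ok X n x → F n x ∸ G n x ≤ 2 ^ K n
             hle n x ok = ℕ.≤-trans (ℕ.m∸n≤m (F n x) (G n x)) (ℕ.<⇒≤ (hF n x ok))
             gt : 0 < F n x ∸ G n x
             gt = ℕ.m<n⇒0<n∸m (ℕ.≰⇒> nle)
             e1 : D n x ∸ F n x ≡ 2 ^ K n ∸ (F n x ∸ G n x)
             e1 = trans (cong (D n x ∸_) (sym (ℕ.m∸n+n≡m (ℕ.<⇒≤ (ℕ.≰⇒> nle))))) (trans (cong (D n x ∸_) (ℕ.+-comm (F n x ∸ G n x) (G n x))) (trans (cong (_∸ (G n x + (F n x ∸ G n x))) (ℕ.+-comm (2 ^ K n) (G n x))) (ℕ.[m+n]∸[m+o]≡n∸o (G n x) (2 ^ K n) (F n x ∸ G n x))))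
       out : N X (λ n x → D n x ∸ F n x) → N X (λ n x → leN (F n x) (G n x))
       out (mkN s p f c sp) = mkN (λ n → L n * 1 + s n) (PB-+ (PB-* PL (PB-const 1)) p) _
         (λ n → cp-seq (c n) (cp-exp (L n) (topE n) (topn n)) (λ i → i))
         (λ n x ok → mod-refl (cong +_ (final n (f n (enc X n x)) x ok (sp n x ok))))

   n-ren : ∀ {X Y : Ctx} {F} (π : ∀ n → Dom Y n → Dom X n) (ρ : ∀ n → Fin (wid X n) → Fin (wid Y n)) →
     (∀ n y → Ok Y n y → Ok X n (π n y)) → (∀ n y → Ok Y n y → ∀ i → enc Y n y (ρ n i) ≡ enc X n (π n y) i) →
     N X F → N Y (λ n y → F n (π n y))
   n-ren {X} {Y} π ρ hok henc (mkN s p f c sp) = mkN (λ n → s n + 0) (PB-+ p (PB-const 0)) _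
     (λ n → cp-seq (cp-wire (ρ n)) (c n) (λ i → i))
     (λ n y ok → mod-trans (mod-refl (cong +_ (num-cong (λ i → lem n y ok i)))) (sp n (π n y) (hok n y ok)))
     where
     lem : ∀ n y → Ok Y n y → ∀ i → f n (λ j → enc Y n y (ρ n j)) i ≡ f n (enc X n (π n y)) i
     lem n y ok i = trans (sym (correct (c n) (λ j → enc Y n y (ρ n j)) i)) (trans (rv-cong 𝔹A (henc n y ok) (gts (cir (c n))) (outs (cir (c n)) i)) (correct (c n) (enc X n (π n y)) i))

   module _ {X : Ctx} {w : ℕ → ℕ} {pw : PB w} {P : ∀ n → Dom X n → ℕ → Set} where
     n-wk : ∀ {F} → N X F → N (extC X w pw P) (λ n xy → F n (proj₁ xy))
     n-wk {F} = n-ren {X} {extC X w pw P} {F} (λ n → proj₁) (λ n i → i ↑ˡ w n) (λ n y ok → proj₁ ok)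
       (λ n y ok i → cong [ enc X n (proj₁ y) , toBits (w n) (proj₂ y) ] (Fin.splitAt-↑ˡ (wid X n) i (w n)))

     n-var : N (extC X w pw P) (λ n xy → proj₂ xy)
     n-var = mkN (λ n → L n * 1) (PB-* PL (PB-const 1)) (λ n x i → evE 𝔹A x (padE (L n) (w n) (λ j → wid X n ↑ʳ j) i))
       (λ n → cp-exp (L n) _ (padE-nodes (L n) (w n) (λ j → wid X n ↑ʳ j)))
       (λ n y ok → mod-trans (mod-refl (cong +_ (num-cong (padE-ev (L n) (w n) _ _))))
          (mod-trans (ℕ⇒mod {q = proj₁ (num-pad (L n) (w n) _)} (proj₂ (num-pad (L n) (w n) _)))
            (mod-refl (cong +_ (trans (num-cong (λ i → cong [ enc X n (proj₁ y) , toBits (w n) (proj₂ y) ] (Fin.splitAt-↑ʳ (wid X n) (w n) i)))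
              (num-toBits< (w n) (proj₂ y) (proj₁ (proj₂ ok))))))))

     n-let : ∀ {F G} → (∀ n → w n ≤ L n) → N X F → (∀ n x → Ok X n x → F n x < 2 ^ w n) → (∀ n x → Ok X n x → P n x (F n x)) →
       N (extC X w pw P) G → N X (λ n x → G n (x , F n x))
     n-let {F} {G} wL (mkN s p f c sp) hF hP (mkN s' p' f' c' sp') = mkN (λ n → s' n + s n) (PB-+ p' p) _
       (λ n → cp-seq (cp-withIn (c n)) (c' n) (ω n))
       (λ n x ok → mod-trans (mod-refl (cong +_ (num-cong (lem n x ok)))) (sp' n (x , F n x) (ok , hF n x ok , hP n x ok)))
       where
       ω : ∀ n → Fin (wid X n + w n) → Fin (L n) ⊎ Fin (wid X n)
       ω n k = [ (λ i → inj₂ i) , (λ j → inj₁ (Fin.inject≤ j (wL n))) ] (Fin.splitAt (wid X n) k)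
       numF : ∀ n x → Ok X n x → num (f n (enc X n x)) ≡ F n x
       numF n x ok = mod-unique (num< (f n (enc X n x))) (ℕ.<-≤-trans (hF n x ok) (ℕ.^-monoʳ-≤ 2 (wL n))) (sp n x ok)
       pt : ∀ n x → Ok X n x → ∀ k → [ f n (enc X n x) , enc X n x ] (ω n k) ≡ enc (extC X w pw P) n (x , F n x) k
       pt n x ok k with Fin.splitAt (wid X n) k
       ... | inj₁ i = refl
       ... | inj₂ j = trans (sym (toBits-num (f n (enc X n x)) (Fin.inject≤ j (wL n)))) (trans (cong (λ z → toBits (L n) z (Fin.inject≤ j (wL n))) (numF n x ok)) (sym (toBits-inject (w n) (L n) (wL n) (F n x) j)))
       lem : ∀ n x → Ok X n x → ∀ i → f' n (λ k → [ f n (enc X n x) , enc X n x ] (ω n k)) i ≡ f' n (enc (extC X w pw P) n (x , F n x)) i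
       lem n x ok i = trans (sym (correct (c' n) _ i)) (trans (rv-cong 𝔹A (pt n x ok) (gts (cir (c' n))) (outs (cir (c' n)) i)) (correct (c' n) _ i))

   module _ {X : Ctx} {w : ℕ → ℕ} {pw : PB w} where
     XY : Ctx
     XY = extC X w pw (λ _ _ _ → ⊤)

     -- One level of counting. The gates of the summand's circuit become additional summation bits,
     -- so the summand is a small tree `E`, and the hypothesis yields an integer circuit `H` for the
     -- sum in the variables that remain.
     module SumProof {F : ∀ n → Dom XY n → ℕ} (s : ℕ → ℕ) (p : PB s) (f : ∀ n → (Fin (wid XY n) → Bool) → Fin (L n) → Bool)
                     (c : ∀ n → Cp (wid XY n) (Fin (L n)) (s n) (f n))
                     (sp : ∀ n x → Ok XY n x → Mod (2 ^ L n) (+ num (f n (enc XY n x))) (+ F n x)) where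
       k : ℕ → ℕ
       k n = len (cir (c n))
       G : ∀ n → Gates (wid X n + w n) (k n)
       G n = gts (cir (c n))
       ι : ∀ n → Fin (wid X n + w n) → Fin (wid X n + (w n + k n))
       ι n i = [ (λ i → i ↑ˡ (w n + k n)) , (λ j → wid X n ↑ʳ (j ↑ˡ k n)) ] (Fin.splitAt (wid X n) i)
       κ : ∀ n → Fin (k n) → Fin (wid X n + (w n + k n))
       κ n j = wid X n ↑ʳ (w n ↑ʳ j)
       E : ∀ n → Exp (wid X n + (w n + k n))
       E n = chkE (G n) (ι n) (κ n) ⊗ linE (ι n) (κ n) (outs (cir (c n)))
       nE : ∀ n → nodes (E n) ≤ suc (1 + L n * 3 + s n * 15)
       nE n = s≤s (ℕ.+-mono-≤ (ℕ.≤-reflexive (nodes-linE (ι n) (κ n) (outs (cir (c n))))) (ℕ.≤-trans (nodes-chkE (G n) (ι n) (κ n)) (ℕ.*-monoˡ-≤ 15 (size≤ (c n)))))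
       closed = sumC (wid X) (λ n → w n + k n) (widPB X) (PB-+ pw (PB-≤ (λ n → size≤ (c n)) p)) E
         (PB-≤ nE (PB-suc (PB-+ (PB-+ (PB-const 1) (PB-* PL (PB-const 3))) (PB-* p (PB-const 15)))))
       H : ∀ n → Circuit (wid X n)
       H n = proj₁ (proj₂ (proj₂ closed) n)
       xv : ∀ n → Dom X n → Vec Bool (wid X n)
       xv n x = Vec.tabulate (enc X n x)
       yin : ∀ n → Dom X n → Vec Bool (w n) → Fin (wid X n + w n) → Bool
       yin n x a i = [ enc X n x , Vec.lookup a ] (Fin.splitAt (wid X n) i)
       abstract
         lookup-x : ∀ n x i → Vec.lookup (b2z (xv n x)) i ≡ Defs.bool→ℤ (enc X n x i)
         lookup-x n x i = trans (Vec.lookup-map i Defs.bool→ℤ (xv n x)) (cong Defs.bool→ℤ (Vec.lookup∘tabulate (enc X n x) i))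
         hι : ∀ n x a g i → Vec.lookup (b2z (xv n x) Vec.++ b2z (a Vec.++ g)) (ι n i) ≡ Defs.bool→ℤ (yin n x a i)
         hι n x a g i with Fin.splitAt (wid X n) i
         ... | inj₁ j = trans (lookup-++b (b2z (xv n x)) (a Vec.++ g) j) (lookup-x n x j)
         ... | inj₂ j = trans (lookup-++b' (b2z (xv n x)) (a Vec.++ g) (j ↑ˡ k n)) (cong Defs.bool→ℤ (Vec.lookup-++ˡ a g j))
         hκ : ∀ n x (a : Vec Bool (w n)) g j → Vec.lookup (b2z (xv n x) Vec.++ b2z (a Vec.++ g)) (κ n j) ≡ Defs.bool→ℤ (Vec.lookup g j)
         hκ n x a g j = trans (lookup-++b' (b2z (xv n x)) (a Vec.++ g) (w n ↑ʳ j)) (cong Defs.bool→ℤ (Vec.lookup-++ʳ a g j))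
         evalH : ∀ n x → evalC (H n) (b2z (xv n x)) ≡ Σb (w n) (λ a → + num (f n (yin n x a)))
         evalH n x = trans (proj₂ (proj₂ (proj₂ (proj₂ closed) n)) (b2z (xv n x)))
           (trans (Σb-++ (w n) (k n) (λ ε → evE ℤA (Vec.lookup (b2z (xv n x) Vec.++ b2z ε)) (E n)))
             (Σb-cong (w n) (λ a → trans (Σb-cong (k n) (λ g → cong₂ ℤ._*_
                 (evE-chkE (G n) (ι n) (κ n) _ (yin n x a) g (hι n x a g) (hκ n x a g))
                 (evE-linE (ι n) (κ n) _ (yin n x a) (Vec.lookup g) (hι n x a g) (hκ n x a g) (outs (cir (c n))))))
               (trans (Σb-chk (G n) (yin n x a) (λ g → + num (λ i → rv 𝔹A (yin n x a) (Vec.lookup g) (outs (cir (c n)) i))))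
                 (cong +_ (num-cong (λ i → trans (rv-cong₂ (yin n x a) (lookup-gvV (G n) (yin n x a)) (outs (cir (c n)) i)) (correct (c n) (yin n x a) i))))))))
         term : ∀ n x → Ok X n x → ∀ a → Mod (2 ^ L n) (+ num (f n (yin n x a))) (+ F n (x , num (Vec.lookup a)))
         term n x ok a = mod-trans (mod-refl (cong +_ (num-cong (λ i → trans (sym (correct (c n) _ i)) (trans (rv-cong 𝔹A pt (G n) (outs (cir (c n)) i)) (correct (c n) _ i))))))
           (sp n (x , num (Vec.lookup a)) (ok , num< (Vec.lookup a) , tt))
           where
           pt : ∀ i → yin n x a i ≡ enc XY n (x , num (Vec.lookup a)) i
           pt i with Fin.splitAt (wid X n) i
           ... | inj₁ j = refl
           ... | inj₂ j = sym (toBits-num (Vec.lookup a) j)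
         total : ∀ n x → Ok X n x → Mod (2 ^ L n) (evalC (H n) (b2z (xv n x))) (+ sumN (2 ^ w n) (λ y → F n (x , y)))
         total n x ok = mod-trans (mod-refl (evalH n x)) (mod-trans (Σb-mod (w n) (term n x ok)) (mod-refl (Σb-num (w n) (λ y → F n (x , y)))))
       result : N X (λ n x → sumN (2 ^ w n) (λ y → F n (x , y)))
       -- `H` may compute a huge integer. Simulated modulo 2 ^ L it is a Boolean circuit again, and
       -- sums can be nested.
       result = mkN (λ n → 1 + proj₁ closed n * costOp (L n)) (PB-+ (PB-const 1) (PB-* (proj₁ (proj₂ closed)) PcostOp)) _
         (λ n → cp-map (λ i → output (H n) , i) (cp-≤ (s≤s (ℕ.*-monoˡ-≤ (costOp (L n)) (proj₁ (proj₂ (proj₂ (proj₂ closed) n))))) (proj₁ (proj₂ (simG (L n) (gates (H n)))))))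
         (λ n x ok → mod-trans (proj₂ (proj₂ (simG (L n) (gates (H n)))) (enc X n x) (output (H n)))
           (mod-trans (mod-refl (rv-cong ℤA (λ i → sym (lookup-x n x i)) (gates (H n)) (output (H n)))) (total n x ok)))

     n-sum : ∀ {F} → N XY F → N X (λ n x → sumN (2 ^ w n) (λ y → F n (x , y)))
     n-sum (mkN s p f c sp) = SumProof.result s p f c sp

   module FoldProof {X : Ctx} {w : ℕ → ℕ} {pw : PB w} {P : ∀ n → Dom X n → ℕ → Set} (wL : ∀ n → w n ≤ L n) where
     Acc Step In : Ctx
     Acc = extC X w pw P
     Step = extC Acc (λ _ → 1) (PB-const 1) (λ _ _ _ → ⊤)
     In = extC X L PL (λ _ _ _ → ⊤)

     -- The bit `b zero` is consumed last, so the bits of a number are processed from the most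
     -- significant one, as square-and-multiply requires.
     foldB : (ℕ → ℕ → ℕ) → ℕ → ∀ {k} → (Fin k → Bool) → ℕ
     foldB st a {zero} b = a
     foldB st a {suc k} b = st (foldB st a (λ j → b (Fin.suc j))) (b2n (b Fin.zero))

     module _ {A₀ : ∀ n → Dom X n → ℕ} {G : ∀ n → Dom Step n → ℕ}
         (NA : N X A₀) (NG : N Step G)
         (hA : ∀ n x → Ok X n x → A₀ n x < 2 ^ w n × P n x (A₀ n x))
         (hG : ∀ n x a b → Ok X n x → a < 2 ^ w n → P n x a → b < 2 → G n ((x , a) , b) < 2 ^ w n × P n x (G n ((x , a) , b))) where
       private
         module A = N NA
         module S = N NG
       st : ∀ n → Dom X n → ℕ → ℕ → ℕ
       st n x a b = G n ((x , a) , b)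
       V : ℕ → ℕ
       V n = wid X n + L n
       abstract
         lowBits : ∀ n (b : Fin (L n) → Bool) v → v < 2 ^ w n → Mod (2 ^ L n) (+ num b) (+ v) → ∀ i → b (Fin.inject≤ i (wL n)) ≡ toBits (w n) v i
         lowBits n b v lt m i = trans (sym (toBits-num b (Fin.inject≤ i (wL n))))
           (trans (cong (λ z → toBits (L n) z (Fin.inject≤ i (wL n))) (mod-unique (num< b) (ℕ.<-≤-trans lt (ℕ.^-monoʳ-≤ 2 (wL n))) m)) (sym (toBits-inject (w n) (L n) (wL n) v i)))
         fold-ok : ∀ n x → Ok X n x → ∀ {k} (b : Fin k → Bool) → foldB (st n x) (A₀ n x) b < 2 ^ w n × P n x (foldB (st n x) (A₀ n x) b)
         fold-ok n x ok {zero} b = hA n x ok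
         fold-ok n x ok {suc k} b = hG n x _ _ ok (proj₁ ih) (proj₂ ih) (lt (b Fin.zero))
           where
           ih : foldB (st n x) (A₀ n x) (λ j → b (Fin.suc j)) < 2 ^ w n × P n x (foldB (st n x) (A₀ n x) (λ j → b (Fin.suc j)))
           ih = fold-ok n x ok (λ j → b (Fin.suc j))
           lt : ∀ c → b2n c < 2
           lt false = s≤s z≤n
           lt true = s≤s (s≤s z≤n)
       ω : ∀ n → Fin (L n) → Fin (wid X n + w n + 1) → Fin (w n) ⊎ Fin (V n)
       ω n e i = [ (λ j → [ (λ a → inj₂ (a ↑ˡ L n)) , inj₁ ] (Fin.splitAt (wid X n) j)) , (λ _ → inj₂ (wid X n ↑ʳ e)) ] (Fin.splitAt (wid X n + w n) i)
       fk : ∀ n {k} → (Fin k → Fin (L n)) → (Fin (V n) → Bool) → Fin (w n) → Bool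
       fk n {zero} β x i = A.fn n (λ j → x (j ↑ˡ L n)) (Fin.inject≤ i (wL n))
       fk n {suc k} β x i = S.fn n (λ j → [ fk n (λ l → β (Fin.suc l)) x , x ] (ω n (β Fin.zero) j)) (Fin.inject≤ i (wL n))
       cpk : ∀ n k (β : Fin k → Fin (L n)) → Cp (V n) (Fin (w n)) (k * S.sz n + (A.sz n + 0)) (fk n β)
       cpk n zero β = cp-map (λ i → Fin.inject≤ i (wL n)) (cp-seq (cp-wire (_↑ˡ L n)) (A.cpn n) (λ i → i))
       cpk n (suc k) β = cp-≤ (ℕ.≤-reflexive (sym (ℕ.+-assoc (S.sz n) (k * S.sz n) _)))
         (cp-map (λ i → Fin.inject≤ i (wL n)) (cp-seq (cp-withIn (cpk n k (λ l → β (Fin.suc l)))) (S.cpn n) (ω n (β Fin.zero))))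
       abstract
         fk-spec : ∀ n x → Ok X n x → (y : Fin (V n) → Bool) → (∀ i → y (i ↑ˡ L n) ≡ enc X n x i) → ∀ {k} (β : Fin k → Fin (L n)) i →
           fk n β y i ≡ toBits (w n) (foldB (st n x) (A₀ n x) (λ l → y (wid X n ↑ʳ β l))) i
         fk-spec n x ok y hy {zero} β i = lowBits n (A.fn n (λ j → y (j ↑ˡ L n))) (A₀ n x) (proj₁ (hA n x ok)) (mod-trans (mod-refl (cong +_ (num-cong (λ j →
             trans (sym (correct (A.cpn n) _ j)) (trans (rv-cong 𝔹A hy (gts (cir (A.cpn n))) (outs (cir (A.cpn n)) j)) (correct (A.cpn n) _ j)))))) (A.spec n x ok)) i
         fk-spec n x ok y hy {suc k} β i = lowBits n (S.fn n (λ j → [ fk n (λ l → β (Fin.suc l)) y , y ] (ω n (β Fin.zero) j))) (foldB (st n x) (A₀ n x) (λ l → y (wid X n ↑ʳ β l))) (proj₁ (fold-ok n x ok (λ l → y (wid X n ↑ʳ β l)))) (mod-trans (mod-refl (cong +_ (num-cong (λ j →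
             trans (sym (correct (S.cpn n) _ j)) (trans (rv-cong 𝔹A pt (gts (cir (S.cpn n))) (outs (cir (S.cpn n)) j)) (correct (S.cpn n) _ j)))))) (S.spec n ((x , a) , b2n e) ((ok , proj₁ (fold-ok n x ok β') , proj₂ (fold-ok n x ok β')) , lt e , tt))) i
           where
           β' : Fin k → Bool
           β' l = y (wid X n ↑ʳ β (Fin.suc l))
           a : ℕ
           a = foldB (st n x) (A₀ n x) β'
           e : Bool
           e = y (wid X n ↑ʳ β Fin.zero)
           lt : ∀ c → b2n c < 2
           lt false = s≤s z≤n
           lt true = s≤s (s≤s z≤n)
           bit : ∀ c (i : Fin 1) → c ≡ toBits 1 (b2n c) i
           bit false Fin.zero = refl
           bit true Fin.zero = refl
           pt : ∀ i → [ fk n (λ l → β (Fin.suc l)) y , y ] (ω n (β Fin.zero) i) ≡ enc Step n ((x , a) , b2n e) i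
           pt i with Fin.splitAt (wid X n + w n) i
           ... | inj₂ i = bit e i
           ... | inj₁ j with Fin.splitAt (wid X n) j
           ... | inj₁ i = hy i
           ... | inj₂ i = fk-spec n x ok y hy (λ l → β (Fin.suc l)) i
       result : N In (λ n xe → foldB (st n (proj₁ xe)) (A₀ n (proj₁ xe)) (toBits (L n) (proj₂ xe)))
       result = mkN (λ n → L n * 1 + (L n * S.sz n + (A.sz n + 0))) (PB-+ (PB-* PL (PB-const 1)) (PB-+ (PB-* PL S.szPB) (PB-+ A.szPB (PB-const 0)))) _
         (λ n → cp-seq (cpk n (L n) (λ i → i)) (cp-exp (L n) (padE (L n) (w n) (λ i → i)) (padE-nodes (L n) (w n) (λ i → i))) (λ i → i))
         (λ n xe ok → mod-refl (cong +_ (fin n (proj₁ xe) (proj₂ xe) ok)))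
         where
         abstract
           fin : ∀ n x e → Ok In n (x , e) → num (λ i → evE 𝔹A (fk n (λ i → i) (enc In n (x , e))) (padE (L n) (w n) (λ i → i) i)) ≡ foldB (st n x) (A₀ n x) (toBits (L n) e)
           fin n x e ok = mod-unique (num< (λ i → evE 𝔹A (fk n (λ i → i) y) (padE (L n) (w n) (λ i → i) i))) (ℕ.<-≤-trans (proj₁ fo) (ℕ.^-monoʳ-≤ 2 (wL n)))
             (mod-trans (mod-refl (cong +_ (num-cong (padE-ev (L n) (w n) (λ i → i) (fk n (λ i → i) y)))))
              (mod-trans (ℕ⇒mod {q = proj₁ (num-pad (L n) (w n) (fk n (λ i → i) y))} (proj₂ (num-pad (L n) (w n) (fk n (λ i → i) y))))
               (mod-refl (cong +_ (trans (num-cong (λ i → trans (fk-spec n x (proj₁ ok) y (λ i → cong [ enc X n x , toBits (L n) e ] (Fin.splitAt-↑ˡ (wid X n) i (L n))) (λ i → i) i)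
                    (cong (λ z → toBits (w n) z i) fe))) (num-toBits< (w n) (foldB (st n x) (A₀ n x) (toBits (L n) e)) (proj₁ fo)))))))
             where
             y : Fin (V n) → Bool
             y = enc In n (x , e)
             fo : foldB (st n x) (A₀ n x) (toBits (L n) e) < 2 ^ w n × P n x (foldB (st n x) (A₀ n x) (toBits (L n) e))
             fo = fold-ok n x (proj₁ ok) (toBits (L n) e)
             fold-cong : ∀ {k} {b c : Fin k → Bool} → (∀ i → b i ≡ c i) → foldB (st n x) (A₀ n x) b ≡ foldB (st n x) (A₀ n x) c
             fold-cong {zero} h = refl
             fold-cong {suc k} h = cong₂ (st n x) (fold-cong (λ i → h (Fin.suc i))) (cong b2n (h Fin.zero))
             fe : foldB (st n x) (A₀ n x) (λ l → y (wid X n ↑ʳ l)) ≡ foldB (st n x) (A₀ n x) (toBits (L n) e)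
             fe = fold-cong (λ l → cong [ enc X n x , toBits (L n) e ] (Fin.splitAt-↑ʳ (wid X n) (L n) l))

-- Search, division and modular powers

module BoundedSearch where
 open import Data.Nat using (_≤_; _<_; _+_; _*_; _∸_; _^_; _≤ᵇ_; _<ᵇ_; _⊔_)
 open import Data.Nat.DivMod
 open import Data.Bool using (T)
 open import Relation.Binary.Definitions using (tri<; tri≈; tri>)
 open Growth
 open SumClosure using (SumClosed)
 open Verification
 open Counting

 eqN : ℕ → ℕ → ℕ
 eqN a b = leN a b * leN b a

 -- Bounded minimisation as a count: `y` contributes 1 as long as no witness up to `y` exists, and
 -- there are as many such `y` as the least witness says.
 μ : ℕ → (ℕ → ℕ) → ℕ
 μ S φ = sumN S (λ y → leN (sumN S (λ y' → leN y' y * φ y')) 0)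

 abstract
   leN≤1 : ∀ a b → leN a b ≤ 1
   leN≤1 a b with a ≤ᵇ b
   ... | true = s≤s z≤n
   ... | false = z≤n

   leN-elim : ∀ a b → (a ≤ b × leN a b ≡ 1) ⊎ (b < a × leN a b ≡ 0)
   leN-elim a b with a ℕ.≤? b
   ... | yes h = inj₁ (h , leN-yes h)
   ... | no h = inj₂ (ℕ.≰⇒> h , leN-no (ℕ.≰⇒> h))

   eqN-refl : ∀ {a b} → a ≡ b → eqN a b ≡ 1
   eqN-refl {a} refl = cong₂ _*_ (leN-yes (ℕ.≤-refl {a})) (leN-yes (ℕ.≤-refl {a}))

   eqN-≢ : ∀ {a b} → a ≢ b → eqN a b ≡ 0
   eqN-≢ {a} {b} ne with ℕ.<-cmp a b
   ... | tri< h _ _ = trans (cong (leN a b *_) (leN-no h)) (ℕ.*-zeroʳ (leN a b))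
   ... | tri≈ _ e _ = ⊥-elim (ne e)
   ... | tri> _ _ h = cong (_* leN b a) (leN-no h)

   eqN≡1⇒ : ∀ {a b} → eqN a b ≢ 0 → a ≡ b
   eqN≡1⇒ {a} {b} h with a ℕ.≟ b
   ... | yes e = e
   ... | no ne = ⊥-elim (h (eqN-≢ ne))

   eqN≤1 : ∀ a b → eqN a b ≤ 1
   eqN≤1 a b = ℕ.*-mono-≤ (leN≤1 a b) (leN≤1 b a)

   sumN-ones : ∀ M (f : ℕ → ℕ) → (∀ k → k < M → f k ≡ 1) → sumN M f ≡ M
   sumN-ones zero f h = refl
   sumN-ones (suc M) f h = trans (cong₂ _+_ (sumN-ones M f (λ k l → h k (ℕ.m<n⇒m<1+n l))) (h M ℕ.≤-refl)) (ℕ.+-comm M 1)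

   sumN-threshold : ∀ M t (f : ℕ → ℕ) → t ≤ M → (∀ k → k < t → f k ≡ 1) → (∀ k → t ≤ k → f k ≡ 0) → sumN M f ≡ t
   sumN-threshold zero .zero f z≤n h h' = refl
   sumN-threshold (suc M) t f l h h' with ℕ.m≤n⇒m<n∨m≡n l
   ... | inj₁ (s≤s t≤M) = trans (cong₂ _+_ (sumN-threshold M t f t≤M h h') (h' M t≤M)) (ℕ.+-identityʳ t)
   ... | inj₂ refl = sumN-ones (suc M) f h

   -- The quotient counts the positive multiples of the divisor that do not exceed `a`.
   quo-spec : ∀ M a q → a / suc q ≤ M → sumN M (λ k → leN (suc k * suc q) a) ≡ a / suc q
   quo-spec M a q l = sumN-threshold M (a / suc q) (λ k → leN (suc k * suc q) a) l
     (λ k lt → leN-yes (ℕ.≤-trans (ℕ.*-monoˡ-≤ (suc q) lt) (m/n*n≤m a (suc q))))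
     (λ k le → leN-no (ℕ.<-≤-trans (lt a) (ℕ.*-monoˡ-≤ (suc q) (s≤s le))))
     where
     lt : ∀ a → a < suc (a / suc q) * suc q
     lt a = ℕ.≤-<-trans (ℕ.≤-reflexive (m≡m%n+[m/n]*n a (suc q))) (ℕ.+-monoˡ-< ((a / suc q) * suc q) (m%n<n a (suc q)))

   min-witness : ∀ (φ : ℕ → ℕ) y → φ y ≢ 0 → ∃[ m ] (m ≤ y × φ m ≢ 0 × (∀ i → i < m → φ i ≡ 0))
   min-witness φ y h = go y 0 (ℕ.+-identityʳ y) (λ _ ())
     where
     go : ∀ d m → d + m ≡ y → (∀ i → i < m → φ i ≡ 0) → ∃[ m ] (m ≤ y × φ m ≢ 0 × (∀ i → i < m → φ i ≡ 0))
     go zero m refl z = m , ℕ.≤-refl , h , z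
     go (suc d) m e z with φ m ℕ.≟ 0
     ... | no ne = m , ℕ.≤-trans (ℕ.m≤n+m m (suc d)) (ℕ.≤-reflexive e) , ne , z
     ... | yes z0 = go d (suc m) (trans (ℕ.+-suc d m) e) (λ { i (s≤s l) → [ (λ lt → z i lt) , (λ { refl → z0 }) ] (ℕ.m≤n⇒m<n∨m≡n l) })

   μ-spec : ∀ S φ y → y < S → φ y ≢ 0 → μ S φ ≤ y × φ (μ S φ) ≢ 0
   μ-spec S φ y l h with min-witness φ y h
   ... | m , m≤y , hm , z = subst (λ k → k ≤ y × φ k ≢ 0) (sym eq) (m≤y , hm)
     where
     zle : ∀ i k → ((i ≤ k × leN i k ≡ 1) ⊎ (k < i × leN i k ≡ 0)) → (i ≤ k → φ i ≡ 0) → leN i k * φ i ≡ 0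
     zle i k (inj₁ (h , _)) f = trans (cong (leN i k *_) (f h)) (ℕ.*-zeroʳ (leN i k))
     zle i k (inj₂ (_ , e)) f = cong (_* φ i) e
     m<S : m < S
     m<S = ℕ.≤-<-trans m≤y l
     eq : μ S φ ≡ m
     eq = sumN-threshold S m (λ y → leN (sumN S (λ y' → leN y' y * φ y')) 0) (ℕ.<⇒≤ m<S)
       (λ k k<m → leN-yes (ℕ.≤-reflexive (sumN≡0 S (λ i → leN i k * φ i) (λ i _ → zle i k (leN-elim i k) (λ i≤k → z i (ℕ.≤-<-trans i≤k k<m))))))
       (λ k m≤k → leN-no (ℕ.<-≤-trans (ℕ.n≢0⇒n>0 (λ e → hm (trans (sym (trans (cong (_* φ m) (leN-yes m≤k)) (ℕ.+-identityʳ (φ m)))) e))) (term≤sumN S (λ y' → leN y' k * φ y') m m<S)))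

   μ≤ : ∀ S φ → μ S φ ≤ S
   μ≤ S φ = ℕ.≤-trans (sumN-≤ S (λ i _ → leN≤1 (sumN S (λ y' → leN y' i * φ y')) 0)) (ℕ.≤-reflexive (ℕ.*-identityʳ S))

 module Bounded (sumC : SumClosed) (r : ℕ → ℕ) (Pr : PB r) (r≥1 : ∀ n → 1 ≤ r n) where
   module NN = Num sumC (λ n → 20 * r n) (PB-* (PB-const 20) Pr)
   open NN

   abstract
     2^mono : ∀ {a b} → a ≤ b → 2 ^ a ≤ 2 ^ b
     2^mono = ℕ.^-monoʳ-≤ 2
     lvl-mono : ∀ {k l} n → k ≤ l → 2 ^ (k * r n) ≤ 2 ^ (l * r n)
     lvl-mono n h = 2^mono (ℕ.*-monoˡ-≤ (r n) h)
     lvl-+ : ∀ k l n → 2 ^ (k * r n) * 2 ^ (l * r n) ≡ 2 ^ ((k + l) * r n)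
     lvl-+ k l n = trans (sym (ℕ.^-distribˡ-+-* 2 (k * r n) (l * r n))) (cong (2 ^_) (sym (ℕ.*-distribʳ-+ (r n) k l)))
     lvl< : ∀ {k l} n → k < l → 2 ^ (k * r n) < 2 ^ (l * r n)
     lvl< {k} {l} n h = ℕ.^-monoʳ-< 2 (s≤s (s≤s z≤n)) (ℕ.<-≤-trans (ℕ.m<n+m (k * r n) (r≥1 n)) (ℕ.*-monoˡ-≤ (r n) h))
     2≤lvl : ∀ n → 2 ≤ 2 ^ (1 * r n)
     2≤lvl n = 2^mono {1} (ℕ.≤-trans (r≥1 n) (ℕ.≤-reflexive (sym (ℕ.+-identityʳ (r n)))))
     lvl-double : ∀ k n → 2 ^ (k * r n) + 2 ^ (k * r n) ≤ 2 ^ (suc k * r n)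
     lvl-double k n = ℕ.≤-trans (ℕ.≤-reflexive (cong (2 ^ (k * r n) +_) (sym (ℕ.+-identityʳ _))))
       (ℕ.≤-trans (ℕ.*-monoˡ-≤ (2 ^ (k * r n)) (2≤lvl n)) (ℕ.≤-reflexive (lvl-+ 1 k n)))

   -- Level k means values up to 2 ^ (k r); the bit representations have room for levels below 20.
   record NB (X : Ctx) (k : ℕ) (F : ∀ n → Dom X n → ℕ) : Set where
     constructor nb
     field
       nn : N X F
       bd : ∀ n x → Ok X n x → F n x ≤ 2 ^ (k * r n)
   open NB public

   module _ {X : Ctx} where
     b-bound : ∀ {k j : ℕ} {F : ∀ n → Dom X n → ℕ} → (∀ n x → Ok X n x → F n x ≤ 2 ^ (j * r n)) → NB X k F → NB X j F
     b-bound h (nb a _) = nb a h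

     b-cong : ∀ {k : ℕ} {F G : ∀ n → Dom X n → ℕ} → (∀ n x → Ok X n x → F n x ≡ G n x) → NB X k F → NB X k G
     b-cong h (nb a b) = nb (n-cong h a) (λ n x o → ℕ.≤-trans (ℕ.≤-reflexive (sym (h n x o))) (b n x o))

     b-const : ∀ {k} (c : ℕ → ℕ) → (∀ n → c n ≤ 2 ^ (k * r n)) → NB X k (λ n _ → c n)
     b-const c h = nb (n-const c) (λ n x _ → h n)

     b-0 : NB X 0 (λ _ _ → 0)
     b-0 = b-const (λ _ → 0) (λ _ → z≤n)

     b-1 : NB X 0 (λ _ _ → 1)
     b-1 = b-const (λ _ → 1) (λ _ → s≤s z≤n)

     b-+ : ∀ {k l : ℕ} {F G : ∀ n → Dom X n → ℕ} → NB X k F → NB X l G → NB X (suc (k ⊔ l)) (λ n x → F n x + G n x)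
     b-+ {k} {l} (nb a b) (nb a' b') = nb (n-+ a a') (λ n x o → ℕ.≤-trans
       (ℕ.+-mono-≤ (ℕ.≤-trans (b n x o) (lvl-mono n (ℕ.m≤m⊔n k l))) (ℕ.≤-trans (b' n x o) (lvl-mono n (ℕ.m≤n⊔m k l)))) (lvl-double (k ⊔ l) n))

     b-suc : ∀ {k : ℕ} {F : ∀ n → Dom X n → ℕ} → NB X k F → NB X (suc k) (λ n x → suc (F n x))
     b-suc {k} (nb a b) = nb (n-+ (n-const (λ _ → 1)) a) (λ n x o → ℕ.≤-trans (ℕ.+-mono-≤ (ℕ.m^n>0 2 (k * r n)) (b n x o)) (lvl-double k n))

     b-* : ∀ {k l : ℕ} {F G : ∀ n → Dom X n → ℕ} → NB X k F → NB X l G → NB X (k + l) (λ n x → F n x * G n x)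
     b-* {k} {l} (nb a b) (nb a' b') = nb (n-* a a') (λ n x o → ℕ.≤-trans (ℕ.*-mono-≤ (b n x o) (b' n x o)) (ℕ.≤-reflexive (lvl-+ k l n)))

     b-∸ : ∀ {k l : ℕ} {F G : ∀ n → Dom X n → ℕ} → (∀ n x → Ok X n x → G n x ≤ F n x) → NB X k F → NB X l G → NB X k (λ n x → F n x ∸ G n x)
     b-∸ {F = F} {G} h (nb a b) (nb a' b') = nb (n-∸ h a a') (λ n x o → ℕ.≤-trans (ℕ.m∸n≤m (F n x) (G n x)) (b n x o))

     -- For numerals the conditions `T (k <ᵇ 20)` reduce to `⊤` and are filled in silently. They say
     -- that the values fit into the 20 r bits reserved for comparison.
     b-le : ∀ {k l : ℕ} {F G : ∀ n → Dom X n → ℕ} → {p : T (k <ᵇ 20)} {q : T (l <ᵇ 20)} → NB X k F → NB X l G → NB X 0 (λ n x → leN (F n x) (G n x))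
     b-le {k} {l} {F} {G} {p = p} {q = q} (nb a b) (nb a' b') = nb (n-le (λ n x o → ℕ.≤-<-trans (b n x o) (lvl< n (ℕ.<ᵇ⇒< k 20 p))) (λ n x o → ℕ.≤-<-trans (b' n x o) (lvl< n (ℕ.<ᵇ⇒< l 20 q))) a a')
       (λ n x o → leN≤1 (F n x) (G n x))

     b-eq : ∀ {k l : ℕ} {F G : ∀ n → Dom X n → ℕ} → {p : T (k <ᵇ 20)} {q : T (l <ᵇ 20)} → NB X k F → NB X l G → NB X 0 (λ n x → eqN (F n x) (G n x))
     b-eq {p = p} {q = q} a b = b-* (b-le {p = p} {q = q} a b) (b-le {p = q} {q = p} b a)

   _▹⟨_,_⟩ : Ctx → (w : ℕ → ℕ) → PB w → Ctx
   X ▹⟨ w , pw ⟩ = extC X w pw (λ _ _ _ → ⊤)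

   module _ {X : Ctx} {w : ℕ → ℕ} {pw : PB w} {P : ∀ n → Dom X n → ℕ → Set} where
     b-wk : ∀ {k : ℕ} {F : ∀ n → Dom X n → ℕ} → NB X k F → NB (extC X w pw P) k (λ n xy → F n (proj₁ xy))
     b-wk (nb a b) = nb (n-wk a) (λ n xy o → b n (proj₁ xy) (proj₁ o))

     b-var : ∀ {k} → (∀ n → w n ≤ k * r n) → NB (extC X w pw P) k (λ n xy → proj₂ xy)
     b-var h = nb n-var (λ n xy o → ℕ.≤-trans (ℕ.<⇒≤ (proj₁ (proj₂ o))) (2^mono (h n)))

   module _ {X : Ctx} {w : ℕ → ℕ} {pw : PB w} where
     b-sum : ∀ {k : ℕ} c {F : ∀ n → Dom X n × ℕ → ℕ} → (∀ n → w n ≤ c * r n) → NB (X ▹⟨ w , pw ⟩) k F → NB X (c + k) (λ n x → sumN (2 ^ w n) (λ y → F n (x , y)))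
     b-sum {k} c h (nb a b) = nb (n-sum a) (λ n x o → ℕ.≤-trans (sumN-≤ (2 ^ w n) (λ y l → b n (x , y) (o , l , tt)))
       (ℕ.≤-trans (ℕ.*-monoˡ-≤ (2 ^ (k * r n)) (2^mono (h n))) (ℕ.≤-reflexive (lvl-+ c k n))))

   -- Weakening below the last variable. In the nested sums of `μ` the formula speaks of the inner
   -- candidate and not of the outer one.
   b-skip : ∀ {X : Ctx} {w w' : ℕ → ℕ} {pw : PB w} {pw' : PB w'} {k : ℕ} {F : ∀ n → Dom X n × ℕ → ℕ} → NB (X ▹⟨ w' , pw' ⟩) k F →
     NB ((X ▹⟨ w , pw ⟩) ▹⟨ w' , pw' ⟩) k (λ n xyz → F n (proj₁ (proj₁ xyz) , proj₂ xyz))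
   b-skip {X} {w} {w'} {pw} {pw'} {k} {F} (nb a b) = nb (n-ren {X ▹⟨ w' , pw' ⟩} {(X ▹⟨ w , pw ⟩) ▹⟨ w' , pw' ⟩} {F} (λ n z → proj₁ (proj₁ z) , proj₂ z) ρ
       (λ n y ok → proj₁ (proj₁ ok) , proj₂ ok) (λ n y ok i → lem n y i) a) (λ n z ok → b n _ (proj₁ (proj₁ ok) , proj₂ ok))
     where
     ρ : ∀ n → Fin (wid X n + w' n) → Fin (wid X n + w n + w' n)
     ρ n i = [ (λ j → (j ↑ˡ w n) ↑ˡ w' n) , (λ j → (wid X n + w n) ↑ʳ j) ] (Fin.splitAt (wid X n) i)
     lem : ∀ n (z : (Dom X n × ℕ) × ℕ) i → enc ((X ▹⟨ w , pw ⟩) ▹⟨ w' , pw' ⟩) n z (ρ n i) ≡ enc (X ▹⟨ w' , pw' ⟩) n (proj₁ (proj₁ z) , proj₂ z) i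
     lem n ((x , y) , z) i with Fin.splitAt (wid X n) i
     ... | inj₁ j = trans (cong [ enc (X ▹⟨ w , pw ⟩) n (x , y) , toBits (w' n) z ] (Fin.splitAt-↑ˡ (wid X n + w n) (j ↑ˡ w n) (w' n)))
                          (cong [ enc X n x , toBits (w n) y ] (Fin.splitAt-↑ˡ (wid X n) j (w n)))
     ... | inj₂ j = cong [ enc (X ▹⟨ w , pw ⟩) n (x , y) , toBits (w' n) z ] (Fin.splitAt-↑ʳ (wid X n + w n) (w' n) j)

   P2r : PB (λ n → 2 * r n)
   P2r = PB-* (PB-const 2) Pr

   module _ {X : Ctx} where
     -- The count runs over 2 ^ (2 r) candidates, whence the bound on the quotient among the
     -- premises.
     b-quo : ∀ {k l : ℕ} {F Q : ∀ n → Dom X n → ℕ} → {p : T (k <ᵇ 20)} {q : T (3 + l <ᵇ 20)} → NB X k F → NB X l (λ n x → suc (Q n x)) →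
       (∀ n x → Ok X n x → F n x / suc (Q n x) ≤ 2 ^ (2 * r n)) → NB X 2 (λ n x → F n x / suc (Q n x))
     b-quo {k} {l} {F} {Q} {p = p} {q = q} a b h = nb (nn (b-cong (λ n x o → quo-spec (2 ^ (2 * r n)) (F n x) (Q n x) (h n x o))
       (b-sum {X} {λ n → 2 * r n} {P2r} 2 {λ n xy → leN (suc (proj₂ xy) * suc (Q n (proj₁ xy))) (F n (proj₁ xy))} (λ n → ℕ.≤-refl)
          (b-le {p = q} {q = p} (b-* (b-suc (b-var {k = 2} (λ n → ℕ.≤-refl))) (b-wk b)) (b-wk a)))))
       h

     b-mod : ∀ {k l : ℕ} {F Q : ∀ n → Dom X n → ℕ} → {p : T (k <ᵇ 20)} {q : T (3 + l <ᵇ 20)} → NB X k F → NB X l (λ n x → suc (Q n x)) →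
       (∀ n x → Ok X n x → F n x ≤ 2 ^ (2 * r n) * suc (Q n x)) → NB X l (λ n x → F n x % suc (Q n x))
     b-mod {k} {l} {F} {Q} {p = p} {q = q} a b h = nb (nn (b-cong (λ n x o → sym (m%n≡m∸m/n*n (F n x) (suc (Q n x))))
         (b-∸ (λ n x o → m/n*n≤m (F n x) (suc (Q n x))) a (b-* (b-quo {p = p} {q = q} a b hq) b))))
       (λ n x o → ℕ.≤-trans (m%n≤n (F n x) (suc (Q n x))) (bd b n x o))
       where
       hq : ∀ n x → Ok X n x → F n x / suc (Q n x) ≤ 2 ^ (2 * r n)
       hq n x o = ℕ.≤-trans (/-monoˡ-≤ (suc (Q n x)) (h n x o)) (ℕ.≤-reflexive (m*n/n≡m (2 ^ (2 * r n)) (suc (Q n x))))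

     b-μ : ∀ {w : ℕ → ℕ} {pw : PB w} {k : ℕ} {F : ∀ n → Dom X n × ℕ → ℕ} → {p : T (suc k <ᵇ 20)} → (∀ n → w n ≤ r n) → NB (X ▹⟨ w , pw ⟩) k F → NB X 1 (λ n x → μ (2 ^ w n) (λ y → F n (x , y)))
     b-μ {w} {pw} {k} {F} {p = p} h a = nb (nn (b-sum {X} {w} {pw} 1 h' (b-le {p = p}
         (b-sum {X ▹⟨ w , pw ⟩} {w} {pw} 1 h' (b-* (b-le (b-var {k = 1} h') (b-wk (b-var {k = 1} h'))) (b-skip a))) b-0)))
         (λ n x o → ℕ.≤-trans (μ≤ (2 ^ w n) (λ y → F n (x , y))) (2^mono (h' n)))
       where
       h' : ∀ n → w n ≤ 1 * r n
       h' n = ℕ.≤-trans (h n) (ℕ.≤-reflexive (sym (ℕ.+-identityʳ (r n))))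

   module _ {X : Ctx} where
     -- Square-and-multiply. The exponent goes through `n-let`, which exposes its bits, and the
     -- invariant `P` keeps the accumulator below the modulus, so that intermediate products stay at
     -- level 2.
     b-pow : ∀ {k : ℕ} {G E Q : ∀ n → Dom X n → ℕ} → {p : T (k <ᵇ 20)} → NB X 1 G → NB X k E → NB X 1 (λ n x → suc (Q n x)) →
       NB X 1 (λ n x → (G n x ^ E n x) % suc (Q n x))
     b-pow {k} {G} {E} {Q} {p = p} a e b = nb (n-cong (λ n x o → powq n x o) (n-let {w = L} {pw = PL} {P = λ _ _ _ → ⊤} (λ n → ℕ.≤-refl) (nn e) (λ n x o → E< n x o) (λ _ _ _ → tt) res))
         (λ n x o → ℕ.≤-trans (m%n≤n (G n x ^ E n x) (suc (Q n x))) (bd b n x o))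
       where
       E< : ∀ n x → Ok X n x → E n x < 2 ^ L n
       E< n x o = ℕ.<-≤-trans (ℕ.≤-<-trans (bd e n x o) (lvl< n (ℕ.<ᵇ⇒< k 20 p))) (2^mono (ℕ.n≤1+n (20 * r n)))
       wL : ∀ n → 1 * r n ≤ L n
       wL n = ℕ.≤-trans (ℕ.*-monoˡ-≤ (r n) (s≤s (z≤n {19}))) (ℕ.n≤1+n (20 * r n))
       P : ∀ n → Dom X n → ℕ → Set
       P n x a = a < suc (Q n x)
       module FP = FoldProof {X} {λ n → 1 * r n} {PB-* (PB-const 1) Pr} {P} wL
       stepF : ∀ n → Dom FP.Step n → ℕ
       -- The second factor is `G` for bit 1 and 1 for bit 0.
       stepF n ((x , a) , c) = (((a * a) % suc (Q n x)) * (c * G n x + (1 ∸ c))) % suc (Q n x)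
       mul≤ : ∀ c g B → c < 2 → g ≤ B → 1 ≤ B → c * g + (1 ∸ c) ≤ B
       mul≤ zero g B lt hg hB = hB
       mul≤ (suc zero) g B lt hg hB = ℕ.≤-trans (ℕ.≤-reflexive (trans (ℕ.+-identityʳ _) (ℕ.+-identityʳ g))) hg
       mul≤ (suc (suc c)) g B (s≤s (s≤s ())) hg hB
       one≤ : ∀ n j → 1 ≤ 2 ^ (j * r n)
       one≤ n j = ℕ.m^n>0 2 (j * r n)
       1≤2 : ∀ n → 2 ^ (1 * r n) ≤ 2 ^ (2 * r n)
       1≤2 n = lvl-mono {1} {2} n (s≤s z≤n)
       mB : NB FP.Step 1 (λ n z → proj₂ z * G n (proj₁ (proj₁ z)) + (1 ∸ proj₂ z))
       mB = b-bound (λ n z o → mul≤ (proj₂ z) (G n (proj₁ (proj₁ z))) (2 ^ (1 * r n)) (proj₁ (proj₂ o)) (bd a n _ (proj₁ (proj₁ o))) (one≤ n 1))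
         (b-+ (b-* (b-var {k = 1} (λ n → ℕ.≤-trans (r≥1 n) (ℕ.≤-reflexive (sym (ℕ.+-identityʳ (r n)))))) (b-wk (b-wk a))) (b-∸ (λ n z o → ℕ.≤-pred (proj₁ (proj₂ o))) b-1 (b-var {k = 1} (λ n → ℕ.≤-trans (r≥1 n) (ℕ.≤-reflexive (sym (ℕ.+-identityʳ (r n))))))))
       accB : NB FP.Step 1 (λ n z → proj₂ (proj₁ z))
       accB = b-wk (b-var {k = 1} (λ n → ℕ.≤-refl))
       QB : NB FP.Step 1 (λ n z → suc (Q n (proj₁ (proj₁ z))))
       QB = b-wk (b-wk b)
       stepB : NB FP.Step 1 stepF
       stepB = b-mod {FP.Step} {2} {1} (b-* (b-mod {FP.Step} {2} {1} (b-* accB accB) QB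
           (λ n z o → ℕ.*-mono-≤ (ℕ.≤-trans (bd accB n z o) (1≤2 n)) (ℕ.<⇒≤ (proj₂ (proj₂ (proj₁ o)))))) mB) QB
         (λ n z o → ℕ.≤-trans (ℕ.*-mono-≤ (m%n≤n (proj₂ (proj₁ z) * proj₂ (proj₁ z)) (suc (Q n (proj₁ (proj₁ z))))) (ℕ.≤-trans (bd mB n z o) (1≤2 n))) (ℕ.≤-reflexive (ℕ.*-comm (suc (Q n (proj₁ (proj₁ z)))) (2 ^ (2 * r n)))))
       startB : NB X 1 (λ n x → 1 % suc (Q n x))
       startB = b-mod b-1 b (λ n x o → ℕ.*-mono-≤ (one≤ n 2) (s≤s z≤n))
       A₀ : ∀ n → Dom X n → ℕ
       A₀ n x = 1 % suc (Q n x)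
       hA : ∀ n x → Ok X n x → A₀ n x < 2 ^ (1 * r n) × P n x (A₀ n x)
       hA n x o = ℕ.<-≤-trans (m%n<n 1 (suc (Q n x))) (bd b n x o) , m%n<n 1 (suc (Q n x))
       hG : ∀ n x a b' → Ok X n x → a < 2 ^ (1 * r n) → P n x a → b' < 2 → stepF n ((x , a) , b') < 2 ^ (1 * r n) × P n x (stepF n ((x , a) , b'))
       hG n x a b' o _ _ _ = ℕ.<-≤-trans (m%n<n (((a * a) % suc (Q n x)) * (b' * G n x + (1 ∸ b'))) (suc (Q n x))) (bd b n x o) , m%n<n (((a * a) % suc (Q n x)) * (b' * G n x + (1 ∸ b'))) (suc (Q n x))
       foldv : ∀ n → Dom X n → ∀ {k} → (Fin k → Bool) → ℕ
       foldv n x = FP.foldB (λ a c → stepF n ((x , a) , c)) (A₀ n x)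
       res : N FP.In (λ n xe → foldv n (proj₁ xe) (toBits (L n) (proj₂ xe)))
       res = FP.result {A₀ = A₀} {G = stepF} (nn startB) (nn stepB) hA hG
       pw-spec : ∀ n x {k} (c : Fin k → Bool) → foldv n x c ≡ (G n x ^ num c) % suc (Q n x)
       pw-spec n x {zero} c = refl
       pw-spec n x {suc k} c = begin
         (((f * f) % q) * (b2n (c Fin.zero) * g + (1 ∸ b2n (c Fin.zero)))) % q
           ≡⟨ cong (λ z → (((z * z) % q) * m) % q) (pw-spec n x (λ i → c (Fin.suc i))) ⟩
         ((((h % q) * (h % q)) % q) * m) % q ≡⟨ cong (λ z → (z * m) % q) (sym (%-distribˡ-* h h q)) ⟩
         (((h * h) % q) * m) % q ≡⟨ absorb (h * h) m ⟩
         (h * h * m) % q ≡⟨ cong (_% q) (expo (c Fin.zero)) ⟩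
         (g ^ (b2n (c Fin.zero) + 2 * e')) % q ∎
         where
         open ≡-Reasoning
         q g e' h f m : ℕ
         q = suc (Q n x)
         g = G n x
         e' = num (λ i → c (Fin.suc i))
         h = g ^ e'
         f = foldv n x (λ i → c (Fin.suc i))
         m = b2n (c Fin.zero) * g + (1 ∸ b2n (c Fin.zero))
         absorb : ∀ a b → ((a % q) * b) % q ≡ (a * b) % q
         absorb a b = trans (%-distribˡ-* (a % q) b q) (trans (cong (λ z → (z * (b % q)) % q) (m%n%n≡m%n a q)) (sym (%-distribˡ-* a b q)))
         h2 : h * h ≡ g ^ (2 * e')
         h2 = trans (sym (ℕ.^-distribˡ-+-* g e' e')) (cong (g ^_) (cong (e' +_) (sym (ℕ.+-identityʳ e'))))
         expo : ∀ t → h * h * (b2n t * g + (1 ∸ b2n t)) ≡ g ^ (b2n t + 2 * e')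
         expo false = trans (ℕ.*-identityʳ (h * h)) h2
         expo true = trans (cong₂ _*_ h2 (trans (ℕ.+-identityʳ (g + 0)) (ℕ.+-identityʳ g))) (ℕ.*-comm (g ^ (2 * e')) g)
       powq : ∀ n x → Ok X n x → foldv n x (toBits (L n) (E n x)) ≡ (G n x ^ E n x) % suc (Q n x)
       powq n x o = trans (pw-spec n x (toBits (L n) (E n x))) (cong (λ z → (G n x ^ z) % suc (Q n x)) (num-toBits< (L n) (E n x) (E< n x o)))

-- Residues, orders and primitive roots

module Residue where
 open import Data.Nat using (_≤_; _<_; _+_; _*_; _∸_; _^_; NonZero)
 open import Data.Nat.DivMod
 open import Data.Nat.Divisibility
 open import Data.Nat.Primality
 open import Data.Nat.Primality.Factorisation using (factorise)
 open import Data.Nat.Coprimality as Cop using (Coprime; coprime-divisor)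
 open import Data.Nat.Induction using (<-rec)
 open import Data.Integer using (ℤ; +_)
 open import Data.List using ([]; _∷_)
 open import Data.List.Relation.Unary.All using ([]; _∷_)
 open Verification using (Mod; mod; mod-refl; mod-sym; mod-trans; mod-op)

 abstract
   mod⇒% : ∀ {q a b} → Mod (suc q) (+ a) (+ b) → a % suc q ≡ b % suc q
   mod⇒% {q} {a} {b} m with m | mod-sym m
   ... | mod (+ k) e | _ = trans (cong (_% suc q) (ℤ.+-injective (trans e (cong (λ z → + b ℤ.+ z) (sym (ℤ.pos-* k (suc q))))))) ([m+kn]%n≡m%n b k (suc q))
   ... | mod (ℤ.-[1+ k ]) e | mod k' e' = sym (trans (cong (_% suc q) b≡) ([m+kn]%n≡m%n a (suc k) (suc q)))
     where
     lem : ∀ y q m → y ≡ (y ℤ.+ (ℤ.- q) ℤ.* m) ℤ.+ q ℤ.* m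
     lem = ZS.solve-∀
     b≡ : b ≡ a + suc k * suc q
     b≡ = ℤ.+-injective (trans (lem (+ b) (+ suc k) (+ suc q)) (trans (cong (λ z → z ℤ.+ + suc k ℤ.* + suc q) (sym e)) (cong (λ z → + a ℤ.+ z) (sym (ℤ.pos-* (suc k) (suc q))))))

   %-mod : ∀ q a → Mod (suc q) (+ (a % suc q)) (+ a)
   %-mod q a = mod-sym (mod (+ (a / suc q)) (trans (cong +_ (m≡m%n+[m/n]*n a (suc q))) (cong (λ z → + (a % suc q) ℤ.+ z) (ℤ.pos-* (a / suc q) (suc q)))))

   %⇒mod : ∀ {q a b} → a % suc q ≡ b % suc q → Mod (suc q) (+ a) (+ b)
   %⇒mod {q} {a} {b} e = mod-trans (mod-sym (%-mod q a)) (mod-trans (mod-refl (cong +_ e)) (%-mod q b))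

   mod0⇒∣ : ∀ {q z} → Mod q z (+ 0) → q ∣ ℤ.∣ z ∣
   mod0⇒∣ {q} {z} (mod k e) = divides ℤ.∣ k ∣ (trans (cong ℤ.∣_∣ (trans e (ℤ.+-identityˡ (k ℤ.* + q)))) (ℤ.∣i*j∣≡∣i∣*∣j∣ k (+ q)))

   ∣⇒mod0 : ∀ {q z} → q ∣ ℤ.∣ z ∣ → Mod q z (+ 0)
   ∣⇒mod0 {q} {+ n} (divides k e) = mod (+ k) (trans (cong +_ e) (trans (ℤ.pos-* k q) (sym (ℤ.+-identityˡ _))))
   ∣⇒mod0 {q} {ℤ.-[1+ n ]} (divides k e) = mod (ℤ.- + k) (trans (cong (λ z → ℤ.- (+ z)) e) (trans (cong ℤ.-_ (ℤ.pos-* k q)) (lem (+ k) (+ q))))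
     where
     lem : ∀ k q → ℤ.- (k ℤ.* q) ≡ + 0 ℤ.+ (ℤ.- k) ℤ.* q
     lem = ZS.solve-∀

   mod-diff : ∀ {q x y} → Mod q (x ℤ.- y) (+ 0) → Mod q x y
   mod-diff {q} {x} {y} m = mod-trans (mod-refl (lem x y)) (mod-trans (mod-op plus m (mod-refl {b = y} refl)) (mod-refl (ℤ.+-identityˡ y)))
     where
     lem : ∀ x y → x ≡ (x ℤ.- y) ℤ.+ y
     lem = ZS.solve-∀

   mod-undiff : ∀ {q x y} → Mod q x y → Mod q (x ℤ.- y) (+ 0)
   mod-undiff {q} {x} {y} m = mod-trans (mod-op minus m (mod-refl {b = y} refl)) (mod-refl (ℤ.+-inverseʳ y))

   euclid : ∀ {q} → Prime q → ∀ x y → Mod q (x ℤ.* y) (+ 0) → Mod q x (+ 0) ⊎ Mod q y (+ 0)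
   euclid {q} pq x y m with euclidsLemma ℤ.∣ x ∣ ℤ.∣ y ∣ pq (subst (q ∣_) (ℤ.∣i*j∣≡∣i∣*∣j∣ x y) (mod0⇒∣ m))
   ... | inj₁ d = inj₁ (∣⇒mod0 d)
   ... | inj₂ d = inj₂ (∣⇒mod0 d)

   mod-cancel : ∀ {q} → Prime q → ∀ x y z → ¬ Mod q x (+ 0) → Mod q (x ℤ.* y) (x ℤ.* z) → Mod q y z
   mod-cancel pq x y z nx m with euclid pq x (y ℤ.- z) (mod-trans (mod-refl (lem x y z)) (mod-undiff m))
     where
     lem : ∀ x y z → x ℤ.* (y ℤ.- z) ≡ x ℤ.* y ℤ.- x ℤ.* z
     lem = ZS.solve-∀
   ... | inj₁ d = ⊥-elim (nx d)
   ... | inj₂ d = mod-diff d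

 -- Polynomial functions in Horner form. Degree and leading coefficient are what the count of roots
 -- modulo a prime depends on.
 data Monic : ℕ → (ℤ → ℤ) → Set where
   mon0 : ∀ {f} → (∀ x → f x ≡ + 1) → Monic 0 f
   monS : ∀ {d f g} c → Monic d g → (∀ x → f x ≡ x ℤ.* g x ℤ.+ c) → Monic (suc d) f

 abstract
   monic-+ : ∀ {d f k} r → Monic (suc d) f → Monic d k → Monic (suc d) (λ x → f x ℤ.+ r ℤ.* k x)
   monic-+ r (monS {g = g} c mg e) (mon0 e') = monS (c ℤ.+ r) mg (λ x → trans (cong₂ (λ a b → a ℤ.+ r ℤ.* b) (e x) (e' x)) (lem x (g x) c r))
     where
     lem : ∀ x g c r → (x ℤ.* g ℤ.+ c) ℤ.+ r ℤ.* + 1 ≡ x ℤ.* g ℤ.+ (c ℤ.+ r)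
     lem = ZS.solve-∀
   monic-+ r (monS {g = g} c mg e) (monS {g = k} c' mk e') = monS (c ℤ.+ r ℤ.* c') (monic-+ r mg mk)
     (λ x → trans (cong₂ (λ a b → a ℤ.+ r ℤ.* b) (e x) (e' x)) (lem x (g x) (k x) c c' r))
     where
     lem : ∀ x g k c c' r → (x ℤ.* g ℤ.+ c) ℤ.+ r ℤ.* (x ℤ.* k ℤ.+ c') ≡ x ℤ.* (g ℤ.+ r ℤ.* k) ℤ.+ (c ℤ.+ r ℤ.* c')
     lem = ZS.solve-∀

   -- With f = x g + c, the difference f(x) - f(r) is (x - r) g(x) + r (g(x) - g(r)), and induction
   -- splits off x - r from the last term.
   factor : ∀ {d f} → Monic (suc d) f → ∀ r → ∃[ h ] (Monic d h × (∀ x → f x ℤ.- f r ≡ (x ℤ.- r) ℤ.* h x))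
   factor {zero} (monS {g = g} c (mon0 e') e) r = g , mon0 e' , λ x → trans (cong₂ ℤ._-_ (trans (e x) (cong (λ z → x ℤ.* z ℤ.+ c) (e' x))) (trans (e r) (cong (λ z → r ℤ.* z ℤ.+ c) (e' r))))
       (trans (lem x r c) (cong ((x ℤ.- r) ℤ.*_) (sym (e' x))))
     where
     lem : ∀ x r c → (x ℤ.* + 1 ℤ.+ c) ℤ.- (r ℤ.* + 1 ℤ.+ c) ≡ (x ℤ.- r) ℤ.* + 1
     lem = ZS.solve-∀
   factor {suc d} (monS {g = g} c mg e) r with factor mg r
   ... | k , mk , ek = (λ x → g x ℤ.+ r ℤ.* k x) , monic-+ r mg mk ,
       λ x → trans (cong₂ ℤ._-_ (e x) (e r)) (trans (lem x r c (g x) (g r)) (trans (cong (λ z → (x ℤ.- r) ℤ.* g x ℤ.+ r ℤ.* z) (ek x)) (lem2 x r (g x) (k x))))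
     where
     lem : ∀ x r c gx gr → (x ℤ.* gx ℤ.+ c) ℤ.- (r ℤ.* gr ℤ.+ c) ≡ (x ℤ.- r) ℤ.* gx ℤ.+ r ℤ.* (gx ℤ.- gr)
     lem = ZS.solve-∀
     lem2 : ∀ x r gx kx → (x ℤ.- r) ℤ.* gx ℤ.+ r ℤ.* ((x ℤ.- r) ℤ.* kx) ≡ (x ℤ.- r) ℤ.* (gx ℤ.+ r ℤ.* kx)
     lem2 = ZS.solve-∀

   -- Splitting off the root `ρ (suc d)` leaves a polynomial of degree `d` that vanishes at the
   -- other points, because they are incongruent to that root and `q` is prime.
   root-bound : ∀ {q} → Prime q → ∀ d {f} → Monic d f → (ρ : ℕ → ℤ) → (∀ i → i ≤ d → Mod q (f (ρ i)) (+ 0)) →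
     (∀ i j → i < j → j ≤ d → ¬ Mod q (ρ i) (ρ j)) → ⊥
   root-bound {q} pq zero (mon0 e) ρ hr hd = absurd (∣1⇒≡1 (mod0⇒∣ (mod-trans (mod-refl (sym (e (ρ 0)))) (hr 0 z≤n))))
     where
     absurd : q ≡ 1 → ⊥
     absurd refl = ¬prime[1] pq
   root-bound {q} pq (suc d) mf ρ hr hd with factor mf (ρ (suc d))
   ... | h , mh , eh = root-bound pq d mh ρ
     (λ i l → [ (λ z → ⊥-elim (hd i (suc d) (s≤s l) ℕ.≤-refl (mod-diff z))) , (λ z → z) ]
        (euclid pq _ _ (mod-trans (mod-refl (sym (eh (ρ i)))) (mod-op minus (hr i (ℕ.≤-trans l (ℕ.n≤1+n d))) (hr (suc d) ℕ.≤-refl)))))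
     (λ i j l l' → hd i j l (ℕ.≤-trans l' (ℕ.n≤1+n d)))

   monic-pow : ∀ d → Monic d (λ x → x ℤ.^ d)
   monic-pow zero = mon0 (λ _ → refl)
   monic-pow (suc d) = monS (+ 0) (monic-pow d) (λ x → sym (ℤ.+-identityʳ _))

   monic-pow-1 : ∀ d → Monic (suc d) (λ x → x ℤ.^ suc d ℤ.- + 1)
   monic-pow-1 d = monS (ℤ.- + 1) (monic-pow d) (λ x → refl)

   pos-^ : ∀ a k → + (a ^ k) ≡ (+ a) ℤ.^ k
   pos-^ a zero = refl
   pos-^ a (suc k) = trans (ℤ.pos-* a (a ^ k)) (cong (+ a ℤ.*_) (pos-^ a k))

   extract : ∀ p → Prime p → ∀ N → 1 ≤ N → ∃[ b ] ∃[ N' ] (N ≡ p ^ b * N' × ¬ p ∣ N' × 1 ≤ N')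
   extract p pp = <-rec _ go
     where
     1<p : 1 < p
     1<p = ℕ.nonTrivial⇒n>1 p {{prime⇒nonTrivial pp}}
     go : ∀ N → (∀ {M} → M < N → 1 ≤ M → ∃[ b ] ∃[ N' ] (M ≡ p ^ b * N' × ¬ p ∣ N' × 1 ≤ N')) → 1 ≤ N →
       ∃[ b ] ∃[ N' ] (N ≡ p ^ b * N' × ¬ p ∣ N' × 1 ≤ N')
     go N rec l with p ∣? N
     ... | no nd = 0 , N , sym (ℕ.+-identityʳ N) , nd , l
     ... | yes (divides zero e) = ⊥-elim (ℕ.<-irrefl (sym e) l)
     ... | yes (divides (suc M) e) with rec {suc M} (ℕ.<-≤-trans (ℕ.m<m*n (suc M) p 1<p) (ℕ.≤-reflexive (sym e))) (s≤s z≤n)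
     ...   | b , N' , e' , nd , l' = suc b , N' , trans e (trans (cong (_* p) e') (trans (ℕ.*-comm (p ^ b * N') p) (sym (ℕ.*-assoc p (p ^ b) N')))) , nd , l'

   cop-prime : ∀ {p n} → Prime p → ¬ p ∣ n → Coprime p n
   cop-prime {p} {n} pp nd {d} (d∣p , d∣n) with prime⇒irreducible pp d∣p
   ... | inj₁ e = e
   ... | inj₂ refl = ⊥-elim (nd d∣n)

   cop-* : ∀ {a b n} → Coprime a n → Coprime b n → Coprime (a * b) n
   cop-* {a} {b} {n} ca cb {d} (d∣ab , d∣n) = cb (coprime-divisor {d} {a} {b} (λ (e∣d , e∣a) → ca (e∣a , ∣-trans e∣d d∣n)) d∣ab , d∣n)

   cop-^ : ∀ {p n} → Coprime p n → ∀ k → Coprime (p ^ k) n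
   cop-^ c zero (d∣1 , _) = ∣1⇒≡1 d∣1
   cop-^ {p} c (suc k) = cop-* {p} {p ^ k} c (cop-^ c k)

   cop-div : ∀ {a b n} → Coprime a b → a ∣ n → b ∣ n → a * b ∣ n
   cop-div {a} {b} c (divides k e) b∣n = subst (a * b ∣_) (trans (ℕ.*-comm a k) (sym e))
     (*-monoʳ-∣ a (coprime-divisor (Cop.sym c) (subst (b ∣_) (trans e (ℕ.*-comm k a)) b∣n)))

   prime-factor : ∀ n → 2 ≤ n → ∃[ p ] (Prime p × p ∣ n)
   prime-factor n@(suc _) l with factorise n
   ... | record { factors = [] ; isFactorisation = e } = ⊥-elim (ℕ.<-irrefl (sym e) l)
   ... | record { factors = p ∷ ps ; isFactorisation = e ; factorsPrime = pp ∷ _ } = p , pp , subst (p ∣_) (sym e) (m∣m*n _)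

   -- The prime powers of `m` are peeled off one at a time. If all of them divide `N`, coprimality
   -- reassembles them to `m`.
   bad-prime-power : ∀ N m → 1 ≤ m → m ∣ N ⊎ (∃[ p ] ∃[ k ] (Prime p × p ^ k ∣ m × ¬ p ^ k ∣ N))
   bad-prime-power N = <-rec _ go
     where
     go : ∀ m → (∀ {M} → M < m → 1 ≤ M → M ∣ N ⊎ (∃[ p ] ∃[ k ] (Prime p × p ^ k ∣ M × ¬ p ^ k ∣ N))) → 1 ≤ m →
       m ∣ N ⊎ (∃[ p ] ∃[ k ] (Prime p × p ^ k ∣ m × ¬ p ^ k ∣ N))
     go (suc zero) rec l = inj₁ (1∣ N)
     go m@(suc (suc _)) rec l with prime-factor m (s≤s (s≤s z≤n))
     ... | p , pp , p∣m with extract p pp m l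
     ...   | zero , m' , e , nd , _ = ⊥-elim (nd (subst (p ∣_) (trans e (ℕ.+-identityʳ m')) p∣m))
     ...   | suc b , m' , e , nd , l' with p ^ suc b ∣? N
     ...     | no nd' = inj₂ (p , suc b , pp , subst (p ^ suc b ∣_) (sym e) (m∣m*n m') , nd')
     ...     | yes d with rec {m'} m'<m l'
       where
       1<p^ : 1 < p ^ suc b
       1<p^ = ℕ.<-≤-trans (ℕ.nonTrivial⇒n>1 p {{prime⇒nonTrivial pp}}) (ℕ.≤-trans (ℕ.≤-reflexive (sym (ℕ.*-identityʳ p))) (ℕ.*-monoʳ-≤ p (ℕ.m^n>0 p {{prime⇒nonZero pp}} b)))
       m'<m : m' < m
       m'<m = ℕ.<-≤-trans (ℕ.m<m*n m' (p ^ suc b) {{ℕ.>-nonZero l'}} 1<p^) (ℕ.≤-reflexive (trans (ℕ.*-comm m' (p ^ suc b)) (sym e)))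
     ...       | inj₁ d' = inj₁ (subst (_∣ N) (sym e) (cop-div (cop-^ (cop-prime pp nd) (suc b)) d d'))
     ...       | inj₂ (p' , k , pp' , d' , nd') = inj₂ (p' , k , pp' , ∣-trans d' (subst (m' ∣_) (sym e) (n∣m*n (p ^ suc b))) , nd')

 abstract
   least : ∀ (P : ℕ → Set) → (∀ n → Dec (P n)) → ∀ y → P y → ∃[ m ] (m ≤ y × P m × (∀ i → i < m → ¬ P i))
   least P P? y h = go y 0 (ℕ.+-identityʳ y) (λ _ ())
     where
     go : ∀ d m → d + m ≡ y → (∀ i → i < m → ¬ P i) → ∃[ m ] (m ≤ y × P m × (∀ i → i < m → ¬ P i))
     go zero m refl z = m , ℕ.≤-refl , h , z
     go (suc d) m e z with P? m
     ... | yes p = m , ℕ.≤-trans (ℕ.m≤n+m m (suc d)) (ℕ.≤-reflexive e) , p , z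
     ... | no np = go d (suc m) (trans (ℕ.+-suc d m) e) (λ { i (s≤s l) → [ (λ lt → z i lt) , (λ { refl → np }) ] (ℕ.m≤n⇒m<n∨m≡n l) })

 module Prim (q' : ℕ) (pq : Prime (suc q')) where
   q : ℕ
   q = suc q'

   infix 4 _≈_
   _≈_ : ℕ → ℕ → Set
   a ≈ b = Mod q (+ a) (+ b)

   Unit : ℕ → Set
   Unit x = ¬ x ≈ 0

   record Ord (x N : ℕ) : Set where
     field
       pos : 1 ≤ N
       power-one : x ^ N ≈ 1
       div : ∀ k → x ^ k ≈ 1 → N ∣ k
   open Ord

   abstract
     ≈-* : ∀ {a b c d} → a ≈ b → c ≈ d → a * c ≈ b * d
     ≈-* {a} {b} {c} {d} h h' = mod-trans (mod-refl (ℤ.pos-* a c)) (mod-trans (mod-op times h h') (mod-refl (sym (ℤ.pos-* b d))))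

     ≈-^ : ∀ {a b} → a ≈ b → ∀ k → a ^ k ≈ b ^ k
     ≈-^ h zero = mod-refl refl
     ≈-^ h (suc k) = ≈-* h (≈-^ h k)

     ≈-1^ : ∀ {a} → a ≈ 1 → ∀ k → a ^ k ≈ 1
     ≈-1^ h k = mod-trans (≈-^ h k) (mod-refl (cong +_ (ℕ.^-zeroˡ k)))

     ≈? : ∀ a b → Dec (a ≈ b)
     ≈? a b with a % q ℕ.≟ b % q
     ... | yes e = yes (%⇒mod e)
     ... | no ne = no (λ h → ne (mod⇒% h))

     1≉0 : ¬ 1 ≈ 0
     1≉0 h = ¬prime[1] (subst Prime (∣1⇒≡1 (mod0⇒∣ h)) pq)

     unit-* : ∀ {a b} → Unit a → Unit b → Unit (a * b)
     unit-* {a} {b} ua ub h with euclid pq (+ a) (+ b) (mod-trans (mod-refl (sym (ℤ.pos-* a b))) h)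
     ... | inj₁ z = ua z
     ... | inj₂ z = ub z

     unit-^ : ∀ {a} → Unit a → ∀ k → Unit (a ^ k)
     unit-^ ua zero = 1≉0
     unit-^ ua (suc k) = unit-* ua (unit-^ ua k)

     cancel : ∀ a b c → Unit a → a * b ≈ a * c → b ≈ c
     cancel a b c ua h = mod-cancel pq (+ a) (+ b) (+ c) ua (mod-trans (mod-refl (sym (ℤ.pos-* a b))) (mod-trans h (mod-refl (ℤ.pos-* a c))))

     pow-diff : ∀ {x} → Unit x → ∀ i j → i ≤ j → x ^ i ≈ x ^ j → x ^ (j ∸ i) ≈ 1
     pow-diff {x} ux i j l h = cancel (x ^ i) (x ^ (j ∸ i)) 1 (unit-^ ux i)
       (mod-trans (mod-refl (cong +_ (trans (sym (ℕ.^-distribˡ-+-* x i (j ∸ i))) (cong (x ^_) (ℕ.m+[n∸m]≡n l)))))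
         (mod-trans (mod-sym h) (mod-refl (cong +_ (sym (ℕ.*-identityʳ (x ^ i)))))))

     -- Among the powers with exponents 0, ..., q two share a residue; the difference of their
     -- exponents is the witness.
     pow-exists : ∀ {x} → Unit x → ∃[ k ] (1 ≤ k × k ≤ q × x ^ k ≈ 1)
     pow-exists {x} ux with Fin.pigeonhole (ℕ.n<1+n q) (λ i → Fin.fromℕ< (m%n<n (x ^ Fin.toℕ i) q))
     ... | i , j , i<j , e = Fin.toℕ j ∸ Fin.toℕ i , ℕ.m<n⇒0<n∸m i<j , ℕ.≤-trans (ℕ.m∸n≤m _ (Fin.toℕ i)) (ℕ.≤-pred (Fin.toℕ<n j)) ,
       pow-diff ux (Fin.toℕ i) (Fin.toℕ j) (ℕ.<⇒≤ i<j) (%⇒mod (trans (sym (Fin.toℕ-fromℕ< (m%n<n (x ^ Fin.toℕ i) q))) (trans (cong Fin.toℕ e) (Fin.toℕ-fromℕ< (m%n<n (x ^ Fin.toℕ j) q)))))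

     pow-rem : ∀ x m j → x ^ suc m ≈ 1 → x ^ (j % suc m) ≈ x ^ j
     pow-rem x m j h = mod-sym (mod-trans (mod-refl (cong (λ z → + (x ^ z)) (m≡m%n+[m/n]*n j (suc m))))
       (mod-trans (mod-refl (cong +_ (ℕ.^-distribˡ-+-* x r (k * suc m))))
         (mod-trans (≈-* {x ^ r} {x ^ r} {x ^ (k * suc m)} {1} (mod-refl refl) big) (mod-refl (cong +_ (ℕ.*-identityʳ (x ^ r)))))))
       where
       r k : ℕ
       r = j % suc m
       k = j / suc m
       big : x ^ (k * suc m) ≈ 1
       big = mod-trans (mod-refl (cong +_ (trans (cong (x ^_) (ℕ.*-comm k (suc m))) (sym (ℕ.^-*-assoc x (suc m) k))))) (≈-1^ {x ^ suc m} h k)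

     ord-least : ∀ x m → x ^ suc m ≈ 1 → (∀ i → i < m → ¬ x ^ suc i ≈ 1) → Ord x (suc m)
     ord-least x m one' minimal = record { pos = s≤s z≤n ; power-one = one' ; div = dv }
       where
       small : ∀ t → t < suc m → x ^ t ≈ 1 → t ≡ 0
       small zero _ _ = refl
       small (suc t) (s≤s l) h = ⊥-elim (minimal t l h)
       dv : ∀ j → x ^ j ≈ 1 → suc m ∣ j
       dv j h = m%n≡0⇒n∣m j (suc m) (small (j % suc m) (m%n<n j (suc m)) (mod-trans (pow-rem x m j one') h))

     ord-exists : ∀ {x} → Unit x → ∃[ N ] (Ord x N × N ≤ q)
     ord-exists {x} ux = go (pow-exists ux)
       where
       go : ∃[ k ] (1 ≤ k × k ≤ q × x ^ k ≈ 1) → ∃[ N ] (Ord x N × N ≤ q)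
       go (zero , () , _)
       go (suc k , l , k≤q , e) = fin (least (λ i → x ^ suc i ≈ 1) (λ i → ≈? (x ^ suc i) 1) k e)
         where
         fin : ∃[ m ] (m ≤ k × x ^ suc m ≈ 1 × (∀ i → i < m → ¬ x ^ suc i ≈ 1)) → ∃[ N ] (Ord x N × N ≤ q)
         fin (m , m≤k , one' , minimal) = suc m , ord-least x m one' minimal , ℕ.≤-trans (s≤s m≤k) k≤q

     ord-pow : ∀ {x} a b → 1 ≤ a → Ord x (a * b) → 1 ≤ b → Ord (x ^ a) b
     ord-pow {x} a@(suc _) b la o lb = record { pos = lb ; power-one = mod-trans (mod-refl (cong +_ (ℕ.^-*-assoc x a b))) (power-one o)
       ; div = λ k h → *-cancelˡ-∣ a (div o (a * k) (mod-trans (mod-refl (cong +_ (sym (ℕ.^-*-assoc x a k)))) h)) }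

     ^-swap : ∀ x a b → (x ^ a) ^ b ≡ (x ^ b) ^ a
     ^-swap x a b = trans (ℕ.^-*-assoc x a b) (trans (cong (x ^_) (ℕ.*-comm a b)) (sym (ℕ.^-*-assoc x b a)))

     *-^ : ∀ x y k → (x * y) ^ k ≡ x ^ k * y ^ k
     *-^ x y zero = refl
     *-^ x y (suc k) = trans (cong (x * y *_) (*-^ x y k)) (lem x y (x ^ k) (y ^ k))
       where
       lem : ∀ a b c d → (a * b) * (c * d) ≡ (a * c) * (b * d)
       lem = NS.solve-∀

     -- Raising (x y) ^ k to the power `a` removes `x`, so `b` divides `a * k` and hence, by
     -- coprimality, `k`.
     half : ∀ {x y a b} → Ord x a → Ord y b → Coprime a b → ∀ k → (x * y) ^ k ≈ 1 → b ∣ k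
     half {x} {y} {a} {b} ox oy c k h = coprime-divisor (Cop.sym c) (subst (b ∣_) refl (div oy (a * k)
       (mod-trans (mod-sym (mod-trans (≈-* {(x ^ a) ^ k} {1} {y ^ (a * k)} {y ^ (a * k)} (≈-1^ (power-one ox) k) (mod-refl refl)) (mod-refl (cong +_ (ℕ.+-identityʳ (y ^ (a * k)))))))
         (mod-trans (mod-refl (cong +_ eq)) (≈-1^ h a)))))
       where
       eq : (x ^ a) ^ k * y ^ (a * k) ≡ ((x * y) ^ k) ^ a
       eq = trans (cong₂ _*_ (^-swap x a k) (trans (cong (y ^_) (ℕ.*-comm a k)) (sym (ℕ.^-*-assoc y k a)))) (trans (sym (*-^ (x ^ k) (y ^ k) a)) (cong (_^ a) (sym (*-^ x y k))))

     ord-* : ∀ {x y a b} → Ord x a → Ord y b → Coprime a b → Ord (x * y) (a * b)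
     ord-* {x} {y} {a} {b} ox oy c = record
       { pos = ℕ.*-mono-≤ (pos ox) (pos oy)
       ; power-one = mod-trans (mod-refl (cong +_ (*-^ x y (a * b)))) (≈-* {x ^ (a * b)} {1} {y ^ (a * b)} {1}
           (mod-trans (mod-refl (cong +_ (sym (ℕ.^-*-assoc x a b)))) (≈-1^ (power-one ox) b))
           (mod-trans (mod-refl (cong +_ (trans (cong (y ^_) (ℕ.*-comm a b)) (sym (ℕ.^-*-assoc y b a))))) (≈-1^ (power-one oy) a)))
       ; div = λ k h → cop-div c (half oy ox (Cop.sym c) k (mod-trans (mod-refl (cong (λ z → + (z ^ k)) (ℕ.*-comm y x))) h)) (half ox oy c k h) }

     -- Some prime power p ^ k divides m = m' p ^ k but not N = p ^ b N'. Then x ^ m' has order p ^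
     -- k and g ^ (p ^ b) has the coprime order N', so their product has order p ^ k N', which
     -- exceeds N because b < k.
     grow : ∀ {g N x m} → Ord g N → Ord x m → ¬ m ∣ N → Unit g → Unit x → ∃[ g' ] ∃[ N' ] (Ord g' N' × N < N' × Unit g')
     grow {g} {N} {x} {m} og ox nd ug ux with bad-prime-power N m (pos ox)
     ... | inj₁ d = ⊥-elim (nd d)
     ... | inj₂ (p , k , pp , divides m' em , npk) with extract p pp N (pos og)
     ...   | b , N' , eN , ndp , lN' = x ^ m' * g ^ (p ^ b) , p ^ k * N' ,
         ord-* (ord-pow m' (p ^ k) lm' (subst (Ord x) em ox) (ℕ.m^n>0 p k)) (ord-pow (p ^ b) N' (ℕ.m^n>0 p b) (subst (Ord g) eN og) lN') (cop-^ (cop-prime pp ndp) k) ,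
         ℕ.<-≤-trans (ℕ.≤-<-trans (ℕ.≤-reflexive eN) (ℕ.*-monoˡ-< N' {{ℕ.>-nonZero lN'}} (ℕ.^-monoʳ-< p 1<p b<k))) ℕ.≤-refl , unit-* (unit-^ ux m') (unit-^ ug (p ^ b))
       where
       instance
         nzp : NonZero p
         nzp = prime⇒nonZero pp
       1<p : 1 < p
       1<p = ℕ.nonTrivial⇒n>1 p {{prime⇒nonTrivial pp}}
       lm' : 1 ≤ m'
       lm' = ℕ.n≢0⇒n>0 (λ e → ℕ.<-irrefl (sym (trans em (cong (_* p ^ k) e))) (pos ox))
       b<k : b < k
       b<k with b ℕ.<? k
       ... | yes l = l
       ... | no nl = ⊥-elim (npk (subst (p ^ k ∣_) (sym eN) (∣-trans (le⇒∣ (ℕ.≮⇒≥ nl)) (m∣m*n N'))))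
         where
         le⇒∣ : k ≤ b → p ^ k ∣ p ^ b
         le⇒∣ l = subst (p ^ k ∣_) (trans (sym (ℕ.^-distribˡ-+-* p k (b ∸ k))) (cong (p ^_) (ℕ.m+[n∸m]≡n l))) (m∣m*n (p ^ (b ∸ k)))

     ord≤ : ∀ {x N} → Unit x → Ord x N → N ≤ q
     ord≤ {x} {N} ux o = go (pow-exists ux)
       where
       go : ∃[ k ] (1 ≤ k × k ≤ q × x ^ k ≈ 1) → N ≤ q
       go (zero , () , _)
       go (suc k , _ , k≤q , e) = ℕ.≤-trans (∣⇒≤ (div o (suc k) e)) k≤q

     -- Orders never exceed `q`, so `grow` applies only finitely often, and `fuel` bounds how often.
     -- When it no longer applies, the order of every unit divides `N`.
     max-ord : ∀ fuel {g N} → Ord g N → Unit g → q < N + fuel → ∃[ g ] ∃[ N ] (Ord g N × Unit g × (∀ x → x < q → Unit x → x ^ N ≈ 1))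
     max-ord zero {g} {N} o ug l = ⊥-elim (ℕ.<⇒≱ l (ℕ.≤-trans (ℕ.≤-reflexive (ℕ.+-identityʳ N)) (ord≤ ug o)))
     max-ord (suc fuel) {g} {N} o ug l = go (ℕ.anyUpTo? dec× q)
       where
       Bad : ℕ → Set
       Bad x = Unit x × ¬ x ^ N ≈ 1
       dec× : ∀ x → Dec (Bad x)
       dec× x = both (≈? x 0) (≈? (x ^ N) 1)
         where
         both : Dec (x ≈ 0) → Dec (x ^ N ≈ 1) → Dec (Bad x)
         both (yes z) _ = no (λ p → proj₁ p z)
         both (no nz) (yes z) = no (λ p → proj₂ p z)
         both (no nz) (no z) = yes (nz , z)
       bigger : ∀ {x} → Bad x → ∃[ m ] (Ord x m × m ≤ q) → ∃[ g' ] ∃[ N' ] (Ord g' N' × N < N' × Unit g')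
       bigger {x} (ux , ne) (m , ox , _) = grow o ox nd ug ux
         where
         nd : ¬ m ∣ N
         nd (divides k e) = ne (mod-trans (mod-refl (cong +_ (trans (cong (x ^_) (trans e (ℕ.*-comm k m))) (sym (ℕ.^-*-assoc x m k))))) (≈-1^ (power-one ox) k))
       next : ∃[ g' ] ∃[ N' ] (Ord g' N' × N < N' × Unit g') → ∃[ g ] ∃[ N ] (Ord g N × Unit g × (∀ x → x < q → Unit x → x ^ N ≈ 1))
       next (g' , N' , o' , N<N' , ug') = max-ord fuel o' ug' (ℕ.<-≤-trans l (ℕ.≤-trans (ℕ.≤-reflexive (ℕ.+-suc N fuel)) (ℕ.+-monoˡ-≤ fuel N<N')))
       go : Dec (∃[ x ] (x < q × Bad x)) → ∃[ g ] ∃[ N ] (Ord g N × Unit g × (∀ x → x < q → Unit x → x ^ N ≈ 1))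
       go (yes (x , _ , bad)) = next (bigger bad (ord-exists (proj₁ bad)))
       go (no none) = g , N , o , ug , λ x x<q ux → stable x x<q ux (≈? (x ^ N) 1)
         where
         stable : ∀ x → x < q → Unit x → Dec (x ^ N ≈ 1) → x ^ N ≈ 1
         stable x x<q ux (yes z) = z
         stable x x<q ux (no nz) = ⊥-elim (none (x , x<q , ux , nz))

     unit< : ∀ {h} → 1 ≤ h → h < q → Unit h
     unit< {h@(suc _)} l l' z = ℕ.<⇒≱ l' (∣⇒≤ (mod0⇒∣ z))

     -- If `h` were no power of `g`, the N' + 1 powers of `g` together with `h` would be too many
     -- roots of X ^ (N' + 1) - 1 modulo `q`.
     module Cover (g N' : ℕ) (o : Ord g (suc N')) (ug : Unit g) (all : ∀ x → x < q → Unit x → x ^ suc N' ≈ 1) (h : ℕ) (l : 1 ≤ h) (l' : h < q) where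
       ρ : ℕ → ℕ
       ρ i = pick (i ℕ.<? suc N')
         where
         pick : Dec (i < suc N') → ℕ
         pick (yes _) = g ^ i
         pick (no _) = h
       ρ-lt : ∀ i → i < suc N' → ρ i ≡ g ^ i
       ρ-lt i lt with i ℕ.<? suc N'
       ... | yes _ = refl
       ... | no n = ⊥-elim (n lt)
       ρ-ge : ∀ i → ¬ i < suc N' → ρ i ≡ h
       ρ-ge i nl with i ℕ.<? suc N'
       ... | yes lt = ⊥-elim (nl lt)
       ... | no n = refl
       root : ∀ i → Dec (i < suc N') → ρ i ^ suc N' ≈ 1
       root i (yes lt) = mod-trans (mod-refl (cong (λ z → + (z ^ suc N')) (ρ-lt i lt))) (mod-trans (mod-refl (cong +_ (^-swap g i (suc N')))) (≈-1^ {g ^ suc N'} (power-one o) i))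
       root i (no nl) = mod-trans (mod-refl (cong (λ z → + (z ^ suc N')) (ρ-ge i nl))) (all h l' (unit< l l'))
       pow1 : ∀ a → a ^ suc N' ≈ 1 → Mod q ((+ a) ℤ.^ suc N' ℤ.- + 1) (+ 0)
       pow1 a z = mod-undiff (mod-trans (mod-refl (sym (pos-^ a (suc N')))) z)
       covered : (∀ e → e < suc N' → ¬ g ^ e ≈ h) → ⊥
       covered none = root-bound pq (suc N') (monic-pow-1 N') (λ i → + ρ i) (λ i _ → pow1 (ρ i) (root i (i ℕ.<? suc N')))
           (λ i j i<j j≤N m → distinct i j i<j j≤N m (j ℕ.<? suc N'))
         where
         distinct : ∀ i j → i < j → j ≤ suc N' → ρ i ≈ ρ j → Dec (j < suc N') → ⊥
         distinct i j i<j j≤N m (yes j<N) = ℕ.<⇒≱ (ℕ.≤-<-trans (ℕ.m∸n≤m j i) j<N) (∣⇒≤ {{ℕ.>-nonZero (ℕ.m<n⇒0<n∸m i<j)}} (div o (j ∸ i) (pow-diff ug i j (ℕ.<⇒≤ i<j)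
             (mod-trans (mod-refl (cong +_ (sym (ρ-lt i (ℕ.<-trans i<j j<N))))) (mod-trans m (mod-refl (cong +_ (ρ-lt j j<N))))))))
         distinct i j i<j j≤N m (no nj) = none i (ℕ.<-≤-trans i<j j≤N) (mod-trans (mod-refl (cong +_ (sym (ρ-lt i (ℕ.<-≤-trans i<j j≤N))))) (mod-trans m (mod-refl (cong +_ (ρ-ge j nj)))))
       found : ∃[ e ] (e < q × g ^ e ≈ h)
       found = go (ℕ.anyUpTo? (λ e → ≈? (g ^ e) h) (suc N'))
         where
         go : Dec (∃[ e ] (e < suc N' × g ^ e ≈ h)) → ∃[ e ] (e < q × g ^ e ≈ h)
         go (yes (e , e<N , m)) = e , ℕ.<-≤-trans e<N (ord≤ ug o) , m
         go (no none) = ⊥-elim (covered (λ e l m → none (e , l , m)))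

     primitive-root : ∃[ g ] (g < q × (∀ h → 1 ≤ h → h < q → ∃[ e ] (e < q × (g ^ e) % q ≡ h)))
     primitive-root = go (max-ord (suc q) {1} {1} (record { pos = s≤s z≤n ; power-one = mod-refl refl ; div = λ k _ → 1∣ k }) 1≉0 (ℕ.≤-trans (ℕ.n<1+n q) (ℕ.n≤1+n (suc q))))
       where
       go : ∃[ g ] ∃[ N ] (Ord g N × Unit g × (∀ x → x < q → Unit x → x ^ N ≈ 1)) → ∃[ g ] (g < q × (∀ h → 1 ≤ h → h < q → ∃[ e ] (e < q × (g ^ e) % q ≡ h)))
       go (g , zero , o , ug , all) = ⊥-elim (ℕ.<-irrefl refl (pos o))
       go (g , suc N' , o , ug , all) = g % q , m%n<n g q , cover
         where
         cover : ∀ h → 1 ≤ h → h < q → ∃[ e ] (e < q × ((g % q) ^ e) % q ≡ h)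
         cover h l l' = fin (Cover.found g N' o ug all h l l')
           where
           fin : ∃[ e ] (e < q × g ^ e ≈ h) → ∃[ e ] (e < q × ((g % q) ^ e) % q ≡ h)
           fin (e , l1 , m) = e , l1 , trans (mod⇒% (mod-trans (≈-^ (%-mod q' g) e) m)) (m<n⇒m%n≡m l')

-- A lower bound for the number of primes

module PrimeCount where
 open import Data.Nat
 open import Data.Nat.Properties
 open import Data.Nat.Tactic.RingSolver using (solve-∀)
 open import Data.Nat.Divisibility
 open import Data.Nat.Primality
 open Growth
 open Residue using (extract; prime-factor)

 -- The binomial coefficient of i + j over i. The symmetric indexing makes Pascal's rule a
 -- structural recursion.
 binom : ℕ → ℕ → ℕ
 binom zero j = 1
 binom (suc i) zero = 1
 binom (suc i) (suc j) = binom i (suc j) + binom (suc i) j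

 abstract
   -- Mutual induction: Pascal's rule reduces each of the two absorption identities to one instance
   -- of either.
   absorbˡ : ∀ i j → suc i * binom (suc i) j ≡ suc (i + j) * binom i j
   absorbʳ : ∀ i j → suc j * binom i (suc j) ≡ suc (i + j) * binom i j
   absorbˡ zero zero = refl
   absorbˡ zero (suc j) = cong suc (absorbˡ zero j)
   absorbˡ (suc i) zero rewrite +-identityʳ i = lem (suc (suc i)) (binom-0 i)
     where
     binom-0 : ∀ i → binom (suc i) 0 ≡ 1
     binom-0 i = refl
     lem : ∀ a → 1 ≡ 1 → a * 1 ≡ a * 1
     lem a _ = refl
   absorbˡ (suc i) (suc j) = begin
     suc (suc i) * (X + Y) ≡⟨ *-distribˡ-+ (suc (suc i)) X Y ⟩
     suc (suc i) * X + suc (suc i) * Y ≡⟨ cong (suc (suc i) * X +_) (trans (absorbˡ (suc i) j) (sym (absorbʳ (suc i) j))) ⟩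
     suc (suc i) * X + suc j * X ≡⟨ lem i j X ⟩
     suc (suc i + suc j) * X ∎
     where
     open ≡-Reasoning
     X Y : ℕ
     X = binom (suc i) (suc j)
     Y = binom (suc (suc i)) j
     lem : ∀ i j x → suc (suc i) * x + suc j * x ≡ suc (suc i + suc j) * x
     lem = solve-∀
   absorbʳ zero j = refl
   absorbʳ (suc i) zero = begin
     1 * (binom i 1 + 1) ≡⟨ trans (+-identityʳ _) (cong (_+ 1) (trans (sym (+-identityʳ (binom i 1))) (absorbʳ i 0))) ⟩
     suc (i + 0) * binom i 0 + 1 ≡⟨ cong (λ z → suc (i + 0) * z + 1) (b0 i) ⟩
     suc (i + 0) * 1 + 1 ≡⟨ lem i ⟩
     suc (suc i + 0) * 1 ∎
     where
     open ≡-Reasoning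
     b0 : ∀ i → binom i 0 ≡ 1
     b0 zero = refl
     b0 (suc i) = refl
     lem : ∀ i → suc (i + 0) * 1 + 1 ≡ suc (suc i + 0) * 1
     lem = solve-∀
   absorbʳ (suc i) (suc j) = begin
     suc (suc j) * (Y + X) ≡⟨ *-distribˡ-+ (suc (suc j)) Y X ⟩
     suc (suc j) * Y + suc (suc j) * X ≡⟨ cong (_+ suc (suc j) * X) (trans (absorbʳ i (suc j)) (sym (absorbˡ i (suc j)))) ⟩
     suc i * X + suc (suc j) * X ≡⟨ lem i j X ⟩
     suc (suc i + suc j) * X ∎
     where
     open ≡-Reasoning
     X Y : ℕ
     X = binom (suc i) (suc j)
     Y = binom i (suc (suc j))
     lem : ∀ i j x → suc i * x + suc (suc j) * x ≡ suc (suc i + suc j) * x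
     lem = solve-∀

 leib : ℕ → ℕ → ℕ
 leib i j = suc (i + j) * binom i j

 abstract
   binom-pos : ∀ i j → 1 ≤ binom i j
   binom-pos zero j = s≤s z≤n
   binom-pos (suc i) zero = s≤s z≤n
   binom-pos (suc i) (suc j) = ≤-trans (binom-pos i (suc j)) (m≤m+n _ _)

   -- Leibniz's harmonic triangle: 1 / leib (i+1) j = 1 / leib i j - 1 / leib i (j+1).
   leib-step : ∀ i j D → leib i j ∣ D → leib i (suc j) ∣ D → leib (suc i) j ∣ D
   leib-step i j D (divides a ea) (divides b eb) = divides (a ∸ b) (sym (*-cancelˡ-≡ _ _ (suc i) main))
     where
     open ≡-Reasoning
     s ℓ : ℕ
     s = suc (suc (i + j))
     ℓ = leib i j
     e1 : suc j * leib i (suc j) ≡ s * ℓ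
     e1 = begin
       suc j * (suc (i + suc j) * binom i (suc j)) ≡⟨ lem (suc j) (suc (i + suc j)) (binom i (suc j)) ⟩
       suc (i + suc j) * (suc j * binom i (suc j)) ≡⟨ cong₂ (λ x y → suc x * y) (+-suc i j) (absorbʳ i j) ⟩
       s * ℓ ∎
       where
       lem : ∀ a b c → a * (b * c) ≡ b * (a * c)
       lem = solve-∀
     e2 : suc i * leib (suc i) j ≡ s * ℓ
     e2 = begin
       suc i * (suc (suc i + j) * binom (suc i) j) ≡⟨ lem (suc i) (suc (suc i + j)) (binom (suc i) j) ⟩
       suc (suc i + j) * (suc i * binom (suc i) j) ≡⟨ cong (suc (suc i + j) *_) (absorbˡ i j) ⟩
       s * ℓ ∎
       where
       lem : ∀ a b c → a * (b * c) ≡ b * (a * c)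
       lem = solve-∀
     sb : s * ℓ * b ≡ suc j * D
     sb = trans (cong (_* b) (sym e1)) (trans (*-assoc (suc j) (leib i (suc j)) b) (cong (suc j *_) (trans (*-comm (leib i (suc j)) b) (sym eb))))
     sa : s * ℓ * a ≡ s * D
     sa = trans (*-assoc s ℓ a) (cong (s *_) (trans (*-comm ℓ a) (sym ea)))
     main : suc i * ((a ∸ b) * leib (suc i) j) ≡ suc i * D
     main = begin
       suc i * ((a ∸ b) * leib (suc i) j) ≡⟨ lem (suc i) (a ∸ b) (leib (suc i) j) ⟩
       suc i * leib (suc i) j * (a ∸ b) ≡⟨ cong (_* (a ∸ b)) e2 ⟩
       s * ℓ * (a ∸ b) ≡⟨ *-distribˡ-∸ (s * ℓ) a b ⟩
       s * ℓ * a ∸ s * ℓ * b ≡⟨ cong₂ _∸_ sa sb ⟩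
       s * D ∸ suc j * D ≡⟨ sym (*-distribʳ-∸ D s (suc j)) ⟩
       (s ∸ suc j) * D ≡⟨ cong (_* D) (trans (cong (_∸ suc j) (cong suc (sym (+-suc i j)))) (m+n∸n≡m (suc i) (suc j))) ⟩
       suc i * D ∎
       where
       lem : ∀ a b c → a * (b * c) ≡ a * c * b
       lem = solve-∀

   -- Every common multiple of 1, ..., M is a multiple of the entries of Leibniz's triangle, in
   -- particular of 2n + 1 times the central binomial coefficient. This bounds common multiples from
   -- below.
   leib-∣ : ∀ D M → (∀ k → 1 ≤ k → k ≤ M → k ∣ D) → ∀ i j → suc (i + j) ≤ M → leib i j ∣ D
   leib-∣ D M h zero j l = subst (_∣ D) (sym (*-identityʳ (suc j))) (h (suc j) (s≤s z≤n) l)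
   leib-∣ D M h (suc i) j l = leib-step i j D (leib-∣ D M h i j (≤-trans (n≤1+n _) l)) (leib-∣ D M h i (suc j) (≤-trans (≤-reflexive (cong suc (+-suc i j))) l))

   binom-monoʳ : ∀ i j → binom i j ≤ binom i (suc j)
   binom-monoʳ zero j = ≤-refl
   binom-monoʳ (suc i) zero = ≤-trans (binom-pos (suc i) 0) (m≤n+m 1 (binom i 1))
   binom-monoʳ (suc i) (suc j) = m≤n+m _ (binom i (suc (suc j)))

   binom-monoˡ : ∀ i j → binom i j ≤ binom (suc i) j
   binom-monoˡ zero zero = ≤-refl
   binom-monoˡ (suc i) zero = ≤-refl
   binom-monoˡ i (suc j) = m≤m+n (binom i (suc j)) _

   central : ∀ n → 2 ^ n ≤ binom n n
   central zero = ≤-refl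
   central (suc n) = +-mono-≤ (≤-trans (central n) (binom-monoʳ n n)) (≤-trans (≤-reflexive (+-identityʳ (2 ^ n))) (≤-trans (central n) (binom-monoˡ n n)))

 primeInd : ℕ → ℕ
 primeInd n with prime? n
 ... | yes _ = 1
 ... | no _ = 0

 -- A prime power that divides some k up to 2 ^ s has exponent at most `s`. The product of these
 -- factors is therefore a common multiple of 1, ..., 2 ^ s, and it is controlled by the number of
 -- primes.
 primePow : ℕ → ℕ → ℕ
 primePow s n with prime? n
 ... | yes _ = n ^ s
 ... | no _ = 1

 abstract
   primePow-∣ : ∀ s Y k → 1 ≤ k → k ≤ 2 ^ s → (∀ p → Prime p → p ∣ k → p ≤ Y) → k ∣ prodN Y (λ y → primePow s (suc y))
   primePow-∣ s zero (suc zero) l l' h = ∣-refl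
   primePow-∣ s zero k@(suc (suc _)) l l' h with prime-factor k (s≤s (s≤s z≤n))
   ... | p , pp , d = ⊥-elim (≢-nonZero⁻¹ p {{prime⇒nonZero pp}} (n≤0⇒n≡0 (h p pp d)))
   primePow-∣ s (suc Y) k l l' h with prime? (suc Y)
   ... | no np = subst (k ∣_) (sym (*-identityʳ _)) (primePow-∣ s Y k l l' (λ p pp d → ≤-pred (≤∧≢⇒< (h p pp d) (λ { refl → np pp }))))
   ... | yes pY with extract (suc Y) pY k l
   ...   | a , k' , e , nd , lk = subst (_∣ _) (trans (*-comm k' _) (sym e)) (*-pres-∣ rec pa)
     where
     p : ℕ
     p = suc Y
     1<p : 1 < p
     1<p = nonTrivial⇒n>1 p {{prime⇒nonTrivial pY}}
     k'∣k : k' ∣ k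
     k'∣k = subst (k' ∣_) (sym e) (n∣m*n (p ^ a))
     p^a≤ : p ^ a ≤ 2 ^ s
     p^a≤ = ≤-trans (∣⇒≤ {{>-nonZero l}} (subst (p ^ a ∣_) (sym e) (m∣m*n k'))) l'
     a≤s : a ≤ s
     a≤s with a ≤? s
     ... | yes z = z
     ... | no z = ⊥-elim (<⇒≱ (^-monoʳ-< 2 (s≤s (s≤s z≤n)) (≰⇒> z)) (≤-trans (^-monoˡ-≤ a 1<p) p^a≤))
     pa : p ^ a ∣ p ^ s
     pa = subst (p ^ a ∣_) (trans (sym (^-distribˡ-+-* p a (s ∸ a))) (cong (p ^_) (m+[n∸m]≡n a≤s))) (m∣m*n (p ^ (s ∸ a)))
     rec : k' ∣ prodN Y (λ y → primePow s (suc y))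
     rec = primePow-∣ s Y k' lk (≤-trans (∣⇒≤ {{>-nonZero l}} k'∣k) l') (λ r pr d → ≤-pred (≤∧≢⇒< (h r pr (∣-trans d k'∣k)) (λ { refl → nd d })))

   primePow-≤ : ∀ s Y → Y ≤ 2 ^ s → prodN Y (λ y → primePow s (suc y)) ≤ 2 ^ (s * s * sumN Y (λ y → primeInd (suc y)))
   primePow-≤ s zero l = ≤-reflexive (sym (cong (2 ^_) (*-zeroʳ (s * s))))
   primePow-≤ s (suc Y) l with prime? (suc Y)
   ... | no _ = ≤-trans (≤-reflexive (*-identityʳ _)) (≤-trans (primePow-≤ s Y (≤-trans (n≤1+n Y) l)) (≤-reflexive (cong (λ z → 2 ^ (s * s * z)) (sym (+-identityʳ _)))))
   ... | yes _ = ≤-trans (*-mono-≤ (primePow-≤ s Y (≤-trans (n≤1+n Y) l)) (≤-trans (^-monoˡ-≤ s l) (≤-reflexive (^-*-assoc 2 s s))))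
       (≤-reflexive (trans (sym (^-distribˡ-+-* 2 (s * s * c) (s * s))) (cong (2 ^_) (lem (s * s) c))))
     where
     c : ℕ
     c = sumN Y (λ y → primeInd (suc y))
     lem : ∀ a c → a * c + a ≡ a * (c + 1)
     lem = solve-∀

   prodN-pos : ∀ Y (f : ℕ → ℕ) → (∀ y → 1 ≤ f y) → 1 ≤ prodN Y f
   prodN-pos zero f h = s≤s z≤n
   prodN-pos (suc Y) f h = *-mono-≤ (prodN-pos Y f h) (h Y)

   primePow-pos : ∀ s y → 1 ≤ primePow s (suc y)
   primePow-pos s y with prime? (suc y)
   ... | yes _ = m^n>0 (suc y) s
   ... | no _ = s≤s z≤n

   -- Two bounds for the common multiple `D` of 1, ..., 2 ^ s: at least 2 ^ n with n = 2 ^ t, by the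
   -- central binomial coefficient, and at most 2 to the power s s times the number of primes. The
   -- choice s = t + 2 makes room for 2n + 1.
   prime-count-raw : ∀ t → 2 ^ t ≤ (2 + t) * (2 + t) * sumN (2 ^ (2 + t)) (λ y → primeInd (suc y))
   prime-count-raw t = 2^-cancel (≤-trans (≤-trans (central n) (≤-trans (m≤n*m (binom n n) (suc (n + n))) (∣⇒≤ {{>-nonZero (prodN-pos N _ (primePow-pos s))}} (leib-∣ D N all n n 2n<N)))) (primePow-≤ s N ≤-refl))
     where
     s n N D : ℕ
     s = 2 + t
     n = 2 ^ t
     N = 2 ^ s
     D = prodN N (λ y → primePow s (suc y))
     all : ∀ k → 1 ≤ k → k ≤ N → k ∣ D
     all k l l' = primePow-∣ s N k l l' (λ p pp d → ≤-trans (∣⇒≤ {{>-nonZero l}} d) l')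
     2n<N : suc (n + n) ≤ N
     2n<N = ≤-trans (+-monoˡ-≤ (n + n) (m^n>0 2 t)) (≤-trans (≤-trans (m≤m+n (n + (n + n)) n) (≤-reflexive (lem n))) ≤-refl)
       where
       lem : ∀ n → n + (n + n) + n ≡ 2 * (2 * n)
       lem = solve-∀
     2^-cancel : ∀ {a b} → 2 ^ a ≤ 2 ^ b → a ≤ b
     2^-cancel {a} {b} h with a ≤? b
     ... | yes z = z
     ... | no z = ⊥-elim (<⇒≱ (^-monoʳ-< 2 (s≤s (s≤s z≤n)) (≰⇒> z)) h)

   4a<2^a : ∀ b → 4 * (5 + b) < 2 ^ (5 + b)
   4a<2^a zero = s≤s (m≤m+n 20 11)
   4a<2^a (suc b) = ≤-trans (s≤s (≤-reflexive (lem b))) (≤-trans (+-mono-≤ (4a<2^a b) (≤-trans (m≤m+n 4 28) (^-monoʳ-≤ 2 (m≤m+n 5 b)))) (≤-reflexive (cong (2 ^ (5 + b) +_) (sym (+-identityʳ _)))))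
     where
     lem : ∀ b → 4 * (5 + suc b) ≡ 4 * (5 + b) + 4
     lem = solve-∀

   -- Put s = 4 (5 + b), so that s < 2 ^ (5 + b). With fewer primes, s s times their number would
   -- stay below 2 ^ (4 b + 18) = 2 ^ (s - 2), against `prime-count-raw`.
   prime-count : ∀ b → 2 ^ (2 * b + 8) < sumN (2 ^ (4 * (5 + b))) (λ y → primeInd (suc y))
   prime-count b with 2 ^ (2 * b + 8) <? sumN (2 ^ (4 * (5 + b))) (λ y → primeInd (suc y))
   ... | yes z = z
   ... | no z = ⊥-elim (<⇒≱ (begin-strict
       s * s * c ≤⟨ *-monoʳ-≤ (s * s) (≮⇒≥ z) ⟩
       s * s * 2 ^ (2 * b + 8) <⟨ *-monoˡ-< (2 ^ (2 * b + 8)) {{m^n≢0 2 (2 * b + 8)}} (*-mono-< (4a<2^a b) (4a<2^a b)) ⟩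
       2 ^ (5 + b) * 2 ^ (5 + b) * 2 ^ (2 * b + 8) ≡⟨ trans (cong (_* 2 ^ (2 * b + 8)) (sym (^-distribˡ-+-* 2 (5 + b) (5 + b)))) (sym (^-distribˡ-+-* 2 (5 + b + (5 + b)) (2 * b + 8))) ⟩
       2 ^ (5 + b + (5 + b) + (2 * b + 8)) ≡⟨ cong (2 ^_) (lem b) ⟩
       2 ^ (4 * b + 18) ∎) raw)
     where
     open ≤-Reasoning
     s c : ℕ
     s = 4 * (5 + b)
     c = sumN (2 ^ s) (λ y → primeInd (suc y))
     lem : ∀ b → 5 + b + (5 + b) + (2 * b + 8) ≡ 4 * b + 18
     lem = solve-∀
     seq : 2 + (4 * b + 18) ≡ s
     seq = l b
       where
       l : ∀ b → 2 + (4 * b + 18) ≡ 4 * (5 + b)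
       l = solve-∀
     raw : 2 ^ (4 * b + 18) ≤ s * s * c
     raw = subst (λ z → 2 ^ (4 * b + 18) ≤ z * z * sumN (2 ^ z) (λ y → primeInd (suc y))) seq (prime-count-raw (4 * b + 18))

-- From residues to signed binary digits

module DigitConversion where
 open import Data.Nat using (_≤_; _<_; _+_; _*_; _∸_; _^_)
 open import Data.Nat.DivMod
 open import Data.Nat.Divisibility
 open import Data.Nat.Primality
 open import Data.Integer using (ℤ; +_)
 open Growth
 open Verification using (Mod; mod; mod-refl; mod-sym; mod-trans; mod-op; mod-unique)
 open BoundedSearch using (eqN; eqN-refl; eqN-≢)
 open Residue

 -- Turns an indicator into a factor, so that a product over selected indices runs over the full
 -- range.
 sel : ℕ → ℕ → ℕ
 sel b v = b * v + (1 ∸ b)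

 abstract
   sel-1 : ∀ {b} v → b ≡ 1 → sel b v ≡ v
   sel-1 v refl = trans (ℕ.+-identityʳ _) (ℕ.+-identityʳ v)

   sel-0 : ∀ {b} v → b ≡ 0 → sel b v ≡ 1
   sel-0 v refl = refl

   prodN-pos' : ∀ Y (f : ℕ → ℕ) → (∀ y → y < Y → 1 ≤ f y) → 1 ≤ prodN Y f
   prodN-pos' zero f h = s≤s z≤n
   prodN-pos' (suc Y) f h = ℕ.*-mono-≤ (prodN-pos' Y f (λ y l → h y (ℕ.m<n⇒m<1+n l))) (h Y ℕ.≤-refl)

   prodN-mul : ∀ Y (f g : ℕ → ℕ) → prodN Y (λ y → f y * g y) ≡ prodN Y f * prodN Y g
   prodN-mul zero f g = refl
   prodN-mul (suc Y) f g rewrite prodN-mul Y f g = lem (prodN Y f) (prodN Y g) (f Y) (g Y)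
     where
     lem : ∀ a b c d → (a * b) * (c * d) ≡ (a * c) * (b * d)
     lem = NS.solve-∀

   prodN-one : ∀ Y (f : ℕ → ℕ) → (∀ y → y < Y → f y ≡ 1) → prodN Y f ≡ 1
   prodN-one zero f h = refl
   prodN-one (suc Y) f h rewrite prodN-one Y f (λ y l → h y (ℕ.m<n⇒m<1+n l)) = trans (ℕ.+-identityʳ _) (h Y ℕ.≤-refl)

   factor∣prodN : ∀ Y (f : ℕ → ℕ) y → y < Y → f y ∣ prodN Y f
   factor∣prodN (suc Y) f y (s≤s l) with ℕ.m≤n⇒m<n∨m≡n l
   ... | inj₁ lt = ∣-trans (factor∣prodN Y f y lt) (m∣m*n (f Y))
   ... | inj₂ refl = n∣m*n (prodN Y f)

   prodN-≤ : ∀ Y (f g : ℕ → ℕ) → (∀ y → y < Y → f y ≤ g y) → prodN Y f ≤ prodN Y g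
   prodN-≤ zero f g h = ℕ.≤-refl
   prodN-≤ (suc Y) f g h = ℕ.*-mono-≤ (prodN-≤ Y f g (λ y l → h y (ℕ.m<n⇒m<1+n l))) (h Y ℕ.≤-refl)

   prime∣prodN : ∀ {p} → Prime p → ∀ Y f → p ∣ prodN Y f → ∃[ y ] (y < Y × p ∣ f y)
   prime∣prodN pp zero f d = ⊥-elim (¬prime[1] (subst Prime (∣1⇒≡1 d) pp))
   prime∣prodN pp (suc Y) f d with euclidsLemma (prodN Y f) (f Y) pp d
   ... | inj₂ d' = Y , ℕ.≤-refl , d'
   ... | inj₁ d' with prime∣prodN pp Y f d'
   ...   | y , l , d'' = y , ℕ.m<n⇒m<1+n l , d''

   prime∣prime : ∀ {p r} → Prime p → Prime r → p ∣ r → p ≡ r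
   prime∣prime pp pr d with prime⇒irreducible pr d
   ... | inj₁ refl = ⊥-elim (¬prime[1] pp)
   ... | inj₂ e = e

   -- The Chinese remainder step: a new prime is coprime to the product of the smaller ones, so
   -- divisibility by each passes to the product.
   prodN-crt : ∀ (ι : ℕ → ℕ) → (∀ y → ι y ≡ 0 ⊎ (ι y ≡ 1 × Prime (suc y))) → ∀ W Y → (∀ y → y < Y → ι y ≡ 1 → suc y ∣ W) →
     prodN Y (λ y → sel (ι y) (suc y)) ∣ W
   prodN-crt ι hι W zero h = 1∣ W
   prodN-crt ι hι W (suc Y) h with hι Y
   ... | inj₁ e = subst (_∣ W) (trans (sym (ℕ.*-identityʳ _)) (cong (prodN Y (λ y → sel (ι y) (suc y)) *_) (sym (sel-0 (suc Y) e)))) (prodN-crt ι hι W Y (λ y l → h y (ℕ.m<n⇒m<1+n l)))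
   ... | inj₂ (e , pY) = subst (_∣ W) (trans (ℕ.*-comm (suc Y) _) (cong (prodN Y (λ y → sel (ι y) (suc y)) *_) (sym (sel-1 (suc Y) e))))
       (cop-div (cop-prime pY nd) (h Y ℕ.≤-refl e) (prodN-crt ι hι W Y (λ y l → h y (ℕ.m<n⇒m<1+n l))))
     where
     nd : ¬ suc Y ∣ prodN Y (λ y → sel (ι y) (suc y))
     nd d with prime∣prodN pY Y _ d
     ... | y , l , d' with hι y
     ...   | inj₁ e0 = ¬prime[1] (subst Prime (∣1⇒≡1 (subst (suc Y ∣_) (sel-0 (suc y) e0) d')) pY)
     ...   | inj₂ (e1 , py) = ℕ.<-irrefl (ℕ.suc-injective (sym (prime∣prime pY py (subst (suc Y ∣_) (sel-1 (suc y) e1) d')))) l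

   centered : ∀ {w H} → ℤ.∣ w ∣ < H → ∃[ t ] (w ℤ.+ + H ≡ + t × t < H + H)
   centered {+ n} {H} l = n + H , refl , ℕ.+-monoˡ-< H l
   centered {ℤ.-[1+ n ]} {H} l = H ∸ suc n , ℤ.⊖-≥ (ℕ.<⇒≤ l) , ℕ.≤-<-trans (ℕ.m∸n≤m H (suc n)) (ℕ.m<m+n H (ℕ.≤-<-trans z≤n l))

   quotient-unique : ∀ V' X G t → + X ≡ + suc V' ℤ.* G ℤ.+ + t → t < suc V' → + (X / suc V') ≡ G
   quotient-unique V' X G t e l = ℤ.*-cancelˡ-≡ (+ suc V') (+ (X / suc V')) G (trans (trans (lem (+ suc V' ℤ.* + (X / suc V')) (+ (X % suc V'))) (cong (λ z → z ℤ.- + (X % suc V')) eq1)) (trans (cong (λ z → + suc V' ℤ.* G ℤ.+ + t ℤ.- + z) (sym t≡)) (lem2 (+ suc V' ℤ.* G) (+ t))))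
     where
     lem : ∀ a b → a ≡ (b ℤ.+ a) ℤ.- b
     lem = ZS.solve-∀
     lem2 : ∀ a b → a ℤ.+ b ℤ.- b ≡ a
     lem2 = ZS.solve-∀
     eq0 : + X ≡ + (X % suc V') ℤ.+ + suc V' ℤ.* + (X / suc V')
     eq0 = trans (cong +_ (m≡m%n+[m/n]*n X (suc V'))) (cong (λ z → + (X % suc V') ℤ.+ z) (trans (ℤ.pos-* (X / suc V') (suc V')) (ℤ.*-comm (+ (X / suc V')) (+ suc V'))))
     eq1 : + (X % suc V') ℤ.+ + suc V' ℤ.* + (X / suc V') ≡ + suc V' ℤ.* G ℤ.+ + t
     eq1 = trans (sym eq0) e
     t≡ : t ≡ X % suc V'
     t≡ = mod-unique l (m%n<n X (suc V')) (mod-trans (mod-sym (mod G (trans e (trans (ℤ.+-comm (+ suc V' ℤ.* G) (+ t)) (cong (λ z → + t ℤ.+ z) (ℤ.*-comm (+ suc V') G)))))) (mod-sym (%-mod V' X)))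

   -- Rounding to the nearest integer: with half of the divisor added, the floor is insensitive to
   -- errors smaller than that half.
   rounded : ∀ {V' X G w H} → suc V' ≡ H + H → + X ≡ + suc V' ℤ.* G ℤ.+ (w ℤ.+ + H) → ℤ.∣ w ∣ < H → + (X / suc V') ≡ G
   rounded {V'} {X} {G} {w} {H} ev e l with centered {w} {H} l
   ... | t , et , t< = quotient-unique V' X G t (trans e (cong (λ z → + suc V' ℤ.* G ℤ.+ z) et)) (ℕ.<-≤-trans t< (ℕ.≤-reflexive (sym ev)))

   abs-cancel : ∀ {A w X B} → 1 ≤ A → + A ℤ.* w ≡ X → ℤ.∣ X ∣ ≤ A * B → ℤ.∣ w ∣ ≤ B
   abs-cancel {A@(suc _)} {w} {X} {B} l e h = ℕ.*-cancelˡ-≤ A (ℕ.≤-trans (ℕ.≤-reflexive (trans (sym (ℤ.∣i*j∣≡∣i∣*∣j∣ (+ A) w)) (cong ℤ.∣_∣ e))) h)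

 -- Conversion from residues to binary in the style of Hesse, Allender and Barrington.  A j is a product
 -- of primes and Nm j / A j approximates 2 ^ (- j) with exponentially small error, because every a i is huge.
 module HAB (S J : ℕ) (S≥1 : 1 ≤ S) (Z : ℤ) (mem lt : ℕ → ℕ → ℕ)
   (mem01 : ∀ i y → mem i y ≡ 0 ⊎ (mem i y ≡ 1 × Prime (suc y) × 3 ≤ suc y))
   (lt01 : ∀ j y → lt j y ≡ 0 ⊎ (lt j y ≡ 1 × Prime (suc y) × 3 ≤ suc y))
   (lt0 : ∀ y → lt 0 y ≡ 0)
   (ltS : ∀ j y → lt (suc j) y ≡ lt j y + mem j y)
   (c : ℕ → ℕ → ℕ) where

   a A : ℕ → ℕ
   a i = prodN S (λ y → sel (mem i y) (suc y))
   A j = prodN S (λ y → sel (lt j y) (suc y))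
   cof : ℕ → ℕ → ℕ
   cof j y = prodN S (λ y' → sel (lt j y' * (1 ∸ eqN (suc y') (suc y))) (suc y'))
   N' : ℕ → ℕ
   N' j = prodN j (λ i → a i + 1)
   -- `V` is the precision of fixed-point fractions. The at most `S` truncated quotients of `Θ` lose
   -- at most `S` units of 1 / V in total, a sixteenth.
   V Hf : ℕ
   V = 16 * S
   Hf = 8 * S
   quo : ℕ → ℕ → ℕ
   quo j y = (V * c j y) / suc y
   Θ : ℕ → ℕ
   Θ j = sumN S (λ y → lt j y * quo j y)

   module Digits (V' : ℕ) (V≡ : suc V' ≡ V)
     (Xb : ℕ) (Xb1 : 16 * S * ℤ.∣ Z ∣ ≤ Xb) (Xb2 : 8 * 2 ^ J * ℤ.∣ Z ∣ ≤ Xb) (a≥ : ∀ i → i < J → Xb ≤ a i)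
     (c< : ∀ j y → lt j y ≡ 1 → c j y < suc y)
     (cong-c : ∀ j y → y < S → lt j y ≡ 1 → Mod (suc y) (+ (c j y * (cof j y * 2 ^ j))) (Z ℤ.* + N' j)) where

     -- By the Chinese remainder theorem Z Nm = T + A U, where T / A is about Θ / V. So Z / 2 ^ j is
     -- about U + Θ / V, and y = U + R is an integer nearby. `U` is far too long to compute, but U j
     -- - 2 U (j + 1) is the rounding of (2 Θ (j + 1) - Θ j) / V, and this is all that the digit y j
     -- - 2 y (j + 1) needs. The summands `V * S` and `4 * S` keep the subtractions natural;
     -- together they shift the digit by 5 S.
     R Dg dig : ℕ → ℕ
     R j = (Θ j + Hf) / suc V'
     Dg j = ((2 * Θ (suc j) + Hf + V * S) ∸ Θ j) / suc V'
     dig j = Dg j + R j + (4 * S ∸ 2 * R (suc j))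

     abstract
       selpos : ∀ b y → b ≡ 0 ⊎ (b ≡ 1 × Prime (suc y) × 3 ≤ suc y) → 1 ≤ sel b (suc y)
       selpos b y (inj₁ e) = ℕ.≤-reflexive (sym (sel-0 (suc y) e))
       selpos b y (inj₂ (e , _)) = ℕ.≤-trans (s≤s z≤n) (ℕ.≤-reflexive (sym (sel-1 (suc y) e)))

       A≥1 : ∀ j → 1 ≤ A j
       A≥1 j = prodN-pos' S _ (λ y _ → selpos (lt j y) y (lt01 j y))

       a≥1 : ∀ i → 1 ≤ a i
       a≥1 i = prodN-pos' S _ (λ y _ → selpos (mem i y) y (mem01 i y))

       A0 : A 0 ≡ 1
       A0 = prodN-one S _ (λ y _ → sel-0 (suc y) (lt0 y))

       selS : ∀ j y → sel (lt (suc j) y) (suc y) ≡ sel (lt j y) (suc y) * sel (mem j y) (suc y)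
       selS j y with lt01 j y | mem01 j y | lt01 (suc j) y
       ... | inj₁ e | _ | _ rewrite ltS j y | e = sym (ℕ.+-identityʳ _)
       ... | inj₂ (e , _) | inj₁ e' | _ rewrite ltS j y | e | e' = sym (ℕ.*-identityʳ _)
       ... | inj₂ (e , _) | inj₂ (e' , _) | inj₁ e'' = ⊥-elim (absurd (trans (sym (ltS j y)) e''))
         where
         absurd : lt j y + mem j y ≡ 0 → ⊥
         absurd z rewrite e | e' with z
         ... | ()
       ... | inj₂ (e , _) | inj₂ (e' , _) | inj₂ (e'' , _) = ⊥-elim (absurd (trans (sym (ltS j y)) e''))
         where
         absurd : lt j y + mem j y ≡ 1 → ⊥
         absurd z rewrite e | e' with z
         ... | ()

       AS : ∀ j → A (suc j) ≡ A j * a j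
       AS j = trans (prodN-cong S (λ y _ → selS j y)) (prodN-mul S _ _)

       cof-spec : ∀ j y → y < S → lt j y ≡ 1 → suc y * cof j y ≡ A j
       cof-spec j y y<S e = trans (cong (_* cof j y) (sym pick)) (trans (sym (prodN-mul S _ _)) (prodN-cong S (λ y' _ → pt y')))
         where
         f : ℕ → ℕ
         f y' = sel (eqN (suc y') (suc y)) (suc y')
         pick' : ∀ Y → (Y ≤ y → prodN Y f ≡ 1) × (y < Y → prodN Y f ≡ suc y)
         pick' zero = (λ _ → refl) , λ ()
         pick' (suc Y) = (λ l → trans (cong₂ _*_ (proj₁ (pick' Y) (ℕ.<⇒≤ l)) (sel-0 (suc Y) (eqN-≢ (λ z → ℕ.<-irrefl (ℕ.suc-injective z) l)))) refl) ,
           (λ { (s≤s l) → [ (λ y<Y → trans (cong₂ _*_ (proj₂ (pick' Y) y<Y) (sel-0 (suc Y) (eqN-≢ (λ z → ℕ.<-irrefl (ℕ.suc-injective (sym z)) y<Y)))) (ℕ.*-identityʳ _)) ,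
                            (λ { refl → trans (cong₂ _*_ (proj₁ (pick' y) ℕ.≤-refl) (sel-1 (suc y) (eqN-refl {suc y} refl))) (ℕ.+-identityʳ _) }) ] (ℕ.m≤n⇒m<n∨m≡n l) })
         pick : prodN S f ≡ suc y
         pick = proj₂ (pick' S) y<S
         pt : ∀ y' → f y' * sel (lt j y' * (1 ∸ eqN (suc y') (suc y))) (suc y') ≡ sel (lt j y') (suc y')
         pt y' with y' ℕ.≟ y
         ... | yes refl = trans (cong₂ _*_ (sel-1 (suc y) (eqN-refl {suc y} refl)) (sel-0 (suc y) (trans (cong (λ z → lt j y * (1 ∸ z)) (eqN-refl {suc y} refl)) (ℕ.*-zeroʳ (lt j y)))))
                            (trans (ℕ.*-identityʳ (suc y)) (sym (sel-1 (suc y) e)))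
         ... | no ne = trans (cong₂ _*_ (sel-0 (suc y') (eqN-≢ ne')) (cong (λ z → sel (lt j y' * (1 ∸ z)) (suc y')) (eqN-≢ ne')))
                         (trans (ℕ.+-identityʳ _) (cong (λ z → sel z (suc y')) (ℕ.*-identityʳ (lt j y'))))
           where
           ne' : suc y' ≢ suc y
           ne' z = ne (ℕ.suc-injective z)

       cof-div : ∀ j y y' → y' < S → lt j y' ≡ 1 → y' ≢ y → suc y' ∣ cof j y
       cof-div j y y' l e ne = subst (_∣ cof j y) (sel-1 (suc y') (trans (cong (λ z → lt j y' * (1 ∸ z)) (eqN-≢ (λ z → ne (ℕ.suc-injective z)))) (trans (ℕ.*-identityʳ _) e)))
         (factor∣prodN S (λ z → sel (lt j z * (1 ∸ eqN (suc z) (suc y))) (suc z)) y' l)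

       half : ∀ n → ¬ 2 ∣ n → ∃[ h ] (2 * h ≡ n + 1)
       half n nd with n % 2 in eq | m%n<n n 2
       ... | 0 | _ = ⊥-elim (nd (m%n≡0⇒n∣m n 2 eq))
       ... | 1 | _ = suc (n / 2) , trans (lem (n / 2)) (cong (_+ 1) (sym (trans (m≡m%n+[m/n]*n n 2) (cong (λ z → z + (n / 2) * 2) eq))))
         where
         lem : ∀ k → 2 * suc k ≡ (1 + k * 2) + 1
         lem = NS.solve-∀
       ... | suc (suc _) | s≤s (s≤s ())

       prime2 : Prime 2
       prime2 = prime[2]

       a-odd : ∀ i → ¬ 2 ∣ a i
       a-odd i d with prime∣prodN prime2 S _ d
       ... | y , _ , d' with mem01 i y
       ...   | inj₁ e = ℕ.<⇒≱ (s≤s (s≤s z≤n)) (∣⇒≤ (subst (2 ∣_) (sel-0 (suc y) e) d'))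
       ...   | inj₂ (e , py , 3≤) = ℕ.<⇒≱ 3≤ (ℕ.≤-reflexive (sym (prime∣prime prime2 py (subst (2 ∣_) (sel-1 (suc y) e) d'))))

     h : ℕ → ℕ
     h i = proj₁ (half (a i) (a-odd i))
     Nm T : ℕ → ℕ
     Nm j = prodN j h
     T j = sumN S (λ y → lt j y * (c j y * cof j y))

     abstract
       h-spec : ∀ i → 2 * h i ≡ a i + 1
       h-spec i = proj₂ (half (a i) (a-odd i))

       N'≡ : ∀ j → N' j ≡ 2 ^ j * Nm j
       N'≡ zero = refl
       N'≡ (suc j) = trans (cong₂ _*_ (N'≡ j) (sym (h-spec j))) (lem (2 ^ j) (Nm j) (h j))
         where
         lem : ∀ p n h → p * n * (2 * h) ≡ 2 * p * (n * h)
         lem = NS.solve-∀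

       sumN-mod : ∀ q Y (f : ℕ → ℕ) y → y < Y → (∀ y' → y' < Y → y' ≢ y → q ∣ f y') → Mod q (+ sumN Y f) (+ f y)
       sumN-mod q (suc Y) f y (s≤s l) hd with ℕ.m≤n⇒m<n∨m≡n l
       ... | inj₁ y<Y = mod-trans (mod-op plus (sumN-mod q Y f y y<Y (λ y' l' → hd y' (ℕ.m<n⇒m<1+n l'))) (∣⇒mod0 {q} {+ f Y} (hd Y ℕ.≤-refl (λ z → ℕ.<-irrefl (sym z) y<Y)))) (mod-refl (ℤ.+-identityʳ (+ f y)))
       ... | inj₂ refl = mod-trans (mod-op plus (∣⇒mod0 {q} {+ sumN Y f} (sum∣ Y (λ y' l' → hd y' (ℕ.m<n⇒m<1+n l') (λ z → ℕ.<-irrefl z l')))) (mod-refl {b = + f Y} refl)) (mod-refl (ℤ.+-identityˡ (+ f Y)))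
         where
         sum∣ : ∀ Y → (∀ y' → y' < Y → q ∣ f y') → q ∣ sumN Y f
         sum∣ zero h = q ∣0
         sum∣ (suc Y) h = ∣m∣n⇒∣m+n (sum∣ Y (λ y' l' → h y' (ℕ.m<n⇒m<1+n l'))) (h Y ℕ.≤-refl)

       pow2-unit : ∀ q → Prime q → 3 ≤ q → ∀ j → ¬ Mod q (+ (2 ^ j)) (+ 0)
       pow2-unit q pq l zero m = ¬prime[1] (subst Prime (∣1⇒≡1 (mod0⇒∣ m)) pq)
       pow2-unit q pq l (suc j) m with euclid pq (+ 2) (+ (2 ^ j)) (mod-trans (mod-refl (sym (ℤ.pos-* 2 (2 ^ j)))) m)
       ... | inj₁ z = ℕ.<⇒≱ l (∣⇒≤ (mod0⇒∣ z))
       ... | inj₂ z = pow2-unit q pq l j z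

       -- Modulo the prime `suc y` only its own summand of `T` survives. The power 2 ^ j can be
       -- cancelled because all primes in use are odd.
       residue : ∀ j y → y < S → lt j y ≡ 1 → Prime (suc y) → 3 ≤ suc y → Mod (suc y) (Z ℤ.* + Nm j) (+ T j)
       residue j y y<S e py l3 = mod-trans (mod-sym (mod-cancel py (+ (2 ^ j)) (+ (c j y * cof j y)) (Z ℤ.* + Nm j) (pow2-unit (suc y) py l3 j)
           (mod-trans (mod-refl (trans (sym (ℤ.pos-* (2 ^ j) (c j y * cof j y))) (cong +_ (l1 (2 ^ j) (c j y) (cof j y))))) (mod-trans (cong-c j y y<S e)
             (mod-refl (trans (cong (Z ℤ.*_) (trans (cong +_ (N'≡ j)) (ℤ.pos-* (2 ^ j) (Nm j)))) (l2 Z (+ (2 ^ j)) (+ Nm j))))))))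
         (mod-sym (mod-trans (sumN-mod (suc y) S (λ y → lt j y * (c j y * cof j y)) y y<S div) (mod-refl (cong +_ (trans (cong (_* (c j y * cof j y)) e) (ℕ.+-identityʳ _))))))
         where
         l1 : ∀ p c k → p * (c * k) ≡ c * (k * p)
         l1 = NS.solve-∀
         l2 : ∀ z p n → z ℤ.* (p ℤ.* n) ≡ p ℤ.* (z ℤ.* n)
         l2 = ZS.solve-∀
         div : ∀ y' → y' < S → y' ≢ y → suc y ∣ lt j y' * (c j y' * cof j y')
         div y' l' ne = ∣-trans (cof-div j y' y y<S e (λ z → ne (sym z))) (∣-trans (n∣m*n (c j y')) (n∣m*n (lt j y')))

       U-exists : ∀ j → ∃[ u ] (+ A j ℤ.* u ≡ Z ℤ.* + Nm j ℤ.- + T j)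
       U-exists j with ∣⇒mod0 {A j} {Z ℤ.* + Nm j ℤ.- + T j} (prodN-crt (lt j) (λ y → weaken (lt01 j y)) _ S (λ y l e → go y l e (lt01 j y)))
         where
         weaken : ∀ {y} → lt j y ≡ 0 ⊎ (lt j y ≡ 1 × Prime (suc y) × 3 ≤ suc y) → lt j y ≡ 0 ⊎ (lt j y ≡ 1 × Prime (suc y))
         weaken (inj₁ e) = inj₁ e
         weaken (inj₂ (e , p , _)) = inj₂ (e , p)
         go : ∀ y → y < S → lt j y ≡ 1 → lt j y ≡ 0 ⊎ (lt j y ≡ 1 × Prime (suc y) × 3 ≤ suc y) → suc y ∣ ℤ.∣ Z ℤ.* + Nm j ℤ.- + T j ∣
         go y l e (inj₁ e') with trans (sym e) e'
         ... | ()
         go y l e (inj₂ (_ , py , l3)) = mod0⇒∣ (mod-undiff (residue j y l e py l3))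
       ... | mod k e = k , trans (ℤ.*-comm (+ A j) k) (trans (sym (ℤ.+-identityˡ _)) (sym e))

     U : ℕ → ℤ
     U j = proj₁ (U-exists j)
     E : ℕ → ℕ
     E j = sumN S (λ y → lt j y * (cof j y * ((V * c j y) % suc y)))

     abstract
       U-spec : ∀ j → + A j ℤ.* U j ≡ Z ℤ.* + Nm j ℤ.- + T j
       U-spec j = proj₂ (U-exists j)

       -- Division with remainder in each summand: `E` collects the remainders, so Θ / V falls short
       -- of T / A by E / (A V).
       VT : ∀ j → V * T j ≡ A j * Θ j + E j
       VT j = trans (sym (sumN-* S V (λ y → lt j y * (c j y * cof j y)))) (trans (sumN-cong S (λ y l → pt y l (lt01 j y))) (trans (sumN-+ S _ _) (cong (_+ E j) (sumN-* S (A j) (λ y → lt j y * quo j y)))))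
         where
         pt : ∀ y → y < S → lt j y ≡ 0 ⊎ (lt j y ≡ 1 × Prime (suc y) × 3 ≤ suc y) →
           V * (lt j y * (c j y * cof j y)) ≡ A j * (lt j y * quo j y) + lt j y * (cof j y * ((V * c j y) % suc y))
         pt y l (inj₁ e) rewrite e = trans (ℕ.*-zeroʳ V) (sym (trans (ℕ.+-identityʳ _) (ℕ.*-zeroʳ (A j))))
         pt y l (inj₂ (e , _)) = trans (cong (λ z → V * (z * (c j y * cof j y))) e) (trans (l1 V (c j y) (cof j y)) (trans (cong (cof j y *_) (m≡m%n+[m/n]*n (V * c j y) (suc y)))
             (trans (l2 (cof j y) ((V * c j y) % suc y) (quo j y) (suc y)) (cong₂ _+_ (trans (cong (_* quo j y) (cof-spec j y l e)) (cong (A j *_) (trans (sym (ℕ.+-identityʳ _)) (cong (_* quo j y) (sym e)))))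
                (trans (sym (ℕ.+-identityʳ _)) (cong (_* (cof j y * ((V * c j y) % suc y))) (sym e)))))))
           where
           l1 : ∀ v c k → v * (1 * (c * k)) ≡ k * (v * c)
           l1 = NS.solve-∀
           l2 : ∀ k r u s → k * (r + u * s) ≡ s * k * u + k * r
           l2 = NS.solve-∀

       E≤ : ∀ j → E j ≤ S * A j
       E≤ j = sumN-≤ S (λ y l → pt y l (lt01 j y))
         where
         pt : ∀ y → y < S → lt j y ≡ 0 ⊎ (lt j y ≡ 1 × Prime (suc y) × 3 ≤ suc y) → lt j y * (cof j y * ((V * c j y) % suc y)) ≤ A j
         pt y l (inj₁ e) rewrite e = z≤n
         pt y l (inj₂ (e , _)) = ℕ.≤-trans (ℕ.≤-reflexive (trans (cong (_* (cof j y * ((V * c j y) % suc y))) e) (ℕ.+-identityʳ _)))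
           (ℕ.≤-trans (ℕ.*-monoʳ-≤ (cof j y) (m%n≤n (V * c j y) (suc y))) (ℕ.≤-reflexive (trans (ℕ.*-comm (cof j y) (suc y)) (cof-spec j y l e))))

       quo≤ : ∀ j y → lt j y ≡ 1 → quo j y ≤ V
       quo≤ j y e = ℕ.≤-trans (/-monoˡ-≤ (suc y) (ℕ.*-monoʳ-≤ V (ℕ.<⇒≤ (c< j y e)))) (ℕ.≤-reflexive (m*n/n≡m V (suc y)))

       Θ≤ : ∀ j → Θ j ≤ V * S
       Θ≤ j = ℕ.≤-trans (sumN-≤ S (λ y l → pt y (lt01 j y))) (ℕ.≤-reflexive (ℕ.*-comm S V))
         where
         pt : ∀ y → lt j y ≡ 0 ⊎ (lt j y ≡ 1 × Prime (suc y) × 3 ≤ suc y) → lt j y * quo j y ≤ V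
         pt y (inj₁ e) rewrite e = z≤n
         pt y (inj₂ (e , _)) = ℕ.≤-trans (ℕ.≤-reflexive (trans (cong (_* quo j y) e) (ℕ.+-identityʳ _))) (quo≤ j y e)

       h≤a : ∀ i → h i ≤ a i
       h≤a i = ℕ.*-cancelˡ-≤ 2 (ℕ.≤-trans (ℕ.≤-reflexive (h-spec i)) (ℕ.≤-trans (ℕ.+-monoʳ-≤ (a i) (a≥1 i)) (ℕ.≤-reflexive (cong (_+_ (a i)) (sym (ℕ.+-identityʳ (a i)))))))

       A≡ : ∀ j → A j ≡ prodN j a
       A≡ zero = A0
       A≡ (suc j) = trans (AS j) (cong (_* a j) (A≡ j))

       Nm≤A : ∀ j → Nm j ≤ A j
       Nm≤A j = ℕ.≤-trans (prodN-≤ j h a (λ i _ → h≤a i)) (ℕ.≤-reflexive (sym (A≡ j)))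

       D-digit : ∀ j → j < J → + Dg j ≡ (U j ℤ.- + 2 ℤ.* U (suc j)) ℤ.+ + S
       D-digit j j<J = rounded {V'} {X} {G} {w} {Hf} (trans V≡ V2) eqX w<
         where
         X : ℕ
         X = (2 * Θ (suc j) + Hf + V * S) ∸ Θ j
         D G w : ℤ
         D = U j ℤ.- + 2 ℤ.* U (suc j)
         G = D ℤ.+ + S
         w = (+ 2 ℤ.* + Θ (suc j) ℤ.- + Θ j) ℤ.- + V ℤ.* D
         V2 : V ≡ Hf + Hf
         V2 = l S
           where
           l : ∀ S → 16 * S ≡ 8 * S + 8 * S
           l = NS.solve-∀
         X≡ : + X ≡ (+ 2 ℤ.* + Θ (suc j) ℤ.+ + Hf ℤ.+ + V ℤ.* + S) ℤ.- + Θ j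
         X≡ = trans (sym (ℤ.⊖-≥ (ℕ.≤-trans (Θ≤ j) (ℕ.m≤n+m (V * S) (2 * Θ (suc j) + Hf))))) (trans (sym (ℤ.m-n≡m⊖n _ (Θ j)))
                (cong (λ z → z ℤ.- + Θ j) (cong₂ (λ x y → x ℤ.+ + Hf ℤ.+ y) (ℤ.pos-* 2 (Θ (suc j))) (ℤ.pos-* V S))))
         eqX : + X ≡ + suc V' ℤ.* G ℤ.+ (w ℤ.+ + Hf)
         eqX = trans X≡ (trans (l (+ Θ (suc j)) (+ Θ j) (+ Hf) (+ V) (+ S) D) (cong (λ z → + z ℤ.* G ℤ.+ (w ℤ.+ + Hf)) (sym V≡)))
           where
           l : ∀ t1 t0 hf v s d → (+ 2 ℤ.* t1 ℤ.+ hf ℤ.+ v ℤ.* s) ℤ.- t0 ≡ v ℤ.* (d ℤ.+ s) ℤ.+ (((+ 2 ℤ.* t1 ℤ.- t0) ℤ.- v ℤ.* d) ℤ.+ hf)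
           l = ZS.solve-∀
         err : ℤ
         err = + V ℤ.* (Z ℤ.* + Nm j) ℤ.+ (+ a j ℤ.* + E j ℤ.- + 2 ℤ.* + E (suc j))
         -- Multiplication by `A (suc j)` clears the denominators. The terms with `T` cancel, and 2
         -- Nm (suc j) - a j Nm j = Nm j leaves V Z Nm j, which is at most `A (suc j)` in absolute
         -- value since `a j` is at least V |Z|.
         aw : + A (suc j) ℤ.* w ≡ err
         aw = begin
           + A (suc j) ℤ.* w ≡⟨ cong (ℤ._* w) A1 ⟩
           A' ℤ.* a' ℤ.* w ≡⟨ l1 A' a' (+ Θ (suc j)) (+ Θ j) (+ V) (U j) (U (suc j)) ⟩
           + 2 ℤ.* (A' ℤ.* a' ℤ.* + Θ (suc j)) ℤ.- a' ℤ.* (A' ℤ.* + Θ j) ℤ.- + V ℤ.* (a' ℤ.* (A' ℤ.* U j) ℤ.- + 2 ℤ.* (A' ℤ.* a' ℤ.* U (suc j)))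
             ≡⟨ cong₂ (λ x y → + 2 ℤ.* (A' ℤ.* a' ℤ.* + Θ (suc j)) ℤ.- a' ℤ.* (A' ℤ.* + Θ j) ℤ.- + V ℤ.* (a' ℤ.* x ℤ.- + 2 ℤ.* y)) (U-spec j) (trans (cong (ℤ._* U (suc j)) (sym A1)) (U-spec (suc j))) ⟩
           _ ≡⟨ cong₂ (λ x y → + 2 ℤ.* x ℤ.- a' ℤ.* y ℤ.- + V ℤ.* (a' ℤ.* (Z ℤ.* + Nm j ℤ.- + T j) ℤ.- + 2 ℤ.* (Z ℤ.* + Nm (suc j) ℤ.- + T (suc j)))) AΘ1 AΘ0 ⟩
           + 2 ℤ.* (+ V ℤ.* + T (suc j) ℤ.- + E (suc j)) ℤ.- a' ℤ.* (+ V ℤ.* + T j ℤ.- + E j) ℤ.- + V ℤ.* (a' ℤ.* (Z ℤ.* + Nm j ℤ.- + T j) ℤ.- + 2 ℤ.* (Z ℤ.* + Nm (suc j) ℤ.- + T (suc j)))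
             ≡⟨ l2 (+ V) (+ T (suc j)) (+ E (suc j)) a' (+ T j) (+ E j) Z (+ Nm j) (+ Nm (suc j)) ⟩
           + V ℤ.* Z ℤ.* (+ 2 ℤ.* + Nm (suc j) ℤ.- a' ℤ.* + Nm j) ℤ.+ (a' ℤ.* + E j ℤ.- + 2 ℤ.* + E (suc j))
             ≡⟨ cong (λ z → + V ℤ.* Z ℤ.* (z ℤ.- a' ℤ.* + Nm j) ℤ.+ (a' ℤ.* + E j ℤ.- + 2 ℤ.* + E (suc j))) N1 ⟩
           + V ℤ.* Z ℤ.* (+ Nm j ℤ.* (a' ℤ.+ + 1) ℤ.- a' ℤ.* + Nm j) ℤ.+ (a' ℤ.* + E j ℤ.- + 2 ℤ.* + E (suc j)) ≡⟨ l3 (+ V) Z (+ Nm j) a' (a' ℤ.* + E j ℤ.- + 2 ℤ.* + E (suc j)) ⟩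
           err ∎
           where
           open ≡-Reasoning
           A' a' : ℤ
           A' = + A j
           a' = + a j
           A1 : + A (suc j) ≡ A' ℤ.* a'
           A1 = trans (cong +_ (AS j)) (ℤ.pos-* (A j) (a j))
           vt : ∀ j → + V ℤ.* + T j ≡ + A j ℤ.* + Θ j ℤ.+ + E j
           vt j = trans (sym (ℤ.pos-* V (T j))) (trans (cong +_ (VT j)) (cong (λ z → z ℤ.+ + E j) (ℤ.pos-* (A j) (Θ j))))
           mv : ∀ x y e → x ≡ y ℤ.+ e → y ≡ x ℤ.- e
           mv x y e refl = l y e
             where
             l : ∀ y e → y ≡ (y ℤ.+ e) ℤ.- e
             l = ZS.solve-∀
           AΘ0 : A' ℤ.* + Θ j ≡ + V ℤ.* + T j ℤ.- + E j
           AΘ0 = mv _ _ (+ E j) (vt j)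
           AΘ1 : A' ℤ.* a' ℤ.* + Θ (suc j) ≡ + V ℤ.* + T (suc j) ℤ.- + E (suc j)
           AΘ1 = trans (cong (λ z → z ℤ.* + Θ (suc j)) (sym A1)) (mv _ _ (+ E (suc j)) (vt (suc j)))
           N1 : + 2 ℤ.* + Nm (suc j) ≡ + Nm j ℤ.* (a' ℤ.+ + 1)
           N1 = trans (sym (ℤ.pos-* 2 (Nm (suc j)))) (trans (cong +_ (trans (l (Nm j) (h j)) (cong (Nm j *_) (h-spec j)))) (ℤ.pos-* (Nm j) (a j + 1)))
             where
             l : ∀ n h → 2 * (n * h) ≡ n * (2 * h)
             l = NS.solve-∀
           l1 : ∀ A a t1 t0 v u0 u1 → A ℤ.* a ℤ.* ((+ 2 ℤ.* t1 ℤ.- t0) ℤ.- v ℤ.* (u0 ℤ.- + 2 ℤ.* u1)) ≡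
             + 2 ℤ.* (A ℤ.* a ℤ.* t1) ℤ.- a ℤ.* (A ℤ.* t0) ℤ.- v ℤ.* (a ℤ.* (A ℤ.* u0) ℤ.- + 2 ℤ.* (A ℤ.* a ℤ.* u1))
           l1 = ZS.solve-∀
           l2 : ∀ v t1 e1 a t0 e0 z n0 n1 → + 2 ℤ.* (v ℤ.* t1 ℤ.- e1) ℤ.- a ℤ.* (v ℤ.* t0 ℤ.- e0) ℤ.- v ℤ.* (a ℤ.* (z ℤ.* n0 ℤ.- t0) ℤ.- + 2 ℤ.* (z ℤ.* n1 ℤ.- t1))
             ≡ v ℤ.* z ℤ.* (+ 2 ℤ.* n1 ℤ.- a ℤ.* n0) ℤ.+ (a ℤ.* e0 ℤ.- + 2 ℤ.* e1)
           l2 = ZS.solve-∀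
           l3 : ∀ v z n a x → v ℤ.* z ℤ.* (n ℤ.* (a ℤ.+ + 1) ℤ.- a ℤ.* n) ℤ.+ x ≡ v ℤ.* (z ℤ.* n) ℤ.+ x
           l3 = ZS.solve-∀
         errB : ℤ.∣ err ∣ ≤ A (suc j) * (1 + 3 * S)
         errB = begin
           ℤ.∣ err ∣ ≤⟨ ℤ.∣i+j∣≤∣i∣+∣j∣ (+ V ℤ.* (Z ℤ.* + Nm j)) _ ⟩
           ℤ.∣ + V ℤ.* (Z ℤ.* + Nm j) ∣ + ℤ.∣ + a j ℤ.* + E j ℤ.- + 2 ℤ.* + E (suc j) ∣ ≤⟨ ℕ.+-mono-≤ p1 p2 ⟩
           A (suc j) + (A (suc j) * S + 2 * (A (suc j) * S)) ≡⟨ l (A (suc j)) S ⟩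
           A (suc j) * (1 + 3 * S) ∎
           where
           open ℕ.≤-Reasoning
           l : ∀ A S → A + (A * S + 2 * (A * S)) ≡ A * (1 + 3 * S)
           l = NS.solve-∀
           p1 : ℤ.∣ + V ℤ.* (Z ℤ.* + Nm j) ∣ ≤ A (suc j)
           p1 = begin
             ℤ.∣ + V ℤ.* (Z ℤ.* + Nm j) ∣ ≡⟨ trans (ℤ.∣i*j∣≡∣i∣*∣j∣ (+ V) (Z ℤ.* + Nm j)) (cong (V *_) (ℤ.∣i*j∣≡∣i∣*∣j∣ Z (+ Nm j))) ⟩
             V * (ℤ.∣ Z ∣ * Nm j) ≡⟨ sym (ℕ.*-assoc V ℤ.∣ Z ∣ (Nm j)) ⟩
             V * ℤ.∣ Z ∣ * Nm j ≤⟨ ℕ.*-mono-≤ (ℕ.≤-trans Xb1 (a≥ j j<J)) (Nm≤A j) ⟩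
             a j * A j ≡⟨ trans (ℕ.*-comm (a j) (A j)) (sym (AS j)) ⟩
             A (suc j) ∎
           p2 : ℤ.∣ + a j ℤ.* + E j ℤ.- + 2 ℤ.* + E (suc j) ∣ ≤ A (suc j) * S + 2 * (A (suc j) * S)
           p2 = begin
             ℤ.∣ + a j ℤ.* + E j ℤ.- + 2 ℤ.* + E (suc j) ∣ ≤⟨ ℤ.∣i-j∣≤∣i∣+∣j∣ (+ a j ℤ.* + E j) (+ 2 ℤ.* + E (suc j)) ⟩
             ℤ.∣ + a j ℤ.* + E j ∣ + ℤ.∣ + 2 ℤ.* + E (suc j) ∣ ≡⟨ cong₂ _+_ (ℤ.∣i*j∣≡∣i∣*∣j∣ (+ a j) (+ E j)) (ℤ.∣i*j∣≡∣i∣*∣j∣ (+ 2) (+ E (suc j))) ⟩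
             a j * E j + 2 * E (suc j) ≤⟨ ℕ.+-mono-≤ (ℕ.*-monoʳ-≤ (a j) (E≤ j)) (ℕ.*-monoʳ-≤ 2 (ℕ.≤-trans (E≤ (suc j)) (ℕ.≤-reflexive (ℕ.*-comm S (A (suc j)))))) ⟩
             a j * (S * A j) + 2 * (A (suc j) * S) ≡⟨ cong (λ z → z + 2 * (A (suc j) * S)) (trans (l' (a j) S (A j)) (cong (_* S) (sym (AS j)))) ⟩
             A (suc j) * S + 2 * (A (suc j) * S) ∎
             where
             l' : ∀ a s A → a * (s * A) ≡ A * a * s
             l' = NS.solve-∀
         w< : ℤ.∣ w ∣ < Hf
         w< = ℕ.≤-<-trans (abs-cancel (A≥1 (suc j)) aw errB) (ℕ.<-≤-trans (ℕ.+-monoˡ-< (3 * S) (ℕ.<-≤-trans (s≤s (s≤s z≤n)) (ℕ.*-monoʳ-≤ 5 S≥1))) (ℕ.≤-reflexive (l S)))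
           where
           l : ∀ S → 5 * S + 3 * S ≡ 8 * S
           l = NS.solve-∀

       -- The product of the factors 1 + 1 / a i exceeds 1 by at most 4 ^ j / Xb. The bound is
       -- crude, but `Xb2` makes it small enough even after multiplication by |Z|.
       δ-bound : ∀ j → j ≤ J → A j ≤ N' j × Xb * (N' j ∸ A j) ≤ 4 ^ j * A j
       δ-bound zero _ rewrite A0 = ℕ.≤-refl , ℕ.≤-trans (ℕ.≤-reflexive (ℕ.*-zeroʳ Xb)) z≤n
       δ-bound (suc j) j<J with δ-bound j (ℕ.<⇒≤ j<J)
       ... | AN , b rewrite AS j = ℕ.*-mono-≤ AN (ℕ.m≤m+n (a j) 1) , main
         where
         open ℕ.≤-Reasoning
         d : ℕ
         d = N' j ∸ A j
         N'e : N' j ≡ A j + d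
         N'e = sym (ℕ.m+[n∸m]≡n AN)
         step : N' j * (a j + 1) ∸ A j * a j ≡ A j + d * (a j + 1)
         step = trans (cong (λ z → z * (a j + 1) ∸ A j * a j) N'e) (trans (cong (λ z → z ∸ A j * a j) (l (A j) d (a j))) (ℕ.m+n∸m≡n (A j * a j) _))
           where
           l : ∀ A d a → (A + d) * (a + 1) ≡ A * a + (A + d * (a + 1))
           l = NS.solve-∀
         main : Xb * (N' j * (a j + 1) ∸ A j * a j) ≤ 4 ^ suc j * (A j * a j)
         main = begin
           Xb * (N' j * (a j + 1) ∸ A j * a j) ≡⟨ cong (Xb *_) step ⟩
           Xb * (A j + d * (a j + 1)) ≡⟨ l Xb (A j) d (a j + 1) ⟩
           A j * Xb + Xb * d * (a j + 1) ≤⟨ ℕ.+-mono-≤ (ℕ.*-monoʳ-≤ (A j) (a≥ j j<J)) (ℕ.*-mono-≤ b (ℕ.+-monoʳ-≤ (a j) (a≥1 j))) ⟩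
           A j * a j + 4 ^ j * A j * (a j + a j) ≤⟨ ℕ.+-monoˡ-≤ _ (ℕ.≤-trans (ℕ.≤-reflexive (sym (ℕ.+-identityʳ _))) (ℕ.*-monoˡ-≤ (A j * a j) (ℕ.m^n>0 4 j))) ⟩
           4 ^ j * (A j * a j) + 4 ^ j * A j * (a j + a j) ≤⟨ ℕ.m≤m+n _ (4 ^ j * (A j * a j)) ⟩
           4 ^ j * (A j * a j) + 4 ^ j * A j * (a j + a j) + 4 ^ j * (A j * a j) ≡⟨ l2 (4 ^ j) (A j) (a j) ⟩
           4 ^ suc j * (A j * a j) ∎
           where
           l : ∀ X A d b → X * (A + d * b) ≡ A * X + X * d * b
           l = NS.solve-∀
           l2 : ∀ f A a → f * (A * a) + f * A * (a + a) + f * (A * a) ≡ 4 * f * (A * a)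
           l2 = NS.solve-∀

       δZ : ∀ j → j ≤ J → 8 * ((N' j ∸ A j) * ℤ.∣ Z ∣) ≤ 2 ^ j * A j
       δZ j j≤J = ℕ.*-cancelˡ-≤ (2 ^ J) {{ℕ.m^n≢0 2 J}} (begin
         2 ^ J * (8 * (d * ℤ.∣ Z ∣)) ≡⟨ l (2 ^ J) d ℤ.∣ Z ∣ ⟩
         8 * 2 ^ J * ℤ.∣ Z ∣ * d ≤⟨ ℕ.*-monoˡ-≤ d Xb2 ⟩
         Xb * d ≤⟨ proj₂ (δ-bound j j≤J) ⟩
         4 ^ j * A j ≡⟨ cong (_* A j) (trans (ℕ.^-*-assoc 2 2 j) (trans (cong (λ z → 2 ^ (j + z)) (ℕ.+-identityʳ j)) (ℕ.^-distribˡ-+-* 2 j j))) ⟩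
         2 ^ j * 2 ^ j * A j ≤⟨ ℕ.*-monoˡ-≤ (A j) (ℕ.*-monoˡ-≤ (2 ^ j) (ℕ.^-monoʳ-≤ 2 j≤J)) ⟩
         2 ^ J * 2 ^ j * A j ≡⟨ ℕ.*-assoc (2 ^ J) (2 ^ j) (A j) ⟩
         2 ^ J * (2 ^ j * A j) ∎)
         where
         open ℕ.≤-Reasoning
         d : ℕ
         d = N' j ∸ A j
         l : ∀ p d z → p * (8 * (d * z)) ≡ 8 * p * z * d
         l = NS.solve-∀

       -- If `k` is within an eighth of Z / 2 ^ j, the errors add up to less than half of `V`: the
       -- excess of N' over A and the distance of `k` contribute 2 S each and the truncation `S`, in
       -- total 5 S < 8 S.
       R-exact : ∀ j → j ≤ J → ∀ k → 8 * ℤ.∣ + (2 ^ j) ℤ.* k ℤ.- Z ∣ ≤ 2 ^ j → + R j ≡ k ℤ.- U j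
       R-exact j j≤J k near = rounded {V'} {Θ j + Hf} {k ℤ.- U j} {w} {Hf} (trans V≡ (l16 S)) (trans (l0 (+ Θ j) (+ Hf) (+ V) (k ℤ.- U j)) (cong (λ z → + z ℤ.* (k ℤ.- U j) ℤ.+ (w ℤ.+ + Hf)) (sym V≡))) w<
         where
         l16 : ∀ S → 16 * S ≡ 8 * S + 8 * S
         l16 = NS.solve-∀
         w : ℤ
         w = + Θ j ℤ.- + V ℤ.* (k ℤ.- U j)
         l0 : ∀ t hf v g → t ℤ.+ hf ≡ v ℤ.* g ℤ.+ ((t ℤ.- v ℤ.* g) ℤ.+ hf)
         l0 = ZS.solve-∀
         d P : ℕ
         d = N' j ∸ A j
         P = 2 ^ j
         err : ℤ
         err = (+ V ℤ.* (+ d ℤ.* Z) ℤ.- + V ℤ.* (+ A j ℤ.* (+ P ℤ.* k ℤ.- Z))) ℤ.- + P ℤ.* + E j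
         pw : + (P * A j) ℤ.* w ≡ err
         pw = begin
           + (P * A j) ℤ.* w ≡⟨ cong (ℤ._* w) (ℤ.pos-* P (A j)) ⟩
           + P ℤ.* + A j ℤ.* w ≡⟨ l1 (+ P) (+ A j) (+ Θ j) (+ V) k (U j) ⟩
           + P ℤ.* (+ A j ℤ.* + Θ j) ℤ.- + V ℤ.* (+ P ℤ.* + A j ℤ.* k) ℤ.+ + V ℤ.* (+ P ℤ.* (+ A j ℤ.* U j))
             ≡⟨ cong₂ (λ x y → + P ℤ.* x ℤ.- + V ℤ.* (+ P ℤ.* + A j ℤ.* k) ℤ.+ + V ℤ.* (+ P ℤ.* y)) aθ (U-spec j) ⟩
           + P ℤ.* (+ V ℤ.* + T j ℤ.- + E j) ℤ.- + V ℤ.* (+ P ℤ.* + A j ℤ.* k) ℤ.+ + V ℤ.* (+ P ℤ.* (Z ℤ.* + Nm j ℤ.- + T j))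
             ≡⟨ l2 (+ P) (+ V) (+ T j) (+ E j) (+ A j) k Z (+ Nm j) ⟩
           + V ℤ.* (Z ℤ.* (+ P ℤ.* + Nm j)) ℤ.- + V ℤ.* (+ P ℤ.* + A j ℤ.* k) ℤ.- + P ℤ.* + E j
             ≡⟨ cong (λ z → + V ℤ.* (Z ℤ.* z) ℤ.- + V ℤ.* (+ P ℤ.* + A j ℤ.* k) ℤ.- + P ℤ.* + E j) pn ⟩
           + V ℤ.* (Z ℤ.* (+ A j ℤ.+ + d)) ℤ.- + V ℤ.* (+ P ℤ.* + A j ℤ.* k) ℤ.- + P ℤ.* + E j
             ≡⟨ l3 (+ V) Z (+ A j) (+ d) (+ P) k (+ E j) ⟩
           err ∎
           where
           open ≡-Reasoning
           aθ : + A j ℤ.* + Θ j ≡ + V ℤ.* + T j ℤ.- + E j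
           aθ = trans (l (+ A j ℤ.* + Θ j) (+ E j)) (cong (λ z → z ℤ.- + E j) (sym (trans (sym (ℤ.pos-* V (T j))) (trans (cong +_ (VT j)) (cong (λ z → z ℤ.+ + E j) (ℤ.pos-* (A j) (Θ j)))))))
             where
             l : ∀ y e → y ≡ (y ℤ.+ e) ℤ.- e
             l = ZS.solve-∀
           pn : + P ℤ.* + Nm j ≡ + A j ℤ.+ + d
           pn = trans (sym (ℤ.pos-* P (Nm j))) (cong +_ (trans (sym (N'≡ j)) (sym (ℕ.m+[n∸m]≡n (proj₁ (δ-bound j j≤J))))))
           l1 : ∀ p A t v k u → p ℤ.* A ℤ.* (t ℤ.- v ℤ.* (k ℤ.- u)) ≡ p ℤ.* (A ℤ.* t) ℤ.- v ℤ.* (p ℤ.* A ℤ.* k) ℤ.+ v ℤ.* (p ℤ.* (A ℤ.* u))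
           l1 = ZS.solve-∀
           l2 : ∀ p v t e A k z n → p ℤ.* (v ℤ.* t ℤ.- e) ℤ.- v ℤ.* (p ℤ.* A ℤ.* k) ℤ.+ v ℤ.* (p ℤ.* (z ℤ.* n ℤ.- t)) ≡ v ℤ.* (z ℤ.* (p ℤ.* n)) ℤ.- v ℤ.* (p ℤ.* A ℤ.* k) ℤ.- p ℤ.* e
           l2 = ZS.solve-∀
           l3 : ∀ v z A d p k e → v ℤ.* (z ℤ.* (A ℤ.+ d)) ℤ.- v ℤ.* (p ℤ.* A ℤ.* k) ℤ.- p ℤ.* e ≡ (v ℤ.* (d ℤ.* z) ℤ.- v ℤ.* (A ℤ.* (p ℤ.* k ℤ.- z))) ℤ.- p ℤ.* e
           l3 = ZS.solve-∀
         Δ : ℕ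
         Δ = ℤ.∣ + P ℤ.* k ℤ.- Z ∣
         errB : ℤ.∣ err ∣ ≤ P * A j * (5 * S)
         errB = begin
           ℤ.∣ err ∣ ≤⟨ ℕ.≤-trans (ℤ.∣i-j∣≤∣i∣+∣j∣ (+ V ℤ.* (+ d ℤ.* Z) ℤ.- + V ℤ.* (+ A j ℤ.* (+ P ℤ.* k ℤ.- Z))) (+ P ℤ.* + E j)) (ℕ.+-monoˡ-≤ ℤ.∣ + P ℤ.* + E j ∣ (ℤ.∣i-j∣≤∣i∣+∣j∣ (+ V ℤ.* (+ d ℤ.* Z)) (+ V ℤ.* (+ A j ℤ.* (+ P ℤ.* k ℤ.- Z))))) ⟩
           ℤ.∣ + V ℤ.* (+ d ℤ.* Z) ∣ + ℤ.∣ + V ℤ.* (+ A j ℤ.* (+ P ℤ.* k ℤ.- Z)) ∣ + ℤ.∣ + P ℤ.* + E j ∣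
             ≡⟨ cong₂ _+_ (cong₂ _+_ (trans (ℤ.∣i*j∣≡∣i∣*∣j∣ (+ V) (+ d ℤ.* Z)) (cong (V *_) (ℤ.∣i*j∣≡∣i∣*∣j∣ (+ d) Z))) (trans (ℤ.∣i*j∣≡∣i∣*∣j∣ (+ V) _) (cong (V *_) (ℤ.∣i*j∣≡∣i∣*∣j∣ (+ A j) (+ P ℤ.* k ℤ.- Z))))) (ℤ.∣i*j∣≡∣i∣*∣j∣ (+ P) (+ E j)) ⟩
           V * (d * ℤ.∣ Z ∣) + V * (A j * Δ) + P * E j ≡⟨ l S (d * ℤ.∣ Z ∣) (A j) Δ (P * E j) ⟩
           2 * S * (8 * (d * ℤ.∣ Z ∣)) + 2 * S * (A j * (8 * Δ)) + P * E j ≤⟨ ℕ.+-mono-≤ (ℕ.+-mono-≤ (ℕ.*-monoʳ-≤ (2 * S) (δZ j j≤J)) (ℕ.*-monoʳ-≤ (2 * S) (ℕ.*-monoʳ-≤ (A j) near))) (ℕ.*-monoʳ-≤ P (E≤ j)) ⟩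
           2 * S * (P * A j) + 2 * S * (A j * P) + P * (S * A j) ≡⟨ l2 S P (A j) ⟩
           P * A j * (5 * S) ∎
           where
           open ℕ.≤-Reasoning
           l : ∀ S x A y e → 16 * S * x + 16 * S * (A * y) + e ≡ 2 * S * (8 * x) + 2 * S * (A * (8 * y)) + e
           l = NS.solve-∀
           l2 : ∀ S P A → 2 * S * (P * A) + 2 * S * (A * P) + P * (S * A) ≡ P * A * (5 * S)
           l2 = NS.solve-∀
         w< : ℤ.∣ w ∣ < Hf
         w< = ℕ.≤-<-trans (abs-cancel (ℕ.*-mono-≤ (ℕ.m^n>0 2 j) (A≥1 j)) pw errB) (ℕ.*-monoˡ-< S {{ℕ.>-nonZero S≥1}} {5} {8} (s≤s (s≤s (s≤s (s≤s (s≤s (s≤s z≤n)))))))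

       R≤ : ∀ j → 2 * R j ≤ 4 * S
       R≤ j = ℕ.≤-trans (ℕ.*-monoʳ-≤ 2 (ℕ.≤-trans (/-monoˡ-≤ (suc V') le) (ℕ.≤-reflexive (m*n/n≡m (2 * S) (suc V'))))) (ℕ.≤-reflexive (sym (ℕ.*-assoc 2 2 S)))
         where
         le : Θ j + Hf ≤ 2 * S * suc V'
         le = ℕ.≤-trans (ℕ.+-mono-≤ (Θ≤ j) (ℕ.≤-trans (ℕ.≤-trans (ℕ.*-monoˡ-≤ S (ℕ.m≤m+n 8 8)) (ℕ.≤-reflexive (sym (ℕ.*-identityʳ V)))) (ℕ.*-monoʳ-≤ V S≥1)))
                (ℕ.≤-reflexive (trans (l S V) (cong (2 * S *_) (sym V≡))))
           where
           l : ∀ S V → V * S + V * S ≡ 2 * S * V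
           l = NS.solve-∀

     y : ℕ → ℤ
     y j = U j ℤ.+ + R j

     abstract
       dig-spec : ∀ j → j < J → + dig j ℤ.- + (5 * S) ≡ y j ℤ.- + 2 ℤ.* y (suc j)
       dig-spec j l = trans (cong₂ (λ u v → u ℤ.+ + R j ℤ.+ v ℤ.- + (5 * S)) (D-digit j l) e4) (trans (cong (λ z → U j ℤ.- + 2 ℤ.* U (suc j) ℤ.+ + S ℤ.+ + R j ℤ.+ (+ 4 ℤ.* + S ℤ.- + 2 ℤ.* + R (suc j)) ℤ.- z) (ℤ.pos-* 5 S)) (lem (U j) (U (suc j)) (+ S) (+ R j) (+ R (suc j))))
         where
         e4 : + (4 * S ∸ 2 * R (suc j)) ≡ + 4 ℤ.* + S ℤ.- + 2 ℤ.* + R (suc j)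
         e4 = trans (sym (ℤ.⊖-≥ (R≤ (suc j)))) (trans (sym (ℤ.m-n≡m⊖n (4 * S) (2 * R (suc j)))) (cong₂ ℤ._-_ (ℤ.pos-* 4 S) (ℤ.pos-* 2 (R (suc j)))))
         lem : ∀ u0 u1 s r0 r1 → u0 ℤ.- + 2 ℤ.* u1 ℤ.+ s ℤ.+ r0 ℤ.+ (+ 4 ℤ.* s ℤ.- + 2 ℤ.* r1) ℤ.- + 5 ℤ.* s ≡ (u0 ℤ.+ r0) ℤ.- + 2 ℤ.* (u1 ℤ.+ r1)
         lem = ZS.solve-∀

       y-exact : ∀ j → j ≤ J → ∀ k → 8 * ℤ.∣ + (2 ^ j) ℤ.* k ℤ.- Z ∣ ≤ 2 ^ j → y j ≡ k
       y-exact j l k near = trans (cong (λ z → U j ℤ.+ z) (R-exact j l k near)) (lem (U j) k)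
         where
         lem : ∀ u k → u ℤ.+ (k ℤ.- u) ≡ k
         lem = ZS.solve-∀

-- Primes, logarithms and products modulo primes by counting

module ModularPrimes where
 open import Data.Nat using (_≤_; _<_; _+_; _*_; _^_)
 open import Data.Nat.DivMod
 open import Data.Nat.Divisibility
 open import Data.Nat.Primality
 open import Data.Integer using (+_)
 open Growth
 open Verification using (Mod; mod-refl; mod-trans)
 open Counting
 open BoundedSearch
 open Residue
 open DigitConversion using (factor∣prodN)

 abstract
   sumN≢0 : ∀ n f → sumN n f ≢ 0 → ∃[ i ] (i < n × f i ≢ 0)
   sumN≢0 zero f h = ⊥-elim (h refl)
   sumN≢0 (suc n) f h with f n ℕ.≟ 0
   ... | no ne = n , ℕ.≤-refl , ne
   ... | yes e with sumN≢0 n f (λ z → h (cong₂ _+_ z e))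
   ...   | i , l , ne = i , ℕ.m<n⇒m<1+n l , ne

   leN0≡0 : ∀ {a} → leN a 0 ≡ 0 → a ≢ 0
   leN0≡0 {a} e refl with trans (sym (leN-yes (z≤n {0}))) e
   ... | ()

   1≢0 : ∀ {a} → a ≡ 1 → a ≢ 0
   1≢0 refl ()

   mulʳ0 : ∀ {a b} → a ≡ 0 → b * a ≡ 0
   mulʳ0 {a} {b} e = trans (cong (b *_) e) (ℕ.*-zeroʳ b)

   mul11 : ∀ {a b} → a ≡ 1 → b ≡ 1 → a * b ≡ 1
   mul11 refl refl = refl

 -- Recognises the odd primes up to `S`. The prime 2 is left out because the conversion cancels
 -- powers of 2 modulo its primes.
 isPr : ℕ → ℕ → ℕ
 isPr S q = leN q S * (leN 3 q * leN (sumN S (λ d → leN 2 d * (leN (suc d) q * sumN S (λ k → eqN (d * k) q)))) 0)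

 -- The rank of `suc y` among the odd primes, that is, how many of them are smaller. Blocks are
 -- intervals of ranks.
 rk : ℕ → ℕ → ℕ
 rk S y = sumN S (λ y' → leN (suc y') y * isPr S (suc y'))

 -- `mem` selects the block `i` of `Lb` consecutive odd primes, `lt` the union of the blocks before
 -- `j`.
 mem lt : ℕ → ℕ → ℕ → ℕ → ℕ
 mem S Lb i y = isPr S (suc y) * (leN (i * Lb) (rk S y) * leN (suc (rk S y)) (suc i * Lb))
 lt S Lb j y = isPr S (suc y) * leN (suc (rk S y)) (j * Lb)

 primRoot : ℕ → ℕ → ℕ → ℕ
 primRoot S q' g = leN (sumN S (λ h → leN 1 h * (leN (suc h) (suc q') * leN (sumN S (λ e → eqN ((g ^ e) % suc q') h)) 0))) 0

 gen : ℕ → ℕ → ℕ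
 gen S q' = μ S (λ g → primRoot S q' g)

 lg : ℕ → ℕ → ℕ → ℕ
 lg S q' h = μ S (λ e → eqN ((gen S q' ^ e) % suc q') h)

 -- Iterated multiplication modulo a prime through the sum of the discrete logarithms to the least
 -- primitive root. A factor divisible by the modulus has no logarithm, hence the leading indicator.
 prodm : ℕ → ℕ → (ℕ → ℕ) → ℕ
 prodm S q' f = leN (sumN S (λ y → leN (f y % suc q') 0)) 0 * ((gen S q' ^ sumN S (λ y → lg S q' (f y % suc q'))) % suc q')

 abstract
   isPr-yes : ∀ S q → q ≤ S → 3 ≤ q → Prime q → isPr S q ≡ 1
   isPr-yes S q l l3 pq = mul11 (leN-yes l) (mul11 (leN-yes l3) (leN-yes (ℕ.≤-reflexive (sumN≡0 S _ (λ d _ → pt d (2 ℕ.≤? d) (suc d ℕ.≤? q))))))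
     where
     pt : ∀ d → Dec (2 ≤ d) → Dec (suc d ≤ q) → leN 2 d * (leN (suc d) q * sumN S (λ k → eqN (d * k) q)) ≡ 0
     pt d (no n) _ = cong (_* (leN (suc d) q * sumN S (λ k → eqN (d * k) q))) (leN-no (ℕ.≰⇒> n))
     pt d (yes _) (no n) = mulʳ0 {b = leN 2 d} (cong (_* sumN S (λ k → eqN (d * k) q)) (leN-no (ℕ.≰⇒> n)))
     pt d (yes 2≤d) (yes d<q) = mulʳ0 {b = leN 2 d} (mulʳ0 {b = leN (suc d) q} (sumN≡0 S _ (λ k _ → eqN-≢ (λ e → bad (prime⇒irreducible pq (divides k (trans (sym e) (ℕ.*-comm d k))))))))
       where
       bad : d ≡ 1 ⊎ d ≡ q → ⊥
       bad (inj₁ e) = ℕ.<-irrefl (sym e) 2≤d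
       bad (inj₂ e) = ℕ.<-irrefl e d<q

   isPr01 : ∀ S q → isPr S q ≡ 0 ⊎ (isPr S q ≡ 1 × Prime q × 3 ≤ q)
   isPr01 S q = go (q ℕ.≤? S) (3 ℕ.≤? q) (prime? q)
     where
     go : Dec (q ≤ S) → Dec (3 ≤ q) → Dec (Prime q) → isPr S q ≡ 0 ⊎ (isPr S q ≡ 1 × Prime q × 3 ≤ q)
     go (no n) _ _ = inj₁ (cong (_* (leN 3 q * leN (sumN S (λ d → leN 2 d * (leN (suc d) q * sumN S (λ k → eqN (d * k) q)))) 0)) (leN-no (ℕ.≰⇒> n)))
     go (yes _) (no n) _ = inj₁ (mulʳ0 {b = leN q S} (cong (_* leN (sumN S (λ d → leN 2 d * (leN (suc d) q * sumN S (λ k → eqN (d * k) q)))) 0) (leN-no (ℕ.≰⇒> n))))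
     go (yes l) (yes l3) (yes pq) = inj₂ (isPr-yes S q l l3 pq , pq , l3)
     go (yes l) (yes l3) (no np) = inj₁ (mulʳ0 {b = leN q S} (mulʳ0 {b = leN 3 q} (leN-no (comp (¬prime⇒composite {q} {{ℕ.n>1⇒nonTrivial (ℕ.≤-trans (s≤s (s≤s z≤n)) l3)}} np)))))
       where
       comp : Composite q → 0 < sumN S (λ d → leN 2 d * (leN (suc d) q * sumN S (λ k → eqN (d * k) q)))
       comp (hasNonTrivialDivisor {divisor = d} {{nt}} d<q (divides k e)) = res
         where
         d<S : d < S
         d<S = ℕ.<-≤-trans d<q l
         2≤d : 2 ≤ d
         2≤d = ℕ.nonTrivial⇒n>1 d {{nt}}
         res : 0 < sumN S (λ d → leN 2 d * (leN (suc d) q * sumN S (λ k → eqN (d * k) q)))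
         res = ℕ.<-≤-trans (ℕ.*-mono-≤ (ℕ.≤-reflexive (sym (leN-yes 2≤d))) (ℕ.*-mono-≤ (ℕ.≤-reflexive (sym (leN-yes d<q))) inner)) (term≤sumN S (λ d → leN 2 d * (leN (suc d) q * sumN S (λ k → eqN (d * k) q))) d d<S)
           where
           k<S : k < S
           k<S = ℕ.<-≤-trans (ℕ.<-≤-trans (ℕ.m<m*n k d {{ℕ.≢-nonZero (λ k0 → ℕ.<-irrefl (sym (trans e (cong (_* d) k0))) (ℕ.≤-trans (s≤s z≤n) l3))}} 2≤d) (ℕ.≤-reflexive (sym e))) l
           inner : 1 ≤ sumN S (λ k → eqN (d * k) q)
           inner = ℕ.≤-trans (ℕ.≤-reflexive (sym (eqN-refl (trans (ℕ.*-comm d k) (sym e))))) (term≤sumN S (λ k → eqN (d * k) q) k k<S)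

   mem01 : ∀ S Lb i y → mem S Lb i y ≡ 0 ⊎ (mem S Lb i y ≡ 1 × Prime (suc y) × 3 ≤ suc y)
   mem01 S Lb i y = go (isPr01 S (suc y)) (leN-elim (i * Lb) (rk S y)) (leN-elim (suc (rk S y)) (suc i * Lb))
     where
     go : isPr S (suc y) ≡ 0 ⊎ (isPr S (suc y) ≡ 1 × Prime (suc y) × 3 ≤ suc y) →
       ((i * Lb ≤ rk S y × leN (i * Lb) (rk S y) ≡ 1) ⊎ (rk S y < i * Lb × leN (i * Lb) (rk S y) ≡ 0)) →
       ((suc (rk S y) ≤ suc i * Lb × leN (suc (rk S y)) (suc i * Lb) ≡ 1) ⊎ (suc i * Lb < suc (rk S y) × leN (suc (rk S y)) (suc i * Lb) ≡ 0)) →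
       mem S Lb i y ≡ 0 ⊎ (mem S Lb i y ≡ 1 × Prime (suc y) × 3 ≤ suc y)
     go (inj₁ e) _ _ = inj₁ (cong (_* (leN (i * Lb) (rk S y) * leN (suc (rk S y)) (suc i * Lb))) e)
     go (inj₂ _) (inj₂ (_ , e)) _ = inj₁ (mulʳ0 {b = isPr S (suc y)} (cong (_* leN (suc (rk S y)) (suc i * Lb)) e))
     go (inj₂ _) (inj₁ _) (inj₂ (_ , e)) = inj₁ (mulʳ0 {b = isPr S (suc y)} (mulʳ0 {b = leN (i * Lb) (rk S y)} e))
     go (inj₂ (e , p)) (inj₁ (_ , e1)) (inj₁ (_ , e2)) = inj₂ (mul11 e (mul11 e1 e2) , p)

   lt01 : ∀ S Lb j y → lt S Lb j y ≡ 0 ⊎ (lt S Lb j y ≡ 1 × Prime (suc y) × 3 ≤ suc y)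
   lt01 S Lb j y = go (isPr01 S (suc y)) (leN-elim (suc (rk S y)) (j * Lb))
     where
     go : isPr S (suc y) ≡ 0 ⊎ (isPr S (suc y) ≡ 1 × Prime (suc y) × 3 ≤ suc y) →
       ((suc (rk S y) ≤ j * Lb × leN (suc (rk S y)) (j * Lb) ≡ 1) ⊎ (j * Lb < suc (rk S y) × leN (suc (rk S y)) (j * Lb) ≡ 0)) →
       lt S Lb j y ≡ 0 ⊎ (lt S Lb j y ≡ 1 × Prime (suc y) × 3 ≤ suc y)
     go (inj₁ e) _ = inj₁ (cong (_* leN (suc (rk S y)) (j * Lb)) e)
     go (inj₂ _) (inj₂ (_ , e)) = inj₁ (mulʳ0 {b = isPr S (suc y)} e)
     go (inj₂ (e , p)) (inj₁ (_ , e1)) = inj₂ (mul11 e e1 , p)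

   lt0 : ∀ S Lb y → lt S Lb 0 y ≡ 0
   lt0 S Lb y = mulʳ0 {b = isPr S (suc y)} (leN-no (s≤s (z≤n {rk S y})))

   ltS : ∀ S Lb j y → lt S Lb (suc j) y ≡ lt S Lb j y + mem S Lb j y
   ltS S Lb j y = trans (cong (isPr S (suc y) *_) (go (leN-elim (suc (rk S y)) (j * Lb)))) (ℕ.*-distribˡ-+ (isPr S (suc y)) (leN (suc (rk S y)) (j * Lb)) (leN (j * Lb) (rk S y) * leN (suc (rk S y)) (suc j * Lb)))
     where
     go : ((suc (rk S y) ≤ j * Lb × leN (suc (rk S y)) (j * Lb) ≡ 1) ⊎ (j * Lb < suc (rk S y) × leN (suc (rk S y)) (j * Lb) ≡ 0)) →
       leN (suc (rk S y)) (suc j * Lb) ≡ leN (suc (rk S y)) (j * Lb) + leN (j * Lb) (rk S y) * leN (suc (rk S y)) (suc j * Lb)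
     go (inj₁ (l , e)) = trans (leN-yes (ℕ.≤-trans l (ℕ.m≤n+m (j * Lb) Lb))) (sym (cong₂ _+_ e (cong (_* leN (suc (rk S y)) (suc j * Lb)) (leN-no l))))
     go (inj₂ (s≤s l , e)) = sym (trans (cong₂ _+_ e (cong (_* leN (suc (rk S y)) (suc j * Lb)) (leN-yes l))) (ℕ.+-identityʳ _))

   module _ (S q' : ℕ) (pq : Prime (suc q')) (q≤S : suc q' ≤ S) where
     open Prim q' pq using (≈-*; cancel)
     private
       q : ℕ
       q = suc q'
       Cover : ℕ → ℕ → Set
       Cover g h = ∃[ e ] (e < S × (g ^ e) % suc q' ≡ h)

     primRoot⇒ : ∀ g → primRoot S q' g ≢ 0 → ∀ h → 1 ≤ h → h < suc q' → Cover g h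
     primRoot⇒ g nz h l l' = fin (sumN≢0 S (λ e → eqN ((g ^ e) % suc q') h) (leN0≡0 z2))
       where
       R : ℕ → ℕ
       R h = leN 1 h * (leN (suc h) (suc q') * leN (sumN S (λ e → eqN ((g ^ e) % suc q') h)) 0)
       tot : sumN S R ≡ 0
       tot = go (leN-elim (sumN S R) 0)
         where
         go : ((sumN S R ≤ 0 × leN (sumN S R) 0 ≡ 1) ⊎ (0 < sumN S R × leN (sumN S R) 0 ≡ 0)) → sumN S R ≡ 0
         go (inj₁ (z , _)) = ℕ.n≤0⇒n≡0 z
         go (inj₂ (_ , e)) = ⊥-elim (nz e)
       z1 : R h ≡ 0
       z1 = ℕ.n≤0⇒n≡0 (ℕ.≤-trans (term≤sumN S R h (ℕ.<-≤-trans l' q≤S)) (ℕ.≤-reflexive tot))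
       z2 : leN (sumN S (λ e → eqN ((g ^ e) % suc q') h)) 0 ≡ 0
       z2 = trans (sym (trans (cong₂ (λ a b → a * (b * leN (sumN S (λ e → eqN ((g ^ e) % suc q') h)) 0)) (leN-yes l) (leN-yes l')) (trans (ℕ.+-identityʳ _) (ℕ.+-identityʳ _)))) z1
       fin : ∃[ e ] (e < S × eqN ((g ^ e) % suc q') h ≢ 0) → Cover g h
       fin (e , l1 , ne) = e , l1 , eqN≡1⇒ ne

     ⇒primRoot : ∀ g → (∀ h → 1 ≤ h → h < suc q' → Cover g h) → primRoot S q' g ≡ 1
     ⇒primRoot g cov = leN-yes (ℕ.≤-reflexive (sumN≡0 S _ (λ h _ → pt h (1 ℕ.≤? h) (suc h ℕ.≤? suc q'))))
       where
       Q : ℕ → ℕ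
       Q h = leN (sumN S (λ e → eqN ((g ^ e) % suc q') h)) 0
       pt : ∀ h → Dec (1 ≤ h) → Dec (suc h ≤ suc q') → leN 1 h * (leN (suc h) (suc q') * Q h) ≡ 0
       pt h (no n) _ = cong (_* (leN (suc h) (suc q') * Q h)) (leN-no (ℕ.≰⇒> n))
       pt h (yes _) (no n) = mulʳ0 {b = leN 1 h} (cong (_* Q h) (leN-no (ℕ.≰⇒> n)))
       pt h (yes l) (yes l') = mulʳ0 {b = leN 1 h} (mulʳ0 {b = leN (suc h) (suc q')} (fin (cov h l l')))
         where
         fin : Cover g h → Q h ≡ 0
         fin (e , l1 , eq) = leN-no (ℕ.<-≤-trans (s≤s z≤n) (ℕ.≤-trans (ℕ.≤-reflexive (sym (eqN-refl eq))) (term≤sumN S (λ e → eqN ((g ^ e) % suc q') h) e l1)))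

     gen-covers : ∀ h → 1 ≤ h → h < suc q' → Cover (gen S q') h
     gen-covers = primRoot⇒ (gen S q') (go (Prim.primitive-root q' pq))
       where
       go : ∃[ g ] (g < suc q' × (∀ h → 1 ≤ h → h < suc q' → ∃[ e ] (e < suc q' × (g ^ e) % suc q' ≡ h))) → primRoot S q' (gen S q') ≢ 0
       go (g , l , cov) = proj₂ (μ-spec S (primRoot S q') g (ℕ.<-≤-trans l q≤S) (1≢0 (⇒primRoot g (λ h l1 l2 → widen (cov h l1 l2)))))
         where
         widen : ∀ {h} → ∃[ e ] (e < suc q' × (g ^ e) % suc q' ≡ h) → Cover g h
         widen (e , l1 , eq) = e , ℕ.<-≤-trans l1 q≤S , eq

     lg-spec : ∀ h → 1 ≤ h → h < suc q' → (gen S q' ^ lg S q' h) % suc q' ≡ h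
     lg-spec h l l' = go (gen-covers h l l')
       where
       go : Cover (gen S q') h → (gen S q' ^ lg S q' h) % suc q' ≡ h
       go (e , l1 , eq) = eqN≡1⇒ (proj₂ (μ-spec S (λ e → eqN ((gen S q' ^ e) % suc q') h) e l1 (1≢0 (eqN-refl eq))))

     prodm-spec : ∀ f → prodm S q' f ≡ prodN S f % suc q'
     prodm-spec f = go (sumN S Zr ℕ.≟ 0)
       where
       G : ℕ
       G = gen S q'
       Zr : ℕ → ℕ
       Zr y = leN (f y % suc q') 0
       logs : ∀ Y → Y ≤ S → sumN S Zr ≡ 0 → Mod (suc q') (+ (G ^ sumN Y (λ y → lg S q' (f y % suc q')))) (+ prodN Y f)
       logs zero _ _ = mod-refl refl
       logs (suc Y) l z = mod-trans (mod-refl (cong +_ (ℕ.^-distribˡ-+-* G (sumN Y (λ y → lg S q' (f y % suc q'))) (lg S q' (f Y % suc q')))))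
         (≈-* {G ^ sumN Y (λ y → lg S q' (f y % suc q'))} {prodN Y f} {G ^ lg S q' (f Y % suc q')} {f Y} (logs Y (ℕ.<⇒≤ l) z) (mod-trans (%⇒mod {b = f Y % suc q'} (trans (lg-spec (f Y % suc q') pos (m%n<n (f Y) (suc q'))) (sym (m%n%n≡m%n (f Y) (suc q'))))) (%-mod q' (f Y))))
         where
         pos : 1 ≤ f Y % suc q'
         pos = ℕ.n≢0⇒n>0 (λ e → 1≢0 (leN-yes (ℕ.≤-reflexive e)) (ℕ.n≤0⇒n≡0 (ℕ.≤-trans (term≤sumN S Zr Y l) (ℕ.≤-reflexive z))))
       go : Dec (sumN S Zr ≡ 0) → prodm S q' f ≡ prodN S f % suc q'
       go (yes z) = trans (cong (_* ((G ^ sumN S (λ y → lg S q' (f y % suc q'))) % suc q')) (leN-yes (ℕ.≤-reflexive z))) (trans (ℕ.+-identityʳ _) (mod⇒% (logs S ℕ.≤-refl z)))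
       go (no nz) = trans (cong (_* ((G ^ sumN S (λ y → lg S q' (f y % suc q'))) % suc q')) (leN-no (ℕ.n≢0⇒n>0 nz))) (sym (hit (sumN≢0 S Zr nz)))
         where
         hit : ∃[ i ] (i < S × Zr i ≢ 0) → prodN S f % suc q' ≡ 0
         hit (i , l , ne) = n∣m⇒m%n≡0 _ (suc q') (∣-trans (m%n≡0⇒n∣m (f i) (suc q') fi) (factor∣prodN S f i l))
           where
           fi : f i % suc q' ≡ 0
           fi = fin (leN-elim (f i % suc q') 0)
             where
             fin : ((f i % suc q' ≤ 0 × Zr i ≡ 1) ⊎ (0 < f i % suc q' × Zr i ≡ 0)) → f i % suc q' ≡ 0
             fin (inj₁ (z , _)) = ℕ.n≤0⇒n≡0 z
             fin (inj₂ (_ , e)) = ⊥-elim (ne e)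

     -- Some positive power of `a` is 1, so the power before it is an inverse.
     solvable : ∀ a t → ¬ suc q' ∣ a → t < suc q' → ∃[ c ] (c < suc q' × (c * a) % suc q' ≡ t)
     solvable a t na l = go (Prim.pow-exists q' pq {a} (λ m → na (mod0⇒∣ m)))
       where
       go : ∃[ k ] (1 ≤ k × k ≤ suc q' × Mod (suc q') (+ (a ^ k)) (+ 1)) → ∃[ c ] (c < suc q' × (c * a) % suc q' ≡ t)
       go (zero , () , _)
       go (suc k , _ , _ , m) = (t * a ^ k) % suc q' , m%n<n (t * a ^ k) (suc q') ,
         trans (mod⇒% (mod-trans (≈-* {(t * a ^ k) % suc q'} {t * a ^ k} {a} {a} (%-mod q' (t * a ^ k)) (mod-refl refl))
           (mod-trans (mod-refl (cong +_ (lem t (a ^ k) a))) (mod-trans (≈-* {t} {t} {a ^ suc k} {1} (mod-refl refl) m) (mod-refl (cong +_ (ℕ.*-identityʳ t))))))) (m<n⇒m%n≡m l)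
         where
         lem : ∀ t p a → t * p * a ≡ t * (a * p)
         lem = NS.solve-∀

-- Circuit families for these formulas

module PrimeFamilies where
 open import Data.Nat using (_≤_; _+_; _*_; _^_; _<ᵇ_)
 open import Data.Nat.DivMod
 open import Data.Bool using (T)
 open Growth
 open SumClosure using (SumClosed)
 open Counting
 open BoundedSearch
 open ModularPrimes
 open DigitConversion using (sel)

 -- Ten bits of slack in `r` keep multiples of `S` up to 1024 S at level 1, which covers the
 -- constants of the conversion.
 module Arith (sumC : SumClosed) (s r : ℕ → ℕ) (Ps : PB s) (Pr : PB r) (s+10≤r : ∀ n → 10 + s n ≤ r n) where
   open Bounded sumC r Pr (λ n → ℕ.≤-trans (s≤s z≤n) (s+10≤r n)) public

   S : ℕ → ℕ
   S n = 2 ^ s n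

   abstract
     s≤r : ∀ n → s n ≤ r n
     s≤r n = ℕ.≤-trans (ℕ.m≤n+m (s n) 10) (s+10≤r n)
     s≤1r : ∀ n → s n ≤ 1 * r n
     s≤1r n = ℕ.≤-trans (s≤r n) (ℕ.≤-reflexive (sym (ℕ.+-identityʳ (r n))))
     S≤ : ∀ n → S n ≤ 2 ^ (1 * r n)
     S≤ n = 2^mono (s≤1r n)
     1024S≤ : ∀ n → 1024 * S n ≤ 2 ^ (1 * r n)
     1024S≤ n = ℕ.≤-trans (ℕ.≤-reflexive (sym (ℕ.^-distribˡ-+-* 2 10 (s n)))) (2^mono (ℕ.≤-trans (s+10≤r n) (ℕ.≤-reflexive (sym (ℕ.+-identityʳ (r n))))))

   _▹ : Ctx → Ctx
   X ▹ = X ▹⟨ s , Ps ⟩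

   module _ {X : Ctx} where
     b-lift : ∀ {k} l {F : ∀ n → Dom X n → ℕ} → k ≤ l → NB X k F → NB X l F
     b-lift l h a = b-bound (λ n x o → ℕ.≤-trans (bd a n x o) (lvl-mono n h)) a

     b-S : NB X 1 (λ n _ → S n)
     b-S = b-const S S≤

     b-num : ∀ c → c ≤ 1024 → NB X 1 (λ _ _ → c)
     b-num c h = b-const (λ _ → c) (λ n → ℕ.≤-trans (ℕ.≤-trans h (ℕ.≤-trans (ℕ.≤-reflexive (sym (ℕ.*-identityʳ 1024))) (ℕ.*-monoʳ-≤ 1024 (ℕ.m^n>0 2 (s n))))) (1024S≤ n))

     y# : NB (X ▹) 1 (λ n xy → proj₂ xy)
     y# = b-var s≤1r

     sy# : NB (X ▹) 1 (λ n xy → suc (proj₂ xy))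
     sy# = b-bound (λ n xy o → ℕ.≤-trans (proj₁ (proj₂ o)) (S≤ n)) (b-suc y#)

     Σ# : ∀ {k : ℕ} {F : ∀ n → Dom X n × ℕ → ℕ} → NB (X ▹) k F → NB X (1 + k) (λ n x → sumN (S n) (λ y → F n (x , y)))
     Σ# = b-sum 1 s≤1r

     μ# : ∀ {k : ℕ} {F : ∀ n → Dom X n × ℕ → ℕ} → {p : T (suc k <ᵇ 20)} → NB (X ▹) k F → NB X 1 (λ n x → μ (S n) (λ y → F n (x , y)))
     μ# {p = p} = b-μ {p = p} s≤r

   module _ {X : Ctx} where
     b-isPr : ∀ {F : ∀ n → Dom X n → ℕ} → NB X 1 F → NB X 0 (λ n x → isPr (S n) (F n x))
     b-isPr f = b-* (b-le f b-S) (b-* (b-le (b-num 3 (s≤s (s≤s (s≤s z≤n)))) f)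
       (b-le (Σ# (b-* (b-le (b-num 2 (s≤s (s≤s z≤n))) y#) (b-* (b-le (b-suc y#) (b-wk f)) (Σ# (b-eq (b-* (b-wk y#) y#) (b-wk (b-wk f))))))) b-0))

     b-primRoot : ∀ {Q G : ∀ n → Dom X n → ℕ} → NB X 1 (λ n x → suc (Q n x)) → NB X 1 G → NB X 0 (λ n x → primRoot (S n) (Q n x) (G n x))
     b-primRoot q g = b-le (Σ# (b-* (b-le b-1 y#) (b-* (b-le (b-suc y#) (b-wk q)) (b-le (Σ# (b-eq (b-pow (b-wk (b-wk g)) y# (b-wk (b-wk q))) (b-wk y#))) b-0)))) b-0

   module _ {X : Ctx} where
     b-rk : ∀ {Y : ∀ n → Dom X n → ℕ} → NB X 1 Y → NB X 1 (λ n x → rk (S n) (Y n x))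
     b-rk {Y} y = Σ# (b-* (b-le (b-suc y#) (b-wk y)) (b-isPr sy#))

     b-gen : ∀ {Q : ∀ n → Dom X n → ℕ} → NB X 1 (λ n x → suc (Q n x)) → NB X 1 (λ n x → gen (S n) (Q n x))
     b-gen q = μ# (b-primRoot (b-wk q) y#)

   module _ {X : Ctx} where
     b-mem : ∀ {Lb : ℕ → ℕ} {I Y : ∀ n → Dom X n → ℕ} → (∀ n → Lb n ≤ 2 ^ (1 * r n)) → NB X 1 I → NB X 1 (λ n x → suc (Y n x)) → NB X 1 Y → NB X 0 (λ n x → mem (S n) (Lb n) (I n x) (Y n x))
     b-mem {Lb} hL i sy y = b-* (b-isPr sy) (b-* (b-le (b-* i (b-const {k = 1} Lb hL)) (b-rk y)) (b-le (b-suc (b-rk y)) (b-* (b-suc i) (b-const {k = 1} Lb hL))))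

     b-lt : ∀ {Lb : ℕ → ℕ} {k} {J Y : ∀ n → Dom X n → ℕ} → {p : T (k + 1 <ᵇ 20)} → (∀ n → Lb n ≤ 2 ^ (1 * r n)) → NB X k J → NB X 1 (λ n x → suc (Y n x)) → NB X 1 Y → NB X 0 (λ n x → lt (S n) (Lb n) (J n x) (Y n x))
     b-lt {Lb} {p = p} hL j sy y = b-* (b-isPr sy) (b-le {q = p} (b-suc (b-rk y)) (b-* j (b-const {k = 1} Lb hL)))

     b-lg : ∀ {Q H : ∀ n → Dom X n → ℕ} → NB X 1 (λ n x → suc (Q n x)) → NB X 1 H → NB X 1 (λ n x → lg (S n) (Q n x) (H n x))
     b-lg q h = μ# (b-eq (b-pow (b-wk (b-gen q)) y# (b-wk q)) (b-wk h))

     b-sel : ∀ {k} {B W : ∀ n → Dom X n → ℕ} → (∀ n x → Ok X n x → B n x ≤ 1) → NB X 0 B → NB X k W → NB X k (λ n x → sel (B n x) (W n x))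
     b-sel {k} {B} {W} h b w = b-bound bnd (b-+ (b-* b w) (b-∸ h b-1 b))
       where
       sel≤ : ∀ b w M → b ≤ 1 → w ≤ M → 1 ≤ M → sel b w ≤ M
       sel≤ zero w M _ _ l = l
       sel≤ (suc zero) w M _ l _ = ℕ.≤-trans (ℕ.≤-reflexive (trans (ℕ.+-identityʳ (w + 0)) (ℕ.+-identityʳ w))) l
       sel≤ (suc (suc _)) w M (s≤s ()) _ _
       bnd : ∀ n x → Ok X n x → sel (B n x) (W n x) ≤ 2 ^ (k * r n)
       bnd n x o = sel≤ (B n x) (W n x) (2 ^ (k * r n)) (h n x o) (bd w n x o) (ℕ.m^n>0 2 (k * r n))

   module _ {X : Ctx} where
     b-mod2 : ∀ {k} {F Q : ∀ n → Dom X n → ℕ} → k ≤ 2 → NB X k F → NB X 1 (λ n x → suc (Q n x)) → NB X 1 (λ n x → F n x % suc (Q n x))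
     b-mod2 {k} {F} {Q} h f q = b-mod {p = tt} {q = tt} (b-lift 2 h f) q
       (λ n x o → ℕ.≤-trans (ℕ.≤-trans (bd f n x o) (lvl-mono n h)) (ℕ.m≤m*n (2 ^ (2 * r n)) (suc (Q n x))))

   module _ {X : Ctx} where
     b-prodm : ∀ {Q : ∀ n → Dom X n → ℕ} {F : ∀ n → Dom X n × ℕ → ℕ} → NB X 1 (λ n x → suc (Q n x)) → NB (X ▹) 2 F → NB X 1 (λ n x → prodm (S n) (Q n x) (λ y → F n (x , y)))
     b-prodm {Q} {F} q f = b-bound (λ n x o → ℕ.≤-trans (ℕ.*-mono-≤ (leN≤1 (sumN (S n) (λ y → leN (F n (x , y) % suc (Q n x)) 0)) 0) (bd pw n x o)) (ℕ.≤-reflexive (ℕ.+-identityʳ _))) (b-* (b-le (Σ# (b-le (b-mod2 ℕ.≤-refl f (b-wk q)) b-0)) b-0) pw)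
       where
       pw = b-pow (b-gen q) (Σ# (b-lg (b-wk q) (b-mod2 ℕ.≤-refl f (b-wk q)))) q

-- Circuits that simulate a Turing machine

module TuringCircuit where
 open import Data.Nat using (_≤_; _<_; _+_; _*_)
 open import Data.Bool using (_xor_; _∧_)
 open import Data.Maybe using (Maybe; just; nothing)
 open import Data.List using ([]; _∷_)
 open import Data.List.Relation.Unary.All using (All; []; _∷_)
 open CircuitTools
 open SumClosure using (mapV; nodes-mapV; evE-mapV)
 open BitArithmetic using (_⊕_; _⊗_; 0#)

 bitE : ∀ {m} → Bool → Exp m
 bitE true = o#
 bitE false = 0#

 -- Shannon expansion of an arbitrary Boolean function. Its size is exponential in `k`, but `k` will
 -- be a constant of the machine.
 shan : ∀ k → (Vec Bool k → Bool) → Exp k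
 shan zero g = bitE (g [])
 shan (suc k) g = (o# ⊕ v# Fin.zero) ⊗ mapV Fin.suc (shan k (λ e → g (false ∷ e))) ⊕ v# Fin.zero ⊗ mapV Fin.suc (shan k (λ e → g (true ∷ e)))

 shanB : ℕ → ℕ
 shanB zero = 1
 shanB (suc k) = suc (suc (shanB k + 0) + suc (shanB k + 1))

 abstract
   bitE-nodes : ∀ {m} b → nodes (bitE {m} b) ≤ 1
   bitE-nodes true = z≤n
   bitE-nodes false = s≤s z≤n

   bitE-ev : ∀ {m} b (x : Fin m → Bool) → evE 𝔹A x (bitE b) ≡ b
   bitE-ev true x = refl
   bitE-ev false x = refl

   shan-nodes : ∀ k g → nodes (shan k g) ≤ shanB k
   shan-nodes zero g = bitE-nodes (g [])
   shan-nodes (suc k) g = s≤s (ℕ.+-mono-≤ (s≤s (ℕ.+-monoˡ-≤ 0 (ℕ.≤-trans (ℕ.≤-reflexive (nodes-mapV Fin.suc (shan k _))) (shan-nodes k _))))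
                                           (s≤s (ℕ.+-monoˡ-≤ 1 (ℕ.≤-trans (ℕ.≤-reflexive (nodes-mapV Fin.suc (shan k _))) (shan-nodes k _)))))

   shan-ev : ∀ k g (e : Vec Bool k) → evE 𝔹A (Vec.lookup e) (shan k g) ≡ g e
   shan-ev zero g [] = bitE-ev (g []) (Vec.lookup [])
   shan-ev (suc k) g (b ∷ e) = trans (cong₂ (λ p q → ((true xor b) ∧ p) xor (b ∧ q)) (sub (λ e → g (false ∷ e))) (sub (λ e → g (true ∷ e)))) (mux b)
     where
     sub : ∀ h → evE 𝔹A (Vec.lookup (b ∷ e)) (mapV Fin.suc (shan k h)) ≡ h e
     sub h = trans (evE-mapV 𝔹A Fin.suc (Vec.lookup (b ∷ e)) (shan k h)) (shan-ev k h e)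
     mux : ∀ b → ((true xor b) ∧ g (false ∷ e)) xor (b ∧ g (true ∷ e)) ≡ g (b ∷ e)
     mux false with g (false ∷ e)
     ... | true = refl
     ... | false = refl
     mux true = refl

 cp-local : ∀ m k (g : Fin m → Vec Bool k → Bool) (ω : Fin m → Fin k → Fin m) →
   Cp m (Fin m) (m * shanB k) (λ x o → g o (Vec.tabulate (λ i → x (ω o i))))
 cp-local m k g ω = cp-eq eq (cp-exp m (λ o → mapV (ω o) (shan k (g o))) (λ o → ℕ.≤-trans (ℕ.≤-reflexive (nodes-mapV (ω o) (shan k (g o)))) (shan-nodes k (g o))))
   where
   abstract
     eq : ∀ x o → evE 𝔹A x (mapV (ω o) (shan k (g o))) ≡ g o (Vec.tabulate (λ i → x (ω o i)))
     eq x o = trans (evE-mapV 𝔹A (ω o) x (shan k (g o))) (trans (evE-cong 𝔹A (λ i → sym (Vec.lookup∘tabulate (λ i → x (ω o i)) i)) (shan k (g o))) (shan-ev k (g o) (Vec.tabulate (λ i → x (ω o i)))))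

 oneHot : ∀ {K} → Fin K → Fin K → Bool
 oneHot Fin.zero Fin.zero = true
 oneHot Fin.zero (Fin.suc j) = false
 oneHot (Fin.suc i) Fin.zero = false
 oneHot (Fin.suc i) (Fin.suc j) = oneHot i j

 -- Decodes a one-hot vector. If no earlier bit is set, the last index is the default.
 first : ∀ {K} → (Fin (suc K) → Bool) → Fin (suc K)
 first {zero} b = Fin.zero
 first {suc K} b = if b Fin.zero then Fin.zero else Fin.suc (first (λ i → b (Fin.suc i)))

 encS : Sym → Fin 2 → Bool
 encS nothing i = false
 encS (just b) Fin.zero = true
 encS (just b) (Fin.suc i) = b

 decS : Bool → Bool → Sym
 decS false b = nothing
 decS true b = just b

 abstract
   first-oneHot : ∀ {K} (i : Fin (suc K)) (b : Fin (suc K) → Bool) → (∀ j → b j ≡ oneHot i j) → first b ≡ i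
   first-oneHot {zero} Fin.zero b h = refl
   first-oneHot {suc K} Fin.zero b h rewrite h Fin.zero = refl
   first-oneHot {suc K} (Fin.suc i) b h rewrite h Fin.zero = cong Fin.suc (first-oneHot i (λ j → b (Fin.suc j)) (λ j → h (Fin.suc j)))

   oneHot-refl : ∀ {K} (i : Fin K) → oneHot i i ≡ true
   oneHot-refl Fin.zero = refl
   oneHot-refl (Fin.suc i) = oneHot-refl i

   oneHot-≢ : ∀ {K} (i j : Fin K) → i ≢ j → oneHot i j ≡ false
   oneHot-≢ Fin.zero Fin.zero ne = ⊥-elim (ne refl)
   oneHot-≢ Fin.zero (Fin.suc j) ne = refl
   oneHot-≢ (Fin.suc i) Fin.zero ne = refl
   oneHot-≢ (Fin.suc i) (Fin.suc j) ne = oneHot-≢ i j (λ e → ne (cong Fin.suc e))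

   decS-enc : ∀ a → decS (encS a Fin.zero) (encS a (Fin.suc Fin.zero)) ≡ a
   decS-enc nothing = refl
   decS-enc (just b) = refl

 str : List Sym → ℕ → Sym
 str [] i = nothing
 str (x ∷ l) zero = x
 str (x ∷ l) (suc i) = str l i

 module Machine (M : TM) where
   -- `K` counts the states of the machine and the two verdicts, with one bit for each. The 8 stands
   -- for four tape symbols of two bits.
   K' K k : ℕ
   K' = TM.nQ M + 2
   K = suc K'
   k = K + 8

   St : Set
   St = Fin (suc (TM.nQ M)) ⊎ Bool

   idx : St → Fin K
   idx (inj₁ q) = q ↑ˡ 2
   idx (inj₂ false) = suc (TM.nQ M) ↑ʳ Fin.zero
   idx (inj₂ true) = suc (TM.nQ M) ↑ʳ Fin.suc Fin.zero

   halt : Fin 2 → Bool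
   halt Fin.zero = false
   halt (Fin.suc _) = true

   stOf : Fin K → St
   stOf i = [ inj₁ , (λ j → inj₂ (halt j)) ] (Fin.splitAt (suc (TM.nQ M)) i)

   abstract
     stOf-idx : ∀ s → stOf (idx s) ≡ s
     stOf-idx (inj₁ q) = cong [ inj₁ , (λ j → inj₂ (halt j)) ] (Fin.splitAt-↑ˡ (suc (TM.nQ M)) q 2)
     stOf-idx (inj₂ false) = cong [ inj₁ , (λ j → inj₂ (halt j)) ] (Fin.splitAt-↑ʳ (suc (TM.nQ M)) 2 Fin.zero)
     stOf-idx (inj₂ true) = cong [ inj₁ , (λ j → inj₂ (halt j)) ] (Fin.splitAt-↑ʳ (suc (TM.nQ M)) 2 (Fin.suc Fin.zero))

   -- The rules on the blank-extended tape, read off position by position: state, head symbol, and the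
   -- i-th cell on either side given its neighbours on that side (the cell before position 0 is absent).
   act : St → Sym → St × Sym × Move
   act (inj₂ b) a = inj₂ b , a , stay
   act (inj₁ q) a = TM.δ M q a

   newH : Move → Sym → Sym → Sym → Sym
   newH left a l0 r0 = l0
   newH right a l0 r0 = r0
   newH stay a l0 r0 = a

   newL newR : Move → Sym → Maybe Sym → Sym → Sym → Sym
   newL left a p c n = n
   newL right a nothing c n = a
   newL right a (just p) c n = p
   newL stay a p c n = c
   newR right a p c n = n
   newR left a nothing c n = a
   newR left a (just p) c n = p
   newR stay a p c n = c

   before : (ℕ → Sym) → ℕ → Maybe Sym
   before l zero = nothing
   before l (suc i) = just (l i)

   -- The half-tapes are functions, blank beyond the written part, so that a list growing at its end
   -- needs no case distinction.
   record SC : Set where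
     constructor sc
     field
       st : St
       sl : ℕ → Sym
       sh : Sym
       sr : ℕ → Sym
   open SC

   sstep : SC → SC
   sstep (sc q l h r) = let q' = proj₁ (act q h) ; a = proj₁ (proj₂ (act q h)) ; mv = proj₂ (proj₂ (act q h)) in
     sc q' (λ i → newL mv a (before l i) (l i) (l (suc i))) (newH mv a (l 0) (r 0)) (λ i → newR mv a (before r i) (r i) (r (suc i)))

   record _∼_ (c : Config M) (d : SC) : Set where
     constructor sim
     field
       qe : Config.state c ≡ st d
       le : ∀ i → str (Config.lft c) i ≡ sl d i
       he : Config.hd c ≡ sh d
       re : ∀ i → str (Config.rgt c) i ≡ sr d i

   toSC : Config M → SC
   toSC (conf q l h r) = sc q (str l) h (str r)

   abstract
     before-cong : ∀ {l l' : ℕ → Sym} → (∀ i → l i ≡ l' i) → ∀ i → before l i ≡ before l' i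
     before-cong h zero = refl
     before-cong h (suc i) = cong just (h i)

     sstep-cong : ∀ q h {l l' r r' : ℕ → Sym} → (∀ i → l i ≡ l' i) → (∀ i → r i ≡ r' i) → ∀ c → c ∼ sstep (sc q l h r) → c ∼ sstep (sc q l' h r')
     sstep-cong q h {l} {l'} {r} {r'} el er c (sim a b d e) with act q h
     ... | q' , s , mv = sim a (λ i → trans (b i) (trans (cong (λ z → newL mv s z (l i) (l (suc i))) (before-cong el i)) (cong₂ (newL mv s (before l' i)) (el i) (el (suc i)))))
       (trans d (cong₂ (newH mv s) (el 0) (er 0)))
       (λ i → trans (e i) (trans (cong (λ z → newR mv s z (r i) (r (suc i))) (before-cong er i)) (cong₂ (newR mv s (before r' i)) (er i) (er (suc i)))))

     step-list : ∀ q l h r → stepTM M (conf q l h r) ∼ sstep (sc q (str l) h (str r))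
     step-list (inj₂ b) l h r = sim refl (λ i → refl) refl (λ i → refl)
     step-list (inj₁ q) l h r with TM.δ M q h
     step-list (inj₁ q) [] h r | q' , a , left = sim refl (λ i → refl) refl (λ { zero → refl ; (suc i) → refl })
     step-list (inj₁ q) (x ∷ l) h r | q' , a , left = sim refl (λ i → refl) refl (λ { zero → refl ; (suc i) → refl })
     step-list (inj₁ q) l h [] | q' , a , right = sim refl (λ { zero → refl ; (suc i) → refl }) refl (λ i → refl)
     step-list (inj₁ q) l h (x ∷ r) | q' , a , right = sim refl (λ { zero → refl ; (suc i) → refl }) refl (λ i → refl)
     step-list (inj₁ q) l h r | q' , a , stay = sim refl (λ i → refl) refl (λ i → refl)

     step-sim : ∀ c d → c ∼ d → stepTM M c ∼ sstep d
     step-sim (conf q l h r) (sc .q l' .h r') (sim refl el refl er) = sstep-cong q h el er _ (step-list q l h r)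

   siter : ℕ → SC → SC
   siter zero d = d
   siter (suc t) d = sstep (siter t d)

   abstract
     runTM-suc : ∀ t c → runTM M (suc t) c ≡ stepTM M (runTM M t c)
     runTM-suc zero c = refl
     runTM-suc (suc t) c = runTM-suc t (stepTM M c)

     run-sim : ∀ t c d → c ∼ d → runTM M t c ∼ siter t d
     run-sim zero c d h = h
     run-sim (suc t) c d h = subst (_∼ siter (suc t) d) (sym (runTM-suc t c)) (step-sim _ _ (run-sim t c d h))

     halted-step : ∀ c b → Config.state c ≡ inj₂ b → Config.state (stepTM M c) ≡ inj₂ b
     halted-step (conf (inj₂ b) l h r) .b refl = refl

     run-halted : ∀ t c b → Config.state c ≡ inj₂ b → Config.state (runTM M t c) ≡ inj₂ b
     run-halted zero c b h = h
     run-halted (suc t) c b h = run-halted t (stepTM M c) b (halted-step c b h)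

     run-+ : ∀ t t' c → runTM M (t + t') c ≡ runTM M t' (runTM M t c)
     run-+ zero t' c = refl
     run-+ (suc t) t' c = run-+ t t' (stepTM M c)

     -- Halted configurations are fixed, so one running time can serve all words of bounded length.
     run-longer : ∀ t t' c b → t ≤ t' → Config.state (runTM M t c) ≡ inj₂ b → Config.state (runTM M t' c) ≡ inj₂ b
     run-longer t t' c b l h = trans (cong Config.state (trans (cong (λ z → runTM M z c) (sym (ℕ.m+[n∸m]≡n l))) (run-+ t (t' ℕ.∸ t) c))) (run-halted (t' ℕ.∸ t) _ b h)

   module Window (P' : ℕ) where
     P : ℕ
     P = suc P'

     m : ℕ
     m = K + (2 + (P * 2 + P * 2))

     data View : Set where
       qV : Fin K → View
       hV : Fin 2 → View
       lV rV : Fin P → Fin 2 → View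

     at : View → Fin m
     at (qV i) = i ↑ˡ (2 + (P * 2 + P * 2))
     at (hV b) = K ↑ʳ (b ↑ˡ (P * 2 + P * 2))
     at (lV i b) = K ↑ʳ (2 ↑ʳ (Fin.combine i b ↑ˡ (P * 2)))
     at (rV i b) = K ↑ʳ (2 ↑ʳ ((P * 2) ↑ʳ Fin.combine i b))

     cellV : (Fin P → Fin 2 → View) → Fin (P * 2) → View
     cellV c i = c (proj₁ (Fin.remQuot {P} 2 i)) (proj₂ (Fin.remQuot {P} 2 i))

     view : Fin m → View
     view i = [ qV , (λ j → [ hV , (λ j → [ cellV lV , cellV rV ] (Fin.splitAt (P * 2) j)) ] (Fin.splitAt 2 j)) ] (Fin.splitAt K i)

     abstract
       cell-combine : ∀ c i b → cellV c (Fin.combine i b) ≡ c i b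
       cell-combine c i b = cong (λ z → c (proj₁ z) (proj₂ z)) (Fin.remQuot-combine {P} {2} i b)

       view-at : ∀ v → view (at v) ≡ v
       view-at (qV i) rewrite Fin.splitAt-↑ˡ K i (2 + (P * 2 + P * 2)) = refl
       view-at (hV b) rewrite Fin.splitAt-↑ʳ K (2 + (P * 2 + P * 2)) (b ↑ˡ (P * 2 + P * 2)) | Fin.splitAt-↑ˡ 2 b (P * 2 + P * 2) = refl
       view-at (lV i b) rewrite Fin.splitAt-↑ʳ K (2 + (P * 2 + P * 2)) (2 ↑ʳ (Fin.combine i b ↑ˡ (P * 2)))
         | Fin.splitAt-↑ʳ 2 (P * 2 + P * 2) (Fin.combine i b ↑ˡ (P * 2)) | Fin.splitAt-↑ˡ (P * 2) (Fin.combine i b) (P * 2)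
         = cell-combine lV i b
       view-at (rV i b) rewrite Fin.splitAt-↑ʳ K (2 + (P * 2 + P * 2)) (2 ↑ʳ ((P * 2) ↑ʳ Fin.combine i b))
         | Fin.splitAt-↑ʳ 2 (P * 2 + P * 2) ((P * 2) ↑ʳ Fin.combine i b) | Fin.splitAt-↑ʳ (P * 2) (P * 2) (Fin.combine i b)
         = cell-combine rV i b

     prv nxt : Fin P → Fin P
     prv i = Fin.pred i
     nxt i with suc (Fin.toℕ i) ℕ.<? P
     ... | yes l = Fin.fromℕ< l
     ... | no _ = i

     -- Local neighbourhood: the state, the head symbol, and three cells.
     nbh : (Fin 2 → View) → (Fin 2 → View) → (Fin 2 → View) → Fin k → Fin m
     nbh x y z i = at ([ qV , (λ j → [ hV , (λ j → [ x , (λ j → [ y , z ] (Fin.splitAt 2 j)) ] (Fin.splitAt 2 j)) ] (Fin.splitAt 2 j)) ] (Fin.splitAt K i))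

     atQ : Fin K → Fin k
     atQ i = i ↑ˡ 8
     at8 : Fin 8 → Fin k
     at8 j = K ↑ʳ j

     readS : Vec Bool k → Fin 8 → Fin 8 → Sym
     readS e i j = decS (Vec.lookup e (at8 i)) (Vec.lookup e (at8 j))
     readQ : Vec Bool k → St
     readQ e = stOf (first (λ i → Vec.lookup e (atQ i)))

     f0 f1 f2 f3 f4 f5 f6 f7 : Fin 8
     f0 = Fin.zero
     f1 = Fin.suc Fin.zero
     f2 = Fin.suc (Fin.suc Fin.zero)
     f3 = Fin.suc (Fin.suc (Fin.suc Fin.zero))
     f4 = Fin.suc (Fin.suc (Fin.suc (Fin.suc Fin.zero)))
     f5 = Fin.suc (Fin.suc (Fin.suc (Fin.suc (Fin.suc Fin.zero))))
     f6 = Fin.suc (Fin.suc (Fin.suc (Fin.suc (Fin.suc (Fin.suc Fin.zero)))))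
     f7 = Fin.suc (Fin.suc (Fin.suc (Fin.suc (Fin.suc (Fin.suc (Fin.suc Fin.zero))))))

     edge : Fin P → Sym → Maybe Sym
     edge Fin.zero a = nothing
     edge (Fin.suc i) a = just a

     rule : View → St → Sym → Sym → Sym → Sym → Bool
     rule (qV i) q h x y z = oneHot (idx (proj₁ (act q h))) i
     rule (hV b) q h x y z = encS (newH (proj₂ (proj₂ (act q h))) (proj₁ (proj₂ (act q h))) x y) b
     rule (lV i b) q h x y z = encS (newL (proj₂ (proj₂ (act q h))) (proj₁ (proj₂ (act q h))) (edge i x) y z) b
     rule (rV i b) q h x y z = encS (newR (proj₂ (proj₂ (act q h))) (proj₁ (proj₂ (act q h))) (edge i x) y z) b

     wire : View → Fin k → Fin m
     wire (qV i) = nbh hV hV hV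
     wire (hV b) = nbh (lV Fin.zero) (rV Fin.zero) hV
     wire (lV i b) = nbh (lV (prv i)) (lV i) (lV (nxt i))
     wire (rV i b) = nbh (rV (prv i)) (rV i) (rV (nxt i))

     b0 b1 : Fin 2
     b0 = Fin.zero
     b1 = Fin.suc Fin.zero

     local : Fin m → Vec Bool k → Bool
     local o e = rule (view o) (readQ e) (readS e f0 f1) (readS e f2 f3) (readS e f4 f5) (readS e f6 f7)

     next : (Fin m → Bool) → Fin m → Bool
     next x o = local o (Vec.tabulate (λ i → x (wire (view o) i)))

     stepCp : Cp m (Fin m) (m * shanB k) next
     stepCp = cp-local m k local (λ o → wire (view o))

     -- The cells outside the window are unknown, and the resulting error moves inwards by one cell
     -- per step. After `t` steps the claim is restricted accordingly to the first P - t cells on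
     -- either side.
     record Rep (t : ℕ) (x : Fin m → Bool) (d : SC) : Set where
       field
         rq : ∀ i → x (at (qV i)) ≡ oneHot (idx (st d)) i
         rh : ∀ b → x (at (hV b)) ≡ encS (sh d) b
         rl : ∀ (i : Fin P) b → Fin.toℕ i + t < P → x (at (lV i b)) ≡ encS (sl d (Fin.toℕ i)) b
         rr : ∀ (i : Fin P) b → Fin.toℕ i + t < P → x (at (rV i b)) ≡ encS (sr d (Fin.toℕ i)) b
     open Rep

     module Read (x : Fin m → Bool) (c₁ c₂ c₃ : Fin 2 → View) where
       e : Vec Bool k
       e = Vec.tabulate (λ i → x (nbh c₁ c₂ c₃ i))
       cell : (Fin 2 → View) → Sym
       cell c = decS (x (at (c b0))) (x (at (c b1)))
       abstract
         look8 : ∀ j → Vec.lookup e (at8 j) ≡ x (at ([ hV , (λ j → [ c₁ , (λ j → [ c₂ , c₃ ] (Fin.splitAt 2 j)) ] (Fin.splitAt 2 j)) ] (Fin.splitAt 2 j)))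
         look8 j = trans (Vec.lookup∘tabulate (λ i → x (nbh c₁ c₂ c₃ i)) (at8 j)) (cong (λ z → x (at ([ qV , (λ j → [ hV , (λ j → [ c₁ , (λ j → [ c₂ , c₃ ] (Fin.splitAt 2 j)) ] (Fin.splitAt 2 j)) ] (Fin.splitAt 2 j)) ] z))) (Fin.splitAt-↑ʳ K 8 j))
         rdQ : ∀ q → (∀ i → x (at (qV i)) ≡ oneHot (idx q) i) → readQ e ≡ q
         rdQ q h = trans (cong stOf (first-oneHot (idx q) _ (λ i → trans (Vec.lookup∘tabulate (λ i → x (nbh c₁ c₂ c₃ i)) (atQ i)) (trans (cong (λ z → x (at ([ qV , (λ j → [ hV , (λ j → [ c₁ , (λ j → [ c₂ , c₃ ] (Fin.splitAt 2 j)) ] (Fin.splitAt 2 j)) ] (Fin.splitAt 2 j)) ] z))) (Fin.splitAt-↑ˡ K i 8)) (h i))))) (stOf-idx q)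
         rd01 : readS e f0 f1 ≡ cell hV
         rd01 = cong₂ decS (look8 f0) (look8 f1)
         rd23 : readS e f2 f3 ≡ cell c₁
         rd23 = cong₂ decS (look8 f2) (look8 f3)
         rd45 : readS e f4 f5 ≡ cell c₂
         rd45 = cong₂ decS (look8 f4) (look8 f5)
         rd67 : readS e f6 f7 ≡ cell c₃
         rd67 = cong₂ decS (look8 f6) (look8 f7)
         decode : ∀ c s → (∀ b → x (at (c b)) ≡ encS s b) → cell c ≡ s
         decode c s h = trans (cong₂ decS (h b0) (h b1)) (decS-enc s)

     abstract
       next-at : ∀ x v c₁ c₂ c₃ → wire v ≡ nbh c₁ c₂ c₃ → ∀ d t → Rep t x d →
         next x (at v) ≡ rule v (st d) (sh d) (Read.cell x c₁ c₂ c₃ c₁) (Read.cell x c₁ c₂ c₃ c₂) (Read.cell x c₁ c₂ c₃ c₃)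
       next-at x v c₁ c₂ c₃ ew d t R rewrite view-at v | ew
         | Read.rdQ x c₁ c₂ c₃ (st d) (rq R) | Read.rd01 x c₁ c₂ c₃ | Read.decode x c₁ c₂ c₃ hV (sh d) (rh R)
         | Read.rd23 x c₁ c₂ c₃ | Read.rd45 x c₁ c₂ c₃ | Read.rd67 x c₁ c₂ c₃ = refl

       toℕ-nxt : ∀ (i : Fin P) → suc (Fin.toℕ i) < P → Fin.toℕ (nxt i) ≡ suc (Fin.toℕ i)
       toℕ-nxt i l with suc (Fin.toℕ i) ℕ.<? P
       ... | yes l' = Fin.toℕ-fromℕ< l'
       ... | no n = ⊥-elim (n l)

       side-before : ∀ (c : Fin P → Fin 2 → View) (x : Fin m → Bool) (l : ℕ → Sym) t → (∀ (i : Fin P) b → Fin.toℕ i + t < P → x (at (c i b)) ≡ encS (l (Fin.toℕ i)) b) →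
         ∀ (i : Fin P) → Fin.toℕ i + suc t < P → edge i (decS (x (at (c (prv i) b0))) (x (at (c (prv i) b1)))) ≡ before l (Fin.toℕ i)
       side-before c x l t h Fin.zero lt = refl
       side-before c x l t h (Fin.suc i) lt = cong just (trans (cong₂ decS (h (Fin.inject₁ i) b0 lt') (h (Fin.inject₁ i) b1 lt')) (trans (decS-enc (l (Fin.toℕ (Fin.inject₁ i)))) (cong l (Fin.toℕ-inject₁ i))))
         where
         lt' : Fin.toℕ (Fin.inject₁ i) + t < P
         lt' = ℕ.≤-trans (s≤s (ℕ.≤-trans (ℕ.≤-reflexive (cong (_+ t) (Fin.toℕ-inject₁ i))) (ℕ.≤-trans (ℕ.n≤1+n _) (ℕ.≤-trans (ℕ.n≤1+n _) (ℕ.≤-reflexive (cong suc (sym (ℕ.+-suc (Fin.toℕ i) t)))))))) lt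

       side-here : ∀ (c : Fin P → Fin 2 → View) (x : Fin m → Bool) (l : ℕ → Sym) t → (∀ (i : Fin P) b → Fin.toℕ i + t < P → x (at (c i b)) ≡ encS (l (Fin.toℕ i)) b) →
         ∀ (i : Fin P) → Fin.toℕ i + t < P → decS (x (at (c i b0))) (x (at (c i b1))) ≡ l (Fin.toℕ i)
       side-here c x l t h i lt = trans (cong₂ decS (h i b0 lt) (h i b1 lt)) (decS-enc (l (Fin.toℕ i)))

       side-after : ∀ (c : Fin P → Fin 2 → View) (x : Fin m → Bool) (l : ℕ → Sym) t → (∀ (i : Fin P) b → Fin.toℕ i + t < P → x (at (c i b)) ≡ encS (l (Fin.toℕ i)) b) →
         ∀ (i : Fin P) → Fin.toℕ i + suc t < P → decS (x (at (c (nxt i) b0))) (x (at (c (nxt i) b1))) ≡ l (suc (Fin.toℕ i))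
       side-after c x l t h i lt = trans (side-here c x l t h (nxt i) (ℕ.≤-trans (s≤s (ℕ.≤-reflexive (trans (cong (_+ t) e) (sym (ℕ.+-suc (Fin.toℕ i) t))))) lt)) (cong l e)
         where
         e : Fin.toℕ (nxt i) ≡ suc (Fin.toℕ i)
         e = toℕ-nxt i (ℕ.≤-trans (s≤s (ℕ.≤-trans (s≤s (ℕ.m≤m+n (Fin.toℕ i) t)) (ℕ.≤-reflexive (sym (ℕ.+-suc (Fin.toℕ i) t))))) lt)

       weak : ∀ i t → i + suc t < P → i + t < P
       weak i t lt = ℕ.≤-trans (s≤s (ℕ.+-monoʳ-≤ i (ℕ.n≤1+n t))) lt

       next-rep : ∀ t x d → t < P → Rep t x d → Rep (suc t) (next x) (sstep d)
       next-rep t x d t<P R = record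
         { rq = λ i → next-at x (qV i) hV hV hV refl d t R
         ; rh = λ b → trans (next-at x (hV b) (lV Fin.zero) (rV Fin.zero) hV refl d t R)
             (cong₂ (λ p q → encS (newH (proj₂ (proj₂ (act (st d) (sh d)))) (proj₁ (proj₂ (act (st d) (sh d)))) p q) b)
               (side-here lV x (sl d) t (rl R) Fin.zero t<P) (side-here rV x (sr d) t (rr R) Fin.zero t<P))
         ; rl = λ i b lt → trans (next-at x (lV i b) (lV (prv i)) (lV i) (lV (nxt i)) refl d t R)
             (trans (cong (λ p → encS (newL mv a p (here lV i) (after lV i)) b) (side-before lV x (sl d) t (rl R) i lt))
               (cong₂ (λ p q → encS (newL mv a (before (sl d) (Fin.toℕ i)) p q) b) (side-here lV x (sl d) t (rl R) i (weak (Fin.toℕ i) t lt)) (side-after lV x (sl d) t (rl R) i lt)))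
         ; rr = λ i b lt → trans (next-at x (rV i b) (rV (prv i)) (rV i) (rV (nxt i)) refl d t R)
             (trans (cong (λ p → encS (newR mv a p (here rV i) (after rV i)) b) (side-before rV x (sr d) t (rr R) i lt))
               (cong₂ (λ p q → encS (newR mv a (before (sr d) (Fin.toℕ i)) p q) b) (side-here rV x (sr d) t (rr R) i (weak (Fin.toℕ i) t lt)) (side-after rV x (sr d) t (rr R) i lt)))
         }
         where
         mv : Move
         mv = proj₂ (proj₂ (act (st d) (sh d)))
         a : Sym
         a = proj₁ (proj₂ (act (st d) (sh d)))
         here after : (Fin P → Fin 2 → View) → Fin P → Sym
         here c i = decS (x (at (c i b0))) (x (at (c i b1)))
         after c i = decS (x (at (c (nxt i) b0))) (x (at (c (nxt i) b1)))

       iter-rep : ∀ T x d → T < P → Rep 0 x d → Rep T (iterF {m} {m} {Fin m} (λ _ → next) (λ i → i) T x) (siter T d)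
       iter-rep zero x d l R = R
       iter-rep (suc T) x d l R = next-rep T _ (siter T d) (ℕ.<-trans (ℕ.n<1+n T) l) (iter-rep T x d (ℕ.<-trans (ℕ.n<1+n T) l) R)

     module Start {v : ℕ} (word : List (Exp v)) where
       nth : List (Exp v) → ℕ → Maybe (Exp v)
       nth [] i = nothing
       nth (e ∷ w) zero = just e
       nth (e ∷ w) (suc i) = nth w i

       symE : Maybe (Exp v) → Fin 2 → Exp v
       symE nothing b = 0#
       symE (just e) Fin.zero = o#
       symE (just e) (Fin.suc _) = e

       initE : View → Exp v
       initE (qV i) = bitE (oneHot (idx (inj₁ Fin.zero)) i)
       initE (hV b) = symE (nth word 0) b
       initE (lV i b) = 0#
       initE (rV i b) = symE (nth word (suc (Fin.toℕ i))) b

       abstract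
         nth-nodes : ∀ w i b → All (λ e → nodes e ≤ 1) w → nodes (symE (nth w i) b) ≤ 1
         nth-nodes [] i b a = s≤s z≤n
         nth-nodes (e ∷ w) zero Fin.zero (l ∷ a) = z≤n
         nth-nodes (e ∷ w) zero (Fin.suc b) (l ∷ a) = l
         nth-nodes (e ∷ w) (suc i) b (l ∷ a) = nth-nodes w i b a

         init-nodes : All (λ e → nodes e ≤ 1) word → ∀ w → nodes (initE w) ≤ 1
         init-nodes a (qV i) = bitE-nodes (oneHot (idx (inj₁ Fin.zero)) i)
         init-nodes a (hV b) = nth-nodes word 0 b a
         init-nodes a (lV i b) = s≤s z≤n
         init-nodes a (rV i b) = nth-nodes word (suc (Fin.toℕ i)) b a

         sym-ev : ∀ (x : Fin v → Bool) w i b → evE 𝔹A x (symE (nth w i) b) ≡ encS (str (List.map just (List.map (evE 𝔹A x) w)) i) b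
         sym-ev x [] i b = refl
         sym-ev x (e ∷ w) zero Fin.zero = refl
         sym-ev x (e ∷ w) zero (Fin.suc b) = refl
         sym-ev x (e ∷ w) (suc i) b = sym-ev x w i b

         init-rep : ∀ x → Rep 0 (λ o → evE 𝔹A x (initE (view o))) (toSC (initConf M (List.map (evE 𝔹A x) word)))
         init-rep x = record
           { rq = λ i → trans (cong (λ z → evE 𝔹A x (initE z)) (view-at (qV i))) (trans (bitE-ev _ x) (cong (λ z → oneHot (idx z) i) (sym (start word))))
           ; rh = λ b → trans (cong (λ z → evE 𝔹A x (initE z)) (view-at (hV b))) (hd word b)
           ; rl = λ i b _ → trans (cong (λ z → evE 𝔹A x (initE z)) (view-at (lV i b))) (lf word i b)
           ; rr = λ i b _ → trans (cong (λ z → evE 𝔹A x (initE z)) (view-at (rV i b))) (rg word (Fin.toℕ i) b) }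
           where
           start : ∀ w → Config.state (initConf M (List.map (evE 𝔹A x) w)) ≡ inj₁ Fin.zero
           start [] = refl
           start (e ∷ w) = refl
           hd : ∀ w b → evE 𝔹A x (symE (nth w 0) b) ≡ encS (Config.hd (initConf M (List.map (evE 𝔹A x) w))) b
           hd [] b = refl
           hd (e ∷ w) Fin.zero = refl
           hd (e ∷ w) (Fin.suc b) = refl
           lf : ∀ w (i : Fin P) b → false ≡ encS (str (Config.lft (initConf M (List.map (evE 𝔹A x) w))) (Fin.toℕ i)) b
           lf [] i b = refl
           lf (e ∷ w) i b = refl
           rg : ∀ w i b → evE 𝔹A x (symE (nth w (suc i)) b) ≡ encS (str (Config.rgt (initConf M (List.map (evE 𝔹A x) w))) i) b
           rg [] i b = refl
           rg (e ∷ w) i b = sym-ev x w i b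

       accepts : ∀ T → T < P → All (λ e → nodes e ≤ 1) word →
         Cp v (Fin 1) (T * (m * shanB k) + m * 1) (λ x _ → oneHot (idx (Config.state (runTM M T (initConf M (List.map (evE 𝔹A x) word))))) (idx (inj₂ true)))
       accepts T l a = cp-eq ok (cp-map (λ _ → at (qV (idx (inj₂ true)))) (cp-iter T (cp-exp m (λ o → initE (view o)) (λ o → init-nodes a (view o))) (λ _ → stepCp) (λ i → i)))
         where
         abstract
           ok : ∀ x (o : Fin 1) → iterF {m} {m} {Fin m} (λ _ → next) (λ i → i) T (λ o → evE 𝔹A x (initE (view o))) (at (qV (idx (inj₂ true))))
             ≡ oneHot (idx (Config.state (runTM M T (initConf M (List.map (evE 𝔹A x) word))))) (idx (inj₂ true))
           ok x _ = trans (rq (iter-rep T _ _ l (init-rep x)) (idx (inj₂ true)))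
             (cong (λ z → oneHot (idx z) (idx (inj₂ true))) (sym (_∼_.qe (run-sim T (initConf M (List.map (evE 𝔹A x) word)) _ (sim refl (λ _ → refl) refl (λ _ → refl))))))

-- Bits of values at short points from the Turing machine

module BitOracle where
 open import Data.Nat using (_≤_; _<_; _+_; _*_; _^_)
 open import Data.Nat.DivMod
 open import Data.Integer using (ℤ; +_; -[1+_])
 open import Data.Bool using (_xor_; _∧_)
 open import Data.List using ([]; _∷_; _++_)
 import Data.List.Properties as List
 open import Data.List.Relation.Unary.All as All using (All; []; _∷_)
 import Data.List.Relation.Unary.All.Properties as All
 open import Relation.Nullary using (⌊_⌋)
 open Growth
 open CircuitTools
 open Verification using (b2n; num)
 open BitArithmetic using (_⊕_; _⊗_; 0#)
 open TuringCircuit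

 val : List Bool → ℕ
 val [] = 0
 val (b ∷ w) = b2n b + 2 * val w

 -- Polymorphic in the letters, so that the same encoding serves words of bits and words of
 -- expressions that evaluate to those bits.
 enc1 : ∀ {A : Set} → A → A → List A → List A → List A
 enc1 t f [] r = t ∷ t ∷ r
 enc1 t f (b ∷ w) r = f ∷ b ∷ enc1 t f w r

 encAll : ∀ {A : Set} → A → A → List (List A) → List A
 encAll t f [] = []
 encAll t f (w ∷ ws) = enc1 t f w (encAll t f ws)

 fields : ℕ → ∀ {u} → Vec ℤ u → ℕ → Bool → List (List Bool)
 fields n i j b = List.replicate n true ∷ (List.map encInt (Vec.toList i) ++ (encNat j ∷ (b ∷ []) ∷ []))

 abstract
   bit≡ : ∀ n → b2n ⌊ n % 2 ℕ.≟ 1 ⌋ ≡ n % 2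
   bit≡ n = go (n % 2) (m%n<n n 2)
     where
     go : ∀ k → k < 2 → b2n ⌊ k ℕ.≟ 1 ⌋ ≡ k
     go zero _ = refl
     go (suc zero) _ = refl
     go (suc (suc k)) (s≤s (s≤s ()))

   half< : ∀ n → suc n / 2 ≤ n
   half< n = ℕ.≤-pred (m/n<m (suc n) 2 (s≤s (s≤s z≤n)))

   fuel : ∀ k k' n → n ≤ k → n ≤ k' → bitsFuel k n ≡ bitsFuel k' n
   fuel zero zero zero _ _ = refl
   fuel zero (suc k') zero _ _ = refl
   fuel (suc k) zero zero _ _ = refl
   fuel (suc k) (suc k') zero _ _ = refl
   fuel (suc k) (suc k') (suc n) (s≤s l) (s≤s l') = cong (⌊ suc n % 2 ℕ.≟ 1 ⌋ ∷_) (fuel k k' (suc n / 2) (ℕ.≤-trans (half< n) l) (ℕ.≤-trans (half< n) l'))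

   encNat-step : ∀ n → encNat (suc n) ≡ ⌊ suc n % 2 ℕ.≟ 1 ⌋ ∷ encNat (suc n / 2)
   encNat-step n = cong (⌊ suc n % 2 ℕ.≟ 1 ⌋ ∷_) (fuel n (suc n / 2) (suc n / 2) (half< n) ℕ.≤-refl)

   bitsFuel-val : ∀ k n → n ≤ k → val (bitsFuel k n) ≡ n
   bitsFuel-val zero zero _ = refl
   bitsFuel-val (suc k) zero _ = refl
   bitsFuel-val (suc k) (suc n) (s≤s l) = trans (cong₂ (λ a b → a + 2 * b) (bit≡ (suc n)) (bitsFuel-val k (suc n / 2) (ℕ.≤-trans (half< n) l)))
     (trans (cong (λ z → suc n % 2 + z) (ℕ.*-comm 2 (suc n / 2))) (sym (m≡m%n+[m/n]*n (suc n) 2)))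

   encNat-val : ∀ n → val (encNat n) ≡ n
   encNat-val n = bitsFuel-val n n ℕ.≤-refl

   encNat-inj : ∀ {m n} → encNat m ≡ encNat n → m ≡ n
   encNat-inj {m} {n} e = trans (sym (encNat-val m)) (trans (cong val e) (encNat-val n))

   encInt-inj : ∀ {x y} → encInt x ≡ encInt y → x ≡ y
   encInt-inj {+ m} {+ n} e = cong +_ (encNat-inj (List.∷-injectiveʳ e))
   encInt-inj {+ m} { -[1+ n ]} e with List.∷-injectiveˡ e
   ... | ()
   encInt-inj { -[1+ m ]} {+ n} e with List.∷-injectiveˡ e
   ... | ()
   encInt-inj { -[1+ m ]} { -[1+ n ]} e = cong -[1+_] (ℕ.suc-injective (encNat-inj (List.∷-injectiveʳ e)))

   -- A word that ends in `true` has no leading zeros and is therefore the encoding of its own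
   -- value. This is why `point` has a fixed top bit.
   val-canon : ∀ (w : List Bool) → encNat (val (w ++ true ∷ [])) ≡ w ++ true ∷ []
   val-canon [] = refl
   val-canon (b ∷ w) = trans (step (b2n b + 2 * v) pos) (cong₂ _∷_ (hd b) (trans (cong encNat (tl b)) (val-canon w)))
     where
     v : ℕ
     v = val (w ++ true ∷ [])
     vpos : ∀ w → 1 ≤ val (w ++ true ∷ [])
     vpos [] = s≤s z≤n
     vpos (b ∷ w) = ℕ.≤-trans (ℕ.≤-trans (vpos w) (ℕ.m≤m+n _ _)) (ℕ.m≤n+m (2 * val (w ++ true ∷ [])) (b2n b))
     pos : 1 ≤ b2n b + 2 * v
     pos = vpos (b ∷ w)
     step : ∀ n → 1 ≤ n → encNat n ≡ ⌊ n % 2 ℕ.≟ 1 ⌋ ∷ encNat (n / 2)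
     step (suc n) _ = encNat-step n
     md : ∀ b → (b2n b + 2 * v) % 2 ≡ b2n b % 2
     md b = trans (cong (λ z → (b2n b + z) % 2) (ℕ.*-comm 2 v)) ([m+kn]%n≡m%n (b2n b) v 2)
     hd : ∀ b → ⌊ (b2n b + 2 * v) % 2 ℕ.≟ 1 ⌋ ≡ b
     hd b rewrite md b with b
     ... | true = refl
     ... | false = refl
     tl : ∀ b → (b2n b + 2 * v) / 2 ≡ v
     tl b = trans (cong (λ z → (b2n b + z) / 2) (ℕ.*-comm 2 v)) (trans (+-distrib-/-∣ʳ (b2n b) {v * 2} {2} (Data.Nat.Divisibility.divides-refl v)) (cong₂ _+_ (small b) (m*n/n≡m v 2)))
       where
       import Data.Nat.Divisibility
       small : ∀ b → b2n b / 2 ≡ 0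
       small true = refl
       small false = refl

   digits-sum : ∀ J n → n < 2 ^ J → sumN J (λ j → b2n (bitAt (encNat n) j) * 2 ^ j) ≡ n
   digits-sum zero zero _ = refl
   digits-sum zero (suc n) (s≤s ())
   digits-sum (suc J) zero _ = sumN≡0 (suc J) (λ j → b2n (bitAt (encNat 0) j) * 2 ^ j) (λ i _ → refl)
   digits-sum (suc J) (suc n) l = begin
     sumN (1 + J) F ≡⟨ sumN-split 1 J F ⟩
     (0 + b2n (bitAt (encNat (suc n)) 0) * 1) + sumN J (λ j → b2n (bitAt (encNat (suc n)) (suc j)) * 2 ^ suc j)
       ≡⟨ cong₂ _+_ (trans (ℕ.*-identityʳ _) (trans (cong (λ w → b2n (bitAt w 0)) (encNat-step n)) (bit≡ (suc n))))
            (trans (sumN-cong J (λ j _ → trans (cong (λ w → b2n (bitAt w (suc j)) * 2 ^ suc j) (encNat-step n)) (lem (b2n (bitAt (encNat (suc n / 2)) j)) (2 ^ j)))) (sumN-* J 2 _)) ⟩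
     suc n % 2 + 2 * sumN J (λ j → b2n (bitAt (encNat (suc n / 2)) j) * 2 ^ j) ≡⟨ cong (λ z → suc n % 2 + 2 * z) (digits-sum J (suc n / 2) half<2^) ⟩
     suc n % 2 + 2 * (suc n / 2) ≡⟨ trans (cong (λ z → suc n % 2 + z) (ℕ.*-comm 2 (suc n / 2))) (sym (m≡m%n+[m/n]*n (suc n) 2)) ⟩
     suc n ∎
     where
     open ≡-Reasoning
     F : ℕ → ℕ
     F j = b2n (bitAt (encNat (suc n)) j) * 2 ^ j
     lem : ∀ a b → a * (2 * b) ≡ 2 * (a * b)
     lem = NS.solve-∀
     half<2^ : suc n / 2 < 2 ^ J
     half<2^ = m<n*o⇒m/o<n (ℕ.<-≤-trans l (ℕ.≤-reflexive (ℕ.*-comm 2 (2 ^ J))))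

   enc1-spec : ∀ w (r : List Bool) → (List.concatMap (λ b → false ∷ b ∷ []) w ++ true ∷ true ∷ []) ++ r ≡ enc1 true false w r
   enc1-spec [] r = refl
   enc1-spec (b ∷ w) r = cong (λ z → false ∷ b ∷ z) (enc1-spec w r)

   encTuple≡ : ∀ ws → encTuple ws ≡ encAll true false ws
   encTuple≡ [] = refl
   encTuple≡ (w ∷ ws) = trans (enc1-spec w (encTuple ws)) (cong (enc1 true false w) (encTuple≡ ws))

   enc1-inj : ∀ w w' {r r' : List Bool} → enc1 true false w r ≡ enc1 true false w' r' → w ≡ w' × r ≡ r'
   enc1-inj [] [] refl = refl , refl
   enc1-inj [] (b ∷ w') ()
   enc1-inj (b ∷ w) [] ()
   enc1-inj (b ∷ w) (b' ∷ w') e with List.∷-injective (List.∷-injectiveʳ e)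
   ... | refl , e' with enc1-inj w w' e'
   ...   | refl , e'' = refl , e''

   encAll-inj : ∀ ws ws' → encAll true false ws ≡ encAll true false ws' → ws ≡ ws'
   encAll-inj [] [] e = refl
   encAll-inj [] ([] ∷ ws') ()
   encAll-inj [] ((b ∷ w) ∷ ws') ()
   encAll-inj ([] ∷ ws) [] ()
   encAll-inj ((b ∷ w) ∷ ws) [] ()
   encAll-inj (w ∷ ws) (w' ∷ ws') e with enc1-inj w w' e
   ... | refl , e' = cong (w ∷_) (encAll-inj ws ws' e')

   tail-inj : ∀ {u} (i i' : Vec ℤ u) j j' b b' →
     _≡_ {A = List (List Bool)} (List.map encInt (Vec.toList i) ++ (encNat j ∷ (b ∷ []) ∷ [])) (List.map encInt (Vec.toList i') ++ (encNat j' ∷ (b' ∷ []) ∷ [])) →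
     i ≡ i' × j ≡ j' × b ≡ b'
   tail-inj [] [] j j' b b' e = refl , encNat-inj (List.∷-injectiveˡ e) , List.∷-injectiveˡ (List.∷-injectiveˡ (List.∷-injectiveʳ e))
   tail-inj (x ∷ i) (x' ∷ i') j j' b b' e with tail-inj i i' j j' b b' (List.∷-injectiveʳ e)
   ... | refl , ej , eb = cong (_∷ i) (encInt-inj (List.∷-injectiveˡ e)) , ej , eb

   instance-all : ∀ n n' {u u'} (i : Vec ℤ u) (i' : Vec ℤ u') j j' b b' → encInstance n i j b ≡ encInstance n' i' j' b' →
     fields n i j b ≡ fields n' i' j' b'
   instance-all n n' i i' j j' b b' e = encAll-inj (fields n i j b) (fields n' i' j' b') (trans (sym (encTuple≡ (fields n i j b))) (trans e (encTuple≡ (fields n' i' j' b'))))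

   instance-n : ∀ n n' {u u'} (i : Vec ℤ u) (i' : Vec ℤ u') j j' b b' → encInstance n i j b ≡ encInstance n' i' j' b' → n ≡ n'
   instance-n n n' i i' j j' b b' e = trans (sym (List.length-replicate n {true})) (trans (cong List.length (List.∷-injectiveˡ (instance-all n n' i i' j j' b b' e))) (List.length-replicate n' {true}))

   instance-inj : ∀ n {u} (i i' : Vec ℤ u) j j' b b' → encInstance n i j b ≡ encInstance n i' j' b' → i ≡ i' × j ≡ j' × b ≡ b'
   instance-inj n i i' j j' b b' e = tail-inj i i' j j' b b' (List.∷-injectiveʳ (instance-all n n i i' j j' b b' e))

 module Oracle (u : ℕ → ℕ) (f : (n : ℕ) → Poly (u n)) (M : TM) (T : ℕ → ℕ)
   (dec : ∀ w → (EvalLang u f w → Config.state (runTM M (T (List.length w)) (initConf M w)) ≡ inj₂ true) ×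
                (¬ EvalLang u f w → Config.state (runTM M (T (List.length w)) (initConf M w)) ≡ inj₂ false)) where

   abstract
     -- Only instances that claim the bit `true` are asked. When the bit is `false`, injectivity of
     -- the encoding shows that the instance is outside the language.
     decides : ∀ n (i : Vec ℤ (u n)) j → let w = encInstance n i j true in
       Config.state (runTM M (T (List.length w)) (initConf M w)) ≡ inj₂ (bitOf (evalP (f n) i) j)
     decides n i j with bitOf (evalP (f n) i) j in eq
     ... | true = proj₁ (dec (encInstance n i j true)) (n , i , j , true , refl , eq)
     ... | false = proj₂ (dec (encInstance n i j true)) notIn
       where
       notIn : ¬ EvalLang u f (encInstance n i j true)
       notIn (n' , i' , j' , b' , e , eb) with instance-n n n' i i' j j' true b' e
       ... | refl with instance-inj n i i' j j' true b' e
       ...   | refl , refl , refl with trans (sym eq) eb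
       ...     | ()

   open Machine M

   module Input (n s : ℕ) where
     V : ℕ
     V = u n * s + s

     low : Fin (u n) → Fin s → Fin V
     low k t = Fin.combine k t ↑ˡ s
     jv : Fin s → Fin V
     jv t = u n * s ↑ʳ t

     -- The summand `2 ^ s` fixes the length of the encoding, so the input word has the same shape
     -- at all points.
     point : (Fin V → Bool) → Fin (u n) → ℕ
     point x k = num (λ t → x (low k t)) + 2 ^ s
     pts : (Fin V → Bool) → Vec ℤ (u n)
     pts x = Vec.tabulate (λ k → + point x k)

     intE : Fin (u n) → List (Exp V)
     intE k = 0# ∷ (List.tabulate (λ t → v# (low k t)) ++ o# ∷ [])

     jE : ℕ → List (Exp V)
     jE ℓ = List.take ℓ (List.tabulate (λ t → v# (jv t)))

     wordE : ℕ → List (Exp V)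
     wordE ℓ = encAll o# 0# (List.replicate n o# ∷ (List.tabulate intE ++ (jE ℓ ∷ (o# ∷ []) ∷ [])))

     bound : ℕ
     bound = (2 * n + 2) + (u n * (2 * (s + 2) + 2) + ((2 * s + 2) + 4))

     abstract
       enc1-map : ∀ {A B : Set} (g : A → B) t f w r → List.map g (enc1 t f w r) ≡ enc1 (g t) (g f) (List.map g w) (List.map g r)
       enc1-map g t f [] r = refl
       enc1-map g t f (b ∷ w) r = cong (λ z → g f ∷ g b ∷ z) (enc1-map g t f w r)

       encAll-map : ∀ {A B : Set} (g : A → B) t f ws → List.map g (encAll t f ws) ≡ encAll (g t) (g f) (List.map (List.map g) ws)
       encAll-map g t f [] = refl
       encAll-map g t f (w ∷ ws) = trans (enc1-map g t f w (encAll t f ws)) (cong (enc1 (g t) (g f) (List.map g w)) (encAll-map g t f ws))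

       enc1-len : ∀ {A : Set} (t f : A) w r → List.length (enc1 t f w r) ≡ (2 * List.length w + 2) + List.length r
       enc1-len t f [] r = refl
       enc1-len t f (b ∷ w) r = trans (cong (λ z → suc (suc z)) (enc1-len t f w r)) (lem (List.length w) (List.length r))
         where
         lem : ∀ a b → suc (suc ((2 * a + 2) + b)) ≡ (2 * suc a + 2) + b
         lem = NS.solve-∀

       all-len : ∀ {A : Set} (t f : A) {m} (g : Fin m → List A) b ws → (∀ k → List.length (g k) ≤ b) →
         List.length (encAll t f (List.tabulate g ++ ws)) ≤ m * (2 * b + 2) + List.length (encAll t f ws)
       all-len t f {zero} g b ws h = ℕ.≤-refl
       all-len t f {suc m} g b ws h = ℕ.≤-trans (ℕ.≤-reflexive (enc1-len t f (g Fin.zero) _))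
         (ℕ.≤-trans (ℕ.+-mono-≤ (ℕ.+-monoˡ-≤ 2 (ℕ.*-monoʳ-≤ 2 (h Fin.zero))) (all-len t f (λ k → g (Fin.suc k)) b ws (λ k → h (Fin.suc k))))
           (ℕ.≤-reflexive (sym (ℕ.+-assoc (2 * b + 2) (m * (2 * b + 2)) _))))

       word-len : ∀ ℓ → List.length (wordE ℓ) ≤ bound
       word-len ℓ = ℕ.≤-trans (ℕ.≤-reflexive (trans (enc1-len {Exp V} o# 0# (List.replicate n o#) _) (cong (λ z → (2 * z + 2) + List.length (encAll {Exp V} o# 0# (List.tabulate intE ++ (jE ℓ ∷ (o# ∷ []) ∷ [])))) (List.length-replicate n))))
         (ℕ.+-monoʳ-≤ (2 * n + 2) (ℕ.≤-trans (all-len o# 0# intE (s + 2) (jE ℓ ∷ (o# ∷ []) ∷ []) (λ k → ℕ.≤-reflexive (ilen k)))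
           (ℕ.+-monoʳ-≤ (u n * (2 * (s + 2) + 2)) (ℕ.≤-trans (ℕ.≤-reflexive (enc1-len {Exp V} o# 0# (jE ℓ) _)) (ℕ.+-monoˡ-≤ 4 (ℕ.+-monoˡ-≤ 2 (ℕ.*-monoʳ-≤ 2 jlen)))))))
         where
         ilen : ∀ k → List.length (intE k) ≡ s + 2
         ilen k = trans (cong suc (trans (List.length-++ (List.tabulate (λ t → v# {V} (low k t)))) (cong (_+ 1) (List.length-tabulate (λ t → v# {V} (low k t)))))) (sym (ℕ.+-suc s 1))
         jlen : List.length (jE ℓ) ≤ s
         jlen = ℕ.≤-trans (ℕ.≤-reflexive (List.length-take ℓ (List.tabulate (λ t → v# {V} (jv t))))) (ℕ.≤-trans (ℕ.m⊓n≤n ℓ _) (ℕ.≤-reflexive (List.length-tabulate (λ t → v# {V} (jv t)))))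

       enc1-all : ∀ {w r} → All (λ (e : Exp V) → nodes e ≤ 1) w → All (λ e → nodes e ≤ 1) r → All (λ e → nodes e ≤ 1) (enc1 o# 0# w r)
       enc1-all [] ar = z≤n ∷ z≤n ∷ ar
       enc1-all (l ∷ aw) ar = s≤s z≤n ∷ l ∷ enc1-all aw ar

       encAll-all : ∀ {ws} → All (All (λ (e : Exp V) → nodes e ≤ 1)) ws → All (λ e → nodes e ≤ 1) (encAll o# 0# ws)
       encAll-all [] = []
       encAll-all (a ∷ as) = enc1-all a (encAll-all as)

       vars-all : ∀ {m} (g : Fin m → Fin V) → All (λ e → nodes e ≤ 1) (List.tabulate (λ t → v# (g t)))
       vars-all g = All.tabulate⁺ {f = λ t → v# (g t)} (λ t → z≤n)

       int-all : ∀ k → All (λ e → nodes e ≤ 1) (intE k)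
       int-all k = s≤s z≤n ∷ All.++⁺ (vars-all (low k)) (z≤n ∷ [])

       word-nodes : ∀ ℓ → All (λ e → nodes e ≤ 1) (wordE ℓ)
       word-nodes ℓ = encAll-all {List.replicate n o# ∷ (List.tabulate intE ++ (jE ℓ ∷ (o# ∷ []) ∷ []))}
         (All.replicate⁺ n z≤n ∷ All.++⁺ {xs = List.tabulate intE} (All.tabulate⁺ {f = intE} int-all) (All.take⁺ ℓ (vars-all jv) ∷ (z≤n ∷ []) ∷ []))

       val-tab : ∀ {m} (b : Fin m → Bool) → val (List.tabulate b) ≡ num b
       val-tab {zero} b = refl
       val-tab {suc m} b = cong (λ z → b2n (b Fin.zero) + 2 * z) (val-tab (λ i → b (Fin.suc i)))

       val-tab1 : ∀ {m} (b : Fin m → Bool) → val (List.tabulate b ++ true ∷ []) ≡ num b + 2 ^ m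
       val-tab1 {zero} b = refl
       val-tab1 {suc m} b = trans (cong (λ z → b2n (b Fin.zero) + 2 * z) (val-tab1 (λ i → b (Fin.suc i)))) (lem (b2n (b Fin.zero)) (num (λ i → b (Fin.suc i))) (2 ^ m))
         where
         lem : ∀ a b c → a + 2 * (b + c) ≡ (a + 2 * b) + 2 * c
         lem = NS.solve-∀

       int-enc : ∀ x k → List.map (evE 𝔹A x) (intE k) ≡ encInt (+ point x k)
       int-enc x k = cong (false ∷_) (trans (List.map-++ (evE 𝔹A x) (List.tabulate (λ t → v# (low k t))) (o# ∷ [])) (trans (cong (_++ true ∷ []) (List.map-tabulate (λ t → v# (low k t)) (evE 𝔹A x)))
         (trans (sym (val-canon (List.tabulate (λ t → x (low k t))))) (cong encNat (val-tab1 (λ t → x (low k t)))))))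

       toList-tab : ∀ {A : Set} {m} (g : Fin m → A) → Vec.toList (Vec.tabulate g) ≡ List.tabulate g
       toList-tab {m = zero} g = refl
       toList-tab {m = suc m} g = cong (g Fin.zero ∷_) (toList-tab (λ k → g (Fin.suc k)))

       word-enc : ∀ x ℓ j → encNat j ≡ List.map (evE 𝔹A x) (jE ℓ) → List.map (evE 𝔹A x) (wordE ℓ) ≡ encInstance n (pts x) j true
       word-enc x ℓ j ej = trans (encAll-map (evE 𝔹A x) o# 0# (List.replicate n o# ∷ (List.tabulate intE ++ (jE ℓ ∷ (o# ∷ []) ∷ [])))) (trans (cong (encAll true false) lists) (sym (encTuple≡ (fields n (pts x) j true))))
         where
         lists : List.map (List.map (evE 𝔹A x)) (List.replicate n o# ∷ (List.tabulate intE ++ (jE ℓ ∷ (o# ∷ []) ∷ [])))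
               ≡ fields n (pts x) j true
         lists = cong₂ _∷_ (List.map-replicate (evE 𝔹A x) n o#) (trans (List.map-++ (List.map (evE 𝔹A x)) (List.tabulate intE) (jE ℓ ∷ (o# ∷ []) ∷ []))
           (cong₂ _++_ (trans (List.map-tabulate intE (List.map (evE 𝔹A x))) (trans (List.tabulate-cong (int-enc x)) (trans (sym (List.map-tabulate (λ k → + point x k) encInt)) (cong (List.map encInt) (sym (toList-tab (λ k → + point x k)))))))
             (cong₂ _∷_ (sym ej) refl)))

     module Run (Tb : ℕ) (Tb≥ : ∀ ℓ → T (List.length (wordE ℓ)) ≤ Tb) where
       open Window Tb using () renaming (m to mW)
       cost : ℕ
       cost = Tb * (mW * shanB k) + mW * 1

       lenCp : ∀ ℓ → Cp V (Fin 1) cost (λ x _ → oneHot (idx (Config.state (runTM M Tb (initConf M (List.map (evE 𝔹A x) (wordE ℓ)))))) (idx (inj₂ true)))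
       lenCp ℓ = Window.Start.accepts Tb (wordE ℓ) Tb ℕ.≤-refl (word-nodes ℓ)

       answer : (Fin V → Bool) → ℕ → Bool
       answer x j = bitOf (evalP (f n) (pts x)) j

       abstract
         oneHot-bit : ∀ b → oneHot (idx (inj₂ b)) (idx (inj₂ true)) ≡ b
         oneHot-bit true = oneHot-refl (idx (inj₂ true))
         oneHot-bit false = oneHot-≢ (idx (inj₂ false)) (idx (inj₂ true)) (λ e → absurd (trans (sym (stOf-idx (inj₂ false))) (trans (cong stOf e) (stOf-idx (inj₂ true)))))
           where
           absurd : _≡_ {A = St} (inj₂ false) (inj₂ true) → ⊥
           absurd ()

         len-ok : ∀ x ℓ j → encNat j ≡ List.map (evE 𝔹A x) (jE ℓ) →
           oneHot (idx (Config.state (runTM M Tb (initConf M (List.map (evE 𝔹A x) (wordE ℓ)))))) (idx (inj₂ true)) ≡ answer x j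
         len-ok x ℓ j ej = trans (cong (λ z → oneHot (idx z) (idx (inj₂ true))) (run-longer (T (List.length w)) Tb (initConf M w) (answer x j) le
             (subst (λ z → Config.state (runTM M (T (List.length z)) (initConf M z)) ≡ inj₂ (answer x j)) (sym (word-enc x ℓ j ej)) (decides n (pts x) j))))
           (oneHot-bit (answer x j))
           where
           w : List Bool
           w = List.map (evE 𝔹A x) (wordE ℓ)
           le : T (List.length w) ≤ Tb
           le = ℕ.≤-trans (ℕ.≤-reflexive (cong T (List.length-map (evE 𝔹A x) (wordE ℓ)))) (Tb≥ ℓ)

       muxE : Exp 3
       muxE = v# Fin.zero ⊗ v# (Fin.suc Fin.zero) ⊕ (o# ⊕ v# Fin.zero) ⊗ v# (Fin.suc (Fin.suc Fin.zero))

       prefix : (Fin V → Bool) → ℕ → ℕ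
       prefix x ℓ = val (List.map (evE 𝔹A x) (jE ℓ))

       -- Without leading zeros the length of the encoding of j varies, so there is one circuit for each length.
       upTo : ∀ ℓ → ℓ ≤ s → Cp V (Fin 1) (suc ℓ * (cost + 4)) (λ x _ → answer x (prefix x ℓ))
       upTo zero _ = cp-≤ (ℕ.≤-trans (ℕ.m≤m+n cost 4) (ℕ.m≤m+n _ 0)) (cp-eq (λ x _ → len-ok x 0 0 refl) (lenCp 0))
       upTo (suc ℓ) l = cp-≤ (ℕ.≤-reflexive (lem cost (suc ℓ * (cost + 4)))) (cp-eq ok (cp-seq (cp-par (upTo ℓ (ℕ.<⇒≤ l)) (cp-withIn (lenCp (suc ℓ)))) (cp-exp1 muxE ℕ.≤-refl) ω))
         where
         lem : ∀ c r → 4 + (c + r) ≡ (c + 4) + r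
         lem = NS.solve-∀
         t : Fin s
         t = Fin.fromℕ< l
         ω : Fin 3 → Fin 1 ⊎ (Fin 1 ⊎ Fin V)
         ω Fin.zero = inj₂ (inj₂ (jv t))
         ω (Fin.suc Fin.zero) = inj₂ (inj₁ Fin.zero)
         ω (Fin.suc (Fin.suc _)) = inj₁ Fin.zero
         abstract
           split : ∀ x → List.map (evE 𝔹A x) (jE (suc ℓ)) ≡ List.map (evE 𝔹A x) (jE ℓ) ++ x (jv t) ∷ []
           split x = trans (cong (List.map (evE 𝔹A x)) (trans (cong (λ z → List.take (suc z) (List.tabulate (λ t → v# {V} (jv t)))) (sym (Fin.toℕ-fromℕ< l)))
               (trans (List.take-suc-tabulate (λ t → v# {V} (jv t)) t) (cong (λ z → List.take z (List.tabulate (λ t → v# {V} (jv t))) ++ v# {V} (jv t) ∷ []) (Fin.toℕ-fromℕ< l)))))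
             (List.map-++ (evE 𝔹A x) (jE ℓ) (v# (jv t) ∷ []))
           val-0 : ∀ w → val (w ++ false ∷ []) ≡ val w
           val-0 [] = refl
           val-0 (b ∷ w) = cong (λ z → b2n b + 2 * z) (val-0 w)
           case : ∀ x b → x (jv t) ≡ b → (b ∧ oneHot (idx (Config.state (runTM M Tb (initConf M (List.map (evE 𝔹A x) (wordE (suc ℓ))))))) (idx (inj₂ true))) xor ((true xor b) ∧ answer x (prefix x ℓ)) ≡ answer x (prefix x (suc ℓ))
           case x true e = trans (xf (oneHot (idx (Config.state (runTM M Tb (initConf M (List.map (evE 𝔹A x) (wordE (suc ℓ))))))) (idx (inj₂ true)))) (len-ok x (suc ℓ) (prefix x (suc ℓ)) (trans (cong (λ z → encNat (val z)) (trans (split x) (cong (λ b → List.map (evE 𝔹A x) (jE ℓ) ++ b ∷ []) e))) (trans (val-canon (List.map (evE 𝔹A x) (jE ℓ))) (sym (trans (split x) (cong (λ b → List.map (evE 𝔹A x) (jE ℓ) ++ b ∷ []) e))))))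
             where
             xf : ∀ a → (a xor false) ≡ a
             xf true = refl
             xf false = refl
           case x false e = cong (answer x) (sym (trans (cong val (trans (split x) (cong (λ b → List.map (evE 𝔹A x) (jE ℓ) ++ b ∷ []) e))) (val-0 (List.map (evE 𝔹A x) (jE ℓ)))))
           ok : ∀ x (o : Fin 1) → evE 𝔹A (λ i → [ (λ _ → answer x (prefix x ℓ)) , [ (λ _ → oneHot (idx (Config.state (runTM M Tb (initConf M (List.map (evE 𝔹A x) (wordE (suc ℓ))))))) (idx (inj₂ true))) , x ] ] (ω i)) muxE ≡ answer x (prefix x (suc ℓ))
           ok x _ = case x (x (jv t)) refl

       abstract
         prefix-full : ∀ x → prefix x s ≡ num (λ t → x (jv t))
         prefix-full x = trans (cong (λ z → val (List.map (evE 𝔹A x) z)) (List.take-all s (List.tabulate (λ t → v# {V} (jv t))) (ℕ.≤-reflexive (List.length-tabulate (λ t → v# {V} (jv t))))))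
           (trans (cong val (List.map-tabulate (λ t → v# {V} (jv t)) (evE 𝔹A x))) (val-tab (λ t → x (jv t))))

       bitCp : Cp V (Fin 1) (suc s * (cost + 4)) (λ x _ → bitOf (evalP (f n) (pts x)) (num (λ t → x (jv t))))
       bitCp = cp-eq (λ x _ → cong (answer x) (prefix-full x)) (upTo s ℕ.≤-refl)

-- Residues of the value at the Kronecker point

module KroneckerResidues where
 open import Data.Nat using (_≤_; _<_; _+_; _*_; _∸_; _^_)
 open import Data.Nat.DivMod
 open import Data.Integer using (ℤ; +_; -[1+_]; ∣_∣)
 open import Data.List using ([]; _∷_)
 open Growth
 open Evaluation using (mon)
 open CircuitTools
 open SumClosure using (SumClosed)
 open Verification
 open BitArithmetic using (0#)
 open Counting
 open BoundedSearch
 open PrimeFamilies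
 open BitOracle
 open Residue using (%-mod)

 unitC : Ctx
 unitC = record { Dom = λ _ → ⊤ ; Ok = λ _ _ → ⊤ ; wid = λ _ → 0 ; widPB = PB-const 0 ; enc = λ _ _ () }

 abstract
   ∑-mod : ∀ {q} n {f g : ℕ → ℕ} → (∀ i → i < n → Mod q (+ f i) (+ g i)) → Mod q (+ sumN n f) (+ sumN n g)
   ∑-mod zero h = mod-refl refl
   ∑-mod (suc n) h = mod-op plus (∑-mod n (λ i l → h i (ℕ.m<n⇒m<1+n l))) (h n ℕ.≤-refl)

   mon-mod : ∀ {q v} (x y : Vec ℤ v) → (∀ k → Mod q (Vec.lookup x k) (Vec.lookup y k)) → ∀ m → Mod q (mon x m) (mon y m)
   mon-mod [] [] h [] = mod-refl refl
   mon-mod {q} (a ∷ x) (b ∷ y) h (i ∷ m) = mod-op times (pw i) (mon-mod x y (λ k → h (Fin.suc k)) m)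
     where
     pw : ∀ i → Mod q (a ℤ.^ i) (b ℤ.^ i)
     pw zero = mod-refl refl
     pw (suc i) = mod-op times (h Fin.zero) (pw i)

   evalP-mod : ∀ {q v} (f : Poly v) (x y : Vec ℤ v) → (∀ k → Mod q (Vec.lookup x k) (Vec.lookup y k)) → Mod q (evalP f x) (evalP f y)
   evalP-mod [] x y h = mod-refl refl
   evalP-mod ((m , c) ∷ f) x y h = mod-op plus (mod-op times (mod-refl {b = c} refl) (mon-mod x y h m)) (evalP-mod f x y h)

 abstract
   self≡0 : ∀ y → Mod (suc y) (+ suc y) (+ 0)
   self≡0 y = mod (+ 1) (trans (sym (ℤ.*-identityˡ (+ suc y))) (sym (ℤ.+-identityˡ (+ 1 ℤ.* + suc y))))

 module Residues (sumC : SumClosed) (u : ℕ → ℕ) (Pu : PB u) (f : (n : ℕ) → Poly (u n)) (M : TM) (T : ℕ → ℕ) (PT : PB T)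
   (dec : ∀ w → (EvalLang u f w → Config.state (runTM M (T (List.length w)) (initConf M w)) ≡ inj₂ true) ×
                (¬ EvalLang u f w → Config.state (runTM M (T (List.length w)) (initConf M w)) ≡ inj₂ false))
   (s r : ℕ → ℕ) (Ps : PB s) (Pr : PB r) (s+10≤r : ∀ n → 10 + s n ≤ r n) (ex : ∀ n → Fin (u n) → ℕ) (ex< : ∀ n k → ex n k < 2 ^ r n) where

   open Arith sumC s r Ps Pr s+10≤r public
   open NN using (L; PL; N; mkN; n-ren)
   module O = Oracle u f M T dec

   EC : Ctx
   EC = (unitC ▹) ▹⟨ r , Pr ⟩

   -- The low bits of the representative of 2 ^ e modulo suc y that has exactly s + 1 binary digits.
   lowF : ℕ → ℕ → ℕ → ℕ
   lowF S y e = ((2 ^ e) % suc y + (suc y ∸ S % suc y)) % suc y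

   opaque
     lowN : NB EC 1 (λ n ye → lowF (S n) (proj₂ (proj₁ ye)) (proj₂ ye))
     lowN = b-mod2 ℕ.≤-refl (b-+ (b-pow (b-num 2 (s≤s (s≤s z≤n))) (b-var {k = 1} (λ n → ℕ.≤-reflexive (sym (ℕ.+-identityʳ (r n))))) qq)
         (b-∸ (λ n x o → m%n≤n (S n) (suc (proj₂ (proj₁ x)))) qq (b-mod2 (s≤s z≤n) b-S qq))) qq
       where
       qq : NB EC 1 (λ n ye → suc (proj₂ (proj₁ ye)))
       qq = b-wk (sy# {unitC})

   BC2 : Ctx
   BC2 = (unitC ▹) ▹

   pt : ∀ n → ℕ → Fin (u n) → ℕ
   pt n y k = lowF (S n) y (ex n k) + 2 ^ s n

   value : ∀ n → ℕ → ℤ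
   value n y = evalP (f n) (Vec.tabulate (λ k → + pt n y k))

   zbit : ∀ n → ℕ → ℕ → ℕ
   zbit n y j = b2n (bitOf (value n y) j)

   c₀ : ℕ
   c₀ = proj₁ PT
   -- `T` need not be monotone. Its polynomial bound is, and at the longest input word it serves all
   -- lengths of the encoded position.
   bnd Tb : ℕ → ℕ
   bnd n = O.Input.bound n (s n)
   Tb n = (2 + bnd n) ^ c₀

   abstract
     Tb≥ : ∀ n ℓ → T (List.length (O.Input.wordE n (s n) ℓ)) ≤ Tb n
     Tb≥ n ℓ = ℕ.≤-trans (proj₂ PT _) (ℕ.^-monoˡ-≤ c₀ (ℕ.+-monoʳ-≤ 2 (O.Input.word-len n (s n) ℓ)))

     Pbnd : PB bnd
     Pbnd = PB-+ (PB-+ (PB-* (PB-const 2) PB-id) (PB-const 2)) (PB-+ (PB-* Pu (PB-+ (PB-* (PB-const 2) (PB-+ Ps (PB-const 2))) (PB-const 2))) (PB-+ (PB-+ (PB-* (PB-const 2) Ps) (PB-const 2)) (PB-const 4)))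

     PTb : PB Tb
     PTb = PB-^ (PB-+ (PB-const 2) Pbnd) c₀

     Pcost : PB (λ n → O.Input.Run.cost n (s n) (Tb n) (Tb≥ n))
     Pcost = PB-+ (PB-* PTb (PB-* Pm (PB-const _))) (PB-* Pm (PB-const 1))
       where
       Pm : PB (λ n → suc (TM.nQ M + 2) + (2 + (suc (Tb n) * 2 + suc (Tb n) * 2)))
       Pm = PB-+ (PB-const (suc (TM.nQ M + 2))) (PB-+ (PB-const 2) (PB-+ (PB-* (PB-suc PTb) (PB-const 2)) (PB-* (PB-suc PTb) (PB-const 2))))

   s≤L : ∀ n → s n ≤ L n
   s≤L n = ℕ.≤-trans (s≤r n) (ℕ.≤-trans (ℕ.m≤n*m (r n) 20) (ℕ.n≤1+n _))

   module Low = N (nn lowN)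

   sel₂ : ∀ {A B : Set} → (A → Bool) → (B → Bool) → A ⊎ B → Bool
   sel₂ g h = [ g , h ]

   lowIn : ∀ n → Fin (u n) → (Fin (0 + s n + s n) → Bool) → Fin (0 + s n + r n) → Bool
   lowIn n k x i = sel₂ (λ a → x (a ↑ˡ s n)) (toBits (r n) (ex n k)) (Fin.splitAt (0 + s n) i)

   lowB : ∀ n → Fin (u n) → (Fin (0 + s n + s n) → Bool) → Fin (s n) → Bool
   lowB n k x t = Low.fn n (lowIn n k x) (Fin.inject≤ t (s≤L n))

   -- The exponents of the Kronecker point are wired in as constants, which is legitimate because
   -- the circuit for each `n` is chosen separately.
   constE : ∀ n → Fin (u n) → Fin (r n) → Exp (0 + s n + s n)
   constE n k b = TuringCircuit.bitE (toBits (r n) (ex n k) b)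

   constB : ∀ n → Fin (u n) → (Fin (0 + s n + s n) → Bool) → Fin (r n) → Bool
   constB n k x b = evE 𝔹A x (constE n k b)

   constCp : ∀ n k → Cp (0 + s n + s n) (Fin (r n)) (r n * 1) (constB n k)
   constCp n k = cp-exp (r n) (constE n k) (λ b → TuringCircuit.bitE-nodes (toBits (r n) (ex n k) b))

   lowω : ∀ n → Fin (0 + s n + r n) → Fin (r n) ⊎ Fin (0 + s n + s n)
   lowω n i = [ (λ a → inj₂ (a ↑ˡ s n)) , inj₁ ] (Fin.splitAt (0 + s n) i)

   rawCp : ∀ n k → Cp (0 + s n + s n) (Fin (L n)) (Low.sz n + r n * 1) (λ x → Low.fn n (λ i → sel₂ (constB n k x) x (lowω n i)))
   rawCp n k = cp-seq (cp-withIn (constCp n k)) (Low.cpn n) (lowω n)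

   abstract
     lowω-ok : ∀ n k x i → sel₂ (constB n k x) x (lowω n i) ≡ lowIn n k x i
     lowω-ok n k x i = go (Fin.splitAt (0 + s n) i)
       where
       go : ∀ z → sel₂ (constB n k x) x ([ (λ a → inj₂ (a ↑ˡ s n)) , inj₁ ] z) ≡ sel₂ (λ a → x (a ↑ˡ s n)) (toBits (r n) (ex n k)) z
       go (inj₁ a) = refl
       go (inj₂ b) = TuringCircuit.bitE-ev (toBits (r n) (ex n k) b) x

     raw-ok : ∀ n k x o → Low.fn n (λ i → sel₂ (constB n k x) x (lowω n i)) o ≡ Low.fn n (lowIn n k x) o
     raw-ok n k x = NN.fn-cong (nn lowN) n {λ i → sel₂ (constB n k x) x (lowω n i)} {lowIn n k x} (lowω-ok n k x)

   lowCp : ∀ n k → Cp (0 + s n + s n) (Fin (s n)) (Low.sz n + r n * 1) (lowB n k)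
   lowCp n k = cp-map (λ t → Fin.inject≤ t (s≤L n)) (cp-eq {F' = λ x → Low.fn n (lowIn n k x)} (raw-ok n k) (rawCp n k))

   Src : ℕ → Set
   Src n = (Fin (u n) × Fin (s n)) ⊎ Fin (0 + s n + s n)

   allB : ∀ n → (Fin (0 + s n + s n) → Bool) → Src n → Bool
   allB n x = sel₂ (λ io → lowB n (proj₁ io) x (proj₂ io)) x

   allCp : ∀ n → Cp (0 + s n + s n) (Src n) (u n * (Low.sz n + r n * 1)) (allB n)
   allCp n = cp-withIn (cp-many (u n) (lowCp n))

   src : ∀ n → Fin (u n * s n) ⊎ Fin (s n) → Src n
   src n (inj₁ a) = inj₁ (Fin.remQuot {u n} (s n) a)
   src n (inj₂ t) = inj₂ ((0 + s n) ↑ʳ t)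

   wireIn : ∀ n → Fin (O.Input.V n (s n)) → Src n
   wireIn n i = src n (Fin.splitAt (u n * s n) i)

   zbitB : ∀ n → (Fin (0 + s n + s n) → Bool) → Bool
   zbitB n x = bitOf (evalP (f n) (O.Input.pts n (s n) (λ i → allB n x (wireIn n i)))) (num (λ t → allB n x (wireIn n (O.Input.jv n (s n) t))))

   zbitCp : ∀ n → Cp (0 + s n + s n) (Fin 1) (suc (s n) * (O.Input.Run.cost n (s n) (Tb n) (Tb≥ n) + 4) + u n * (Low.sz n + r n * 1)) (λ x _ → zbitB n x)
   zbitCp n = cp-seq (allCp n) (O.Input.Run.bitCp n (s n) (Tb n) (Tb≥ n)) (wireIn n)

   abstract
     encIn : ∀ n y j k i → lowIn n k (enc BC2 n ((tt , y) , j)) i ≡ enc EC n ((tt , y) , ex n k) i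
     encIn n y j k i = go (Fin.splitAt (0 + s n) i)
       where
       go : ∀ z → sel₂ (λ a → enc BC2 n ((tt , y) , j) (a ↑ˡ s n)) (toBits (r n) (ex n k)) z ≡ sel₂ (enc (unitC ▹) n (tt , y)) (toBits (r n) (ex n k)) z
       go (inj₁ a) = cong (sel₂ (enc (unitC ▹) n (tt , y)) (toBits (s n) j)) (Fin.splitAt-↑ˡ (0 + s n) a (s n))
       go (inj₂ b) = refl

     low< : ∀ n y k → y < 2 ^ s n → lowF (S n) y (ex n k) < 2 ^ s n
     low< n y k ly = ℕ.<-≤-trans (m%n<n ((2 ^ ex n k) % suc y + (suc y ∸ S n % suc y)) (suc y)) ly

     lowA : ∀ n y j k o → Low.fn n (lowIn n k (enc BC2 n ((tt , y) , j))) o ≡ Low.fn n (enc EC n ((tt , y) , ex n k)) o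
     lowA n y j k = NN.fn-cong (nn lowN) n {lowIn n k (enc BC2 n ((tt , y) , j))} {enc EC n ((tt , y) , ex n k)} (encIn n y j k)

     lowC : ∀ n y k t → y < 2 ^ s n → Low.fn n (enc EC n ((tt , y) , ex n k)) (Fin.inject≤ t (s≤L n)) ≡ toBits (s n) (lowF (S n) y (ex n k)) t
     lowC n y k t ly = NN.fn-low (nn lowN) n ((tt , y) , ex n k) ((tt , ly , tt) , ex< n k , tt) {s n} (s≤L n) (low< n y k ly) t

     low-ok : ∀ n y j k t → y < 2 ^ s n → j < 2 ^ s n → lowB n k (enc BC2 n ((tt , y) , j)) t ≡ toBits (s n) (lowF (S n) y (ex n k)) t
     low-ok n y j k t ly lj = trans (lowA n y j k (Fin.inject≤ t (s≤L n))) (lowC n y k t ly)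

     lowbit : ∀ n (x : Fin (0 + s n + s n) → Bool) k t → allB n x (wireIn n (O.Input.low n (s n) k t)) ≡ lowB n k x t
     lowbit n x k t = trans (cong (λ z → allB n x (src n z)) (Fin.splitAt-↑ˡ (u n * s n) (Fin.combine k t) (s n)))
       (cong (λ io → lowB n (proj₁ io) x (proj₂ io)) (Fin.remQuot-combine {u n} {s n} k t))

     jbit : ∀ n (x : Fin (0 + s n + s n) → Bool) t → allB n x (wireIn n (O.Input.jv n (s n) t)) ≡ x ((0 + s n) ↑ʳ t)
     jbit n x t = cong (λ z → allB n x (src n z)) (Fin.splitAt-↑ʳ (u n * s n) (s n) t)

     jenc : ∀ n y j t → enc BC2 n ((tt , y) , j) ((0 + s n) ↑ʳ t) ≡ toBits (s n) j t
     jenc n y j t = cong (sel₂ (enc (unitC ▹) n (tt , y)) (toBits (s n) j)) (Fin.splitAt-↑ʳ (0 + s n) (s n) t)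

     numLow : ∀ n y j k → y < 2 ^ s n → j < 2 ^ s n → num (λ t → allB n (enc BC2 n ((tt , y) , j)) (wireIn n (O.Input.low n (s n) k t))) ≡ lowF (S n) y (ex n k)
     numLow n y j k ly lj = trans (num-cong (λ t → trans (lowbit n (enc BC2 n ((tt , y) , j)) k t) (low-ok n y j k t ly lj))) (num-toBits< (s n) (lowF (S n) y (ex n k)) (low< n y k ly))

     numJ : ∀ n y j → j < 2 ^ s n → num (λ t → allB n (enc BC2 n ((tt , y) , j)) (wireIn n (O.Input.jv n (s n) t))) ≡ j
     numJ n y j lj = trans (num-cong (λ t → trans (jbit n (enc BC2 n ((tt , y) , j)) t) (jenc n y j t))) (num-toBits< (s n) j lj)

     zbit-ok : ∀ n y j → y < 2 ^ s n → j < 2 ^ s n → zbitB n (enc BC2 n ((tt , y) , j)) ≡ bitOf (value n y) j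
     zbit-ok n y j ly lj = cong₂ (λ p i → bitOf (evalP (f n) p) i) (Vec.tabulate-cong (λ k → cong (λ z → + (z + 2 ^ s n)) (numLow n y j k ly lj))) (numJ n y j lj)

   oneE : ∀ n → Fin (L n) → Exp 1
   oneE n Fin.zero = v# Fin.zero
   oneE n (Fin.suc _) = 0#

   abstract
     one-nodes : ∀ n i → nodes (oneE n i) ≤ 1
     one-nodes n Fin.zero = z≤n
     one-nodes n (Fin.suc i) = s≤s z≤n

     one-num : ∀ n b → num (λ i → evE 𝔹A (λ _ → b) (oneE n i)) ≡ b2n b
     one-num n b = trans (cong (λ z → b2n b + 2 * z) (BitArithmetic.num-false {L n ∸ 1} (λ _ → false) (λ _ → refl))) (ℕ.+-identityʳ (b2n b))

     b2n≤1 : ∀ b → b2n b ≤ 1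
     b2n≤1 true = s≤s z≤n
     b2n≤1 false = z≤n

   zSz : ℕ → ℕ
   zSz n = suc (s n) * (O.Input.Run.cost n (s n) (Tb n) (Tb≥ n) + 4) + u n * (Low.sz n + r n * 1)

   zFn : ∀ n → (Fin (0 + s n + s n) → Bool) → Fin (L n) → Bool
   zFn n x i = evE 𝔹A (λ _ → zbitB n x) (oneE n i)

   zCp : ∀ n → Cp (0 + s n + s n) (Fin (L n)) (L n * 1 + zSz n) (zFn n)
   zCp n = cp-seq {F = λ x _ → zbitB n x} {H = λ x i → evE 𝔹A x (oneE n i)} (zbitCp n) (cp-exp (L n) (oneE n) (one-nodes n)) (λ i → i)

   abstract
     PzSz : PB (λ n → L n * 1 + zSz n)
     PzSz = PB-+ {λ n → L n * 1} {zSz} (PB-* PL (PB-const 1)) (PB-+ {λ n → suc (s n) * (O.Input.Run.cost n (s n) (Tb n) (Tb≥ n) + 4)} {λ n → u n * (Low.sz n + r n * 1)}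
       (PB-* {λ n → suc (s n)} {λ n → O.Input.Run.cost n (s n) (Tb n) (Tb≥ n) + 4} (PB-suc Ps) (PB-+ Pcost (PB-const 4))) (PB-* Pu (PB-+ Low.szPB (PB-* Pr (PB-const 1)))))

     zSpec : ∀ n yj → Ok BC2 n yj → num (zFn n (enc BC2 n yj)) ≡ zbit n (proj₂ (proj₁ yj)) (proj₂ yj)
     zSpec n ((_ , y) , j) ok = trans (one-num n (zbitB n (enc BC2 n ((tt , y) , j)))) (cong b2n (zbit-ok n y j (proj₁ (proj₂ (proj₁ ok))) (proj₁ (proj₂ ok))))

   opaque
     zbitN : NB BC2 0 (λ n yj → zbit n (proj₂ (proj₁ yj)) (proj₂ yj))
     zbitN = nb (mkN (λ n → L n * 1 + zSz n) PzSz zFn zCp (λ n yj ok → mod-refl (cong +_ (zSpec n yj ok))))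
       (λ n yj ok → b2n≤1 (bitOf (value n (proj₂ (proj₁ yj))) (proj₂ yj)))

   -- Position 0 of `encInt` holds the sign, so bit j of the magnitude sits at position j + 1 and
   -- the weighted sum is twice the absolute value. Hence residues of 2 Z appear instead of those of
   -- Z; `z2` applies the sign.
   mag z2 : ∀ n → ℕ → ℕ
   mag n y = sumN (S n) (λ j → leN 1 j * (zbit n y j * ((2 ^ j) % suc y)))
   z2 n y = ((1 ∸ zbit n y 0) * (mag n y % suc y) + zbit n y 0 * (suc y ∸ mag n y % suc y)) % suc y

   opaque
     z2N : NB (unitC ▹) 1 (λ n y → z2 n (proj₂ y))
     z2N = b-mod2 ℕ.≤-refl (b-+ (b-* (b-∸ (λ n y _ → b2n≤1 (bitOf (value n (proj₂ y)) 0)) b-1 sg) m%) (b-* sg (b-∸ (λ n y _ → m%n≤n (mag n (proj₂ y)) (suc (proj₂ y))) (sy# {unitC}) m%))) (sy# {unitC})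
       where
       m% : NB (unitC ▹) 1 (λ n y → mag n (proj₂ y) % suc (proj₂ y))
       m% = b-mod2 ℕ.≤-refl (Σ# (b-* (b-le b-1 y#) (b-* zbitN (b-pow (b-num 2 (s≤s (s≤s z≤n))) y# (b-wk (sy# {unitC})))))) (sy# {unitC})
       sg : NB (unitC ▹) 0 (λ n y → zbit n (proj₂ y) 0)
       -- The sign is the bit at position 0, obtained by substituting the constant 0 for `j`.
       sg = nb (NN.n-let {P = λ _ _ _ → ⊤} s≤L (NN.n-const (λ _ → 0)) (λ n x o → ℕ.m^n>0 2 (s n)) (λ _ _ _ → tt) (nn zbitN)) (λ n y _ → b2n≤1 (bitOf (value n (proj₂ y)) 0))

   abstract
     -- The `S` positions include that of the sign, so the magnitude has to fit into S - 1 bits;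
     -- this is the factor 2 in the size condition.
     z2-spec : ∀ n y (Z : ℤ) → suc y ≤ S n → ∣ value n y ∣ * 2 < 2 ^ S n → Mod (suc y) (value n y) Z → Mod (suc y) (+ z2 n y) (+ 2 ℤ.* Z)
     z2-spec n y Z l small hZ = mod-trans (mod-trans (%-mod y _) (go (value n y) refl)) (mod-op times (mod-refl {b = + 2} refl) hZ)
       where
       magm : Mod (suc y) (+ mag n y) (+ (2 * ∣ value n y ∣))
       magm = mod-trans (∑-mod (S n) {λ j → leN 1 j * (zbit n y j * ((2 ^ j) % suc y))} {λ j → leN 1 j * (zbit n y j * 2 ^ j)} (λ j _ → mod-trans (mod-refl (pos3 (leN 1 j) (zbit n y j) ((2 ^ j) % suc y)))
           (mod-trans (mod-op times (mod-refl {b = + leN 1 j} refl) (mod-op times (mod-refl {b = + zbit n y j} refl) (%-mod y (2 ^ j)))) (mod-refl (sym (pos3 (leN 1 j) (zbit n y j) (2 ^ j)))))))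
         (mod-refl (cong +_ (full (S n) refl)))
         where
         pos3 : ∀ a b c → + (a * (b * c)) ≡ + a ℤ.* (+ b ℤ.* + c)
         pos3 a b c = trans (ℤ.pos-* a (b * c)) (cong (+ a ℤ.*_) (ℤ.pos-* b c))
         full : ∀ m → S n ≡ m → sumN m (λ j → leN 1 j * (zbit n y j * 2 ^ j)) ≡ 2 * ∣ value n y ∣
         full zero e = nonzero e
           where
           nonzero : ∀ {A : Set} → S n ≡ 0 → A
           nonzero e with ℕ.≤-trans (ℕ.m^n>0 2 (s n)) (ℕ.≤-reflexive e)
           ... | ()
         full (suc m) e = trans (sumN-split 1 m _) (trans (cong₂ _+_ (cong (_* (zbit n y 0 * 1)) (leN-no {1} {0} (s≤s z≤n)))
             (trans (sumN-cong m (λ j _ → trans (cong (_* (zbit n y (suc j) * 2 ^ suc j)) (leN-yes {1} {suc j} (s≤s z≤n))) (lem (zbit n y (suc j)) (2 ^ j)))) (sumN-* m 2 _)))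
             (cong (2 *_) (digits-sum m ∣ value n y ∣ (ℕ.*-cancelˡ-< 2 _ _ (ℕ.≤-trans (s≤s (ℕ.≤-reflexive (ℕ.*-comm 2 ∣ value n y ∣))) (ℕ.≤-trans small (ℕ.≤-reflexive (cong (2 ^_) e))))))))
           where
           lem : ∀ a b → 1 * (a * (2 * b)) ≡ 2 * (a * b)
           lem = NS.solve-∀
       m% : Mod (suc y) (+ (mag n y % suc y)) (+ 2 ℤ.* + ∣ value n y ∣)
       m% = mod-trans (%-mod y (mag n y)) (mod-trans magm (mod-refl (ℤ.pos-* 2 ∣ value n y ∣)))
       go : ∀ v → v ≡ value n y → Mod (suc y) (+ ((1 ∸ zbit n y 0) * (mag n y % suc y) + zbit n y 0 * (suc y ∸ mag n y % suc y))) (+ 2 ℤ.* value n y)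
       go (+ a) e rewrite sym (cong (λ v → b2n (bitOf v 0)) e) = mod-trans (mod-refl (cong +_ (trans (ℕ.+-identityʳ _) (ℕ.+-identityʳ (mag n y % suc y)))))
         (mod-trans m% (mod-refl (cong (+ 2 ℤ.*_) (trans (cong (λ v → + ∣ v ∣) (sym e)) e))))
       go -[1+ a ] e rewrite sym (cong (λ v → b2n (bitOf v 0)) e) = mod-trans (mod-refl (trans (cong +_ (ℕ.+-identityʳ (suc y ∸ mag n y % suc y))) (trans (sym (ℤ.⊖-≥ (m%n≤n (mag n y) (suc y)))) (sym (ℤ.m-n≡m⊖n (suc y) (mag n y % suc y))))))
         (mod-trans (mod-op minus (self≡0 y) m%)
           (mod-refl (trans (neg (+ ∣ value n y ∣)) (cong (+ 2 ℤ.*_) (trans (cong (λ v → ℤ.- (+ ∣ v ∣)) (sym e)) e)))))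
         where
         neg : ∀ a → + 0 ℤ.- + 2 ℤ.* a ≡ + 2 ℤ.* (ℤ.- a)
         neg = ZS.solve-∀

     point-mod : ∀ n y k → suc y ≤ S n → Mod (suc y) (+ pt n y k) (+ (2 ^ ex n k))
     point-mod n y k l = mod-trans (mod-op plus (mod-trans (%-mod y _) (mod-op plus (%-mod y (2 ^ ex n k)) (mod-trans (mod-refl (trans (sym (ℤ.⊖-≥ (m%n≤n (S n) (suc y)))) (sym (ℤ.m-n≡m⊖n (suc y) (S n % suc y)))))
         (mod-op minus (self≡0 y) (%-mod y (S n)))))) (mod-refl {b = + S n} refl))
       (mod-refl (lem (+ (2 ^ ex n k)) (+ S n)))
       where
       lem : ∀ a s → (a ℤ.+ (+ 0 ℤ.- s)) ℤ.+ s ≡ a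
       lem = ZS.solve-∀

-- Blocks of primes and the coefficients of the conversion

module BlockFamilies where
 open import Data.Nat using (_≤_; _<_; _+_; _*_; _∸_; _^_; _⊓_)
 open import Data.Nat.DivMod
 open import Data.Nat.Divisibility
 open import Data.Nat.Primality
 open import Data.Integer using (+_; ∣_∣)
 open Growth
 open SumClosure using (SumClosed)
 open Verification using (mod-refl; mod-trans; mod-op)
 open Counting
 open BoundedSearch
 open ModularPrimes
 open PrimeFamilies
 open KroneckerResidues using (unitC)
 open Residue
 open PrimeCount using (primeInd)
 open DigitConversion

 abstract
   rk≡ : ∀ S Y → Y ≤ S → rk S Y ≡ sumN Y (λ y → isPr S (suc y))
   rk≡ S Y l = trans (cong (λ z → sumN z (λ y' → leN (suc y') Y * isPr S (suc y'))) (sym (ℕ.m+[n∸m]≡n l)))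
     (trans (sumN-split Y (S ∸ Y) (λ y' → leN (suc y') Y * isPr S (suc y')))
       (trans (cong₂ _+_ (sumN-cong Y (λ i i<Y → trans (cong (_* isPr S (suc i)) (leN-yes i<Y)) (ℕ.+-identityʳ _)))
         (sumN≡0 (S ∸ Y) _ (λ i _ → cong (_* isPr S (suc (Y + i))) (leN-no (s≤s (ℕ.m≤m+n Y i))))))
         (ℕ.+-identityʳ _)))

   -- Of the first k odd primes, min(k, (i + 1) Lb) - min(k, i Lb) lie in block `i`. With the
   -- subtraction moved to the other side this goes through by induction on the range.
   block-count : ∀ S Lb i Y → Y ≤ S →
     sumN Y (mem S Lb i) + (sumN Y (λ y → isPr S (suc y)) ⊓ (i * Lb)) ≡ sumN Y (λ y → isPr S (suc y)) ⊓ (suc i * Lb)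
   block-count S Lb i zero l = refl
   block-count S Lb i (suc Y) l = go (isPr01 S (suc Y)) (leN-elim (i * Lb) (rk S Y)) (leN-elim (suc (rk S Y)) (suc i * Lb))
     where
     k c : ℕ
     k = sumN Y (λ y → isPr S (suc y))
     c = sumN Y (mem S Lb i)
     Yk : rk S Y ≡ k
     Yk = rk≡ S Y (ℕ.<⇒≤ l)
     ih : c + (k ⊓ (i * Lb)) ≡ k ⊓ (suc i * Lb)
     ih = block-count S Lb i Y (ℕ.<⇒≤ l)
     iL≤ : i * Lb ≤ suc i * Lb
     iL≤ = ℕ.m≤n+m (i * Lb) Lb
     g : ℕ
     g = isPr S (suc Y)
     go : g ≡ 0 ⊎ (g ≡ 1 × Prime (suc Y) × 3 ≤ suc Y) →
       ((i * Lb ≤ rk S Y × leN (i * Lb) (rk S Y) ≡ 1) ⊎ (rk S Y < i * Lb × leN (i * Lb) (rk S Y) ≡ 0)) →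
       ((suc (rk S Y) ≤ suc i * Lb × leN (suc (rk S Y)) (suc i * Lb) ≡ 1) ⊎ (suc i * Lb < suc (rk S Y) × leN (suc (rk S Y)) (suc i * Lb) ≡ 0)) →
       (c + mem S Lb i Y) + ((k + g) ⊓ (i * Lb)) ≡ (k + g) ⊓ (suc i * Lb)
     go (inj₁ e) _ _ = trans (cong₂ (λ m h → (c + m) + ((k + h) ⊓ (i * Lb))) (cong (_* (leN (i * Lb) (rk S Y) * leN (suc (rk S Y)) (suc i * Lb))) e) e)
       (trans (cong₂ (λ a b → a + (b ⊓ (i * Lb))) (ℕ.+-identityʳ c) (ℕ.+-identityʳ k)) (trans ih (cong (_⊓ (suc i * Lb)) (trans (sym (ℕ.+-identityʳ k)) (cong (λ z → k + z) (sym e))))))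
     go (inj₂ (e , _)) (inj₂ (lt , e1)) _ = trans (cong₂ (λ m h → (c + m) + ((k + h) ⊓ (i * Lb))) (mulʳ0 {b = isPr S (suc Y)} (cong (_* leN (suc (rk S Y)) (suc i * Lb)) e1)) e)
       (trans (cong₂ _+_ (ℕ.+-identityʳ c) (ℕ.m≤n⇒m⊓n≡m (ℕ.≤-trans (ℕ.≤-reflexive (ℕ.+-comm k 1)) k<)))
         (trans (sym (ℕ.+-assoc c k 1)) (trans (cong (_+ 1) (trans (cong (λ z → c + z) (sym (ℕ.m≤n⇒m⊓n≡m (ℕ.<⇒≤ k<)))) (trans ih (ℕ.m≤n⇒m⊓n≡m (ℕ.≤-trans (ℕ.<⇒≤ k<) iL≤)))))
           (trans (sym (ℕ.m≤n⇒m⊓n≡m (ℕ.≤-trans (ℕ.≤-trans (ℕ.≤-reflexive (ℕ.+-comm k 1)) k<) iL≤))) (cong (λ h → (k + h) ⊓ (suc i * Lb)) (sym e))))))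
       where
       k< : k < i * Lb
       k< = subst (_< i * Lb) Yk lt
     go (inj₂ (e , _)) (inj₁ (ge , e1)) (inj₁ (lt , e2)) = trans (cong₂ (λ m h → (c + m) + ((k + h) ⊓ (i * Lb))) (mul11 e (mul11 e1 e2)) e)
       (trans (cong (λ z → (c + 1) + z) (ℕ.m≥n⇒m⊓n≡n (ℕ.≤-trans ge' (ℕ.m≤m+n k 1))))
         (trans (lem c (i * Lb)) (trans (cong (_+ 1) (trans (cong (λ z → c + z) (sym (ℕ.m≥n⇒m⊓n≡n ge'))) (trans ih (ℕ.m≤n⇒m⊓n≡m (ℕ.<⇒≤ lt')))))
           (trans (sym (ℕ.m≤n⇒m⊓n≡m (ℕ.≤-trans (ℕ.≤-reflexive (ℕ.+-comm k 1)) lt'))) (cong (λ h → (k + h) ⊓ (suc i * Lb)) (sym e))))))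
       where
       lem : ∀ c d → (c + 1) + d ≡ (c + d) + 1
       lem = NS.solve-∀
       ge' : i * Lb ≤ k
       ge' = subst (i * Lb ≤_) Yk ge
       lt' : suc k ≤ suc i * Lb
       lt' = subst (λ z → suc z ≤ suc i * Lb) Yk lt
     go (inj₂ (e , _)) (inj₁ (ge , e1)) (inj₂ (s≤s gt , e2)) = trans (cong₂ (λ m h → (c + m) + ((k + h) ⊓ (i * Lb))) (mulʳ0 {b = isPr S (suc Y)} (mulʳ0 {b = leN (i * Lb) (rk S Y)} e2)) e)
       (trans (cong₂ _+_ (ℕ.+-identityʳ c) (ℕ.m≥n⇒m⊓n≡n (ℕ.≤-trans (ℕ.≤-trans iL≤ gt') (ℕ.m≤m+n k 1))))
         (trans (trans (cong (λ z → c + z) (sym (ℕ.m≥n⇒m⊓n≡n (ℕ.≤-trans iL≤ gt')))) (trans ih (ℕ.m≥n⇒m⊓n≡n gt')))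
           (trans (sym (ℕ.m≥n⇒m⊓n≡n (ℕ.≤-trans gt' (ℕ.m≤m+n k 1)))) (cong (λ h → (k + h) ⊓ (suc i * Lb)) (sym e)))))
       where
       gt' : suc i * Lb ≤ k
       gt' = subst (suc i * Lb ≤_) Yk gt

   block-size : ∀ S Lb i → suc i * Lb ≤ sumN S (λ y → isPr S (suc y)) → sumN S (mem S Lb i) ≡ Lb
   block-size S Lb i h = ℕ.+-cancelʳ-≡ (i * Lb) _ _ (trans (cong (λ z → sumN S (mem S Lb i) + z) (sym (ℕ.m≥n⇒m⊓n≡n (ℕ.≤-trans (ℕ.m≤n+m (i * Lb) Lb) h))))
     (trans (block-count S Lb i S ℕ.≤-refl) (ℕ.m≥n⇒m⊓n≡n h)))

   block-prod : ∀ S Lb i Y → 2 ^ sumN Y (mem S Lb i) ≤ prodN Y (λ y → sel (mem S Lb i y) (suc y))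
   block-prod S Lb i zero = ℕ.≤-refl
   block-prod S Lb i (suc Y) = ℕ.≤-trans (ℕ.≤-reflexive (ℕ.^-distribˡ-+-* 2 (sumN Y (mem S Lb i)) (mem S Lb i Y))) (ℕ.*-mono-≤ (block-prod S Lb i Y) (go (mem01 S Lb i Y)))
     where
     go : mem S Lb i Y ≡ 0 ⊎ (mem S Lb i Y ≡ 1 × Prime (suc Y) × 3 ≤ suc Y) → 2 ^ mem S Lb i Y ≤ sel (mem S Lb i Y) (suc Y)
     go (inj₁ e) = ℕ.≤-trans (ℕ.≤-reflexive (cong (2 ^_) e)) (ℕ.≤-reflexive (sym (sel-0 (suc Y) e)))
     go (inj₂ (e , _ , l3)) = ℕ.≤-trans (ℕ.≤-reflexive (cong (2 ^_) e)) (ℕ.≤-trans (ℕ.≤-trans (s≤s (s≤s z≤n)) l3) (ℕ.≤-reflexive (sym (sel-1 (suc Y) e))))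

   eqN-sum≤1 : ∀ Y c → sumN Y (λ y → eqN y c) ≤ 1
   eqN-sum≤1 zero c = z≤n
   eqN-sum≤1 (suc Y) c = go (Y ℕ.≟ c)
     where
     go : Dec (Y ≡ c) → sumN Y (λ y → eqN y c) + eqN Y c ≤ 1
     go (yes refl) = ℕ.≤-trans (ℕ.≤-reflexive (cong₂ _+_ (sumN≡0 Y _ (λ i l → eqN-≢ (λ e → ℕ.<-irrefl e l))) (eqN-refl {Y} refl))) ℕ.≤-refl
     go (no ne) = ℕ.≤-trans (ℕ.≤-reflexive (trans (cong (λ z → sumN Y (λ y → eqN y c) + z) (eqN-≢ ne)) (ℕ.+-identityʳ _))) (eqN-sum≤1 Y c)

   -- The prime 2, at `y` = 1, is the only one that `isPr` leaves out.
   odd-count : ∀ S → sumN S (λ y → primeInd (suc y)) ≤ sumN S (λ y → isPr S (suc y)) + 1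
   odd-count S = ℕ.≤-trans (mono S ℕ.≤-refl) (ℕ.≤-trans (ℕ.≤-reflexive (sumN-+ S (λ y → isPr S (suc y)) (λ y → eqN y 1))) (ℕ.+-monoʳ-≤ _ (eqN-sum≤1 S 1)))
     where
     pt : ∀ y → suc y ≤ S → primeInd (suc y) ≤ isPr S (suc y) + eqN y 1
     pt y l with prime? (suc y)
     ... | no _ = z≤n
     ... | yes p = go y l p
       where
       go : ∀ y → suc y ≤ S → Prime (suc y) → 1 ≤ isPr S (suc y) + eqN y 1
       go zero l p = ⊥-elim (¬prime[1] p)
       go (suc zero) l p = ℕ.≤-trans (ℕ.≤-reflexive (sym (eqN-refl {1} refl))) (ℕ.m≤n+m (eqN 1 1) (isPr S 2))
       go (suc (suc y)) l p = ℕ.≤-trans (ℕ.≤-reflexive (sym (isPr-yes S (suc (suc (suc y))) l (s≤s (s≤s (s≤s z≤n))) p))) (ℕ.m≤m+n _ _)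
     mono : ∀ Y → Y ≤ S → sumN Y (λ y → primeInd (suc y)) ≤ sumN Y (λ y → isPr S (suc y) + eqN y 1)
     mono zero l = z≤n
     mono (suc Y) l = ℕ.+-mono-≤ (mono Y (ℕ.<⇒≤ l)) (pt Y l)

   isPr⇒≤ : ∀ S q → isPr S q ≡ 1 → q ≤ S
   isPr⇒≤ S q e = go (leN-elim q S)
     where
     go : ((q ≤ S × leN q S ≡ 1) ⊎ (S < q × leN q S ≡ 0)) → q ≤ S
     go (inj₁ (l , _)) = l
     go (inj₂ (_ , e0)) = ⊥-elim (1≢0 e (cong (_* (leN 3 q * leN (sumN S (λ d → leN 2 d * (leN (suc d) q * sumN S (λ k → eqN (d * k) q)))) 0)) e0))

   lt⇒≤ : ∀ S Lb j y → lt S Lb j y ≡ 1 → suc y ≤ S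
   lt⇒≤ S Lb j y e = isPr⇒≤ S (suc y) (go (isPr01 S (suc y)))
     where
     go : isPr S (suc y) ≡ 0 ⊎ (isPr S (suc y) ≡ 1 × Prime (suc y) × 3 ≤ suc y) → isPr S (suc y) ≡ 1
     go (inj₁ e0) = ⊥-elim (1≢0 e (cong (_* leN (suc (rk S y)) (j * Lb)) e0))
     go (inj₂ (e1 , _)) = e1

 -- The exact, exponentially long integers of the correctness proof. Their counterparts ending in
 -- `M` are obtained by `prodm` modulo the prime at hand and agree with them as residues.
 cofP : ℕ → ℕ → ℕ → ℕ → ℕ
 cofP S Lb j y = prodN S (λ y' → sel (lt S Lb j y' * (1 ∸ eqN (suc y') (suc y))) (suc y'))

 blockP : ℕ → ℕ → ℕ → ℕ
 blockP S Lb i = prodN S (λ y → sel (mem S Lb i y) (suc y))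

 numP : ℕ → ℕ → ℕ → ℕ
 numP S Lb j = prodN j (λ i → blockP S Lb i + 1)

 -- Search takes the place of a modular inverse. The exponent of 2 is `suc j` because `z` will hold
 -- residues of 2 Z.
 coefP : ℕ → ℕ → (ℕ → ℕ) → ℕ → ℕ → ℕ
 coefP S Lb z j y = μ S (λ c → eqN ((c * (cofP S Lb j y * 2 ^ suc j)) % suc y) ((z y * numP S Lb j) % suc y))

 blockM cofM numM : ℕ → ℕ → ℕ → ℕ → ℕ
 blockM S Lb q' i = prodm S q' (λ y → sel (mem S Lb i y) (suc y))
 cofM S Lb j y = prodm S y (λ y' → sel (lt S Lb j y' * (1 ∸ eqN (suc y') (suc y))) (suc y'))
 numM S Lb j y = prodm S y (λ i → sel (leN (suc i) j) (blockM S Lb y i + 1))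

 coefM : ℕ → ℕ → ℕ → ℕ → ℕ → ℕ
 coefM S Lb zy j y = μ S (λ c → eqN ((c * ((cofM S Lb j y * (2 ^ suc j % suc y)) % suc y)) % suc y) ((zy * numM S Lb j y) % suc y))

 thetaM : ℕ → ℕ → (ℕ → ℕ) → ℕ → ℕ
 thetaM S Lb z j = sumN S (λ y → lt S Lb j y * ((16 * S * coefM S Lb (z y) j y) / suc y))

 abstract
   μ-cong : ∀ S {φ ψ : ℕ → ℕ} → (∀ y → φ y ≡ ψ y) → μ S φ ≡ μ S ψ
   μ-cong S h = sumN-cong S (λ y _ → cong (λ z → leN z 0) (sumN-cong S (λ y' _ → cong (leN y' y *_) (h y'))))

   -- `prodm` always runs over the whole range `S`, and `sel` cuts it down to the indices below `j`.
   prodN-range : ∀ S j (h : ℕ → ℕ) → j ≤ S → prodN S (λ i → sel (leN (suc i) j) (h i)) ≡ prodN j h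
   prodN-range S j h l = trans (cong (λ z → prodN z (λ i → sel (leN (suc i) j) (h i))) (sym (ℕ.m+[n∸m]≡n l))) (go (S ∸ j))
     where
     go : ∀ d → prodN (j + d) (λ i → sel (leN (suc i) j) (h i)) ≡ prodN j h
     go zero = trans (cong (λ z → prodN z (λ i → sel (leN (suc i) j) (h i))) (ℕ.+-identityʳ j)) (prodN-cong j (λ i i<j → sel-1 (h i) (leN-yes i<j)))
     go (suc d) = trans (cong (λ z → prodN z (λ i → sel (leN (suc i) j) (h i))) (ℕ.+-suc j d)) (trans (cong₂ _*_ (go d) (sel-0 (h (j + d)) (leN-no (s≤s (ℕ.m≤m+n j d))))) (ℕ.*-identityʳ _))

 module _ (S Lb : ℕ) (q' : ℕ) (pq : Prime (suc q')) (q≤S : suc q' ≤ S) where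
   open Prim q' pq using (≈-*; _≈_)
   abstract
     prodN-mod : ∀ Y {f g : ℕ → ℕ} → (∀ i → f i ≈ g i) → prodN Y f ≈ prodN Y g
     prodN-mod zero h = mod-refl refl
     prodN-mod (suc Y) {f} {g} h = ≈-* {prodN Y f} {prodN Y g} {f Y} {g Y} (prodN-mod Y h) (h Y)

     blockM-mod : ∀ i → blockM S Lb q' i ≈ blockP S Lb i
     blockM-mod i = mod-trans (mod-refl (cong +_ (prodm-spec S q' pq q≤S (λ y → sel (mem S Lb i y) (suc y))))) (%-mod q' (blockP S Lb i))

     cofM-mod : ∀ j → cofM S Lb j q' ≈ cofP S Lb j q'
     cofM-mod j = mod-trans (mod-refl (cong +_ (prodm-spec S q' pq q≤S (λ y' → sel (lt S Lb j y' * (1 ∸ eqN (suc y') (suc q'))) (suc y'))))) (%-mod q' (cofP S Lb j q'))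

     numM-mod : ∀ j → j ≤ S → numM S Lb j q' ≈ numP S Lb j
     numM-mod j l = mod-trans (mod-refl (cong +_ (prodm-spec S q' pq q≤S (λ i → sel (leN (suc i) j) (blockM S Lb q' i + 1)))))
       (mod-trans (%-mod q' (prodN S (λ i → sel (leN (suc i) j) (blockM S Lb q' i + 1)))) (mod-trans (mod-refl (cong +_ (prodN-range S j (λ i → blockM S Lb q' i + 1) l)))
         (prodN-mod j {λ i → blockM S Lb q' i + 1} {λ i → blockP S Lb i + 1} (λ i → mod-op plus (blockM-mod i) (mod-refl {b = + 1} refl)))))

     -- The two searches test equivalent congruences, so they stop at the same least solution.
     coefM≡ : ∀ z j → j ≤ S → coefM S Lb (z q') j q' ≡ coefP S Lb z j q'
     coefM≡ z j l = μ-cong S (λ c → cong₂ eqN (mod⇒% (lhs c)) (mod⇒% (≈-* {z q'} {z q'} {numM S Lb j q'} {numP S Lb j} (mod-refl refl) (numM-mod j l))))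
       where
       lhs : ∀ c → c * ((cofM S Lb j q' * (2 ^ suc j % suc q')) % suc q') ≈ c * (cofP S Lb j q' * 2 ^ suc j)
       lhs c = ≈-* {c} {c} {(cofM S Lb j q' * (2 ^ suc j % suc q')) % suc q'} {cofP S Lb j q' * 2 ^ suc j} (mod-refl refl)
         (mod-trans (%-mod q' (cofM S Lb j q' * (2 ^ suc j % suc q'))) (≈-* {cofM S Lb j q'} {cofP S Lb j q'} {2 ^ suc j % suc q'} {2 ^ suc j} (cofM-mod j) (%-mod q' (2 ^ suc j))))

     cof-unit : ∀ j → 3 ≤ suc q' → ¬ suc q' ∣ cofP S Lb j q' * 2 ^ suc j
     cof-unit j l3 d = go (euclidsLemma (cofP S Lb j q') (2 ^ suc j) pq d)
       where
       pow : ∀ k → ¬ suc q' ∣ 2 ^ k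
       pow zero d = ¬prime[1] (subst Prime (∣1⇒≡1 d) pq)
       pow (suc k) d with euclidsLemma 2 (2 ^ k) pq d
       ... | inj₁ d' = ℕ.<⇒≱ l3 (∣⇒≤ d')
       ... | inj₂ d' = pow k d'
       fac : ∀ y' → Dec (suc y' ≡ suc q') → lt S Lb j y' ≡ 0 ⊎ (lt S Lb j y' ≡ 1 × Prime (suc y') × 3 ≤ suc y') → ¬ suc q' ∣ sel (lt S Lb j y' * (1 ∸ eqN (suc y') (suc q'))) (suc y')
       fac y' (yes e) _ d = ¬prime[1] (subst Prime (∣1⇒≡1 (subst (suc q' ∣_) (sel-0 (suc y') (trans (cong (λ z → lt S Lb j y' * (1 ∸ z)) (eqN-refl e)) (ℕ.*-zeroʳ (lt S Lb j y')))) d)) pq)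
       fac y' (no ne) (inj₁ e0) d = ¬prime[1] (subst Prime (∣1⇒≡1 (subst (suc q' ∣_) (sel-0 (suc y') (cong (_* (1 ∸ eqN (suc y') (suc q'))) e0)) d)) pq)
       fac y' (no ne) (inj₂ (e1 , py , _)) d = ne (sym (prime∣prime pq py (subst (suc q' ∣_) (sel-1 (suc y') (trans (cong (λ z → lt S Lb j y' * (1 ∸ z)) (eqN-≢ ne)) (trans (ℕ.*-identityʳ _) e1))) d)))
       go : (suc q' ∣ cofP S Lb j q') ⊎ (suc q' ∣ 2 ^ suc j) → ⊥
       go (inj₂ d') = pow (suc j) d'
       go (inj₁ d') with prime∣prodN pq S (λ y' → sel (lt S Lb j y' * (1 ∸ eqN (suc y') (suc q'))) (suc y')) d'
       ... | y' , _ , d'' = fac y' (suc y' ℕ.≟ suc q') (lt01 S Lb j y') d''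

     coefP-spec : ∀ z j → 3 ≤ suc q' → coefP S Lb z j q' < suc q' × coefP S Lb z j q' * (cofP S Lb j q' * 2 ^ suc j) ≈ z q' * numP S Lb j
     coefP-spec z j l3 = go (solvable S q' pq q≤S (cofP S Lb j q' * 2 ^ suc j) ((z q' * numP S Lb j) % suc q') (cof-unit j l3) (m%n<n (z q' * numP S Lb j) (suc q')))
       where
       φ : ℕ → ℕ
       φ c = eqN ((c * (cofP S Lb j q' * 2 ^ suc j)) % suc q') ((z q' * numP S Lb j) % suc q')
       go : ∃[ c ] (c < suc q' × (c * (cofP S Lb j q' * 2 ^ suc j)) % suc q' ≡ (z q' * numP S Lb j) % suc q') →
         coefP S Lb z j q' < suc q' × coefP S Lb z j q' * (cofP S Lb j q' * 2 ^ suc j) ≈ z q' * numP S Lb j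
       go (c , l , e) = ℕ.≤-<-trans (proj₁ sp) l , %⇒mod (eqN≡1⇒ (proj₂ sp))
         where
         sp : μ S φ ≤ c × φ (μ S φ) ≢ 0
         sp = μ-spec S φ c (ℕ.<-≤-trans l q≤S) (1≢0 (eqN-refl e))

 module DigitFamily (sumC : SumClosed) (s r : ℕ → ℕ) (Ps : PB s) (Pr : PB r) (s+10≤r : ∀ n → 10 + s n ≤ r n)
   (z : ℕ → ℕ → ℕ) (zN : Arith.NB sumC s r Ps Pr s+10≤r (Arith._▹ sumC s r Ps Pr s+10≤r unitC) 1 (λ n y → z n (proj₂ y)))
   (Lb : ℕ → ℕ) (Lb≤ : ∀ n → Lb n ≤ 2 ^ (1 * r n)) where

   open Arith sumC s r Ps Pr s+10≤r public
   open NN using (n-ren)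

   opaque
     -- The residue depends on the last variable alone, so a renaming makes it available over every
     -- context.
     zX : ∀ {X : Ctx} → NB (X ▹) 1 (λ n xy → z n (proj₂ xy))
     zX {X} = nb (n-ren {unitC ▹} {X ▹} {λ n y → z n (proj₂ y)} (λ n xy → tt , proj₂ xy) (λ n i → wid X n ↑ʳ i) (λ n xy ok → tt , proj₂ ok)
         (λ n xy ok i → cong [ enc X n (proj₁ xy) , toBits (s n) (proj₂ xy) ] (Fin.splitAt-↑ʳ (wid X n) (s n) i)) (nn zN))
       (λ n xy ok → bd zN n (tt , proj₂ xy) (tt , proj₂ ok))

     le1 : ∀ {X : Ctx} {F : ∀ n → Dom X n → ℕ} → NB X 0 F → ∀ n x → Ok X n x → F n x ≤ 1
     le1 a n x o = bd a n x o

     b-block : ∀ {X : Ctx} {Q I : ∀ n → Dom X n → ℕ} → NB X 1 (λ n x → suc (Q n x)) → NB X 1 I → NB X 1 (λ n x → blockM (S n) (Lb n) (Q n x) (I n x))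
     b-block {X} {Q} {I} q i = b-prodm {X} {Q} {F} q f
       where
       M F : ∀ n → Dom X n × ℕ → ℕ
       M n xy = mem (S n) (Lb n) (I n (proj₁ xy)) (proj₂ xy)
       F n xy = sel (M n xy) (suc (proj₂ xy))
       m : NB (X ▹) 0 M
       m = b-mem {X ▹} {Lb} {λ n xy → I n (proj₁ xy)} {λ n xy → proj₂ xy} Lb≤ (b-wk i) (sy# {X}) (y# {X})
       f : NB (X ▹) 2 F
       f = b-sel {X ▹} {2} {M} {λ n xy → suc (proj₂ xy)} (le1 m) m (b-lift 2 (s≤s z≤n) (sy# {X}))

     b-cof : ∀ {X : Ctx} {J Y : ∀ n → Dom X n → ℕ} → NB X 2 J → NB X 1 (λ n x → suc (Y n x)) → NB X 1 (λ n x → cofM (S n) (Lb n) (J n x) (Y n x))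
     b-cof {X} {J} {Y} j sy = b-prodm {X} {Y} {F} sy f
       where
       M F : ∀ n → Dom X n × ℕ → ℕ
       M n xy = lt (S n) (Lb n) (J n (proj₁ xy)) (proj₂ xy) * (1 ∸ eqN (suc (proj₂ xy)) (suc (Y n (proj₁ xy))))
       F n xy = sel (M n xy) (suc (proj₂ xy))
       e : NB (X ▹) 0 (λ n xy → eqN (suc (proj₂ xy)) (suc (Y n (proj₁ xy))))
       e = b-eq (sy# {X}) (b-wk sy)
       m : NB (X ▹) 0 M
       m = b-* (b-lt {X ▹} {Lb} {2} {λ n xy → J n (proj₁ xy)} {λ n xy → proj₂ xy} Lb≤ (b-wk j) (sy# {X}) (y# {X})) (b-∸ (λ n x o → eqN≤1 (suc (proj₂ x)) (suc (Y n (proj₁ x)))) b-1 e)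
       f : NB (X ▹) 2 F
       f = b-sel {X ▹} {2} {M} {λ n xy → suc (proj₂ xy)} (le1 m) m (b-lift 2 (s≤s z≤n) (sy# {X}))

     b-numr : ∀ {X : Ctx} {J Y : ∀ n → Dom X n → ℕ} → NB X 2 J → NB X 1 (λ n x → suc (Y n x)) → NB X 1 (λ n x → numM (S n) (Lb n) (J n x) (Y n x))
     b-numr {X} {J} {Y} j sy = b-prodm {X} {Y} {F} sy f
       where
       M B F : ∀ n → Dom X n × ℕ → ℕ
       M n xy = leN (suc (proj₂ xy)) (J n (proj₁ xy))
       B n xy = blockM (S n) (Lb n) (Y n (proj₁ xy)) (proj₂ xy)
       F n xy = sel (M n xy) (B n xy + 1)
       m : NB (X ▹) 0 M
       m = b-le (b-suc (y# {X})) (b-wk j)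
       b : NB (X ▹) 1 B
       b = b-block {X ▹} {λ n xy → Y n (proj₁ xy)} {λ n xy → proj₂ xy} (b-wk sy) (y# {X})
       f : NB (X ▹) 2 F
       f = b-sel {X ▹} {2} {M} {λ n xy → B n xy + 1} (le1 m) m (b-+ b b-1)

     b-coef : ∀ {X : Ctx} {J : ∀ n → Dom X n → ℕ} → NB X 2 J → NB (X ▹) 1 (λ n xy → coefM (S n) (Lb n) (z n (proj₂ xy)) (J n (proj₁ xy)) (proj₂ xy))
     b-coef {X} {J} j = μ# {X ▹} {0} {λ n w → eqN (lhs n w) (rhs n (proj₁ w))} (b-eq {k = 1} {l = 1} lhsB (b-wk rhsB))
       where
       q : ∀ {Y} → NB (Y ▹) 1 (λ n xy → suc (proj₂ xy))
       q {Y} = sy# {Y}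
       j' : NB (X ▹) 2 (λ n xy → J n (proj₁ xy))
       j' = b-wk j
       inner rhs : ∀ n → Dom X n × ℕ → ℕ
       inner n xy = (cofM (S n) (Lb n) (J n (proj₁ xy)) (proj₂ xy) * (2 ^ suc (J n (proj₁ xy)) % suc (proj₂ xy))) % suc (proj₂ xy)
       rhs n xy = (z n (proj₂ xy) * numM (S n) (Lb n) (J n (proj₁ xy)) (proj₂ xy)) % suc (proj₂ xy)
       lhs : ∀ n → (Dom X n × ℕ) × ℕ → ℕ
       lhs n w = (proj₂ w * inner n (proj₁ w)) % suc (proj₂ (proj₁ w))
       pw : NB (X ▹) 1 (λ n xy → (2 ^ suc (J n (proj₁ xy))) % suc (proj₂ xy))
       pw = b-pow {X ▹} {3} {λ _ _ → 2} {λ n xy → suc (J n (proj₁ xy))} {λ n xy → proj₂ xy} (b-num 2 (s≤s (s≤s z≤n))) (b-suc j') (q {X})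
       innerB : NB (X ▹) 1 inner
       innerB = b-mod2 {X ▹} {2} {Q = λ n xy → proj₂ xy} ℕ.≤-refl (b-* (b-cof {X ▹} {λ n xy → J n (proj₁ xy)} {λ n xy → proj₂ xy} j' (q {X})) pw) (q {X})
       rhsB : NB (X ▹) 1 rhs
       rhsB = b-mod2 {X ▹} {2} {Q = λ n xy → proj₂ xy} ℕ.≤-refl (b-* (zX {X}) (b-numr {X ▹} {λ n xy → J n (proj₁ xy)} {λ n xy → proj₂ xy} j' (q {X}))) (q {X})
       lhsB : NB ((X ▹) ▹) 1 lhs
       lhsB = b-mod2 {(X ▹) ▹} {2} {Q = λ n w → proj₂ (proj₁ w)} ℕ.≤-refl (b-* (y# {X ▹}) (b-wk innerB)) (b-wk (q {X}))

     b-theta : ∀ {X : Ctx} {J : ∀ n → Dom X n → ℕ} → NB X 2 J → NB X 3 (λ n x → thetaM (S n) (Lb n) (z n) (J n x))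
     b-theta {X} {J} j = Σ# (b-* (b-lt {X ▹} {Lb} {2} {λ n xy → J n (proj₁ xy)} {λ n xy → proj₂ xy} Lb≤ (b-wk j) (sy# {X}) (y# {X}))
         (b-quo {X ▹} {2} {1} {num} {λ n xy → proj₂ xy} {p = tt} {q = tt} numB (sy# {X}) (λ n x o → ℕ.≤-trans (m/n≤m (num n x) (suc (proj₂ x))) (bd numB n x o))))
       where
       16S : NB (X ▹) 1 (λ n _ → 16 * S n)
       16S = b-const (λ n → 16 * S n) (λ n → ℕ.≤-trans (ℕ.*-monoˡ-≤ (S n) (ℕ.m≤m+n 16 1008)) (1024S≤ n))
       num : ∀ n → Dom X n × ℕ → ℕ
       num n xy = 16 * S n * coefM (S n) (Lb n) (z n (proj₂ xy)) (J n (proj₁ xy)) (proj₂ xy)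
       numB : NB (X ▹) 2 num
       numB = b-* 16S (b-coef j)

-- The digits as a family of circuits

module DigitFamilies where
 open import Data.Nat using (_≤_; _<_; _+_; _*_; _∸_; _^_)
 open import Data.Nat.DivMod
 open import Data.Nat.Divisibility using (∣⇒≤)
 open import Data.Nat.Primality
 open import Data.Integer using (ℤ; +_; ∣_∣)
 open Growth
 open SumClosure using (SumClosed)
 open Verification using (Mod; mod-refl; mod-trans; mod-op)
 open Counting
 open BoundedSearch
 open ModularPrimes
 open PrimeFamilies
 open KroneckerResidues using (unitC)
 open BlockFamilies
 open Residue
 open DigitConversion

 module Conversion (S J Lb : ℕ) (S≥1 : 1 ≤ S) (J≤S : suc J ≤ S) (Z : ℤ) (z : ℕ → ℕ)
   (zZ : ∀ y → suc y ≤ S → Mod (suc y) (+ z y) (+ 2 ℤ.* Z))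
   (blocks : J * Lb ≤ sumN S (λ y → isPr S (suc y)))
   (Xb1 : 16 * S * ∣ Z ∣ ≤ 2 ^ Lb) (Xb2 : 8 * 2 ^ J * ∣ Z ∣ ≤ 2 ^ Lb) where

   module H = HAB S J S≥1 Z (mem S Lb) (lt S Lb) (mem01 S Lb) (lt01 S Lb) (lt0 S Lb) (ltS S Lb) (coefP S Lb z)

   abstract
     V≡ : suc (ℕ.pred (16 * S)) ≡ 16 * S
     V≡ = ℕ.suc-pred (16 * S) {{ℕ.>-nonZero (ℕ.≤-trans S≥1 (ℕ.m≤n*m S 16))}}

     a≥ : ∀ i → i < J → 2 ^ Lb ≤ H.a i
     a≥ i l = ℕ.≤-trans (ℕ.≤-reflexive (cong (2 ^_) (sym (block-size S Lb i (ℕ.≤-trans (ℕ.*-monoˡ-≤ Lb l) blocks))))) (block-prod S Lb i S)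

     pick : ∀ j y → lt S Lb j y ≡ 1 → Prime (suc y) × 3 ≤ suc y
     pick j y e = go (lt01 S Lb j y)
       where
       go : lt S Lb j y ≡ 0 ⊎ (lt S Lb j y ≡ 1 × Prime (suc y) × 3 ≤ suc y) → Prime (suc y) × 3 ≤ suc y
       go (inj₁ e0) = ⊥-elim (1≢0 e e0)
       go (inj₂ (_ , p)) = p

     c< : ∀ j y → lt S Lb j y ≡ 1 → coefP S Lb z j y < suc y
     c< j y e = proj₁ (coefP-spec S Lb y (proj₁ (pick j y e)) (lt⇒≤ S Lb j y e) z j (proj₂ (pick j y e)))

     two-unit : ∀ q → 3 ≤ q → ¬ Mod q (+ 2) (+ 0)
     two-unit q l m = ℕ.<⇒≱ l (∣⇒≤ (mod0⇒∣ m))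

     -- The factor 2 common to 2 ^ (j + 1) and to 2 Z is cancelled modulo the odd prime.
     cong-c : ∀ j y → y < S → lt S Lb j y ≡ 1 → Mod (suc y) (+ (coefP S Lb z j y * (H.cof j y * 2 ^ j))) (Z ℤ.* + H.N' j)
     cong-c j y y<S e = mod-cancel (proj₁ (pick j y e)) (+ 2) _ _ (two-unit (suc y) (proj₂ (pick j y e)))
       (mod-trans (mod-refl (trans (sym (ℤ.pos-* 2 (coefP S Lb z j y * (H.cof j y * 2 ^ j)))) (cong +_ (l1 (coefP S Lb z j y) (H.cof j y) (2 ^ j)))))
         (mod-trans (proj₂ (coefP-spec S Lb y (proj₁ (pick j y e)) (lt⇒≤ S Lb j y e) z j (proj₂ (pick j y e))))
           (mod-trans (mod-refl (ℤ.pos-* (z y) (H.N' j))) (mod-trans (mod-op times (zZ y y<S) (mod-refl {b = + H.N' j} refl)) (mod-refl (ℤ.*-assoc (+ 2) Z (+ H.N' j)))))))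
       where
       l1 : ∀ c k p → 2 * (c * (k * p)) ≡ c * (k * (2 * p))
       l1 = NS.solve-∀

   module D = H.Digits (ℕ.pred (16 * S)) V≡ (2 ^ Lb) Xb1 Xb2 a≥ c< cong-c

   abstract
     theta≡ : ∀ j → j ≤ S → thetaM S Lb z j ≡ H.Θ j
     theta≡ j l = sumN-cong S (λ y _ → go y (lt01 S Lb j y))
       where
       go : ∀ y → lt S Lb j y ≡ 0 ⊎ (lt S Lb j y ≡ 1 × Prime (suc y) × 3 ≤ suc y) →
         lt S Lb j y * ((16 * S * coefM S Lb (z y) j y) / suc y) ≡ lt S Lb j y * ((16 * S * coefP S Lb z j y) / suc y)
       go y (inj₁ e) = trans (cong (_* ((16 * S * coefM S Lb (z y) j y) / suc y)) e) (cong (_* ((16 * S * coefP S Lb z j y) / suc y)) (sym e))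
       go y (inj₂ (e , p , _)) = cong (λ c → lt S Lb j y * ((16 * S * c) / suc y)) (coefM≡ S Lb y p (lt⇒≤ S Lb j y e) z j l)

 -- digitM is the signed digit plus 5 S, which makes it a natural number.
 roundM digitM : ℕ → ℕ → (ℕ → ℕ) → ℕ → ℕ
 roundM S Lb z j = (thetaM S Lb z j + 8 * S) / suc (ℕ.pred (16 * S))
 digitM S Lb z j = ((2 * thetaM S Lb z (suc j) + 8 * S + 16 * S * S) ∸ thetaM S Lb z j) / suc (ℕ.pred (16 * S)) + roundM S Lb z j + (4 * S ∸ 2 * roundM S Lb z (suc j))

 module _ (S J Lb : ℕ) (S≥1 : 1 ≤ S) (J≤S : suc J ≤ S) (Z : ℤ) (z : ℕ → ℕ)
   (zZ : ∀ y → suc y ≤ S → Mod (suc y) (+ z y) (+ 2 ℤ.* Z))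
   (blocks : J * Lb ≤ sumN S (λ y → isPr S (suc y)))
   (Xb1 : 16 * S * ∣ Z ∣ ≤ 2 ^ Lb) (Xb2 : 8 * 2 ^ J * ∣ Z ∣ ≤ 2 ^ Lb) where

   open Conversion S J Lb S≥1 J≤S Z z zZ blocks Xb1 Xb2

   partial : ℕ → ℤ
   partial = D.y

   abstract
     round≡ : ∀ j → j ≤ S → roundM S Lb z j ≡ D.R j
     round≡ j l = cong (λ t → (t + 8 * S) / suc (ℕ.pred (16 * S))) (theta≡ j l)

     digit≡ : ∀ j → suc j ≤ S → digitM S Lb z j ≡ D.dig j
     digit≡ j l = cong₂ _+_ (cong₂ _+_ (cong₂ (λ t t' → ((2 * t + 8 * S + 16 * S * S) ∸ t') / suc (ℕ.pred (16 * S))) (theta≡ (suc j) l) (theta≡ j (ℕ.<⇒≤ l)))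
       (round≡ j (ℕ.<⇒≤ l))) (cong (λ t → 4 * S ∸ 2 * t) (round≡ (suc j) l))

     thetaM≤ : ∀ j → j ≤ S → thetaM S Lb z j ≤ 16 * S * S
     thetaM≤ j l = ℕ.≤-trans (ℕ.≤-reflexive (theta≡ j l)) (D.Θ≤ j)

     roundM≤ : ∀ j → j ≤ S → 2 * roundM S Lb z j ≤ 4 * S
     roundM≤ j l = ℕ.≤-trans (ℕ.≤-reflexive (cong (2 *_) (round≡ j l))) (D.R≤ j)

     digitQuo≤ : ∀ j → suc j ≤ S → ((2 * thetaM S Lb z (suc j) + 8 * S + 16 * S * S) ∸ thetaM S Lb z j) / suc (ℕ.pred (16 * S)) ≤ 4 * S
     digitQuo≤ j l = ℕ.≤-trans (/-monoˡ-≤ (suc (ℕ.pred (16 * S))) (ℕ.≤-trans (ℕ.m∸n≤m _ (thetaM S Lb z j)) le)) (ℕ.≤-reflexive (trans (cong (_/ suc (ℕ.pred (16 * S))) (cong (4 * S *_) (sym V≡))) (m*n/n≡m (4 * S) (suc (ℕ.pred (16 * S))))))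
       where
       lem : ∀ S → 2 * (16 * S * S) + 8 * S * S + 16 * S * S + 8 * S * S ≡ 4 * S * (16 * S)
       lem = NS.solve-∀
       le : 2 * thetaM S Lb z (suc j) + 8 * S + 16 * S * S ≤ 4 * S * (16 * S)
       le = ℕ.≤-trans (ℕ.+-monoˡ-≤ (16 * S * S) (ℕ.+-mono-≤ (ℕ.*-monoʳ-≤ 2 (thetaM≤ (suc j) l)) (ℕ.m≤m*n (8 * S) S {{ℕ.>-nonZero S≥1}})))
         (ℕ.≤-trans (ℕ.m≤m+n _ (8 * S * S)) (ℕ.≤-reflexive (lem S)))

     digit-spec : ∀ j → j < J → + digitM S Lb z j ℤ.- + (5 * S) ≡ partial j ℤ.- + 2 ℤ.* partial (suc j)
     digit-spec j l = trans (cong (λ t → + t ℤ.- + (5 * S)) (digit≡ j (ℕ.≤-trans (ℕ.<⇒≤ (s≤s l)) J≤S))) (D.dig-spec j l)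

     partial-exact : ∀ j → j ≤ J → ∀ k → 8 * ∣ + (2 ^ j) ℤ.* k ℤ.- Z ∣ ≤ 2 ^ j → partial j ≡ k
     partial-exact j l k h = D.y-exact j l k h

 -- The bounds are parameters because they follow from the correctness of the conversion and not
 -- from the shape of the formulas. They make the truncated subtractions exact and keep the
 -- quotients at level 2.
 module DigitNB (sumC : SumClosed) (s r : ℕ → ℕ) (Ps : PB s) (Pr : PB r) (s+10≤r : ∀ n → 10 + s n ≤ r n)
   (z : ℕ → ℕ → ℕ) (zN : Arith.NB sumC s r Ps Pr s+10≤r (Arith._▹ sumC s r Ps Pr s+10≤r unitC) 1 (λ n y → z n (proj₂ y)))
   (Lb : ℕ → ℕ) (Lb≤ : ∀ n → Lb n ≤ 2 ^ (1 * r n)) (τ : ℕ → ℕ) (Pτ : PB τ)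
   (τ≤ : ∀ n → τ n ≤ 1 * r n)
   (θ≤ : ∀ n j → j ≤ 2 ^ τ n → thetaM (2 ^ s n) (Lb n) (z n) j ≤ 16 * 2 ^ s n * 2 ^ s n)
   (R≤ : ∀ n j → j ≤ 2 ^ τ n → 2 * roundM (2 ^ s n) (Lb n) (z n) j ≤ 4 * 2 ^ s n)
   (Q≤ : ∀ n j → j < 2 ^ τ n → ((2 * thetaM (2 ^ s n) (Lb n) (z n) (suc j) + 8 * 2 ^ s n + 16 * 2 ^ s n * 2 ^ s n) ∸ thetaM (2 ^ s n) (Lb n) (z n) j) / suc (ℕ.pred (16 * 2 ^ s n)) ≤ 4 * 2 ^ s n) where

   open DigitFamily sumC s r Ps Pr s+10≤r z zN Lb Lb≤

   X : Ctx
   X = unitC ▹⟨ τ , Pτ ⟩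

   Ix : ∀ n → Dom X n → ℕ
   Ix n x = proj₂ x

   opaque
     cS : ∀ c → c ≤ 1024 → NB X 1 (λ n _ → c * S n)
     cS c h = b-const (λ n → c * S n) (λ n → ℕ.≤-trans (ℕ.*-monoˡ-≤ (S n) h) (1024S≤ n))

     VB : NB X 1 (λ n _ → suc (ℕ.pred (16 * S n)))
     VB = b-cong (λ n _ _ → sym (ℕ.suc-pred (16 * S n) {{ℕ.>-nonZero (ℕ.≤-trans (ℕ.m^n>0 2 (s n)) (ℕ.m≤n*m (S n) 16))}})) (cS 16 (ℕ.m≤m+n 16 1008))

     iB : NB X 1 Ix
     iB = b-var {unitC} {τ} {Pτ} {k = 1} τ≤

     twoB : NB X 1 (λ _ _ → 2)
     twoB = b-num {X} 2 (s≤s (s≤s z≤n))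

     θB : NB X 3 (λ n x → thetaM (S n) (Lb n) (z n) (Ix n x))
     θB = b-theta {X} {Ix} (b-lift 2 (s≤s z≤n) iB)

     θ'B : NB X 3 (λ n x → thetaM (S n) (Lb n) (z n) (suc (Ix n x)))
     θ'B = b-theta {X} {λ n x → suc (Ix n x)} (b-suc iB)

     4S≤ : ∀ n → 4 * S n ≤ 2 ^ (2 * r n)
     4S≤ n = ℕ.≤-trans (ℕ.*-monoˡ-≤ (S n) (ℕ.m≤m+n 4 1020)) (ℕ.≤-trans (1024S≤ n) (lvl-mono {1} {2} n (s≤s z≤n)))

     roundB : ∀ (I : ∀ n → Dom X n → ℕ) → NB X 3 (λ n x → thetaM (S n) (Lb n) (z n) (I n x)) → (∀ n x → Ok X n x → I n x ≤ 2 ^ τ n) →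
       NB X 2 (λ n x → roundM (S n) (Lb n) (z n) (I n x))
     roundB I t l = b-quo {X} {4} {1} {λ n x → thetaM (S n) (Lb n) (z n) (I n x) + 8 * S n} {λ n _ → ℕ.pred (16 * S n)} {p = tt} {q = tt} (b-+ t (cS 8 (ℕ.m≤m+n 8 1016))) VB
       (λ n x o → ℕ.≤-trans (ℕ.m≤n*m _ 2) (ℕ.≤-trans (R≤ n (I n x) (l n x o)) (4S≤ n)))

     digitN : NB X 4 (λ n x → digitM (S n) (Lb n) (z n) (Ix n x))
     digitN = b-lift 4 ℕ.≤-refl (b-+ (b-+ quoB (roundB Ix θB (λ n x o → ℕ.<⇒≤ (proj₁ (proj₂ o)))))
         (b-∸ (λ n x o → R≤ n (suc (Ix n x)) (proj₁ (proj₂ o))) (cS 4 (ℕ.m≤m+n 4 1020)) (b-* twoB (roundB (λ n x → suc (Ix n x)) θ'B (λ n x o → proj₁ (proj₂ o))))))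
       where
       num : ∀ n → Dom X n → ℕ
       num n x = (2 * thetaM (S n) (Lb n) (z n) (suc (Ix n x)) + 8 * S n + 16 * S n * S n) ∸ thetaM (S n) (Lb n) (z n) (Ix n x)
       numB : NB X 6 num
       numB = b-∸ (λ n x o → ℕ.≤-trans (θ≤ n (Ix n x) (ℕ.<⇒≤ (proj₁ (proj₂ o)))) (ℕ.m≤n+m (16 * S n * S n) _))
         (b-+ (b-+ (b-* twoB θ'B) (cS 8 (ℕ.m≤m+n 8 1016))) (b-* (cS 16 (ℕ.m≤m+n 16 1008)) (b-S {X}))) θB
       quoB : NB X 2 (λ n x → num n x / suc (ℕ.pred (16 * S n)))
       quoB = b-quo {X} {6} {1} {num} {λ n _ → ℕ.pred (16 * S n)} {p = tt} {q = tt} numB VB (λ n x o → ℕ.≤-trans (Q≤ n (Ix n x) (proj₁ (proj₂ o))) (4S≤ n))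

-- Kronecker substitution and sums over digit positions

module KroneckerSums where
 open import Data.Nat using (_≤_; _<_; _∸_)
 open import Data.Nat.DivMod
 open import Data.Nat.Divisibility using (n∣m*n)
 open import Data.Integer using (ℤ; +_; _+_; _*_; -_; _-_; _^_; ∣_∣)
 import Data.Sum
 open import Data.Vec.Relation.Unary.All using (All; []; _∷_)
 open import Data.Sum using ([_,_]′)
 open Evaluation
 open SumClosure using (Σb-+; Σb-++)
 open Verification using (num; b2n)

 -- The product of those `W t` whose bit is set. The form 1 + b (W - 1) of a factor is polynomial in
 -- the bit and in the weight.
 wgt : ∀ {w} → (Fin w → ℤ) → Vec Bool w → ℤ
 wgt W [] = + 1
 wgt W (b ∷ ε) = (+ 1 + bool→ℤ b * (W Fin.zero - + 1)) * wgt (λ t → W (Fin.suc t)) ε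

 squares : ℤ → ∀ e → Fin e → ℤ
 squares y (suc e) Fin.zero = y
 squares y (suc e) (Fin.suc t) = squares (y * y) e t

 -- The number of bits of a digit position: `b` for the place inside a coefficient and `e` for the
 -- exponent of each variable.
 tau : ℕ → ℕ → ℕ → ℕ
 tau b e zero = b
 tau b e (suc v) = tau b e v ℕ.+ e

 weights : ∀ b e v → Vec ℤ v → Fin (tau b e v) → ℤ
 weights b e zero [] = squares (+ 2) b
 weights b e (suc v) (x ∷ xs) t = [ weights b e v xs , squares x e ]′ (Fin.splitAt (tau b e v) t)

 -- The number of exponent vectors with entries below 2 ^ e, hence of the coefficients packed into
 -- `Z`.
 span : ℕ → ℕ → ℕ
 span e zero = 1
 span e (suc v) = 2 ℕ.^ e ℕ.* span e v

 -- The exponent vector read in base 2 ^ e with its head as leading digit, in accordance with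
 -- `weights`, where the squares of the head occupy the top bits.
 index : ∀ e {v} → Vec ℕ v → ℕ
 index e [] = 0
 index e {suc v} (i ∷ m) = index e m ℕ.+ i ℕ.* span e v

 exponent : ∀ b e v → Fin v → ℕ
 exponent b e (suc v) Fin.zero = 2 ℕ.^ b ℕ.* span e v
 exponent b e (suc v) (Fin.suc k) = exponent b e v k

 kronecker : ∀ b e v → Vec ℤ v
 kronecker b e v = Vec.tabulate (λ k → + (2 ℕ.^ exponent b e v k))

 abstract
   span≥1 : ∀ e v → 1 ≤ span e v
   span≥1 e zero = ℕ.≤-refl
   span≥1 e (suc v) = ℕ.*-mono-≤ (ℕ.m^n>0 2 e) (span≥1 e v)

   2^tau : ∀ b e v → 2 ℕ.^ tau b e v ≡ 2 ℕ.^ b ℕ.* span e v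
   2^tau b e zero = sym (ℕ.*-identityʳ _)
   2^tau b e (suc v) = trans (ℕ.^-distribˡ-+-* 2 (tau b e v) e) (trans (cong (ℕ._* 2 ℕ.^ e) (2^tau b e v)) (lem (2 ℕ.^ b) (span e v) (2 ℕ.^ e)))
     where
     lem : ∀ b s e → b ℕ.* s ℕ.* e ≡ b ℕ.* (e ℕ.* s)
     lem = NS.solve-∀

   pos-2^ : ∀ n → + (2 ℕ.^ n) ≡ (+ 2) ^ n
   pos-2^ zero = refl
   pos-2^ (suc n) = trans (ℤ.pos-* 2 (2 ℕ.^ n)) (cong (λ z → + 2 * z) (pos-2^ n))

   pos-2^+ : ∀ m n → + (2 ℕ.^ (m ℕ.+ n)) ≡ + (2 ℕ.^ m) * + (2 ℕ.^ n)
   pos-2^+ m n = trans (cong +_ (ℕ.^-distribˡ-+-* 2 m n)) (ℤ.pos-* (2 ℕ.^ m) (2 ℕ.^ n))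

   sumZ-double : ∀ n (f : ℕ → ℤ) → sumZ (2 ℕ.* n) f ≡ sumZ n (λ i → f (2 ℕ.* i) + f (1 ℕ.+ 2 ℕ.* i))
   sumZ-double zero f = refl
   sumZ-double (suc n) f = trans (cong (λ z → sumZ z f) (ℕ.*-suc 2 n)) (trans (ℤ.+-assoc (sumZ (2 ℕ.* n) f) _ _) (cong (λ z → z + (f (2 ℕ.* n) + f (1 ℕ.+ 2 ℕ.* n))) (sumZ-double n f)))

   Σb-sumZ : ∀ w (f : ℕ → ℤ) → Σb w (λ a → f (num (Vec.lookup a))) ≡ sumZ (2 ℕ.^ w) f
   Σb-sumZ zero f = sym (ℤ.+-identityˡ (f 0))
   Σb-sumZ (suc w) f = trans (Σb-sumZ w (λ i → f (2 ℕ.* i) + f (1 ℕ.+ 2 ℕ.* i))) (sym (sumZ-double (2 ℕ.^ w) f))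

   Σb-* : ∀ p k (φ : Vec Bool p → ℤ) → Σb p (λ a → k * φ a) ≡ k * Σb p φ
   Σb-* zero k φ = refl
   Σb-* (suc p) k φ = trans (Σb-cong p (λ a → sym (ℤ.*-distribˡ-+ k (φ (false ∷ a)) (φ (true ∷ a))))) (Σb-* p k (λ a → φ (false ∷ a) + φ (true ∷ a)))

   Σb-swap : ∀ p d (φ : Vec Bool p → Vec Bool d → ℤ) → Σb p (λ a → Σb d (φ a)) ≡ Σb d (λ c → Σb p (λ a → φ a c))
   Σb-swap zero d φ = refl
   Σb-swap (suc p) d φ = trans (Σb-cong p (λ a → sym (Σb-+ d (φ (false ∷ a)) (φ (true ∷ a))))) (Σb-swap p d (λ a c → φ (false ∷ a) c + φ (true ∷ a) c))

   sumZ-grid : ∀ E K (g : ℕ → ℤ) → sumZ (E ℕ.* K) g ≡ sumZ E (λ i → sumZ K (λ k → g (k ℕ.+ i ℕ.* K)))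
   sumZ-grid zero K g = refl
   sumZ-grid (suc E) K g = trans (cong (λ z → sumZ z g) (ℕ.+-comm K (E ℕ.* K))) (trans (sumZ-split (E ℕ.* K) K g)
     (cong₂ _+_ (sumZ-grid E K g) (sumZ-cong K (λ k _ → cong g (ℕ.+-comm (E ℕ.* K) k)))))

   wgt-cong : ∀ {w} {W W' : Fin w → ℤ} → (∀ t → W t ≡ W' t) → ∀ ε → wgt W ε ≡ wgt W' ε
   wgt-cong h [] = refl
   wgt-cong h (b ∷ ε) = cong₂ (λ y z → (+ 1 + bool→ℤ b * (y - + 1)) * z) (h Fin.zero) (wgt-cong (λ t → h (Fin.suc t)) ε)

   wgt-++ : ∀ {p d} (A : Fin p → ℤ) (C : Fin d → ℤ) (a : Vec Bool p) (c : Vec Bool d) → wgt (λ t → [ A , C ]′ (Fin.splitAt p t)) (a Vec.++ c) ≡ wgt A a * wgt C c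
   wgt-++ A C [] c = sym (ℤ.*-identityˡ _)
   wgt-++ {suc p} A C (b ∷ a) c = trans (cong (λ z → h * z) (trans (wgt-cong shift (a Vec.++ c)) (wgt-++ (λ t → A (Fin.suc t)) C a c))) (sym (ℤ.*-assoc h _ _))
     where
     h : ℤ
     h = + 1 + bool→ℤ b * (A Fin.zero - + 1)
     join : ∀ t (w : Fin p ⊎ Fin _) → Fin.splitAt p t ≡ w → [ A , C ]′ (Fin.splitAt (suc p) (Fin.suc t)) ≡ [ (λ t → A (Fin.suc t)) , C ]′ w
     join t (inj₁ _) e = cong (λ w → [ A , C ]′ (Data.Sum.map₁ Fin.suc w)) e
     join t (inj₂ _) e = cong (λ w → [ A , C ]′ (Data.Sum.map₁ Fin.suc w)) e
     shift : ∀ t → [ A , C ]′ (Fin.splitAt (suc p) (Fin.suc t)) ≡ [ (λ t → A (Fin.suc t)) , C ]′ (Fin.splitAt p t)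
     shift t = join t (Fin.splitAt p t) refl

   wgt-squares : ∀ y {e} (ε : Vec Bool e) → wgt (squares y e) ε ≡ y ^ num (Vec.lookup ε)
   wgt-squares y [] = refl
   wgt-squares y (b ∷ ε) = trans (cong₂ _*_ (fac b) (trans (wgt-squares (y * y) ε) (sq (num (Vec.lookup ε))))) (sym (ℤ.^-distribˡ-+-* y (b2n b) (2 ℕ.* num (Vec.lookup ε))))
     where
     l0 : ∀ y → + 1 + + 0 * (y - + 1) ≡ + 1
     l0 = ZS.solve-∀
     l1 : ∀ y → + 1 + + 1 * (y - + 1) ≡ y * + 1
     l1 = ZS.solve-∀
     fac : ∀ b → + 1 + bool→ℤ b * (y - + 1) ≡ y ^ b2n b
     fac false = l0 y
     fac true = l1 y
     sq : ∀ n → (y * y) ^ n ≡ y ^ (2 ℕ.* n)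
     sq n = trans (cong (λ z → z ^ n) (cong (λ z → y * z) (sym (ℤ.*-identityʳ y)))) (ℤ.^-*-assoc y 2 n)

   num-++ : ∀ {p d} (a : Vec Bool p) (c : Vec Bool d) → num (Vec.lookup (a Vec.++ c)) ≡ num (Vec.lookup a) ℕ.+ 2 ℕ.^ p ℕ.* num (Vec.lookup c)
   num-++ [] c = sym (ℕ.+-identityʳ _)
   num-++ {suc p} (b ∷ a) c = trans (cong (λ z → b2n b ℕ.+ 2 ℕ.* z) (num-++ a c)) (lem (b2n b) (num (Vec.lookup a)) (2 ℕ.^ p) (num (Vec.lookup c)))
     where
     lem : ∀ b a p c → b ℕ.+ 2 ℕ.* (a ℕ.+ p ℕ.* c) ≡ b ℕ.+ 2 ℕ.* a ℕ.+ 2 ℕ.* p ℕ.* c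
     lem = NS.solve-∀

   -- Cutting a position into its bit fields turns the sum over positions into one over exponent
   -- vectors and places inside a coefficient. The product of the weights becomes the monomial times
   -- a power of 2.
   Σb-weights : ∀ b e v (x : Vec ℤ v) (g : ℕ → ℤ) → Σb (tau b e v) (λ ε → g (num (Vec.lookup ε)) * wgt (weights b e v x) ε) ≡
     box v (2 ℕ.^ e) (λ m → mon x m * sumZ (2 ℕ.^ b) (λ l → (+ 2) ^ l * g (l ℕ.+ 2 ℕ.^ b ℕ.* index e m)))
   Σb-weights b e zero [] g = trans (Σb-cong b (λ ε → trans (cong (λ z → g (num (Vec.lookup ε)) * z) (wgt-squares (+ 2) ε)) (ℤ.*-comm _ ((+ 2) ^ num (Vec.lookup ε)))))
     (trans (Σb-sumZ b (λ l → (+ 2) ^ l * g l)) (trans (sumZ-cong (2 ℕ.^ b) (λ l _ → cong (λ z → (+ 2) ^ l * g z) (sym (trans (cong (λ z → l ℕ.+ z) (ℕ.*-zeroʳ (2 ℕ.^ b))) (ℕ.+-identityʳ l))))) (sym (ℤ.*-identityˡ _))))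
   Σb-weights b e (suc v) (x ∷ xs) g = begin
     Σb ((tau b e v) ℕ.+ e) (λ ε → g (num (Vec.lookup ε)) * wgt (weights b e (suc v) (x ∷ xs)) ε) ≡⟨ Σb-++ (tau b e v) e _ ⟩
     Σb (tau b e v) (λ a → Σb e (λ c → g (num (Vec.lookup (a Vec.++ c))) * wgt (weights b e (suc v) (x ∷ xs)) (a Vec.++ c))) ≡⟨ Σb-swap (tau b e v) e _ ⟩
     Σb e (λ c → Σb (tau b e v) (λ a → g (num (Vec.lookup (a Vec.++ c))) * wgt (weights b e (suc v) (x ∷ xs)) (a Vec.++ c))) ≡⟨ Σb-cong e (λ c → inner c) ⟩
     Σb e (λ c → G (num (Vec.lookup c))) ≡⟨ Σb-sumZ e G ⟩
     sumZ (2 ℕ.^ e) G ≡⟨ sumZ-cong (2 ℕ.^ e) (λ i _ → trans (sym (box-* v (2 ℕ.^ e) (x ^ i) _)) (box-cong v (2 ℕ.^ e) (λ m _ → trans (sym (ℤ.*-assoc (x ^ i) (mon xs m) _))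
          (cong (λ z → x ^ i * mon xs m * z) (sumZ-cong (2 ℕ.^ b) (λ l _ → cong (λ z → (+ 2) ^ l * g z) (pos l i m))))))) ⟩
     box (suc v) (2 ℕ.^ e) (λ m → mon (x ∷ xs) m * sumZ (2 ℕ.^ b) (λ l → (+ 2) ^ l * g (l ℕ.+ 2 ℕ.^ b ℕ.* index e m))) ∎
     where
     open ≡-Reasoning
     G : ℕ → ℤ
     G i = x ^ i * box v (2 ℕ.^ e) (λ m → mon xs m * sumZ (2 ℕ.^ b) (λ l → (+ 2) ^ l * g ((l ℕ.+ 2 ℕ.^ b ℕ.* index e m) ℕ.+ 2 ℕ.^ (tau b e v) ℕ.* i)))
     shuffle : ∀ a b c → a * (b * c) ≡ c * (a * b)
     shuffle = ZS.solve-∀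
     inner : ∀ c → Σb (tau b e v) (λ a → g (num (Vec.lookup (a Vec.++ c))) * wgt (weights b e (suc v) (x ∷ xs)) (a Vec.++ c)) ≡ G (num (Vec.lookup c))
     inner c = trans (Σb-cong (tau b e v) (λ a → trans (cong₂ _*_ (cong g (num-++ a c)) (trans (wgt-++ (weights b e v xs) (squares x e) a c) (cong (λ z → wgt (weights b e v xs) a * z) (wgt-squares x c))))
         (shuffle (g (num (Vec.lookup a) ℕ.+ 2 ℕ.^ (tau b e v) ℕ.* num (Vec.lookup c))) (wgt (weights b e v xs) a) (x ^ num (Vec.lookup c)))))
       (trans (Σb-* (tau b e v) (x ^ num (Vec.lookup c)) _) (cong (λ z → x ^ num (Vec.lookup c) * z) (Σb-weights b e v xs (λ i → g (i ℕ.+ 2 ℕ.^ (tau b e v) ℕ.* num (Vec.lookup c))))))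
     pos : ∀ l i (m : Vec ℕ v) → (l ℕ.+ 2 ℕ.^ b ℕ.* index e m) ℕ.+ 2 ℕ.^ (tau b e v) ℕ.* i ≡ l ℕ.+ 2 ℕ.^ b ℕ.* (index e m ℕ.+ i ℕ.* span e v)
     pos l i m = trans (cong (λ z → (l ℕ.+ 2 ℕ.^ b ℕ.* index e m) ℕ.+ z ℕ.* i) (2^tau b e v)) (lem l (2 ℕ.^ b) (index e m) (span e v) i)
       where
       lem : ∀ l b k s i → (l ℕ.+ b ℕ.* k) ℕ.+ b ℕ.* s ℕ.* i ≡ l ℕ.+ b ℕ.* (k ℕ.+ i ℕ.* s)
       lem = NS.solve-∀

 -- Inverse to `index`: division by `span` reads the exponent vector off a position, so the
 -- coefficients become a sequence.
 coefAt : ∀ e v → (Vec ℕ v → ℤ) → ℕ → ℤ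
 coefAt e zero φ k = φ []
 coefAt e (suc v) φ k = coefAt e v (λ m → φ (_/_ k (span e v) {{ℕ.>-nonZero (span≥1 e v)}} ∷ m)) (_%_ k (span e v) {{ℕ.>-nonZero (span≥1 e v)}})

 abstract
   split-grid : ∀ i k K (K≥1 : 1 ≤ K) → k < K → _/_ (k ℕ.+ i ℕ.* K) K {{ℕ.>-nonZero K≥1}} ≡ i × _%_ (k ℕ.+ i ℕ.* K) K {{ℕ.>-nonZero K≥1}} ≡ k
   split-grid i k (suc K) K≥1 l = trans (+-distrib-/-∣ʳ k {n = i ℕ.* suc K} {suc K} (n∣m*n i)) (cong₂ ℕ._+_ (m<n⇒m/n≡0 l) (m*n/n≡m i (suc K))) ,
     trans ([m+kn]%n≡m%n k i (suc K)) (m<n⇒m%n≡m l)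

   coefAt-grid : ∀ e v φ i k → k < span e v → coefAt e (suc v) φ (k ℕ.+ i ℕ.* span e v) ≡ coefAt e v (λ m → φ (i ∷ m)) k
   coefAt-grid e v φ i k l = cong₂ (λ a c → coefAt e v (λ m → φ (a ∷ m)) c) (proj₁ (split-grid i k (span e v) (span≥1 e v) l)) (proj₂ (split-grid i k (span e v) (span≥1 e v) l))

   index< : ∀ e {v} (m : Vec ℕ v) → All (_< 2 ℕ.^ e) m → index e m < span e v
   index< e [] [] = ℕ.≤-refl
   index< e {suc v} (i ∷ m) (l ∷ h) = ℕ.<-≤-trans (ℕ.+-monoˡ-< (i ℕ.* span e v) (index< e m h)) (ℕ.*-monoˡ-≤ (span e v) l)

   coefAt-index : ∀ e {v} φ (m : Vec ℕ v) → All (_< 2 ℕ.^ e) m → coefAt e v φ (index e m) ≡ φ m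
   coefAt-index e φ [] [] = refl
   coefAt-index e {suc v} φ (i ∷ m) (l ∷ h) = trans (coefAt-grid e v φ i (index e m) (index< e m h)) (coefAt-index e (λ m → φ (i ∷ m)) m h)

   coefAt-sum : ∀ e v φ (h : ℕ → ℤ) → sumZ (span e v) (λ k → coefAt e v φ k * h k) ≡ box v (2 ℕ.^ e) (λ m → φ m * h (index e m))
   coefAt-sum e zero φ h = ℤ.+-identityˡ _
   coefAt-sum e (suc v) φ h = trans (sumZ-grid (2 ℕ.^ e) (span e v) _) (sumZ-cong (2 ℕ.^ e) (λ i _ → trans (sumZ-cong (span e v) (λ k l → cong (λ z → z * h (k ℕ.+ i ℕ.* span e v)) (coefAt-grid e v φ i k l)))
     (coefAt-sum e v (λ m → φ (i ∷ m)) (λ k → h (k ℕ.+ i ℕ.* span e v)))))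

   coefAt-bound : ∀ e v φ C → (∀ m → ∣ φ m ∣ ≤ C) → ∀ k → ∣ coefAt e v φ k ∣ ≤ C
   coefAt-bound e zero φ C h k = h []
   coefAt-bound e (suc v) φ C h k = coefAt-bound e v _ C (λ m → h _) _

   mon-kronecker : ∀ b e v (m : Vec ℕ v) → mon (kronecker b e v) m ≡ + (2 ℕ.^ (2 ℕ.^ b ℕ.* index e m))
   mon-kronecker b e zero [] = cong (λ z → + (2 ℕ.^ z)) (sym (ℕ.*-zeroʳ (2 ℕ.^ b)))
   mon-kronecker b e (suc v) (i ∷ m) = trans (cong₂ _*_ pw (mon-kronecker b e v m)) (trans (sym (pos-2^+ (B ℕ.* i) _)) (cong (λ z → + (2 ℕ.^ z)) (lem (2 ℕ.^ b) (span e v) i (index e m))))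
     where
     B : ℕ
     B = 2 ℕ.^ b ℕ.* span e v
     pw : (+ (2 ℕ.^ B)) ^ i ≡ + (2 ℕ.^ (B ℕ.* i))
     pw = trans (cong (λ z → z ^ i) (pos-2^ B)) (trans (ℤ.^-*-assoc (+ 2) B i) (sym (pos-2^ (B ℕ.* i))))
     lem : ∀ b s i k → b ℕ.* s ℕ.* i ℕ.+ b ℕ.* k ≡ b ℕ.* (k ℕ.+ i ℕ.* s)
     lem = NS.solve-∀

 -- When 2 ^ B exceeds the coefficients by a constant factor, the tail Σ_{β ≥ k} c_β 2 ^ (B (β ∸ k)) is the
 -- rounding of Z / 2 ^ (B k), so consecutive tails isolate the coefficients.
 module Tails (B K : ℕ) (c : ℕ → ℤ) (C : ℕ) (c≤ : ∀ k → ∣ c k ∣ ≤ C) (C≤ : 1 ℕ.+ 8 ℕ.* C ≤ 2 ℕ.^ B) where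
   low tail : ℕ → ℤ
   low k = sumZ k (λ β → c β * + (2 ℕ.^ (B ℕ.* β)))
   tail k = sumZ (K ∸ k) (λ i → c (k ℕ.+ i) * + (2 ℕ.^ (B ℕ.* i)))

   abstract
     -- The terms below a block boundary grow geometrically and amount to at most an eighth of the
     -- weight of that boundary. This is the tolerance that the rounding allows.
     low-bound : ∀ k → 8 ℕ.* ∣ low k ∣ ≤ 2 ℕ.^ (B ℕ.* k)
     low-bound zero = z≤n
     low-bound (suc k) = begin
       8 ℕ.* ∣ low k + c k * P ∣ ≤⟨ ℕ.*-monoʳ-≤ 8 (ℤ.∣i+j∣≤∣i∣+∣j∣ (low k) (c k * P)) ⟩
       8 ℕ.* (∣ low k ∣ ℕ.+ ∣ c k * P ∣) ≡⟨ cong (λ z → 8 ℕ.* (∣ low k ∣ ℕ.+ z)) (ℤ.∣i*j∣≡∣i∣*∣j∣ (c k) P) ⟩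
       8 ℕ.* (∣ low k ∣ ℕ.+ ∣ c k ∣ ℕ.* p) ≡⟨ ℕ.*-distribˡ-+ 8 ∣ low k ∣ _ ⟩
       8 ℕ.* ∣ low k ∣ ℕ.+ 8 ℕ.* (∣ c k ∣ ℕ.* p) ≤⟨ ℕ.+-mono-≤ (low-bound k) (ℕ.*-monoʳ-≤ 8 (ℕ.*-monoˡ-≤ p (c≤ k))) ⟩
       p ℕ.+ 8 ℕ.* (C ℕ.* p) ≡⟨ lem p C ⟩
       (1 ℕ.+ 8 ℕ.* C) ℕ.* p ≤⟨ ℕ.*-monoˡ-≤ p C≤ ⟩
       2 ℕ.^ B ℕ.* p ≡⟨ trans (sym (ℕ.^-distribˡ-+-* 2 B (B ℕ.* k))) (cong (2 ℕ.^_) (sym (ℕ.*-suc B k))) ⟩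
       2 ℕ.^ (B ℕ.* suc k) ∎
       where
       open ℕ.≤-Reasoning
       p : ℕ
       p = 2 ℕ.^ (B ℕ.* k)
       P : ℤ
       P = + p
       lem : ∀ p C → p ℕ.+ 8 ℕ.* (C ℕ.* p) ≡ (1 ℕ.+ 8 ℕ.* C) ℕ.* p
       lem = NS.solve-∀

     shift : ∀ k i → + (2 ℕ.^ (B ℕ.* (k ℕ.+ i))) ≡ + (2 ℕ.^ (B ℕ.* k)) * + (2 ℕ.^ (B ℕ.* i))
     shift k i = trans (cong (λ z → + (2 ℕ.^ z)) (ℕ.*-distribˡ-+ B k i)) (pos-2^+ (B ℕ.* k) (B ℕ.* i))

     low-tail : ∀ k → k ≤ K → low K ≡ low k + + (2 ℕ.^ (B ℕ.* k)) * tail k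
     low-tail k l = trans (cong low (sym (ℕ.m+[n∸m]≡n l))) (trans (sumZ-split k (K ∸ k) _) (cong (λ z → low k + z)
       (trans (sumZ-cong (K ∸ k) (λ i _ → trans (cong (λ z → c (k ℕ.+ i) * z) (shift k i)) (lem (c (k ℕ.+ i)) (+ (2 ℕ.^ (B ℕ.* k))) (+ (2 ℕ.^ (B ℕ.* i)))))) (sumZ-* (K ∸ k) (+ (2 ℕ.^ (B ℕ.* k))) _))))
       where
       lem : ∀ a b d → a * (b * d) ≡ b * (a * d)
       lem = ZS.solve-∀

     tail-step : ∀ k → k < K → tail k ≡ c k + + (2 ℕ.^ B) * tail (suc k)
     tail-step k l = trans (cong (λ z → sumZ z (λ i → c (k ℕ.+ i) * + (2 ℕ.^ (B ℕ.* i)))) (ℕ.+-∸-assoc 1 l)) (trans (sumZ-first (K ∸ suc k) _)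
       (cong₂ _+_ (trans (cong₂ (λ y z → c y * + (2 ℕ.^ z)) (ℕ.+-identityʳ k) (ℕ.*-zeroʳ B)) (ℤ.*-identityʳ (c k)))
         (trans (sumZ-cong (K ∸ suc k) (λ i _ → trans (cong₂ (λ y z → c y * z) (ℕ.+-suc k i) (trans (cong (λ z → + (2 ℕ.^ z)) (ℕ.*-suc B i)) (pos-2^+ B (B ℕ.* i))))
             (lem (c (suc k ℕ.+ i)) (+ (2 ℕ.^ B)) (+ (2 ℕ.^ (B ℕ.* i)))))) (sumZ-* (K ∸ suc k) (+ (2 ℕ.^ B)) _))))
       where
       lem : ∀ a b d → a * (b * d) ≡ b * (a * d)
       lem = ZS.solve-∀

     tail-near : ∀ k → k ≤ K → 8 ℕ.* ∣ + (2 ℕ.^ (B ℕ.* k)) * tail k - low K ∣ ≤ 2 ℕ.^ (B ℕ.* k)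
     tail-near k l = ℕ.≤-trans (ℕ.≤-reflexive (cong (8 ℕ.*_) (trans (cong ∣_∣ (trans (cong (λ z → + (2 ℕ.^ (B ℕ.* k)) * tail k - z) (low-tail k l)) (lem (+ (2 ℕ.^ (B ℕ.* k)) * tail k) (low k)))) (ℤ.∣-i∣≡∣i∣ (low k))))) (low-bound k)
       where
       lem : ∀ a b → a - (b + a) ≡ - b
       lem = ZS.solve-∀

   module _ (y d : ℕ → ℤ) (exact : ∀ j → j ≤ B ℕ.* K → ∀ k → 8 ℕ.* ∣ + (2 ℕ.^ j) * k - low K ∣ ≤ 2 ℕ.^ j → y j ≡ k)
     (diff : ∀ j → j < B ℕ.* K → d j ≡ y j - + 2 * y (suc j)) where
     abstract
       -- Whatever values `y` takes in between, a run of signed digits depends only on `y` at its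
       -- two ends. Exactness at the block boundaries therefore determines the coefficient.
       telescope : ∀ a n → a ℕ.+ n ≤ B ℕ.* K → sumZ n (λ l → (+ 2) ^ l * d (l ℕ.+ a)) ≡ y a - (+ 2) ^ n * y (n ℕ.+ a)
       telescope a zero l = lem (y a)
         where
         lem : ∀ a → + 0 ≡ a - + 1 * a
         lem = ZS.solve-∀
       telescope a (suc n) l = trans (cong₂ (λ p q → p + (+ 2) ^ n * q) (telescope a n (ℕ.≤-trans (ℕ.+-monoʳ-≤ a (ℕ.n≤1+n n)) l)) (diff (n ℕ.+ a) (ℕ.≤-trans (ℕ.≤-reflexive (ℕ.+-comm (suc n) a)) l)))
         (lem (y a) ((+ 2) ^ n) (y (n ℕ.+ a)) (y (suc n ℕ.+ a)))
         where
         lem : ∀ a p q r → (a - p * q) + p * (q - + 2 * r) ≡ a - (+ 2 * p) * r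
         lem = ZS.solve-∀

       extract-coef : ∀ k → k < K → sumZ B (λ l → (+ 2) ^ l * d (l ℕ.+ B ℕ.* k)) ≡ c k
       extract-coef k l = trans (telescope (B ℕ.* k) B (ℕ.≤-trans (ℕ.≤-reflexive (trans (ℕ.+-comm (B ℕ.* k) B) (sym (ℕ.*-suc B k)))) (ℕ.*-monoʳ-≤ B l)))
         (trans (cong₂ (λ p q → p - q) (exact (B ℕ.* k) (ℕ.*-monoʳ-≤ B (ℕ.<⇒≤ l)) (tail k) (tail-near k (ℕ.<⇒≤ l)))
           (cong₂ _*_ (sym (pos-2^ B)) (trans (cong y (sym (ℕ.*-suc B k))) (exact (B ℕ.* suc k) (ℕ.*-monoʳ-≤ B l) (tail (suc k)) (tail-near (suc k) l)))))
         (trans (cong (λ z → z - + (2 ℕ.^ B) * tail (suc k)) (tail-step k l)) (lem (c k) (+ (2 ℕ.^ B) * tail (suc k)))))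
         where
         lem : ∀ a b → (a + b) - b ≡ a
         lem = ZS.solve-∀

 module Formula {v : ℕ} (f : Poly v) (b e C : ℕ) (bounded : BoundedExp (2 ℕ.^ e) f) (c≤ : ∀ m → ∣ coeff f m ∣ ≤ C) (C≤ : 1 ℕ.+ 8 ℕ.* C ≤ 2 ℕ.^ (2 ℕ.^ b)) where
   c : ℕ → ℤ
   c = coefAt e v (coeff f)
   open Tails (2 ℕ.^ b) (span e v) c C (coefAt-bound e v (coeff f) C c≤) C≤

   Z : ℤ
   Z = evalP f (kronecker b e v)

   abstract
     Z≡low : Z ≡ low (span e v)
     Z≡low = trans (evalP-box f (2 ℕ.^ e) bounded (kronecker b e v)) (trans (box-cong v (2 ℕ.^ e) (λ m _ → cong (λ z → coeff f m * z) (mon-kronecker b e v m)))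
       (sym (coefAt-sum e v (coeff f) (λ k → + (2 ℕ.^ (2 ℕ.^ b ℕ.* k))))))

     Z-bound : ∣ Z ∣ ≤ 2 ℕ.^ (2 ℕ.^ tau b e v)
     Z-bound = ℕ.≤-trans (ℕ.m≤n*m ∣ Z ∣ 8) (ℕ.≤-trans (ℕ.≤-reflexive (cong (λ z → 8 ℕ.* ∣ z ∣) Z≡low)) (ℕ.≤-trans (low-bound (span e v)) (ℕ.≤-reflexive (cong (2 ℕ.^_) (sym (2^tau b e v))))))

     evalP-digits : (y d : ℕ → ℤ) → (∀ j → j ≤ 2 ℕ.^ tau b e v → ∀ k → 8 ℕ.* ∣ + (2 ℕ.^ j) * k - Z ∣ ≤ 2 ℕ.^ j → y j ≡ k) →
       (∀ j → j < 2 ℕ.^ tau b e v → d j ≡ y j - + 2 * y (suc j)) →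
       ∀ x → evalP f x ≡ Σb (tau b e v) (λ ε → d (num (Vec.lookup ε)) * wgt (weights b e v x) ε)
     evalP-digits y d exact diff x = trans (evalP-box f (2 ℕ.^ e) bounded x) (sym (trans (Σb-weights b e v x d) (box-cong v (2 ℕ.^ e) (λ m h →
       trans (cong (λ z → mon x m * z) (trans (extract-coef y d (λ j l k n → exact j (ℕ.≤-trans l (ℕ.≤-reflexive (sym (2^tau b e v)))) k (subst (λ z → 8 ℕ.* ∣ + (2 ℕ.^ j) * k - z ∣ ≤ 2 ℕ.^ j) (sym Z≡low) n))
           (λ j l → diff j (ℕ.<-≤-trans l (ℕ.≤-reflexive (sym (2^tau b e v))))) (index e m) (index< e m h)) (coefAt-index e (coeff f) m h)))
         (ℤ.*-comm (mon x m) (coeff f m))))))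

 abstract
   box-bound : ∀ e v φ D → (∀ m → All (_< 2 ℕ.^ e) m → ∣ φ m ∣ ≤ D) → ∣ box v (2 ℕ.^ e) φ ∣ ≤ span e v ℕ.* D
   box-bound e zero φ D h = ℕ.≤-trans (h [] []) (ℕ.≤-reflexive (sym (ℕ.+-identityʳ D)))
   box-bound e (suc v) φ D h = ℕ.≤-trans (go (2 ℕ.^ e) ℕ.≤-refl) (ℕ.≤-reflexive (sym (ℕ.*-assoc (2 ℕ.^ e) (span e v) D)))
     where
     go : ∀ E → E ≤ 2 ℕ.^ e → ∣ sumZ E (λ i → box v (2 ℕ.^ e) (λ m → φ (i ∷ m))) ∣ ≤ E ℕ.* (span e v ℕ.* D)
     go zero l = z≤n
     go (suc E) l = ℕ.≤-trans (ℤ.∣i+j∣≤∣i∣+∣j∣ (sumZ E (λ i → box v (2 ℕ.^ e) (λ m → φ (i ∷ m)))) (box v (2 ℕ.^ e) (λ m → φ (E ∷ m)))) (ℕ.≤-trans (ℕ.+-mono-≤ (go E (ℕ.<⇒≤ l)) (box-bound e v (λ m → φ (E ∷ m)) D (λ m a → h (E ∷ m) (l ∷ a))))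
       (ℕ.≤-reflexive (ℕ.+-comm (E ℕ.* (span e v ℕ.* D)) (span e v ℕ.* D))))

   mon-bound : ∀ E M {v} (x : Vec ℤ v) (m : Vec ℕ v) → (∀ k → ∣ Vec.lookup x k ∣ ≤ 2 ℕ.^ M) → All (_< E) m → ∣ mon x m ∣ ≤ 2 ℕ.^ (v ℕ.* (E ℕ.* M))
   mon-bound E M [] [] h [] = ℕ.≤-refl
   mon-bound E M {suc v} (x ∷ xs) (i ∷ m) h (l ∷ a) = ℕ.≤-trans (ℕ.≤-reflexive (ℤ.∣i*j∣≡∣i∣*∣j∣ (x ^ i) (mon xs m)))
     (ℕ.≤-trans (ℕ.*-mono-≤ (ℕ.≤-trans (pw i) (ℕ.^-monoʳ-≤ 2 (ℕ.*-monoˡ-≤ M (ℕ.<⇒≤ l)))) (mon-bound E M xs m (λ k → h (Fin.suc k)) a)) (ℕ.≤-reflexive (sym (ℕ.^-distribˡ-+-* 2 (E ℕ.* M) (v ℕ.* (E ℕ.* M))))))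
     where
     pw : ∀ i → ∣ x ^ i ∣ ≤ 2 ℕ.^ (i ℕ.* M)
     pw zero = ℕ.≤-refl
     pw (suc i) = ℕ.≤-trans (ℕ.≤-reflexive (ℤ.∣i*j∣≡∣i∣*∣j∣ x (x ^ i))) (ℕ.≤-trans (ℕ.*-mono-≤ (h Fin.zero) (pw i)) (ℕ.≤-reflexive (sym (ℕ.^-distribˡ-+-* 2 M (i ℕ.* M)))))

   -- Applied to the short representatives. It keeps the number of bits of the value below `S`, so
   -- that bit positions are themselves short numbers.
   evalP-bound : ∀ {v} (f : Poly v) e C M → BoundedExp (2 ℕ.^ e) f → (∀ m → ∣ coeff f m ∣ ≤ C) → ∀ x → (∀ k → ∣ Vec.lookup x k ∣ ≤ 2 ℕ.^ M) →
     ∣ evalP f x ∣ ≤ span e v ℕ.* (C ℕ.* 2 ℕ.^ (v ℕ.* (2 ℕ.^ e ℕ.* M)))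
   evalP-bound {v} f e C M bounded c≤ x h = ℕ.≤-trans (ℕ.≤-reflexive (cong ∣_∣ (evalP-box f (2 ℕ.^ e) bounded x)))
     (box-bound e v _ _ (λ m a → ℕ.≤-trans (ℕ.≤-reflexive (ℤ.∣i*j∣≡∣i∣*∣j∣ (coeff f m) (mon x m))) (ℕ.*-mono-≤ (c≤ m) (mon-bound (2 ℕ.^ e) M x m h a))))

   degree⇒bounded : ∀ {v} (f : Poly v) D E → D < E → DegreeAtMost f D → BoundedExp E f
   degree⇒bounded f D E l h m na = go (coeff f m ℤ.≟ + 0)
     where
     all : ∀ {v} (m : Vec ℕ v) → totalDeg m < E → All (_< E) m
     all [] _ = []
     all (i ∷ m) l = ℕ.≤-<-trans (ℕ.m≤m+n i (totalDeg m)) l ∷ all m (ℕ.≤-<-trans (ℕ.m≤n+m (totalDeg m) i) l)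
     go : Dec (coeff f m ≡ + 0) → coeff f m ≡ + 0
     go (yes e) = e
     go (no ne) = ⊥-elim (na (all m (ℕ.≤-<-trans (h m ne) l)))

-- The final sum and the substitution of the weights

module FinalCircuit where
 open import Data.Nat using (_≤_)
 open import Data.Integer using (ℤ; +_; _+_; _*_; _-_)
 open import Data.Sum using ([_,_]′)
 open Growth
 open Evaluation
 open CircuitTools
 open SumClosure
 open Verification
 open KroneckerSums

 wgtE : ∀ {V w} → (Fin w → Fin V) → (Fin w → Fin V) → Exp V
 wgtE {w = zero} W ε = o#
 wgtE {w = suc w} W ε = op# times (op# plus o# (op# times (v# (ε Fin.zero)) (op# minus (v# (W Fin.zero)) o#))) (wgtE (λ t → W (Fin.suc t)) (λ t → ε (Fin.suc t)))

 powE : ∀ {V} → ℕ → Exp V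
 powE zero = o#
 powE (suc s) = op# times (op# plus o# o#) (powE s)

 abstract
   nodes-wgtE : ∀ {V w} (W ε : Fin w → Fin V) → nodes (wgtE W ε) ≡ w ℕ.* 4
   nodes-wgtE {w = zero} W ε = refl
   nodes-wgtE {w = suc w} W ε = trans (cong (λ z → suc (z ℕ.+ 3)) (nodes-wgtE (λ t → W (Fin.suc t)) (λ t → ε (Fin.suc t)))) (cong suc (ℕ.+-comm (w ℕ.* 4) 3))

   evE-wgtE : ∀ {V w} (W ε : Fin w → Fin V) (x : Fin V → ℤ) (a : Vec Bool w) → (∀ t → x (ε t) ≡ bool→ℤ (Vec.lookup a t)) →
     evE ℤA x (wgtE W ε) ≡ wgt (λ t → x (W t)) a
   evE-wgtE W ε x [] h = refl
   evE-wgtE W ε x (b ∷ a) h = cong₂ (λ y z → (+ 1 + y * (x (W Fin.zero) - + 1)) * z) (h Fin.zero) (evE-wgtE (λ t → W (Fin.suc t)) (λ t → ε (Fin.suc t)) x a (λ t → h (Fin.suc t)))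

   nodes-powE : ∀ {V} s → nodes (powE {V} s) ≡ s ℕ.* 2
   nodes-powE zero = refl
   nodes-powE {V} (suc s) = trans (cong (λ z → suc (z ℕ.+ 1)) (nodes-powE {V} s)) (cong suc (ℕ.+-comm (s ℕ.* 2) 1))

   evE-powE : ∀ {V} (x : Fin V → ℤ) s → evE ℤA x (powE s) ≡ + (2 ℕ.^ s)
   evE-powE x zero = refl
   evE-powE x (suc s) = trans (cong (λ z → + 2 * z) (evE-powE x s)) (sym (ℤ.pos-* 2 (2 ℕ.^ s)))

 -- Multiplied by 2 ^ s it undoes the shift of the digits by 5 S.
 fiveE : ∀ {V} → Exp V
 fiveE = op# plus (op# plus (op# plus (op# plus o# o#) o#) o#) o#

 -- The weights are variables here, and each occurs once in the tree. Their actual values, of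
 -- exponential degree in the inputs, could not enter a summand of small formal degree.
 module WeightedSum (sumC : SumClosed) (τ L s sz : ℕ → ℕ) (Pτ : PB τ) (PL : PB L) (Ps : PB s) (Psz : PB sz)
   (fn : ∀ n → (Fin (τ n) → Bool) → Fin (L n) → Bool) (cp : ∀ n → Cp (τ n) (Fin (L n)) (sz n) (fn n)) where
   k : ℕ → ℕ
   k n = len (cir (cp n))
   G : ∀ n → Gates (τ n) (k n)
   G n = gts (cir (cp n))
   ι : ∀ n → Fin (τ n) → Fin (τ n ℕ.+ (τ n ℕ.+ k n))
   ι n j = τ n ↑ʳ (j ↑ˡ k n)
   κ : ∀ n → Fin (k n) → Fin (τ n ℕ.+ (τ n ℕ.+ k n))
   κ n j = τ n ↑ʳ (τ n ↑ʳ j)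
   ω : ∀ n → Fin (τ n) → Fin (τ n ℕ.+ (τ n ℕ.+ k n))
   ω n j = j ↑ˡ (τ n ℕ.+ k n)
   E : ∀ n → Exp (τ n ℕ.+ (τ n ℕ.+ k n))
   E n = op# times (chkE (G n) (ι n) (κ n)) (op# times (op# minus (linE (ι n) (κ n) (outs (cir (cp n)))) (op# times fiveE (powE (s n)))) (wgtE (ω n) (ι n)))

   abstract
     nE : ∀ n → nodes (E n) ≤ suc (suc (τ n ℕ.* 4 ℕ.+ suc (suc (s n ℕ.* 2 ℕ.+ 4) ℕ.+ (1 ℕ.+ L n ℕ.* 3))) ℕ.+ sz n ℕ.* 15)
     nE n = s≤s (ℕ.+-mono-≤ (ℕ.≤-reflexive (cong suc (cong₂ ℕ._+_ (nodes-wgtE (ω n) (ι n)) (cong suc (cong₂ ℕ._+_ (cong (λ z → suc (z ℕ.+ 4)) (nodes-powE (s n))) (nodes-linE (ι n) (κ n) (outs (cir (cp n)))))))))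
       (ℕ.≤-trans (nodes-chkE (G n) (ι n) (κ n)) (ℕ.*-monoˡ-≤ 15 (size≤ (cp n)))))

     PE : PB (λ n → nodes (E n))
     PE = PB-≤ nE (PB-suc (PB-+ (PB-suc (PB-+ (PB-* Pτ (PB-const 4)) (PB-suc (PB-+ (PB-suc (PB-+ (PB-* Ps (PB-const 2)) (PB-const 4))) (PB-+ (PB-const 1) (PB-* PL (PB-const 3))))))) (PB-* Psz (PB-const 15))))

   module _ (n : ℕ) (W : Vec ℤ (τ n)) where
     abstract
       value : sumE (τ n) (τ n ℕ.+ k n) (E n) W ≡ Σb (τ n) (λ a → (+ num (fn n (Vec.lookup a)) - + (5 ℕ.* 2 ℕ.^ s n)) * wgt (Vec.lookup W) a)
       value = trans (Σb-++ (τ n) (k n) (λ ε → evE ℤA (Vec.lookup (W Vec.++ b2z ε)) (E n)))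
         (Σb-cong (τ n) (λ a → trans (Σb-cong (k n) (λ g → cong₂ _*_ (evE-chkE (G n) (ι n) (κ n) (x a g) (Vec.lookup a) g (hι a g) (hκ a g))
             (cong₂ _*_ (cong₂ _-_ (evE-linE (ι n) (κ n) (x a g) (Vec.lookup a) (Vec.lookup g) (hι a g) (hκ a g) (outs (cir (cp n)))) (trans (cong (λ z → + 5 * z) (evE-powE (x a g) (s n))) (sym (ℤ.pos-* 5 (2 ℕ.^ s n)))))
               (trans (evE-wgtE (ω n) (ι n) (x a g) a (hι a g)) (wgt-cong (λ t → lookup-++b W (a Vec.++ g) t) a)))))
           (trans (Σb-chk (G n) (Vec.lookup a) (λ g → (+ num (λ i → rv 𝔹A (Vec.lookup a) (Vec.lookup g) (outs (cir (cp n)) i)) - + (5 ℕ.* 2 ℕ.^ s n)) * wgt (Vec.lookup W) a))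
             (cong (λ z → (+ z - + (5 ℕ.* 2 ℕ.^ s n)) * wgt (Vec.lookup W) a) (num-cong (λ i → trans (rv-cong₂ (Vec.lookup a) (lookup-gvV (G n) (Vec.lookup a)) (outs (cir (cp n)) i)) (correct (cp n) (Vec.lookup a) i)))))))
         where
         x : Vec Bool (τ n) → Vec Bool (k n) → Fin (τ n ℕ.+ (τ n ℕ.+ k n)) → ℤ
         x a g = Vec.lookup (W Vec.++ b2z (a Vec.++ g))
         hι : ∀ a g i → x a g (ι n i) ≡ bool→ℤ (Vec.lookup a i)
         hι a g i = trans (lookup-++b' W (a Vec.++ g) (i ↑ˡ k n)) (cong bool→ℤ (Vec.lookup-++ˡ a g i))
         hκ : ∀ a g j → x a g (κ n j) ≡ bool→ℤ (Vec.lookup g j)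
         hκ a g j = trans (lookup-++b' W (a Vec.++ g) (τ n ↑ʳ j)) (cong bool→ℤ (Vec.lookup-++ʳ a g j))

   abstract
     circuits : ∃[ S ] (PB S × (∀ n → Σ[ C ∈ Circuit (τ n) ] (size C ≤ S n × (∀ W → evalC C W ≡ Σb (τ n) (λ a → (+ num (fn n (Vec.lookup a)) - + (5 ℕ.* 2 ℕ.^ s n)) * wgt (Vec.lookup W) a)))))
     circuits = go (sumC τ (λ n → τ n ℕ.+ k n) Pτ (PB-+ Pτ (PB-≤ (λ n → size≤ (cp n)) Psz)) E PE)
       where
       go : ∃[ S ] (PB S × (∀ n → Σ[ C ∈ Circuit (τ n) ] (size C ≤ S n × (∀ W → evalC C W ≡ sumE (τ n) (τ n ℕ.+ k n) (E n) W)))) →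
         ∃[ S ] (PB S × (∀ n → Σ[ C ∈ Circuit (τ n) ] (size C ≤ S n × (∀ W → evalC C W ≡ Σb (τ n) (λ a → (+ num (fn n (Vec.lookup a)) - + (5 ℕ.* 2 ℕ.^ s n)) * wgt (Vec.lookup W) a)))))
       go (S , PS , h) = S , PS , λ n → proj₁ (h n) , proj₁ (proj₂ (h n)) , λ W → trans (proj₂ (proj₂ (h n)) W) (value n W)

 substBC : ∀ {v k m O} → Gates v k → (Fin m → Ref v k) → BC m O → BC v O
 substBC G σ B = bc (graft G σ (gts B)) (λ o → trRef σ (outs B o))

 parBC : ∀ {v O O'} → BC v O → BC v O' → BC v (O ⊎ O')
 parBC B C = bc (graft (gts B) var (gts C)) [ (λ o → wkRef (len C) (outs B o)) , (λ o → trRef var (outs C o)) ]′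

 -- With sharing each square costs one gate, while the formal degree doubles. Here the degree bound
 -- is given up and only the bound on the size remains.
 squaresBC : ∀ e → BC 1 (Fin e)
 squaresBC zero = bc [] (λ ())
 squaresBC (suc e) = bc (graft sq (λ _ → gate Fin.zero) (gts (squaresBC e))) λ { Fin.zero → var Fin.zero ; (Fin.suc t) → trRef (λ _ → gate Fin.zero) (outs (squaresBC e) t) }
   where
   sq : Gates 1 1
   sq = [] ▷ (times , var Fin.zero , var Fin.zero)

 weightsBC : ∀ b e v → BC v (Fin (tau b e v))
 weightsBC b e zero = substBC ([] ▷ (plus , one , one)) (λ _ → gate Fin.zero) (squaresBC b)
 weightsBC b e (suc v) = bc (gts P) (λ t → outs P (Fin.splitAt (tau b e v) t))
   where
   P : BC (suc v) (Fin (tau b e v) ⊎ Fin e)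
   P = parBC (substBC [] (λ i → var (Fin.suc i)) (weightsBC b e v)) (substBC [] (λ _ → var Fin.zero) (squaresBC e))

 composeBC : ∀ {v m} → BC v (Fin m) → Circuit m → Circuit v
 composeBC B C = record { size = size C ℕ.+ len B ; gates = graft (gts B) (outs B) (gates C) ; output = trRef (outs B) (output C) }

 abstract
   ev-substBC : ∀ {v k m O} (G : Gates v k) (σ : Fin m → Ref v k) (B : BC m O) x y → (∀ i → rv ℤA x (gv ℤA x G) (σ i) ≡ y i) → ∀ o → ev ℤA (substBC G σ B) x o ≡ ev ℤA B y o
   ev-substBC G σ B x y h o = trans (rv-tr ℤA x G σ (gts B) (outs B o)) (rv-cong ℤA h (gts B) (outs B o))

   len-squaresBC : ∀ e → len (squaresBC e) ≡ e
   len-squaresBC zero = refl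
   len-squaresBC (suc e) = trans (ℕ.+-comm (len (squaresBC e)) 1) (cong suc (len-squaresBC e))

   ev-squaresBC : ∀ e x t → ev ℤA (squaresBC e) x t ≡ squares (x Fin.zero) e t
   ev-squaresBC (suc e) x Fin.zero = refl
   ev-squaresBC (suc e) x (Fin.suc t) = trans (rv-tr ℤA x ([] ▷ (times , var Fin.zero , var Fin.zero)) (λ _ → gate Fin.zero) (gts (squaresBC e)) (outs (squaresBC e) t))
     (ev-squaresBC e (λ _ → x Fin.zero * x Fin.zero) t)

   len-weightsBC : ∀ b e v → len (weightsBC b e v) ≡ suc (tau b e v)
   len-weightsBC b e zero = trans (ℕ.+-comm (len (squaresBC b)) 1) (cong suc (len-squaresBC b))
   len-weightsBC b e (suc v) = trans (cong₂ ℕ._+_ (trans (ℕ.+-identityʳ _) (len-squaresBC e)) (trans (ℕ.+-identityʳ _) (len-weightsBC b e v))) (ℕ.+-comm e (suc (tau b e v)))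

   ev-weightsBC : ∀ b e v (x : Vec ℤ v) t → ev ℤA (weightsBC b e v) (Vec.lookup x) t ≡ weights b e v x t
   ev-weightsBC b e zero [] t = trans (ev-substBC ([] ▷ (plus , one , one)) (λ _ → gate Fin.zero) (squaresBC b) _ (λ _ → + 2) (λ _ → refl) t) (ev-squaresBC b (λ _ → + 2) t)
   ev-weightsBC b e (suc v) (x ∷ xs) t = go (Fin.splitAt (tau b e v) t)
     where
     A : BC (suc v) (Fin (tau b e v))
     A = substBC [] (λ i → var (Fin.suc i)) (weightsBC b e v)
     C : BC (suc v) (Fin e)
     C = substBC [] (λ _ → var Fin.zero) (squaresBC e)
     go : ∀ w → ev ℤA (parBC A C) (Vec.lookup (x ∷ xs)) w ≡ [ weights b e v xs , squares x e ]′ w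
     go (inj₁ o) = trans (rv-wk ℤA _ (gts A) var (gts C) (outs A o)) (trans (ev-substBC [] (λ i → var (Fin.suc i)) (weightsBC b e v) _ (Vec.lookup xs) (λ _ → refl) o) (ev-weightsBC b e v xs o))
     go (inj₂ o) = trans (rv-tr ℤA _ (gts A) var (gts C) (outs C o)) (trans (ev-substBC [] (λ _ → var Fin.zero) (squaresBC e) _ (λ _ → x) (λ _ → refl) o) (ev-squaresBC e (λ _ → x) o))

   evalC-composeBC : ∀ {v m} (B : BC v (Fin m)) (C : Circuit m) x (y : Vec ℤ m) → (∀ i → ev ℤA B (Vec.lookup x) i ≡ Vec.lookup y i) → evalC (composeBC B C) x ≡ evalC C y
   evalC-composeBC B C x y h = trans (rv-tr ℤA (Vec.lookup x) (gts B) (outs B) (gates C) (output C)) (rv-cong ℤA h (gates C) (output C))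

-- Choice of the parameters and conclusion

module Assembly where
 open import Data.Nat using (_≤_; _<_; _+_; _*_; _∸_; _^_)
 open import Data.Integer using (ℤ; +_; ∣_∣)
 import Data.Sum
 open import Data.Nat.DivMod using (_/_)
 open Growth
 open Evaluation
 open CircuitTools
 open SumClosure using (SumClosed; sumClosed)
 open Verification
 open Counting
 open BoundedSearch
 open ModularPrimes
 open KroneckerResidues
 open BlockFamilies
 open DigitFamilies
 open KroneckerSums
 open FinalCircuit
 open PrimeCount using (primeInd; prime-count)

 abstract
   tau≡ : ∀ b e v → tau b e v ≡ b + v * e
   tau≡ b e zero = sym (ℕ.+-identityʳ b)
   tau≡ b e (suc v) = trans (cong (_+ e) (tau≡ b e v)) (lem b (v * e) e)
     where
     lem : ∀ b w e → b + w + e ≡ b + (e + w)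
     lem = NS.solve-∀

   exponent≤ : ∀ b e v k → exponent b e v k ≤ 2 ^ tau b e v
   exponent≤ b e (suc v) Fin.zero = ℕ.≤-trans (ℕ.≤-reflexive (sym (2^tau b e v))) (ℕ.^-monoʳ-≤ 2 (ℕ.m≤m+n (tau b e v) e))
   exponent≤ b e (suc v) (Fin.suc k) = ℕ.≤-trans (exponent≤ b e v k) (ℕ.^-monoʳ-≤ 2 (ℕ.m≤m+n (tau b e v) e))

   span≤2^tau : ∀ b e v → span e v ≤ 2 ^ tau b e v
   span≤2^tau b e v = ℕ.≤-trans (ℕ.m≤n*m (span e v) (2 ^ b) {{ℕ.m^n≢0 2 b}}) (ℕ.≤-reflexive (sym (2^tau b e v)))

 -- One input size, with t = 2 ^ τ digits, primes up to 2 ^ s and 64 t primes per block.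
 module Bounds (τ s p u : ℕ) (p≤τ : p ≤ τ) (e≤τ : suc p ≤ τ) (u≤τ : u ≤ τ) (s≡ : s ≡ 4 * (5 + τ)) where
   t : ℕ
   t = 2 ^ τ

   abstract
     t≥1 : 1 ≤ t
     t≥1 = ℕ.m^n>0 2 τ

     τ≤t : τ ≤ t
     τ≤t = ℕ.<⇒≤ (n<2^n τ)

     s≤24t : s ≤ 24 * t
     s≤24t = ℕ.≤-trans (ℕ.≤-reflexive s≡) (ℕ.≤-trans (ℕ.*-monoʳ-≤ 4 (ℕ.+-mono-≤ (ℕ.*-monoʳ-≤ 5 t≥1) τ≤t)) (ℕ.≤-reflexive (lem t)))
       where
       lem : ∀ t → 4 * (5 * t + t) ≡ 24 * t
       lem = NS.solve-∀

     τ<s : τ < s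
     τ<s = ℕ.≤-trans (ℕ.≤-trans (ℕ.m≤n+m (suc τ) 4) (ℕ.m≤m+n (5 + τ) (3 * (5 + τ)))) (ℕ.≤-reflexive (sym s≡))

     τ+6≤s : τ + 6 ≤ s
     τ+6≤s = ℕ.≤-trans (ℕ.≤-trans (ℕ.m≤m+n (τ + 6) (14 + 3 * τ)) (ℕ.≤-reflexive (lem τ))) (ℕ.≤-reflexive (sym s≡))
       where
       lem : ∀ τ → τ + 6 + (14 + 3 * τ) ≡ 4 * (5 + τ)
       lem = NS.solve-∀

     t<S : suc t ≤ 2 ^ s
     t<S = ℕ.^-monoʳ-< 2 (s≤s (s≤s z≤n)) τ<s

     Lb≡ : 2 ^ (τ + 6) ≡ 64 * t
     Lb≡ = trans (ℕ.^-distribˡ-+-* 2 τ 6) (ℕ.*-comm t 64)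

     -- The exponent 64 t of a block product dominates 4 + s + t, at most 29 t, as well as 3 + 2 t
     -- in `near₂`. Thus every block product exceeds the multiples of |Z| that the conversion asks
     -- for.
     near₁ : ∀ {z} → z ≤ 2 ^ t → 16 * 2 ^ s * z ≤ 2 ^ (2 ^ (τ + 6))
     near₁ {z} h = ℕ.≤-trans (ℕ.*-monoʳ-≤ (16 * 2 ^ s) h) (ℕ.≤-trans (ℕ.≤-reflexive (trans (cong (_* 2 ^ t) (sym (ℕ.^-distribˡ-+-* 2 4 s))) (sym (ℕ.^-distribˡ-+-* 2 (4 + s) t))))
       (ℕ.^-monoʳ-≤ 2 (ℕ.≤-trans (ℕ.+-monoˡ-≤ t (ℕ.+-mono-≤ (ℕ.*-monoʳ-≤ 4 t≥1) s≤24t)) (ℕ.≤-trans (ℕ.m≤m+n _ (35 * t)) (ℕ.≤-reflexive (trans (lem t) (sym Lb≡)))))))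
       where
       lem : ∀ t → 4 * t + 24 * t + t + 35 * t ≡ 64 * t
       lem = NS.solve-∀

     near₂ : ∀ {z} → z ≤ 2 ^ t → 8 * 2 ^ t * z ≤ 2 ^ (2 ^ (τ + 6))
     near₂ {z} h = ℕ.≤-trans (ℕ.*-monoʳ-≤ (8 * 2 ^ t) h) (ℕ.≤-trans (ℕ.≤-reflexive (trans (cong (_* 2 ^ t) (sym (ℕ.^-distribˡ-+-* 2 3 t))) (sym (ℕ.^-distribˡ-+-* 2 (3 + t) t))))
       (ℕ.^-monoʳ-≤ 2 (ℕ.≤-trans (ℕ.+-monoˡ-≤ t (ℕ.+-monoˡ-≤ t (ℕ.*-monoʳ-≤ 3 t≥1))) (ℕ.≤-trans (ℕ.m≤m+n _ (59 * t)) (ℕ.≤-reflexive (trans (lem t) (sym Lb≡)))))))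
       where
       lem : ∀ t → 3 * t + t + t + 59 * t ≡ 64 * t
       lem = NS.solve-∀

     -- The `t` blocks need 64 t t = 2 ^ (2 τ + 6) odd primes, and more than 2 ^ (2 τ + 8) primes
     -- are available up to 2 ^ s. The value s = 4 (5 + τ) is dictated by `prime-count`.
     enough-primes : t * 2 ^ (τ + 6) ≤ sumN (2 ^ s) (λ y → isPr (2 ^ s) (suc y))
     enough-primes = ℕ.+-cancelʳ-≤ 1 _ _ (ℕ.≤-trans (ℕ.≤-trans (ℕ.≤-reflexive (ℕ.+-comm _ 1)) (s≤s le))
       (ℕ.≤-trans (prime-count τ) (ℕ.≤-trans (ℕ.≤-reflexive (cong (λ z → sumN (2 ^ z) (λ y → primeInd (suc y))) (sym s≡))) (odd-count (2 ^ s)))))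
       where
       lem : ∀ τ → τ + (τ + 6) + 2 ≡ 2 * τ + 8
       lem = NS.solve-∀
       le : t * 2 ^ (τ + 6) ≤ 2 ^ (2 * τ + 8)
       le = ℕ.≤-trans (ℕ.≤-reflexive (sym (ℕ.^-distribˡ-+-* 2 τ (τ + 6)))) (ℕ.^-monoʳ-≤ 2 (ℕ.≤-trans (ℕ.m≤m+n _ 2) (ℕ.≤-reflexive (lem τ))))

     -- The value at a short point has on the order of u 2 ^ (p + 1) (s + 1) bits, at most a
     -- constant times t ^ 3. Since 2 ^ s is 2 ^ 20 t ^ 4, the positions of these bits are below 2 ^
     -- s with room for the constants.
     value-fits : ∀ {a σ} → σ ≤ t → a ≤ σ * (2 ^ (2 ^ p) * 2 ^ (u * (2 ^ suc p * suc s))) → a * 2 < 2 ^ (2 ^ s)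
     value-fits {a} {σ} hσ h = ℕ.≤-<-trans (ℕ.≤-trans (ℕ.*-monoˡ-≤ 2 (ℕ.≤-trans h (ℕ.*-monoˡ-≤ _ (ℕ.≤-trans hσ (ℕ.<⇒≤ (n<2^n t))))))
         (ℕ.≤-reflexive (trans (ℕ.*-comm (2 ^ t * (2 ^ (2 ^ p) * 2 ^ x)) 2) (trans (cong (λ z → 2 * (2 ^ t * z)) (sym (ℕ.^-distribˡ-+-* 2 (2 ^ p) x))) (cong (2 *_) (sym (ℕ.^-distribˡ-+-* 2 t (2 ^ p + x))))))))
       (ℕ.^-monoʳ-< 2 (s≤s (s≤s z≤n)) (ℕ.≤-<-trans big (ℕ.<-≤-trans strict S≥)))
       where
       x c : ℕ
       x = u * (2 ^ suc p * suc s)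
       c = t * (t * t)
       c≥1 : 1 ≤ c
       c≥1 = ℕ.*-mono-≤ t≥1 (ℕ.*-mono-≤ t≥1 t≥1)
       t≤c : t ≤ c
       t≤c = ℕ.≤-trans (ℕ.≤-reflexive (sym (ℕ.*-identityʳ t))) (ℕ.*-monoʳ-≤ t (ℕ.*-mono-≤ t≥1 t≥1))
       x≤ : x ≤ 25 * c
       x≤ = ℕ.≤-trans (ℕ.*-mono-≤ (ℕ.≤-trans u≤τ τ≤t) (ℕ.*-mono-≤ (ℕ.^-monoʳ-≤ 2 e≤τ) (ℕ.+-mono-≤ t≥1 s≤24t))) (ℕ.≤-reflexive (lem t))
         where
         lem : ∀ t → t * (t * (t + 24 * t)) ≡ 25 * (t * (t * t))
         lem = NS.solve-∀
       big : suc (t + (2 ^ p + x)) ≤ 28 * c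
       big = ℕ.≤-trans (ℕ.+-mono-≤ c≥1 (ℕ.+-mono-≤ t≤c (ℕ.+-mono-≤ (ℕ.≤-trans (ℕ.^-monoʳ-≤ 2 p≤τ) t≤c) x≤))) (ℕ.≤-reflexive (lem c))
         where
         lem : ∀ c → c + (c + (c + 25 * c)) ≡ 28 * c
         lem = NS.solve-∀
       S≥ : 32 * (t * c) ≤ 2 ^ s
       S≥ = ℕ.≤-trans (ℕ.≤-reflexive (sym (trans (ℕ.^-distribˡ-+-* 2 5 (τ + (τ + (τ + τ)))) (cong (32 *_) (trans (ℕ.^-distribˡ-+-* 2 τ (τ + (τ + τ))) (cong (t *_) (trans (ℕ.^-distribˡ-+-* 2 τ (τ + τ)) (cong (t *_) (ℕ.^-distribˡ-+-* 2 τ τ)))))))))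
         (ℕ.^-monoʳ-≤ 2 (ℕ.≤-trans (ℕ.m≤n+m (5 + (τ + (τ + (τ + τ)))) 15) (ℕ.≤-reflexive (trans (lem τ) (sym s≡)))))
         where
         lem : ∀ τ → 15 + (5 + (τ + (τ + (τ + τ)))) ≡ 4 * (5 + τ)
         lem = NS.solve-∀
       strict : 28 * c < 32 * (t * c)
       strict = ℕ.<-≤-trans (ℕ.*-monoˡ-< c {{ℕ.>-nonZero c≥1}} (ℕ.m<m+n 28 {4} (s≤s z≤n))) (ℕ.*-monoʳ-≤ 32 (ℕ.≤-trans (ℕ.≤-reflexive (sym (ℕ.+-identityʳ c))) (ℕ.*-monoˡ-≤ c t≥1)))

     -- The 3 in p + 3: coefficients are below 2 ^ 2 ^ p, and blocks of 8 times as many digits leave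
     -- the margin of 8 that `Tails` requires.
     separated : 1 + 8 * 2 ^ (2 ^ p) ≤ 2 ^ (2 ^ (p + 3))
     separated = ℕ.≤-trans (ℕ.≤-trans (ℕ.+-monoˡ-≤ (8 * q) (ℕ.≤-trans (ℕ.m^n>0 2 (2 ^ p)) (ℕ.m≤n*m q 8))) (ℕ.≤-reflexive (trans (lem q) (sym (ℕ.^-distribˡ-+-* 2 4 (2 ^ p))))))
       (ℕ.^-monoʳ-≤ 2 (ℕ.≤-trans (ℕ.+-monoˡ-≤ (2 ^ p) (ℕ.*-monoʳ-≤ 4 (ℕ.m^n>0 2 p))) (ℕ.≤-trans (ℕ.m≤m+n _ (3 * 2 ^ p)) (ℕ.≤-reflexive (trans (lem' (2 ^ p)) (sym (ℕ.^-distribˡ-+-* 2 p 3)))))))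
       where
       q : ℕ
       q = 2 ^ (2 ^ p)
       lem : ∀ q → 8 * q + 8 * q ≡ 16 * q
       lem = NS.solve-∀
       lem' : ∀ P → 4 * P + P + 3 * P ≡ P * 8
       lem' = NS.solve-∀

 module Final (sumC : SumClosed) (u : ℕ → ℕ) (Pu : PB u) (f : (n : ℕ) → Poly (u n)) (p : ℕ → ℕ) (Pp : PB p)
   (deg : ∀ n → DegreeAtMost (f n) (2 ^ p n)) (small : ∀ n → CoeffBitsizeAtMost (f n) (2 ^ p n)) (M : TM) (T : ℕ → ℕ) (PT : PB T)
   (dec : ∀ w → (EvalLang u f w → Config.state (runTM M (T (List.length w)) (initConf M w)) ≡ Data.Sum.inj₂ true) ×
                (¬ EvalLang u f w → Config.state (runTM M (T (List.length w)) (initConf M w)) ≡ Data.Sum.inj₂ false))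
   (s r : ℕ → ℕ) (Ps : PB s) (Pr : PB r) (s≡ : ∀ n → s n ≡ 4 * (5 + tau (p n + 3) (suc (p n)) (u n))) (s+10≤r : ∀ n → 10 + s n ≤ r n) where

   τ : ℕ → ℕ
   τ n = tau (p n + 3) (suc (p n)) (u n)

   ex : ∀ n → Fin (u n) → ℕ
   ex n = exponent (p n + 3) (suc (p n)) (u n)

   abstract
     b≤τ : ∀ n → p n + 3 ≤ τ n
     b≤τ n = ℕ.≤-trans (ℕ.m≤m+n (p n + 3) _) (ℕ.≤-reflexive (sym (tau≡ (p n + 3) (suc (p n)) (u n))))

     u≤τ : ∀ n → u n ≤ τ n
     u≤τ n = ℕ.≤-trans (ℕ.m≤m*n (u n) (suc (p n))) (ℕ.≤-trans (ℕ.m≤n+m _ (p n + 3)) (ℕ.≤-reflexive (sym (tau≡ (p n + 3) (suc (p n)) (u n)))))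

     Pτ : PB τ
     Pτ = PB-≤ (λ n → ℕ.≤-reflexive (tau≡ (p n + 3) (suc (p n)) (u n))) (PB-+ (PB-+ Pp (PB-const 3)) (PB-* Pu (PB-suc Pp)))

   module A (n : ℕ) = Bounds (τ n) (s n) (p n) (u n) (ℕ.≤-trans (ℕ.m≤m+n (p n) 3) (b≤τ n))
     (ℕ.≤-trans (ℕ.≤-trans (ℕ.≤-reflexive (ℕ.+-comm 1 (p n))) (ℕ.+-monoʳ-≤ (p n) (s≤s z≤n))) (b≤τ n)) (u≤τ n) (s≡ n)

   abstract
     s≤r' : ∀ n → s n ≤ 1 * r n
     s≤r' n = ℕ.≤-trans (ℕ.≤-trans (ℕ.m≤n+m (s n) 10) (s+10≤r n)) (ℕ.≤-reflexive (sym (ℕ.+-identityʳ (r n))))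

     ex< : ∀ n k → ex n k < 2 ^ r n
     ex< n k = ℕ.≤-<-trans (exponent≤ (p n + 3) (suc (p n)) (u n) k) (ℕ.^-monoʳ-< 2 (s≤s (s≤s z≤n)) (ℕ.<-≤-trans (A.τ<s n) (ℕ.≤-trans (s≤r' n) (ℕ.≤-reflexive (ℕ.+-identityʳ (r n))))))

   open Residues sumC u Pu f M T PT dec s r Ps Pr s+10≤r ex ex< using (S; NB; nn; bd; z2; z2N; z2-spec; value; point-mod; pt; lowF; low<; module NN)
   open NN using (L; PL; fn-cong)

   Lb : ℕ → ℕ
   Lb n = 2 ^ (τ n + 6)

   abstract
     bounded : ∀ n → BoundedExp (2 ^ suc (p n)) (f n)
     bounded n = degree⇒bounded (f n) (2 ^ p n) (2 ^ suc (p n)) (ℕ.^-monoʳ-< 2 (s≤s (s≤s z≤n)) (ℕ.n<1+n (p n))) (deg n)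

   module K (n : ℕ) = Formula (f n) (p n + 3) (suc (p n)) (2 ^ (2 ^ p n)) (bounded n) (λ m → ℕ.<⇒≤ (small n m)) (A.separated n)

   abstract
     value-small : ∀ n y → suc y ≤ S n → ∣ value n y ∣ * 2 < 2 ^ S n
     value-small n y l = A.value-fits n {∣ value n y ∣} {span (suc (p n)) (u n)} (span≤2^tau (p n + 3) (suc (p n)) (u n))
       (evalP-bound (f n) (suc (p n)) (2 ^ (2 ^ p n)) (suc (s n)) (bounded n) (λ m → ℕ.<⇒≤ (small n m)) (Vec.tabulate (λ k → + pt n y k)) coord)
       where
       coord : ∀ k → ∣ Vec.lookup (Vec.tabulate (λ k → + pt n y k)) k ∣ ≤ 2 ^ suc (s n)
       coord k = ℕ.≤-trans (ℕ.≤-reflexive (cong ∣_∣ (Vec.lookup∘tabulate (λ k → + pt n y k) k)))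
         (ℕ.≤-trans (ℕ.+-monoˡ-≤ (2 ^ s n) (ℕ.<⇒≤ (low< n y k l))) (ℕ.≤-reflexive (cong (_+_ (2 ^ s n)) (sym (ℕ.+-identityʳ (2 ^ s n))))))

     residues : ∀ n y → suc y ≤ S n → Mod (suc y) (+ z2 n y) (+ 2 ℤ.* K.Z n)
     residues n y l = z2-spec n y (K.Z n) l (value-small n y l) (evalP-mod (f n) (Vec.tabulate (λ k → + pt n y k)) (kronecker (p n + 3) (suc (p n)) (u n)) (λ k →
       mod-trans (mod-refl (Vec.lookup∘tabulate (λ k → + pt n y k) k)) (mod-trans (point-mod n y k l) (mod-refl (sym (Vec.lookup∘tabulate (λ k → + (2 ^ ex n k)) k))))))

     S≥1 : ∀ n → 1 ≤ S n
     S≥1 n = ℕ.m^n>0 2 (s n)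

     t≤S : ∀ n j → j ≤ 2 ^ τ n → j ≤ S n
     t≤S n j l = ℕ.≤-trans l (ℕ.<⇒≤ (A.t<S n))

     θ≤ : ∀ n j → j ≤ 2 ^ τ n → thetaM (S n) (Lb n) (z2 n) j ≤ 16 * S n * S n
     θ≤ n j l = thetaM≤ (S n) (2 ^ τ n) (Lb n) (S≥1 n) (A.t<S n) (K.Z n) (z2 n) (residues n) (A.enough-primes n) (A.near₁ n (K.Z-bound n)) (A.near₂ n (K.Z-bound n)) j (t≤S n j l)

     R≤ : ∀ n j → j ≤ 2 ^ τ n → 2 * roundM (S n) (Lb n) (z2 n) j ≤ 4 * S n
     R≤ n j l = roundM≤ (S n) (2 ^ τ n) (Lb n) (S≥1 n) (A.t<S n) (K.Z n) (z2 n) (residues n) (A.enough-primes n) (A.near₁ n (K.Z-bound n)) (A.near₂ n (K.Z-bound n)) j (t≤S n j l)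

     Q≤ : ∀ n j → j < 2 ^ τ n → ((2 * thetaM (S n) (Lb n) (z2 n) (suc j) + 8 * S n + 16 * S n * S n) ∸ thetaM (S n) (Lb n) (z2 n) j) / suc (ℕ.pred (16 * S n)) ≤ 4 * S n
     Q≤ n j l = digitQuo≤ (S n) (2 ^ τ n) (Lb n) (S≥1 n) (A.t<S n) (K.Z n) (z2 n) (residues n) (A.enough-primes n) (A.near₁ n (K.Z-bound n)) (A.near₂ n (K.Z-bound n)) j (t≤S n (suc j) l)

     Lb≤ : ∀ n → Lb n ≤ 2 ^ (1 * r n)
     Lb≤ n = ℕ.^-monoʳ-≤ 2 (ℕ.≤-trans (A.τ+6≤s n) (s≤r' n))

     τ≤r : ∀ n → τ n ≤ 1 * r n
     τ≤r n = ℕ.≤-trans (ℕ.<⇒≤ (A.τ<s n)) (s≤r' n)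

   open DigitNB sumC s r Ps Pr s+10≤r z2 z2N Lb Lb≤ τ Pτ τ≤r θ≤ R≤ Q≤ using (X; digitN)
   module DN = NN.N (nn digitN)

   D : ∀ n → ℕ → ℕ
   D n j = digitM (S n) (Lb n) (z2 n) j

   abstract
     -- The digit has level 4, far below 2 ^ L, so the residue delivered by the circuit is the digit
     -- itself.
     digit-bits : ∀ n (a : Vec Bool (τ n)) → num (DN.fn n (Vec.lookup a)) ≡ D n (num (Vec.lookup a))
     digit-bits n a = trans (num-cong (fn-cong (nn digitN) n (λ i → sym (toBits-num (Vec.lookup a) i))))
       (mod-unique (num< (DN.fn n (enc X n x))) (ℕ.≤-<-trans (bd digitN n x ok) (ℕ.^-monoʳ-< 2 (s≤s (s≤s z≤n)) (s≤s (ℕ.*-monoˡ-≤ (r n) (ℕ.m≤m+n 4 16))))) (DN.spec n x ok))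
       where
       x : Dom X n
       x = tt , num (Vec.lookup a)
       ok : Ok X n x
       ok = tt , num< (Vec.lookup a) , tt

     digit-formula : ∀ n x → Σb (τ n) (λ a → (+ num (DN.fn n (Vec.lookup a)) ℤ.- + (5 * 2 ^ s n)) ℤ.* wgt (Vec.lookup (Vec.tabulate (weights (p n + 3) (suc (p n)) (u n) x))) a) ≡ evalP (f n) x
     digit-formula n x = trans (Σb-cong (τ n) (λ a → cong₂ ℤ._*_ (cong (λ z → + z ℤ.- + (5 * 2 ^ s n)) (digit-bits n a)) (wgt-cong (Vec.lookup∘tabulate (weights (p n + 3) (suc (p n)) (u n) x)) a)))
       (sym (K.evalP-digits n
         (partial (S n) (2 ^ τ n) (Lb n) (S≥1 n) (A.t<S n) (K.Z n) (z2 n) (residues n) (A.enough-primes n) (A.near₁ n (K.Z-bound n)) (A.near₂ n (K.Z-bound n)))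
         (λ j → + D n j ℤ.- + (5 * 2 ^ s n))
         (partial-exact (S n) (2 ^ τ n) (Lb n) (S≥1 n) (A.t<S n) (K.Z n) (z2 n) (residues n) (A.enough-primes n) (A.near₁ n (K.Z-bound n)) (A.near₂ n (K.Z-bound n)))
         (digit-spec (S n) (2 ^ τ n) (Lb n) (S≥1 n) (A.t<S n) (K.Z n) (z2 n) (residues n) (A.enough-primes n) (A.near₁ n (K.Z-bound n)) (A.near₂ n (K.Z-bound n))) x))

     conclusion : VP0nb u f
     conclusion = go (WeightedSum.circuits sumC τ L s DN.sz Pτ PL Ps DN.szPB DN.fn DN.cpn)
       where
       go : ∃[ σ ] (PB σ × (∀ n → Σ[ C ∈ Circuit (τ n) ] (size C ≤ σ n × (∀ W → evalC C W ≡ Σb (τ n) (λ a → (+ num (DN.fn n (Vec.lookup a)) ℤ.- + (5 * 2 ^ s n)) ℤ.* wgt (Vec.lookup W) a))))) → VP0nb u f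
       go (σ , Pσ , h) = fromPB Pu , (λ n → σ n + suc (τ n)) , fromPB (PB-+ Pσ (PB-suc Pτ)) , λ n → C n , ℕ.+-mono-≤ (proj₁ (proj₂ (h n))) (ℕ.≤-reflexive (len-weightsBC (p n + 3) (suc (p n)) (u n))) ,
         evalP⇒≈P {f = circuitPoly (C n)} {f n} (λ x → trans (evalP-circuit (C n) x) (trans (evalC-composeBC (W n) (proj₁ (h n)) x (Vec.tabulate (weights (p n + 3) (suc (p n)) (u n) x))
           (λ i → trans (ev-weightsBC (p n + 3) (suc (p n)) (u n) x i) (sym (Vec.lookup∘tabulate (weights (p n + 3) (suc (p n)) (u n) x) i))))
           (trans (proj₂ (proj₂ (h n)) (Vec.tabulate (weights (p n + 3) (suc (p n)) (u n) x))) (digit-formula n x))))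
         where
         W : ∀ n → BC (u n) (Fin (τ n))
         W n = weightsBC (p n + 3) (suc (p n)) (u n)
         C : ∀ n → Circuit (u n)
         C n = composeBC (W n) (proj₁ (h n))

 abstract
   -- The parameters are hidden behind an abstract existential, since powers 2 ^ (s n) must never be evaluated.
   parameters : ∀ τ → PB τ → ∃[ s ] ∃[ r ] (PB s × PB r × (∀ n → s n ≡ 4 * (5 + τ n)) × (∀ n → 10 + s n ≤ r n))
   parameters τ Pτ = (λ n → 4 * (5 + τ n)) , (λ n → 10 + 4 * (5 + τ n)) , Ps , PB-+ (PB-const 10) Ps , (λ n → refl) , (λ n → ℕ.≤-refl)
     where
     Ps : PB (λ n → 4 * (5 + τ n))
     Ps = PB-* (PB-const 4) (PB-+ (PB-const 5) Pτ)

open Growth using (PB; PB-≤; PB-+; PB-*; PB-const; PB-suc; toPB)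
open SumClosure using (sumClosed)
open KroneckerSums using (tau)
open Assembly
open import Data.Nat using (_+_; _*_; _≤_)

theorem8 : (u : ℕ → ℕ) (f : (n : ℕ) → Poly (u n)) →
  PolyTimeEvaluable u f → VP0≡VNP0 → VP0nb u f
theorem8 u f (Pu , (p , Pp , bounds) , (M , T , PT , dec)) hyp = go (parameters τ (PB-≤ (λ n → ℕ.≤-reflexive (tau≡ (p n + 3) (suc (p n)) (u n))) (PB-+ (PB-+ (toPB Pp) (PB-const 3)) (PB-* (toPB Pu) (PB-suc (toPB Pp))))))
  where
  τ : ℕ → ℕ
  τ n = tau (p n + 3) (suc (p n)) (u n)
  go : ∃[ s ] ∃[ r ] (PB s × PB r × (∀ n → s n ≡ 4 * (5 + τ n)) × (∀ n → 10 + s n ≤ r n)) → VP0nb u f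
  go (s , r , Ps , Pr , s≡ , s≤r) = Final.conclusion (sumClosed hyp) u (toPB Pu) f p (toPB Pp) (λ n → proj₁ (bounds n)) (λ n → proj₂ (bounds n)) M T (toPB PT) dec s r Ps Pr s≡ s≤r
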